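{- Let $n\ge2$, let $f\in\mathbb{R}[x_1,\dots,x_n]$ be a form of degree $n$ in $n$ variables, and let $\mathcal{Z}$ be a nonempty $\mathrm{SL}_n(\mathbb{Z})$-invariant subset of $\mathbb{Z}^n\setminus\{\vec 0\}$. Suppose that: (i) $f(\mathcal{Z})$ is discrete in $\mathbb{R}$; (ii) $f$ does not represent $0$ over $\mathbb{Q}$ non-trivially; (iii) $f$ is not totally imaginary (which, in particular, is satisfied if $n$ is odd). Then $f$ is a norm form.
   Context: A form of degree $n$ in $n$ variables is a homogeneous polynomial $f(\vec x)\in\mathbb{R}[\vec x]$, $\vec x=(x_1,\dots,x_n)$, which factors as $f=l_1\cdots l_n$ with $l_1,\dots,l_n$ linear forms with complex coefficients, linearly independent over $\mathbb{C}$. Up to scaling the factors, the $l_i$ consist of $s$ pairs of complex-conjugate (non-real) linear forms and $t$ real linear forms, $n=2s+t$; $f$ is totally imaginary if $t=0$. $f$ represents $0$ over $\mathbb{Q}$ non-trivially if $f(\vec v)=0$ for some $\vec v\in\mathbb{Q}^n\setminus\{\vec 0\}$. A subset of $\mathbb{R}$ is discrete in $\mathbb{R}$ if it has no accumulation point in $\mathbb{R}$. $\mathrm{SL}_n(\mathbb{R})$ acts on $\mathbb{R}[\vec x]$ by $(gp)(\vec x)=p(g^{ -1}\vec x)$; forms $f$ and $gf$ with $g\in\mathrm{SL}_n(\mathbb{Q})$ are called $\mathbb{Q}$-equivalent. Norm form: let $K=\mathbb{Q}\alpha_1+\dots+\mathbb{Q}\alpha_n$ be a number field of degree $n$ and $\theta_1,\dots,\theta_n$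 all the embeddings of $K$ into $\mathbb{C}$. Put $l_i(\vec x)=\theta_i(\alpha_1)x_1+\dots+\theta_i(\alpha_n)x_n$ and $\mathfrak{N}_K(\vec x)=\prod_{i=1}^n l_i(\vec x)$. A norm form (corresponding to $K$) is a form $\mathbb{Q}$-equivalent to $c\cdot\mathfrak{N}_K(\vec x)$ for some $c\in\mathbb{R}^*$. -}

module Defs where

open import Level using (0ℓ; _⊔_)
open import Algebra.Bundles using (CommutativeRing; RawRing)
open import Algebra.Morphism.Structures using (IsRingHomomorphism)
import Algebra.Construct.DirectProduct as DirectProduct
import Algebra.Definitions.RawSemiring as RawSemiringDefinitions
import Algebra.Properties.Ring as RingProperties
import Algebra.Solver.Ring.NaturalCoefficients.Default as SemiringSolver
open import Data.Fin.Base using (Fin; zero; suc; toℕ)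
open import Data.Fin.Properties using () renaming (_≟_ to _≟ᶠ_)
open import Data.Integer.Base using (ℤ; +_; -[1+_])
import Data.Integer.Properties as ℤ
open import Data.List.Base as List using (List; []; _∷_)
open import Data.Nat.Base as ℕ using (ℕ; zero; suc)
import Data.Nat.Properties as ℕ
open import Data.Product.Base using (Σ; ∃; ∃-syntax; _×_; _,_; proj₁; proj₂)
open import Data.Rational.Base as ℚ using (ℚ; 0ℚ)
import Data.Rational.Properties as ℚ
open import Data.Sum.Base using (_⊎_; inj₁; inj₂)
open import Data.Vec.Base as Vec using (Vec; lookup)
open import Data.Vec.Functional using (Vector; removeAt)
import Data.Vec.Properties as Vec
open import Function.Base using (_∘_)
open import Function.Bundles using (_↔_; Inverse)
open import Relation.Binary.Core using (Rel)
import Relation.Binary.Construct.NonStrictToStrict as NonStrictToStrict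
open import Relation.Binary.PropositionalEquality.Core using (_≡_; _≢_)
open import Relation.Binary.Structures using (IsTotalOrder)
open import Relation.Nullary using (¬_; yes; no)
open import Relation.Unary using (Pred; _∈_)

ℤ-ring : CommutativeRing 0ℓ 0ℓ
ℤ-ring = ℤ.+-*-commutativeRing

ℚ-ring : CommutativeRing 0ℓ 0ℓ
ℚ-ring = ℚ.+-*-commutativeRing

record IsField {c ℓ} (A : CommutativeRing c ℓ) : Set (c ⊔ ℓ) where
  open CommutativeRing A hiding (zero)
  field
    0≉1     : ¬ (0# ≈ 1#)
    inverse : ∀ x → ¬ (x ≈ 0#) → ∃[ y ] x * y ≈ 1#

module Matrices {c ℓ} (A : CommutativeRing c ℓ) where
  open CommutativeRing A hiding (zero)
  open RawSemiringDefinitions (RawRing.rawSemiring rawRing) using (sum; _^_)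

  Matrix : ℕ → Set c
  Matrix n = Vector (Vector Carrier n) n

  1ᴹ : ∀ {n} → Matrix n
  1ᴹ i j with i ≟ᶠ j
  ... | yes _ = 1#
  ... | no  _ = 0#

  _*ᴹ_ : ∀ {n} → Matrix n → Matrix n → Matrix n
  (M *ᴹ N) i k = sum (λ j → M i j * N j k)

  _≈ᴹ_ : ∀ {n} → Rel (Matrix n) ℓ
  M ≈ᴹ N = ∀ i j → M i j ≈ N i j

  _*ᵛ_ : ∀ {n} → Matrix n → Vec Carrier n → Vec Carrier n
  M *ᵛ v = Vec.tabulate (λ i → sum (λ j → M i j * lookup v j))

  -- Laplace expansion along the first row.
  det : ∀ {n} → Matrix n → Carrier
  det {zero}  M = 1#
  det {suc n} M =
    sum (λ j → (- 1#) ^ toℕ j * (M zero j * det (λ i → removeAt (M (suc i)) j)))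

  SL : ∀ n → Pred (Matrix n) ℓ
  SL n M = det M ≈ 1#

  InverseOf : ∀ {n} → Matrix n → Pred (Matrix n) ℓ
  InverseOf M N = ((M *ᴹ N) ≈ᴹ 1ᴹ) × ((N *ᴹ M) ≈ᴹ 1ᴹ)

module Polynomials {c ℓ} (A : CommutativeRing c ℓ) where
  open CommutativeRing A hiding (zero)
  open RawSemiringDefinitions (RawRing.rawSemiring rawRing) using (sum; product; _^_)

  -- A list of terms (coefficient , exponents).  The same exponents may occur
  -- in several terms, so polynomials are compared by _≈ₚ_, not by _≡_.
  Poly : ℕ → Set c
  Poly n = List (Carrier × Vec ℕ n)

  coeff : ∀ {n} → Poly n → Vec ℕ n → Carrier
  coeff []            β = 0#
  coeff ((a , α) ∷ p) β with Vec.≡-dec ℕ._≟_ α β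
  ... | yes _ = a + coeff p β
  ... | no  _ = coeff p β

  _≈ₚ_ : ∀ {n} → Rel (Poly n) ℓ
  p ≈ₚ q = ∀ β → coeff p β ≈ coeff q β

  Homogeneous : ∀ {n} → ℕ → Pred (Poly n) ℓ
  Homogeneous d p = ∀ β → Vec.sum β ≢ d → coeff p β ≈ 0#

  const : ∀ {n} → Carrier → Poly n
  const {n} a = List.[ a , Vec.replicate n 0 ]

  linear : ∀ {n} → Vector Carrier n → Poly n
  linear {n} l = List.tabulate (λ i → l i , Vec.replicate n 0 Vec.[ i ]≔ 1)

  _*ₚ_ : ∀ {n} → Poly n → Poly n → Poly n
  _*ₚ_ = List.cartesianProductWith
    (λ { (a , α) (b , β) → a * b , Vec.zipWith ℕ._+_ α β })

  _^ₚ_ : ∀ {n} → Poly n → ℕ → Poly n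
  p ^ₚ zero  = const 1#
  p ^ₚ suc k = p *ₚ (p ^ₚ k)

  productₚ : ∀ {n m} → Vector (Poly n) m → Poly n
  productₚ {m = zero}  ps = const 1#
  productₚ {m = suc m} ps = ps zero *ₚ productₚ (ps ∘ suc)

  -- p ∘ₚ q = p(q₁,…,qₘ)
  _∘ₚ_ : ∀ {m n} → Poly m → Vector (Poly n) m → Poly n
  p ∘ₚ q = List.concatMap
    (λ { (a , α) → const a *ₚ productₚ (λ i → q i ^ₚ lookup α i) }) p

  eval : ∀ {n} → Poly n → Vector Carrier n → Carrier
  eval p x = List.foldr
    (λ { (a , α) s → a * product (λ i → x i ^ lookup α i) + s }) 0# p

-- The real numbers, axiomatised.  Given excluded middle, these axioms determine
-- ℝ up to unique isomorphism.
record CompleteOrderedField : Set₁ where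
  field
    ring    : CommutativeRing 0ℓ 0ℓ
    isField : IsField ring
  open CommutativeRing ring public hiding (ring; zero)
  open IsField isField public

  field
    _≤_          : Rel Carrier 0ℓ
    isTotalOrder : IsTotalOrder _≈_ _≤_
    +-monoʳ-≤    : ∀ x {y z} → y ≤ z → (x + y) ≤ (x + z)
    *-nonNeg     : ∀ {x y} → 0# ≤ x → 0# ≤ y → 0# ≤ (x * y)

  UpperBound : Pred Carrier 0ℓ → Pred Carrier 0ℓ
  UpperBound S b = ∀ x → x ∈ S → x ≤ b

  field
    supremum : (S : Pred Carrier 0ℓ) → ∃ S → ∃ (UpperBound S) →
               ∃[ s ] (UpperBound S s × (∀ b → UpperBound S b → s ≤ b))

  open IsTotalOrder isTotalOrder public
    using (total; antisym; ≤-respˡ-≈; ≤-respʳ-≈)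
    renaming (refl to ≤-refl; trans to ≤-trans)
  open NonStrictToStrict _≈_ _≤_ public using (_<_)

module Over (ℛ : CompleteOrderedField) where
  open CompleteOrderedField ℛ renaming (Carrier to ℝ; ring to ℝ-ring)
  open RawSemiringDefinitions (RawRing.rawSemiring rawRing) using () renaming (_×_ to _·_)
  open RingProperties (CommutativeRing.ring ℝ-ring)
    using (-‿distribˡ-*; -‿involutive; -1*x≈-x; -0#≈0#)

  0≤1 : 0# ≤ 1#
  0≤1 with total 0# 1#
  ... | inj₁ 0≤1 = 0≤1
  ... | inj₂ 1≤0 = ≤-respʳ-≈ [-1]*[-1]≈1 (*-nonNeg 0≤-1 0≤-1)
    where
    0≤-1 : 0# ≤ (- 1#)
    0≤-1 = ≤-respˡ-≈ (-‿inverseˡ 1#) (≤-respʳ-≈ (+-identityʳ _) (+-monoʳ-≤ (- 1#) 1≤0))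
    [-1]*[-1]≈1 : (- 1#) * (- 1#) ≈ 1#
    [-1]*[-1]≈1 = trans (sym (-‿distribˡ-* 1# (- 1#)))
                        (trans (-‿cong (*-identityˡ _)) (-‿involutive 1#))

  1≤suc : ∀ k → 1# ≤ (suc k · 1#)
  0≤ℕ : ∀ k → 0# ≤ (k · 1#)
  1≤suc k = ≤-respˡ-≈ (+-identityʳ 1#) (+-monoʳ-≤ 1# (0≤ℕ k))
  0≤ℕ zero    = ≤-refl
  0≤ℕ (suc k) = ≤-trans 0≤1 (1≤suc k)

  suc≉0 : ∀ k → ¬ ((suc k · 1#) ≈ 0#)
  suc≉0 k eq = 0≉1 (antisym 0≤1 (≤-respʳ-≈ eq (1≤suc k)))

  fromℤ : ℤ → ℝ
  fromℤ (+ k)    = k · 1#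
  fromℤ -[1+ k ] = - (suc k · 1#)

  fromℚ : ℚ → ℝ
  fromℚ q = fromℤ (ℚ.numerator q) * proj₁ (inverse (suc d-1 · 1#) (suc≉0 d-1))
    where d-1 = ℚ.denominator-1 q

  ℂ : Set
  ℂ = ℝ × ℝ

  _*ᶜ_ : ℂ → ℂ → ℂ
  (a , b) *ᶜ (c , d) = (a * c) + (- (b * d)) , (a * d) + (b * c)

  ℂ-ring : CommutativeRing 0ℓ 0ℓ
  ℂ-ring = record
    { Carrier = ℂ
    ; _≈_ = CommutativeRing._≈_ ℝ²
    ; _+_ = CommutativeRing._+_ ℝ²
    ; _*_ = _*ᶜ_
    ; -_  = CommutativeRing.-_ ℝ²
    ; 0#  = 0# , 0#
    ; 1#  = 1# , 0#
    ; isCommutativeRing = record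
      { isRing = record
        { +-isAbelianGroup = CommutativeRing.+-isAbelianGroup ℝ²
        ; *-cong     = λ (p , q) (r , s) →
            +-cong (*-cong p r) (-‿cong (*-cong q s)) ,
            +-cong (*-cong p s) (*-cong q r)
        ; *-assoc    = *ᶜ-assoc
        ; *-identity = 1*-identityˡ , (λ z → transᶜ (*ᶜ-comm z _) (1*-identityˡ z))
        ; distrib    = *ᶜ-distribˡ ,
            (λ x y z → transᶜ (*ᶜ-comm (y +ᶜ z) x)
              (transᶜ (*ᶜ-distribˡ x y z) (+ᶜ-cong (*ᶜ-comm x y) (*ᶜ-comm x z))))
        }
      ; *-comm = *ᶜ-comm
      }
    }
    where
    ℝ² = DirectProduct.commutativeRing ℝ-ring ℝ-ring
    open CommutativeRing ℝ² using ()
      renaming (_≈_ to _≈ᶜ_; _+_ to _+ᶜ_; trans to transᶜ; +-cong to +ᶜ-cong)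
    open SemiringSolver (CommutativeRing.commutativeSemiring ℝ-ring)

    -- Negation enters the semiring identities below as a variable n = - 1#.
    neg : ∀ x → - x ≈ (- 1#) * x
    neg x = sym (-1*x≈-x x)

    *ᶜ-assoc : ∀ x y z → ((x *ᶜ y) *ᶜ z) ≈ᶜ (x *ᶜ (y *ᶜ z))
    *ᶜ-assoc (a , b) (c , d) (e , f) =
      trans (+-cong (*-congʳ (+-congˡ (neg _))) (neg _))
        (trans
          (solve 7 (λ n a b c d e f →
            (a :* c :+ n :* (b :* d)) :* e :+ n :* ((a :* d :+ b :* c) :* f)
            := a :* (c :* e :+ n :* (d :* f)) :+ n :* (b :* (c :* f :+ d :* e)))
            refl (- 1#) a b c d e f)
          (sym (+-cong (*-congˡ (+-congˡ (neg _))) (neg _)))) ,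
      trans (+-congʳ (*-congʳ (+-congˡ (neg _))))
        (trans
          (solve 7 (λ n a b c d e f →
            (a :* c :+ n :* (b :* d)) :* f :+ (a :* d :+ b :* c) :* e
            := a :* (c :* f :+ d :* e) :+ b :* (c :* e :+ n :* (d :* f)))
            refl (- 1#) a b c d e f)
          (sym (+-congˡ (*-congˡ (+-congˡ (neg _))))))

    *ᶜ-comm : ∀ x y → (x *ᶜ y) ≈ᶜ (y *ᶜ x)
    *ᶜ-comm (a , b) (c , d) =
      +-cong (*-comm a c) (-‿cong (*-comm b d)) ,
      trans (+-comm _ _) (+-cong (*-comm b c) (*-comm a d))

    1*-identityˡ : ∀ z → ((1# , 0#) *ᶜ z) ≈ᶜ z
    1*-identityˡ (a , b) =
      trans (+-cong (*-identityˡ a) (trans (-‿cong (zeroˡ b)) -0#≈0#)) (+-identityʳ a) ,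
      trans (+-cong (*-identityˡ b) (zeroˡ a)) (+-identityʳ b)

    *ᶜ-distribˡ : ∀ x y z → (x *ᶜ (y +ᶜ z)) ≈ᶜ ((x *ᶜ y) +ᶜ (x *ᶜ z))
    *ᶜ-distribˡ (a , b) (c , d) (e , f) =
      trans (+-congˡ (neg _))
        (trans
          (solve 7 (λ n a b c d e f →
            a :* (c :+ e) :+ n :* (b :* (d :+ f))
            := (a :* c :+ n :* (b :* d)) :+ (a :* e :+ n :* (b :* f)))
            refl (- 1#) a b c d e f)
          (sym (+-cong (+-congˡ (neg _)) (+-congˡ (neg _))))) ,
      solve 6 (λ a b c d e f →
        a :* (d :+ f) :+ b :* (c :+ e)
        := (a :* d :+ b :* c) :+ (a :* f :+ b :* e))
        refl a b c d e f

  open CommutativeRing ℂ-ring using ()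
    renaming (_≈_ to _≈ᶜ_; 0# to 0ᶜ; rawRing to ℂ-rawRing)
  open RawSemiringDefinitions (RawRing.rawSemiring ℂ-rawRing) using () renaming (sum to sumᶜ)

  fromℝ : ℝ → ℂ
  fromℝ a = a , 0#

  conj : ℂ → ℂ
  conj (a , b) = a , - b

  module ℝ[x] = Polynomials ℝ-ring
  module ℂ[x] = Polynomials ℂ-ring

  fromℝ[x] : ∀ {n} → ℝ[x].Poly n → ℂ[x].Poly n
  fromℝ[x] = List.map (λ { (a , α) → fromℝ a , α })

  LinearlyIndependent : ∀ {m n} → Vector (Vector ℂ n) m → Set
  LinearlyIndependent l =
    (c : Vector ℂ _) → (∀ j → sumᶜ (λ i → c i *ᶜ l i j) ≈ᶜ 0ᶜ) → ∀ i → c i ≈ᶜ 0ᶜ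

  -- A linear form Σⱼ lⱼxⱼ is given by its vector of coefficients.
  record Factors {n} (f : ℝ[x].Poly n) (l : Vector (Vector ℂ n) n) : Set where
    field
      factorization : fromℝ[x] f ℂ[x].≈ₚ ℂ[x].productₚ (λ i → ℂ[x].linear (l i))
      independent   : LinearlyIndependent l

  record Form (n : ℕ) : Set where
    field
      poly        : ℝ[x].Poly n
      homogeneous : ℝ[x].Homogeneous n poly
      factors     : ∃[ l ] Factors poly l

  _∝_ : ∀ {n} → Rel (Vector ℂ n) 0ℓ
  l ∝ m = ∃[ z ] (¬ (z ≈ᶜ 0ᶜ) × (∀ j → l j ≈ᶜ (z *ᶜ m j)))

  RealUpToScaling : ∀ {n} → Pred (Vector ℂ n) 0ℓ
  RealUpToScaling {n} l = Σ (Vector ℝ n) (λ r → l ∝ (fromℝ ∘ r))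

  -- Up to scaling, the linear forms lᵢ consist of s pairs of conjugate non-real
  -- forms and t real forms; the bijection forces n = 2s + t.
  record HasSignature {n} (l : Vector (Vector ℂ n) n) (s t : ℕ) : Set where
    field
      index : (Fin s ⊎ Fin s ⊎ Fin t) ↔ Fin n
    open Inverse index using (to)
    field
      nonReal   : ∀ k → ¬ RealUpToScaling (l (to (inj₁ k)))
      conjugate : ∀ k → l (to (inj₂ (inj₁ k))) ∝ (conj ∘ l (to (inj₁ k)))
      real      : ∀ k → RealUpToScaling (l (to (inj₂ (inj₂ k))))

  TotallyImaginary : ∀ {n} → Form n → Set
  TotallyImaginary f =
    ∃[ l ] (Factors (Form.poly f) l × (∃[ s ] HasSignature l s 0))

  RepresentsZeroOverℚ : ∀ {n} → Form n → Set
  RepresentsZeroOverℚ {n} f =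
    Σ (Vec ℚ n) λ v → v ≢ Vec.replicate n 0ℚ ×
      ℝ[x].eval (Form.poly f) (fromℚ ∘ lookup v) ≈ 0#

  Values : ∀ {n} → Form n → Pred (Vec ℤ n) 0ℓ → Pred ℝ 0ℓ
  Values {n} f Z y =
    Σ (Vec ℤ n) λ v → v ∈ Z × y ≈ ℝ[x].eval (Form.poly f) (fromℤ ∘ lookup v)

  AccumulationPoint : Pred ℝ 0ℓ → Pred ℝ 0ℓ
  AccumulationPoint S a =
    ∀ ε → 0# < ε → ∃[ y ] (y ∈ S × ¬ (y ≈ a) × (a - ε) < y × y < (a + ε))

  Discrete : Pred ℝ 0ℓ → Set
  Discrete S = ∀ a → ¬ AccumulationPoint S a

  -- K = ℚα₁ + … + ℚαₙ of degree n; the basis α is part of the data since the norm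
  -- polynomial depends on it.
  record NumberField (n : ℕ) : Set₁ where
    field
      ring    : CommutativeRing 0ℓ 0ℓ
      isField : IsField ring
    open CommutativeRing ring public
      using () renaming (rawRing to K-rawRing; Carrier to K; _≈_ to _≈ᴷ_; _*_ to _*ᴷ_; 0# to 0ᴷ)
    open RawSemiringDefinitions (RawRing.rawSemiring K-rawRing) using () renaming (sum to sumᴷ)
    field
      ι           : ℚ → K
      ι-homo      : IsRingHomomorphism ℚ.+-*-rawRing K-rawRing ι
      α           : Vector K n
      spanning    : ∀ x → Σ (Vector ℚ n) λ q → x ≈ᴷ sumᴷ (λ i → ι (q i) *ᴷ α i)
      independent : (q : Vector ℚ n) → sumᴷ (λ i → ι (q i) *ᴷ α i) ≈ᴷ 0ᴷ → ∀ i → q i ≡ 0ℚ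

  -- θ₁,…,θₙ are all the embeddings of K into ℂ, without repetition.
  record AllEmbeddings {n} (𝒦 : NumberField n)
                       (θ : Fin n → NumberField.K 𝒦 → ℂ) : Set where
    open NumberField 𝒦
    field
      homo     : ∀ i → IsRingHomomorphism K-rawRing ℂ-rawRing (θ i)
      distinct : ∀ {i j} → i ≢ j → ¬ (∀ x → θ i x ≈ᶜ θ j x)
      complete : ∀ φ → IsRingHomomorphism K-rawRing ℂ-rawRing φ →
                 ∃[ i ] (∀ x → φ x ≈ᶜ θ i x)

  normPoly : ∀ {n} (𝒦 : NumberField n) → (Fin n → NumberField.K 𝒦 → ℂ) → ℂ[x].Poly n
  normPoly 𝒦 θ = ℂ[x].productₚ (λ i → ℂ[x].linear (λ j → θ i (α j)))
    where open NumberField 𝒦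

  open Matrices ℚ-ring using (Matrix; SL; InverseOf)

  -- p = gq for some g ∈ SLₙ(ℚ), where (gq)(x) = q(hx) with h = g⁻¹.  Stated in
  -- ℂ[x], which contains ℝ[x], since norm polynomials are defined over ℂ.
  ℚ-Equivalent : ∀ {n} → Rel (ℂ[x].Poly n) 0ℓ
  ℚ-Equivalent {n} p q =
    Σ (Matrix n) λ g → g ∈ SL n × Σ (Matrix n) λ h → h ∈ InverseOf g ×
      p ℂ[x].≈ₚ (q ℂ[x].∘ₚ (λ i → ℂ[x].linear (λ j → fromℝ (fromℚ (h i j)))))

  IsNormForm : ∀ {n} → Form n → Set₁
  IsNormForm {n} f =
    Σ (NumberField n) λ 𝒦 → Σ (Fin n → NumberField.K 𝒦 → ℂ) λ θ →
      AllEmbeddings 𝒦 θ ×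
      (Σ ℝ λ c → ¬ (c ≈ 0#) ×
        ℚ-Equivalent (fromℝ[x] (Form.poly f)) (ℂ[x].const (fromℝ c) ℂ[x].*ₚ normPoly 𝒦 θ))

SLℤ-Invariant : ∀ {n} → Pred (Vec ℤ n) 0ℓ → Set
SLℤ-Invariant {n} Z = ∀ γ → γ ∈ SL n → ∀ v → v ∈ Z → (γ *ᵛ v) ∈ Z
  where open Matrices ℤ-ring

{-# OPTIONS --safe #-}

-- By Euclid's algorithm there is an m ≥ 1 such that every value of f on ℤⁿ ∖ {0} is
-- (c / m)ⁿ f(z) with z ∈ Z and an integer c ≥ 1.  Hence |f| is bounded away from 0 on ℤⁿ ∖ {0} and takes finitely many
-- values in every bounded interval.  Complex conjugation permutes the lines of the linear
-- factors of f; as f is not totally imaginary, it fixes one of them, that of l_{i₀}, and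
-- the common zero line of the other factors is real.  By Dirichlet's pigeonhole principle
-- there are, for every T, n independent integral vectors on which T^{-(n-1)} l_{i₀} and the
-- T lᵢ with i ≠ i₀ are bounded.  In such bases f takes one of finitely many shapes, so two
-- bases, for very different T, give the same linear factors up to scalars.  The change of
-- basis is a rational matrix γ with lᵢ ∘ γ = eᵢ lᵢ, where e_{i₀} ≠ eᵢ for i ≠ i₀.
-- Since f has no rational zero, ℚ[γ] is a field acting on ℚⁿ; as e_{i₀} is a simple
-- eigenvalue, ℚⁿ has dimension one over it.  Transporting the multiplication to ℚⁿ by means
-- of a vector b, the embeddings become x ↦ lᵢ(x) / lᵢ(b), and f = f(b) · N.
module Submission where

open import Level using (Level; 0ℓ)
open import Algebra.Bundles using (CommutativeRing; RawRing)
open import Algebra.Morphism.Structures using (IsRingHomomorphism)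
import Algebra.Morphism.RingMonomorphism as RingMonomorphism
import Algebra.Definitions.RawSemiring as RawSemiringDefinitions
import Algebra.Properties.Semiring.Mult as SemiringMult
import Algebra.Properties.Semiring.Exp as SemiringExp
import Algebra.Properties.Semiring.Sum as SemiringSum
import Algebra.Properties.Ring as RingProperties
import Algebra.Properties.AbelianGroup as AbelianGroupProperties
import Algebra.Solver.Ring as RingSolver
open import Algebra.Solver.Ring.AlmostCommutativeRing using (fromCommutativeRing; _-Raw-AlmostCommutative⟶_)
open import Axiom.ExcludedMiddle using (ExcludedMiddle)
open import Data.Empty using (⊥-elim)
open import Data.Fin.Base as Fin using (Fin; zero; suc; toℕ; punchIn)
import Data.Fin.Properties as Fin
open import Data.Integer.Base as ℤ using (ℤ; +_; -[1+_]; 0ℤ; 1ℤ; -1ℤ)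
import Data.Integer.Properties as ℤ
open import Data.List.Base as List using ([]; _∷_)
open import Data.Maybe.Base using (Maybe; just; nothing)
open import Data.Nat.Base as ℕ using (ℕ; zero; suc)
import Data.Nat.Properties as ℕ
open import Data.Product.Base using (Σ; ∃; ∃₂; _×_; _,_; proj₁; proj₂)
open import Data.Rational.Base as ℚ using (ℚ; 0ℚ; 1ℚ)
import Data.Rational.Properties as ℚ
import Data.Rational.Unnormalised.Base as ℚᵘ
import Data.Sign.Base as Sign
open import Data.Sum.Base as Sum using (_⊎_; inj₁; inj₂; [_,_]′)
open import Data.Vec.Base as Vec using (Vec; []; _∷_; lookup; replicate)
import Data.Vec.Properties as Vec
open import Data.Vec.Functional using (Vector; removeAt)
open import Function.Base using (_∘_; id)
open import Function.Bundles using (_↔_; mk↔ₛ′; Inverse)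
open import Relation.Binary.Definitions using (Decidable)
open import Relation.Binary.PropositionalEquality as ≡ using (_≡_; _≢_)
import Relation.Binary.Reasoning.Setoid as SetoidReasoning
open import Relation.Nullary using (¬_; Dec; yes; no)
open import Relation.Nullary.Decidable using (¬?; _×-dec_)
open import Relation.Unary using (Pred; _∈_; _∉_)
open import Defs

-- Rings and linear algebra

-- The weights T^-(n-1) and T have product one, so weighting the factors does not change the form,
-- and a lower bound for |f| says that no nonzero integral vector makes all weighted factors small,
-- uniformly in T. This yields n independent vectors: the `j`-th one is sought in a box that is long
-- in direction `j` only and thinner by a factor D in the others; its `j`-th coordinate must then be
-- large, or f would be too small at it. For large D the matrix of coordinates is diagonally
-- dominant, and D does not depend on T, which is why finitely many shapes serve all T. Contracting
-- a single direction requires a real line, whence the role of conjugation. The bounds from above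
-- and below on the weighted factors also separate e_{i₀} from the other multipliers: if two agreed,
-- the change of weights alone would drive a factor out of its bounds. About the remaining
-- multipliers nothing is known, and they may coincide. Hence ℚ[γ] is handled through a complex
-- polynomial ρ that isolates i₀, and rationality is recovered by descending a linear system from ℂ
-- to ℚ.

module RingKit {c ℓ : Level} (R : CommutativeRing c ℓ) where
  open CommutativeRing R hiding (zero)
  open RawSemiringDefinitions (RawRing.rawSemiring rawRing) using (product) renaming (_×_ to _·_)
  open Matrices R using (1ᴹ)
  open SemiringSum semiring using (sum; sum-cong-≋; ∑-distrib-+; ∑-comm; sum-replicate-zero; *-distribˡ-sum; *-distribʳ-sum)
  open RingProperties ring using (-0#≈0#; -‿distribˡ-*; -‿distribʳ-*; -‿involutive)
  open AbelianGroupProperties +-abelianGroup using () renaming (⁻¹-∙-comm to -‿+-comm)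
  open SemiringMult semiring using (×1-homo-*; ×-homo-+)
  open SetoidReasoning setoid

  -- The formula of `fromℤ`, for an arbitrary ring; as coefficient map of the ring solver it makes
  -- integral constants and negation available there.
  fromInt : ℤ → Carrier
  fromInt (+ k)    = k · 1#
  fromInt -[1+ k ] = - (suc k · 1#)

  fromInt-cong : ∀ {i j} → i ≡ j → fromInt i ≈ fromInt j
  fromInt-cong ≡.refl = refl

  fromInt-⊖ : ∀ m n → fromInt (m ℤ.⊖ n) ≈ m · 1# + - (n · 1#)
  fromInt-⊖ zero    zero    = sym (trans (+-congˡ -0#≈0#) (+-identityʳ _))
  fromInt-⊖ zero    (suc n) = sym (+-identityˡ _)
  fromInt-⊖ (suc m) zero    = sym (trans (+-congˡ -0#≈0#) (+-identityʳ _))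
  fromInt-⊖ (suc m) (suc n) = begin
    fromInt (suc m ℤ.⊖ suc n)                       ≈⟨ fromInt-cong (ℤ.[1+m]⊖[1+n]≡m⊖n m n) ⟩
    fromInt (m ℤ.⊖ n)                               ≈⟨ fromInt-⊖ m n ⟩
    m · 1# + - (n · 1#)                             ≈⟨ +-congʳ (+-identityˡ _) ⟨
    0# + m · 1# + - (n · 1#)                        ≈⟨ +-congʳ (+-congʳ (-‿inverseʳ 1#)) ⟨
    1# + - 1# + m · 1# + - (n · 1#)                 ≈⟨ +-congʳ (trans (+-assoc _ _ _) (trans (+-congˡ (+-comm _ _)) (sym (+-assoc _ _ _)))) ⟩
    1# + m · 1# + - 1# + - (n · 1#)                 ≈⟨ trans (+-assoc _ _ _) (+-congˡ (-‿+-comm _ _)) ⟩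
    1# + m · 1# + - (1# + n · 1#)                   ∎

  fromInt-+ : ∀ i j → fromInt (i ℤ.+ j) ≈ fromInt i + fromInt j
  fromInt-+ (+ m)    (+ n)    = ×-homo-+ 1# m n
  fromInt-+ (+ m)    -[1+ n ] = fromInt-⊖ m (suc n)
  fromInt-+ -[1+ m ] (+ n)    = trans (fromInt-⊖ n (suc m)) (+-comm _ _)
  fromInt-+ -[1+ m ] -[1+ n ] = begin
    - (suc (suc (m ℕ.+ n)) · 1#)               ≈⟨ -‿cong (SemiringMult.×-congˡ semiring (≡.cong suc (ℕ.+-suc m n))) ⟨
    - ((suc m ℕ.+ suc n) · 1#)                 ≈⟨ -‿cong (×-homo-+ 1# (suc m) (suc n)) ⟩
    - (suc m · 1# + suc n · 1#)                ≈⟨ -‿+-comm _ _ ⟨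
    - (suc m · 1#) + - (suc n · 1#)            ∎

  fromInt-+◃ : ∀ k → fromInt (Sign.+ ℤ.◃ k) ≈ k · 1#
  fromInt-+◃ zero    = refl
  fromInt-+◃ (suc k) = refl

  fromInt--◃ : ∀ k → fromInt (Sign.- ℤ.◃ k) ≈ - (k · 1#)
  fromInt--◃ zero    = sym -0#≈0#
  fromInt--◃ (suc k) = refl

  fromInt-* : ∀ i j → fromInt (i ℤ.* j) ≈ fromInt i * fromInt j
  fromInt-* (+ m)    (+ n)    = trans (fromInt-+◃ (m ℕ.* n)) (×1-homo-* m n)
  fromInt-* (+ m)    -[1+ n ] = trans (fromInt--◃ (m ℕ.* suc n)) (trans (-‿cong (×1-homo-* m (suc n))) (-‿distribʳ-* _ _))
  fromInt-* -[1+ m ] (+ n)    = trans (fromInt--◃ (suc m ℕ.* n)) (trans (-‿cong (×1-homo-* (suc m) n)) (-‿distribˡ-* _ _))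
  fromInt-* -[1+ m ] -[1+ n ] = begin
    (suc m ℕ.* suc n) · 1#                     ≈⟨ ×1-homo-* (suc m) (suc n) ⟩
    suc m · 1# * suc n · 1#                    ≈⟨ -‿involutive _ ⟨
    - (- (suc m · 1# * suc n · 1#))            ≈⟨ -‿cong (-‿distribˡ-* _ _) ⟩
    - (- (suc m · 1#) * suc n · 1#)            ≈⟨ -‿distribʳ-* _ _ ⟩
    - (suc m · 1#) * - (suc n · 1#)            ∎

  fromInt-neg : ∀ i → fromInt (ℤ.- i) ≈ - fromInt i
  fromInt-neg (+ zero)  = sym -0#≈0#
  fromInt-neg (+ suc n) = refl
  fromInt-neg -[1+ n ]  = sym (-‿involutive _)

  fromInt-1 : fromInt 1ℤ ≈ 1#
  fromInt-1 = +-identityʳ 1#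

  fromInt-morphism : ℤ.+-*-rawRing -Raw-AlmostCommutative⟶ fromCommutativeRing R
  fromInt-morphism = record
    { ⟦_⟧    = fromInt
    ; +-homo = fromInt-+
    ; *-homo = fromInt-*
    ; -‿homo = fromInt-neg
    ; 0-homo = refl
    ; 1-homo = fromInt-1
    }

  fromInt-≟ : ∀ i j → Maybe (fromInt i ≈ fromInt j)
  fromInt-≟ i j with i ℤ.≟ j
  ... | yes i≡j = just (fromInt-cong i≡j)
  ... | no  _   = nothing

  open RingSolver ℤ.+-*-rawRing (fromCommutativeRing R) fromInt-morphism fromInt-≟ public
    using (solve; _:=_; con; _:+_; _:*_; _:-_; :-_)

  sum-cong : ∀ n {f g : Vector Carrier n} → (∀ i → f i ≈ g i) → sum f ≈ sum g
  sum-cong n f≈g = sum-cong-≋ f≈g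

  *-distribˡ-∑ : ∀ n x (f : Vector Carrier n) → x * sum f ≈ sum (λ i → x * f i)
  *-distribˡ-∑ n x f = *-distribˡ-sum x f

  *-distribʳ-∑ : ∀ n x (f : Vector Carrier n) → sum f * x ≈ sum (λ i → f i * x)
  *-distribʳ-∑ n x f = *-distribʳ-sum x f

  ∑-+ : ∀ n (f g : Vector Carrier n) → sum (λ i → f i + g i) ≈ sum f + sum g
  ∑-+ n f g = ∑-distrib-+ f g

  sum-zero : ∀ n {f : Vector Carrier n} → (∀ i → f i ≈ 0#) → sum f ≈ 0#
  sum-zero n f≈0 = trans (sum-cong n f≈0) (sum-replicate-zero n)

  product-cong : ∀ n {f g : Vector Carrier n} → (∀ i → f i ≈ g i) → product f ≈ product g
  product-cong zero    f≈g = refl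
  product-cong (suc n) f≈g = *-cong (f≈g zero) (product-cong n (f≈g ∘ suc))

  product-* : ∀ n (f g : Vector Carrier n) → product (λ i → f i * g i) ≈ product f * product g
  product-* zero    f g = sym (*-identityˡ 1#)
  product-* (suc n) f g = trans (*-congˡ (product-* n (f ∘ suc) (g ∘ suc)))
    (solve 4 (λ a b c d → a :* b :* (c :* d) := a :* c :* (b :* d)) refl _ _ _ _)

  product-zero : ∀ {n} {f : Vector Carrier n} i → f i ≈ 0# → product f ≈ 0#
  product-zero zero    fi≈0 = trans (*-congʳ fi≈0) (zeroˡ _)
  product-zero (suc i) fi≈0 = trans (*-congˡ (product-zero i fi≈0)) (zeroʳ _)

  product-one : ∀ n {f : Vector Carrier n} → (∀ i → f i ≈ 1#) → product f ≈ 1#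
  product-one zero    f≈1 = refl
  product-one (suc n) f≈1 = trans (*-cong (f≈1 zero) (product-one n (f≈1 ∘ suc))) (*-identityˡ 1#)

  product-remove : ∀ {n} (f : Vector Carrier (suc n)) i → product f ≈ f i * product (removeAt f i)
  product-remove {n}     f zero    = refl
  product-remove {suc n} f (suc i) = trans (*-congˡ (product-remove (f ∘ suc) i))
    (solve 3 (λ x y z → x :* (y :* z) := y :* (x :* z)) refl _ _ _)

  1ᴹ-suc : ∀ {n} (i j : Fin n) → 1ᴹ (suc i) (suc j) ≡ 1ᴹ i j
  1ᴹ-suc i j with i Fin.≟ j
  ... | yes _ = ≡.refl
  ... | no  _ = ≡.refl

  1ᴹ-diagonal : ∀ {n} (i : Fin n) → 1ᴹ i i ≡ 1#
  1ᴹ-diagonal i with i Fin.≟ i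
  ... | yes _   = ≡.refl
  ... | no  i≢i = ⊥-elim (i≢i ≡.refl)

  1ᴹ-off-diagonal : ∀ {n} {i j : Fin n} → i ≢ j → 1ᴹ i j ≡ 0#
  1ᴹ-off-diagonal {i = i} {j} i≢j with i Fin.≟ j
  ... | yes i≡j = ⊥-elim (i≢j i≡j)
  ... | no  _   = ≡.refl

  1ᴹ-sym : ∀ {n} (i j : Fin n) → 1ᴹ i j ≡ 1ᴹ j i
  1ᴹ-sym i j with i Fin.≟ j
  ... | yes ≡.refl = ≡.sym (1ᴹ-diagonal i)
  ... | no  i≢j    = ≡.sym (1ᴹ-off-diagonal (i≢j ∘ ≡.sym))

  sum-single : ∀ {n} (i : Fin n) (f : Vector Carrier n) → (∀ j → i ≢ j → f j ≈ 0#) → sum f ≈ f i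
  sum-single zero    f f≈0 = trans (+-congˡ (sum-zero _ (λ j → f≈0 (suc j) λ ()))) (+-identityʳ _)
  sum-single (suc i) f f≈0 = trans (+-cong (f≈0 zero λ ()) (sum-single i (f ∘ suc) (λ j i≢j → f≈0 (suc j) (i≢j ∘ Fin.suc-injective))))
    (+-identityˡ _)

  sum-1ᴹˡ : ∀ {n} (i : Fin n) (f : Vector Carrier n) → sum (λ j → 1ᴹ i j * f j) ≈ f i
  sum-1ᴹˡ i f = trans
    (sum-single i _ (λ j i≢j → trans (*-congʳ (reflexive (1ᴹ-off-diagonal i≢j))) (zeroˡ _)))
    (trans (*-congʳ (reflexive (1ᴹ-diagonal i))) (*-identityˡ _))

  sum-1ᴹʳ : ∀ {n} (i : Fin n) (f : Vector Carrier n) → sum (λ j → f j * 1ᴹ j i) ≈ f i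
  sum-1ᴹʳ {n} i f = trans (sum-cong n (λ j → trans (*-comm _ _) (*-congʳ (reflexive (1ᴹ-sym j i))))) (sum-1ᴹˡ i f)

  sum-*-sum : ∀ {m n} (a : Vector Carrier m) (M : Fin m → Fin n → Carrier) (x : Vector Carrier n) →
    sum (λ i → a i * sum (λ j → M i j * x j)) ≈ sum (λ j → sum (λ i → a i * M i j) * x j)
  sum-*-sum {m} {n} a M x = begin
    sum (λ i → a i * sum (λ j → M i j * x j))      ≈⟨ sum-cong m (λ i → *-distribˡ-∑ n (a i) _) ⟩
    sum (λ i → sum (λ j → a i * (M i j * x j)))    ≈⟨ ∑-comm (λ i j → a i * (M i j * x j)) ⟩
    sum (λ j → sum (λ i → a i * (M i j * x j)))    ≈⟨ sum-cong n (λ j → sum-cong m (λ i → sym (*-assoc _ _ _))) ⟩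
    sum (λ j → sum (λ i → a i * M i j * x j))      ≈⟨ sum-cong n (λ j → sym (*-distribʳ-∑ m (x j) _)) ⟩
    sum (λ j → sum (λ i → a i * M i j) * x j)      ∎

module RingHomKit {c ℓ c′ ℓ′ : Level} (A : CommutativeRing c ℓ) (B : CommutativeRing c′ ℓ′)
  (φ : CommutativeRing.Carrier A → CommutativeRing.Carrier B)
  (φ-homo : IsRingHomomorphism (CommutativeRing.rawRing A) (CommutativeRing.rawRing B) φ) where
  private
    module A = CommutativeRing A
    module B = CommutativeRing B
  open IsRingHomomorphism φ-homo
  module RA = RawSemiringDefinitions (RawRing.rawSemiring A.rawRing)
  module RB = RawSemiringDefinitions (RawRing.rawSemiring B.rawRing)

  φ-sum : ∀ n (f : Vector A.Carrier n) → φ (RA.sum f) B.≈ RB.sum (φ ∘ f)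
  φ-sum zero    f = 0#-homo
  φ-sum (suc n) f = B.trans (+-homo _ _) (B.+-congˡ (φ-sum n (f ∘ suc)))

  φ-product : ∀ n (f : Vector A.Carrier n) → φ (RA.product f) B.≈ RB.product (φ ∘ f)
  φ-product zero    f = 1#-homo
  φ-product (suc n) f = B.trans (*-homo _ _) (B.*-congˡ (φ-product n (f ∘ suc)))

  φ-^ : ∀ x k → φ (x RA.^ k) B.≈ φ x RB.^ k
  φ-^ x zero    = 1#-homo
  φ-^ x (suc k) = B.trans (*-homo _ _) (B.*-congˡ (φ-^ x k))

  φ-fromInt : ∀ i → φ (RingKit.fromInt A i) B.≈ RingKit.fromInt B i
  φ-fromInt = λ { (+ k) → φ-· k ; -[1+ k ] → B.trans (-‿homo _) (B.-‿cong (φ-· (suc k))) }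
    where
    φ-· : ∀ k → φ (k RA.× A.1#) B.≈ k RB.× B.1#
    φ-· zero    = 0#-homo
    φ-· (suc k) = B.trans (+-homo _ _) (B.+-cong 1#-homo (φ-· k))

module FieldKit {c ℓ : Level} (F : CommutativeRing c ℓ) (isField : IsField F)
                (_≈?_ : Decidable (CommutativeRing._≈_ F)) where
  open CommutativeRing F hiding (zero)
  open IsField isField
  open RawSemiringDefinitions (RawRing.rawSemiring rawRing) using (sum; product)
  open RingKit F
  open SetoidReasoning setoid

  cancel-unit : ∀ {x y} → ¬ (x ≈ 0#) → x * y ≈ 0# → y ≈ 0#
  cancel-unit {x} {y} x≉0 xy≈0 with inverse x x≉0
  ... | x⁻¹ , xx⁻¹≈1 = begin
    y               ≈⟨ *-identityˡ y ⟨
    1# * y          ≈⟨ *-congʳ xx⁻¹≈1 ⟨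
    x * x⁻¹ * y     ≈⟨ solve 3 (λ x z y → x :* z :* y := z :* (x :* y)) refl x x⁻¹ y ⟩
    x⁻¹ * (x * y)   ≈⟨ *-congˡ xy≈0 ⟩
    x⁻¹ * 0#        ≈⟨ zeroʳ _ ⟩
    0#              ∎

  *-nonzero : ∀ {x y} → ¬ (x ≈ 0#) → ¬ (y ≈ 0#) → ¬ (x * y ≈ 0#)
  *-nonzero x≉0 y≉0 xy≈0 = y≉0 (cancel-unit x≉0 xy≈0)

  minus≈0 : ∀ {x y} → x - y ≈ 0# → x ≈ y
  minus≈0 {x} {y} x-y≈0 = trans (solve 2 (λ x y → x := (x :- y) :+ y) refl x y) (trans (+-congʳ x-y≈0) (+-identityˡ y))

  *-cancelˡ : ∀ {x y z} → ¬ (x ≈ 0#) → x * y ≈ x * z → y ≈ z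
  *-cancelˡ {x} {y} {z} x≉0 eq = minus≈0 (cancel-unit x≉0
    (trans (solve 3 (λ x y z → x :* (y :- z) := x :* y :- x :* z) refl x y z)
           (trans (+-congʳ eq) (-‿inverseʳ _))))

  product-nonzero : ∀ n {f : Vector Carrier n} → (∀ i → ¬ (f i ≈ 0#)) → ¬ (product f ≈ 0#)
  product-nonzero zero    f≉0 = λ 1≈0 → 0≉1 (sym 1≈0)
  product-nonzero (suc n) f≉0 = *-nonzero (f≉0 zero) (product-nonzero n (f≉0 ∘ suc))

  zero⊎nonzero : ∀ {n} (f : Vector Carrier n) → (∀ i → f i ≈ 0#) ⊎ ∃ (λ i → ¬ (f i ≈ 0#))
  zero⊎nonzero {n} f with Fin.all? (λ i → f i ≈? 0#)
  ... | yes f≈0 = inj₁ f≈0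
  ... | no  f≉0 = inj₂ (Fin.¬∀⟶∃¬ n _ (λ i → f i ≈? 0#) f≉0)

  product≈0 : ∀ n {f : Vector Carrier n} → product f ≈ 0# → ∃ λ i → f i ≈ 0#
  product≈0 n {f} eq with Fin.any? (λ i → f i ≈? 0#)
  ... | yes found = found
  ... | no  none  = ⊥-elim (product-nonzero n (λ i fi≈0 → none (i , fi≈0)) eq)

  sum-eliminate : ∀ n k (a b x : Vector Carrier n) →
    sum (λ j → (a j - k * b j) * x j) ≈ sum (λ j → a j * x j) - k * sum (λ j → b j * x j)
  sum-eliminate n k a b x = begin
    sum (λ j → (a j - k * b j) * x j)
      ≈⟨ sum-cong n (λ j → solve 4 (λ a k b x → (a :- k :* b) :* x := a :* x :+ (:- k) :* (b :* x)) refl (a j) k (b j) (x j)) ⟩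
    sum (λ j → a j * x j + - k * (b j * x j))
      ≈⟨ ∑-+ n (λ j → a j * x j) (λ j → - k * (b j * x j)) ⟩
    sum (λ j → a j * x j) + sum (λ j → - k * (b j * x j))
      ≈⟨ +-congˡ (*-distribˡ-∑ n (- k) (λ j → b j * x j)) ⟨
    sum (λ j → a j * x j) + - k * sum (λ j → b j * x j)
      ≈⟨ solve 3 (λ s k t → s :+ (:- k) :* t := s :- k :* t) refl _ k _ ⟩
    sum (λ j → a j * x j) - k * sum (λ j → b j * x j) ∎

  -- Induction on the number of equations: a pivot in the first column eliminates one equation
  -- together with the first unknown. If that column vanishes, the first unit vector is a solution.
  kernel : ∀ m (A : Fin m → Fin (suc m) → Carrier) →
    ∃ λ (x : Vector Carrier (suc m)) → ∃ (λ j → ¬ (x j ≈ 0#)) × (∀ i → sum (λ j → A i j * x j) ≈ 0#)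
  kernel zero    A = (λ _ → 1#) , (zero , 0≉1 ∘ sym) , λ ()
  kernel (suc m) A with zero⊎nonzero (λ i → A i zero)
  ... | inj₁ column≈0 = e₀ , (zero , 0≉1 ∘ sym) , λ i →
      trans (+-cong (trans (*-congʳ (column≈0 i)) (zeroˡ _)) (sum-zero (suc m) (λ j → zeroʳ (A i (suc j))))) (+-identityˡ 0#)
    where
    e₀ : Fin (suc (suc m)) → Carrier
    e₀ zero    = 1#
    e₀ (suc j) = 0#
  ... | inj₂ (r , p≉0) with inverse (A r zero) p≉0
  ...   | q , pq≈1 with kernel m (λ i j → A (punchIn r i) (suc j) - A (punchIn r i) zero * q * A r (suc j))
  ...     | x′ , (k , x′k≉0) , eqs = x , (suc k , x′k≉0) , row
    where
    S : Fin (suc m) → Carrier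
    S i = sum (λ j → A i (suc j) * x′ j)
    x : Fin (suc (suc m)) → Carrier
    x zero    = - (q * S r)
    x (suc j) = x′ j
    row : ∀ i → A i zero * x zero + S i ≈ 0#
    row i with r Fin.≟ i
    ... | yes ≡.refl = begin
      A r zero * - (q * S r) + S r   ≈⟨ solve 3 (λ p q s → p :* (:- (q :* s)) :+ s := s :- (p :* q) :* s) refl _ _ _ ⟩
      S r - A r zero * q * S r       ≈⟨ +-congˡ (-‿cong (trans (*-congʳ pq≈1) (*-identityˡ _))) ⟩
      S r - S r                      ≈⟨ -‿inverseʳ _ ⟩
      0#                             ∎
    ... | no r≢i = ≡.subst (λ i → A i zero * x zero + S i ≈ 0#) (Fin.punchIn-punchOut r≢i) (begin
      A i′ zero * - (q * S r) + S i′      ≈⟨ solve 4 (λ a q s t → a :* (:- (q :* s)) :+ t := t :- (a :* q) :* s) refl _ _ _ _ ⟩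
      S i′ - A i′ zero * q * S r          ≈⟨ sum-eliminate (suc m) (A i′ zero * q) (A i′ ∘ suc) (A r ∘ suc) x′ ⟨
      sum (λ j → (A i′ (suc j) - A i′ zero * q * A r (suc j)) * x′ j) ≈⟨ eqs _ ⟩
      0#                                  ∎)
      where i′ = punchIn r (Fin.punchOut r≢i)

  TrivialKernel : ∀ {m n} → (Fin m → Fin n → Carrier) → Set _
  TrivialKernel {n = n} A = ∀ (x : Vector Carrier n) → (∀ i → sum (λ j → A i j * x j) ≈ 0#) → ∀ j → x j ≈ 0#

  -- A nonzero kernel vector of the augmented matrix `[b|A]` cannot have first coordinate 0, since
  -- the rest of it would then lie in the kernel of `A`; dividing by minus that coordinate solves
  -- the system.
  injective⇒surjective : ∀ {n} (A : Fin n → Fin n → Carrier) → TrivialKernel A →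
    ∀ (b : Vector Carrier n) → ∃ λ (x : Vector Carrier n) → ∀ i → sum (λ j → A i j * x j) ≈ b i
  injective⇒surjective {n} A A-inj b with kernel n [b|A]
    where
    [b|A] : Fin n → Fin (suc n) → Carrier
    [b|A] i zero    = b i
    [b|A] i (suc j) = A i j
  ... | x , (k , xk≉0) , eqs with x zero ≈? 0#
  ...   | yes t≈0 = ⊥-elim (contradiction k xk≉0)
    where
    x≈0 : ∀ j → x (suc j) ≈ 0#
    x≈0 = A-inj (x ∘ suc) (λ i → trans (sym (+-identityˡ _)) (trans (+-congʳ (sym (trans (*-congˡ t≈0) (zeroʳ _)))) (eqs i)))
    contradiction : ∀ k → ¬ ¬ (x k ≈ 0#)
    contradiction zero    xk≉0 = xk≉0 t≈0
    contradiction (suc j) xk≉0 = xk≉0 (x≈0 j)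
  ...   | no t≉0 with inverse (x zero) t≉0
  ...     | t⁻¹ , tt⁻¹≈1 = (λ j → - t⁻¹ * x (suc j)) , λ i → begin
    sum (λ j → A i j * (- t⁻¹ * x (suc j)))
      ≈⟨ sum-cong n (λ j → solve 3 (λ a t x → a :* (:- t :* x) := :- t :* (a :* x)) refl (A i j) t⁻¹ (x (suc j))) ⟩
    sum (λ j → - t⁻¹ * (A i j * x (suc j)))
      ≈⟨ *-distribˡ-∑ n (- t⁻¹) (λ j → A i j * x (suc j)) ⟨
    - t⁻¹ * sum (λ j → A i j * x (suc j))
      ≈⟨ solve 4 (λ s t u b → :- t :* s := b :* (u :* t) :- t :* (b :* u :+ s)) refl _ t⁻¹ (x zero) (b i) ⟩
    b i * (x zero * t⁻¹) - t⁻¹ * (b i * x zero + sum (λ j → A i j * x (suc j)))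
      ≈⟨ +-cong (*-congˡ tt⁻¹≈1) (-‿cong (*-congˡ (eqs i))) ⟩
    b i * 1# - t⁻¹ * 0#
      ≈⟨ +-cong (*-identityʳ _) (trans (-‿cong (zeroʳ _)) (RingProperties.-0#≈0# ring)) ⟩
    b i + 0#
      ≈⟨ +-identityʳ _ ⟩
    b i ∎

module FieldExtension
  {c ℓ c′ ℓ′ : Level}
  (F : CommutativeRing c ℓ) (F-isField : IsField F) (_≈?_ : Decidable (CommutativeRing._≈_ F))
  (E : CommutativeRing c′ ℓ′) (E-isField : IsField E)
  (φ : CommutativeRing.Carrier F → CommutativeRing.Carrier E)
  (φ-homo : IsRingHomomorphism (CommutativeRing.rawRing F) (CommutativeRing.rawRing E) φ) where

  private
    module F = CommutativeRing F
    module E = CommutativeRing E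
    module FK = FieldKit F F-isField _≈?_
    module FR = RingKit F
    module ER = RingKit E
  open IsRingHomomorphism φ-homo
  open RawSemiringDefinitions (RawRing.rawSemiring F.rawRing) using () renaming (sum to sumF)
  open RawSemiringDefinitions (RawRing.rawSemiring E.rawRing) using () renaming (sum to sumE)

  φ-reflects-0 : ∀ {x} → φ x E.≈ E.0# → x F.≈ F.0#
  φ-reflects-0 {x} φx≈0 with x ≈? F.0#
  ... | yes x≈0 = x≈0
  ... | no  x≉0 with IsField.inverse F-isField x x≉0
  ...   | x⁻¹ , xx⁻¹≈1 = ⊥-elim (IsField.0≉1 E-isField (begin
    E.0#              ≈⟨ E.zeroˡ _ ⟨
    E.0# E.* φ x⁻¹    ≈⟨ E.*-congʳ φx≈0 ⟨
    φ x E.* φ x⁻¹     ≈⟨ *-homo x x⁻¹ ⟨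
    φ (x F.* x⁻¹)     ≈⟨ ⟦⟧-cong xx⁻¹≈1 ⟩
    φ F.1#            ≈⟨ 1#-homo ⟩
    E.1#              ∎))
    where open SetoidReasoning E.setoid

  -- Gaussian elimination only performs operations in the field of the coefficients.
  descend-solution : ∀ N {m} (A : Fin m → Fin N → F.Carrier) (b : Fin m → F.Carrier) (z : Fin N → E.Carrier) →
    (∀ i → sumE (λ j → φ (A i j) E.* z j) E.≈ φ (b i)) →
    ∃ λ (x : Vector F.Carrier N) → ∀ i → sumF (λ j → A i j F.* x j) F.≈ b i
  descend-solution zero    A b z eqs = (λ ()) , λ i → F.sym (φ-reflects-0 (E.sym (eqs i)))
  descend-solution (suc N) A b z eqs with FK.zero⊎nonzero (λ i → A i zero)
  ... | inj₁ column≈0 with descend-solution N (λ i → A i ∘ suc) b (z ∘ suc) eqs′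
    where
    eqs′ : ∀ i → sumE (λ j → φ (A i (suc j)) E.* z (suc j)) E.≈ φ (b i)
    eqs′ i = E.trans (E.sym (E.trans (E.+-congʳ (E.trans (E.*-congʳ (E.trans (⟦⟧-cong (column≈0 i)) 0#-homo)) (E.zeroˡ _)))
      (E.+-identityˡ _))) (eqs i)
  ...   | x′ , sol = x , λ i → F.trans (F.+-congʳ (F.zeroʳ _)) (F.trans (F.+-identityˡ _) (sol i))
    where
    x : Fin (suc N) → F.Carrier
    x zero    = F.0#
    x (suc j) = x′ j
  descend-solution (suc N) A b z eqs | inj₂ (r , p≉0) with IsField.inverse F-isField (A r zero) p≉0
  ... | q , pq≈1 with descend-solution N (λ i j → A i (suc j) F.- A i zero F.* q F.* A r (suc j))
                                       (λ i → b i F.- A i zero F.* q F.* b r) (z ∘ suc) eqs′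
    where
    open SetoidReasoning E.setoid
    S : _ → E.Carrier
    S i = sumE (λ j → φ (A i (suc j)) E.* z (suc j))
    k : _ → E.Carrier
    k i = φ (A i zero F.* q)
    kp≈ : ∀ i → k i E.* φ (A r zero) E.≈ φ (A i zero)
    kp≈ i = E.trans (E.sym (*-homo _ _)) (⟦⟧-cong (F.trans
      (FR.solve 3 (λ a q p → a FR.:* q FR.:* p FR.:= a FR.:* (p FR.:* q)) F.refl _ _ _)
      (F.trans (F.*-congˡ pq≈1) (F.*-identityʳ _))))
    φ-minus : ∀ x c y → φ (x F.- c F.* y) E.≈ φ x E.+ E.- φ c E.* φ y
    φ-minus x c y = E.trans (+-homo _ _) (E.+-congˡ (E.trans (-‿homo _) (E.trans (E.-‿cong (*-homo _ _))
      (ER.solve 2 (λ c y → ER.:- (c ER.:* y) ER.:= (ER.:- c) ER.:* y) E.refl _ _))))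
    eqs′ : ∀ i → sumE (λ j → φ (A i (suc j) F.- A i zero F.* q F.* A r (suc j)) E.* z (suc j)) E.≈ φ (b i F.- A i zero F.* q F.* b r)
    eqs′ i = begin
      sumE (λ j → φ (A i (suc j) F.- A i zero F.* q F.* A r (suc j)) E.* z (suc j))
        ≈⟨ ER.sum-cong N (λ j → E.trans (E.*-congʳ (φ-minus _ _ _))
             (ER.solve 4 (λ a k c z → (a ER.:+ (ER.:- k) ER.:* c) ER.:* z ER.:= a ER.:* z ER.:+ (ER.:- k) ER.:* (c ER.:* z)) E.refl _ _ _ _)) ⟩
      sumE (λ j → φ (A i (suc j)) E.* z (suc j) E.+ E.- k i E.* (φ (A r (suc j)) E.* z (suc j)))
        ≈⟨ ER.∑-+ N _ _ ⟩
      S i E.+ sumE (λ j → E.- k i E.* (φ (A r (suc j)) E.* z (suc j)))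
        ≈⟨ E.+-congˡ (E.sym (ER.*-distribˡ-∑ N (E.- k i) _)) ⟩
      S i E.+ E.- k i E.* S r
        ≈⟨ ER.solve 5 (λ s k t p z → s ER.:+ (ER.:- k) ER.:* t ER.:=
             ((k ER.:* p) ER.:* z ER.:+ s) ER.:+ (ER.:- k) ER.:* (p ER.:* z ER.:+ t)) E.refl (S i) (k i) (S r) (φ (A r zero)) (z zero) ⟩
      (k i E.* φ (A r zero)) E.* z zero E.+ S i E.+ E.- k i E.* (φ (A r zero) E.* z zero E.+ S r)
        ≈⟨ E.+-cong (E.trans (E.+-congʳ (E.*-congʳ (kp≈ i))) (eqs i)) (E.*-congˡ (eqs r)) ⟩
      φ (b i) E.+ E.- k i E.* φ (b r)
        ≈⟨ φ-minus _ _ _ ⟨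
      φ (b i F.- A i zero F.* q F.* b r) ∎
  ...   | x′ , sol = x , row
    where
    open SetoidReasoning F.setoid
    S : _ → F.Carrier
    S i = sumF (λ j → A i (suc j) F.* x′ j)
    x : Fin (suc N) → F.Carrier
    x zero    = q F.* (b r F.- S r)
    x (suc j) = x′ j
    row : ∀ i → A i zero F.* (q F.* (b r F.- S r)) F.+ S i F.≈ b i
    row i = begin
      A i zero F.* (q F.* (b r F.- S r)) F.+ S i
        ≈⟨ FR.solve 5 (λ a q b s t → a FR.:* (q FR.:* (b FR.:- s)) FR.:+ t FR.:= (t FR.:- a FR.:* q FR.:* s) FR.:+ a FR.:* q FR.:* b)
             F.refl _ _ _ _ _ ⟩
      S i F.- A i zero F.* q F.* S r F.+ A i zero F.* q F.* b r
        ≈⟨ F.+-congʳ (F.trans (F.sym (FK.sum-eliminate N (A i zero F.* q) (A i ∘ suc) (A r ∘ suc) x′)) (sol i)) ⟩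
      b i F.- A i zero F.* q F.* b r F.+ A i zero F.* q F.* b r
        ≈⟨ FR.solve 2 (λ b c → b FR.:- c FR.:+ c FR.:= b) F.refl _ _ ⟩
      b i ∎

-- Evaluation of polynomials

module Evaluation {c ℓ : Level} (R : CommutativeRing c ℓ) where
  open CommutativeRing R hiding (zero)
  open RawSemiringDefinitions (RawRing.rawSemiring rawRing) using (sum; product; _^_)
  open RingKit R
  open Polynomials R
  open SemiringExp semiring using (^-congˡ; ^-homo-*)
  open SetoidReasoning setoid

  monomial : ∀ {n} → Vec ℕ n → Vector Carrier n → Carrier
  monomial α x = product (λ i → x i ^ lookup α i)

  eval-congʳ : ∀ {n} (p : Poly n) {x y : Vector Carrier n} → (∀ i → x i ≈ y i) → eval p x ≈ eval p y
  eval-congʳ []            x≈y = refl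
  eval-congʳ {n} ((a , α) ∷ p) x≈y =
    +-cong (*-congˡ (product-cong n (λ i → ^-congˡ (lookup α i) (x≈y i)))) (eval-congʳ p x≈y)

  eval-++ : ∀ {n} (p q : Poly n) x → eval (p List.++ q) x ≈ eval p x + eval q x
  eval-++ []      q x = sym (+-identityˡ _)
  eval-++ (t ∷ p) q x = trans (+-congˡ (eval-++ p q x)) (sym (+-assoc _ _ _))

  monomial-+ : ∀ {n} (α β : Vec ℕ n) x → monomial (Vec.zipWith ℕ._+_ α β) x ≈ monomial α x * monomial β x
  monomial-+ []      []      x = sym (*-identityˡ 1#)
  monomial-+ (j ∷ α) (k ∷ β) x = trans (*-cong (^-homo-* (x zero) j k) (monomial-+ α β (x ∘ suc)))
    (solve 4 (λ a b c d → a :* b :* (c :* d) := a :* c :* (b :* d)) refl _ _ _ _)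

  eval-scaled : ∀ {n} a (α : Vec ℕ n) (q : Poly n) {f : Carrier × Vec ℕ n → Carrier × Vec ℕ n} x →
    (∀ b β → f (b , β) ≡ (a * b , Vec.zipWith ℕ._+_ α β)) →
    eval (List.map f q) x ≈ a * monomial α x * eval q x
  eval-scaled a α []            x f≡ = sym (zeroʳ _)
  eval-scaled a α ((b , β) ∷ q) x f≡ rewrite f≡ b β = trans
    (+-cong (*-congˡ (monomial-+ α β x)) (eval-scaled a α q x f≡))
    (solve 5 (λ a b m n e → a :* b :* (m :* n) :+ a :* m :* e := a :* m :* (b :* n :+ e)) refl _ _ _ _ _)

  eval-*ₚ : ∀ {n} (p q : Poly n) x → eval (p *ₚ q) x ≈ eval p x * eval q x
  eval-*ₚ []            q x = sym (zeroˡ _)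
  eval-*ₚ ((a , α) ∷ p) q x = begin
    eval (((a , α) ∷ p) *ₚ q) x                              ≈⟨ eval-++ (List.map _ q) (p *ₚ q) x ⟩
    eval (List.map _ q) x + eval (p *ₚ q) x                  ≈⟨ +-cong (eval-scaled a α q x (λ _ _ → ≡.refl)) (eval-*ₚ p q x) ⟩
    a * monomial α x * eval q x + eval p x * eval q x        ≈⟨ distribʳ _ _ _ ⟨
    eval ((a , α) ∷ p) x * eval q x                          ∎

  monomial-0 : ∀ n (x : Vector Carrier n) → monomial (replicate n 0) x ≈ 1#
  monomial-0 zero    x = refl
  monomial-0 (suc n) x = trans (*-identityˡ _) (monomial-0 n (x ∘ suc))

  monomial-1 : ∀ {n} i (x : Vector Carrier n) → monomial (replicate n 0 Vec.[ i ]≔ 1) x ≈ x i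
  monomial-1 {suc n} zero    x = trans (*-cong (*-identityʳ _) (monomial-0 n (x ∘ suc))) (*-identityʳ _)
  monomial-1 {suc n} (suc i) x = trans (*-identityˡ _) (monomial-1 i (x ∘ suc))

  eval-const : ∀ {n} a (x : Vector Carrier n) → eval (const a) x ≈ a
  eval-const {n} a x = trans (+-identityʳ _) (trans (*-congˡ (monomial-0 n x)) (*-identityʳ a))

  eval-tabulate : ∀ {m n} (f : Fin m → Carrier × Vec ℕ n) x →
    eval (List.tabulate f) x ≈ sum (λ i → proj₁ (f i) * monomial (proj₂ (f i)) x)
  eval-tabulate {zero}  f x = refl
  eval-tabulate {suc m} f x = +-congˡ (eval-tabulate (f ∘ suc) x)

  eval-linear : ∀ {n} (l x : Vector Carrier n) → eval (linear l) x ≈ sum (λ j → l j * x j)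
  eval-linear {n} l x = trans (eval-tabulate (λ i → l i , replicate n 0 Vec.[ i ]≔ 1) x) (sum-cong n (λ i → *-congˡ (monomial-1 i x)))

  eval-productₚ : ∀ {n} m (ps : Vector (Poly n) m) x → eval (productₚ ps) x ≈ product (λ i → eval (ps i) x)
  eval-productₚ zero    ps x = eval-const 1# x
  eval-productₚ (suc m) ps x = trans (eval-*ₚ (ps zero) (productₚ (ps ∘ suc)) x) (*-congˡ (eval-productₚ m (ps ∘ suc) x))

  eval-^ₚ : ∀ {n} (p : Poly n) k x → eval (p ^ₚ k) x ≈ eval p x ^ k
  eval-^ₚ p zero    x = eval-const 1# x
  eval-^ₚ p (suc k) x = trans (eval-*ₚ p (p ^ₚ k) x) (*-congˡ (eval-^ₚ p k x))

  eval-∘ₚ : ∀ {m n} (p : Poly m) (q : Vector (Poly n) m) x → eval (p ∘ₚ q) x ≈ eval p (λ i → eval (q i) x)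
  eval-∘ₚ         []            q x = refl
  eval-∘ₚ {m} {n} ((a , α) ∷ p) q x = begin
    eval (((a , α) ∷ p) ∘ₚ q) x
      ≈⟨ eval-++ (const a *ₚ qᵅ) (p ∘ₚ q) x ⟩
    eval (const a *ₚ qᵅ) x + eval (p ∘ₚ q) x
      ≈⟨ +-cong (trans (eval-*ₚ (const a) qᵅ x) (*-cong (eval-const a x)
           (trans (eval-productₚ m (λ i → q i ^ₚ lookup α i) x) (product-cong m (λ i → eval-^ₚ (q i) (lookup α i) x)))))
           (eval-∘ₚ p q x) ⟩
    a * monomial α (λ i → eval (q i) x) + eval p (λ i → eval (q i) x) ∎
    where
    qᵅ : Poly n
    qᵅ = productₚ (λ i → q i ^ₚ lookup α i)

  -- The coefficient, in the remaining variables, of the `k`-th power of the first one. Terms with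
  -- equal exponents may be scattered over the list, so `≈ₚ` does not lend itself to induction on
  -- lists; slicing permits induction on the number of variables.
  slice : ∀ {n} → ℕ → Poly (suc n) → Poly n
  slice k []                 = []
  slice k ((a , j ∷ α) ∷ p) with j ℕ.≟ k
  ... | yes _ = (a , α) ∷ slice k p
  ... | no  _ = slice k p

  coeff-slice : ∀ {n} k (p : Poly (suc n)) β → coeff (slice k p) β ≈ coeff p (k ∷ β)
  coeff-slice k []                β = refl
  coeff-slice k ((a , j ∷ α) ∷ p) β with j ℕ.≟ k
  ... | no j≢k with Vec.≡-dec ℕ._≟_ (j ∷ α) (k ∷ β)
  ...   | yes eq = ⊥-elim (j≢k (Vec.∷-injectiveˡ eq))
  ...   | no  _  = coeff-slice k p β
  coeff-slice k ((a , j ∷ α) ∷ p) β | yes ≡.refl with Vec.≡-dec ℕ._≟_ α β | Vec.≡-dec ℕ._≟_ (j ∷ α) (j ∷ β)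
  ...   | yes _   | yes _  = +-congˡ (coeff-slice k p β)
  ...   | yes α≡β | no neq = ⊥-elim (neq (≡.cong (j ∷_) α≡β))
  ...   | no  α≢β | yes eq = ⊥-elim (α≢β (Vec.∷-injectiveʳ eq))
  ...   | no  _   | no _   = coeff-slice k p β

  -- A strict bound for the exponents of the first variable, so that it can serve as a number of
  -- slices.
  headBound : ∀ {n} → Poly (suc n) → ℕ
  headBound []                = 0
  headBound ((a , j ∷ α) ∷ p) = suc j ℕ.⊔ headBound p

  coeff-beyond : ∀ {n} (p : Poly (suc n)) {k} β → headBound p ℕ.≤ k → coeff p (k ∷ β) ≈ 0#
  coeff-beyond []                    β p≤k = refl
  coeff-beyond ((a , j ∷ α) ∷ p) {k} β p≤k with Vec.≡-dec ℕ._≟_ (j ∷ α) (k ∷ β)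
  ... | yes eq = ⊥-elim (ℕ.<-irrefl (Vec.∷-injectiveˡ eq) (ℕ.≤-trans (ℕ.m≤m⊔n (suc j) (headBound p)) p≤k))
  ... | no  _  = coeff-beyond p β (ℕ.≤-trans (ℕ.m≤n⊔m (suc j) (headBound p)) p≤k)

  -- Adjoining one term to a polynomial changes a single slice, that of index `k`.
  sum-at : ∀ {B k} (k<B : k ℕ.< B) a (f : Vector Carrier B) (g : ℕ → Carrier) →
    (∀ j → k ≡ toℕ j → f j ≈ a + g (toℕ j)) → (∀ j → k ≢ toℕ j → f j ≈ g (toℕ j)) →
    sum f ≈ a + sum {B} (g ∘ toℕ)
  sum-at {suc B} {zero}  k<B a f g at off = trans
    (+-cong (at zero ≡.refl) (sum-cong B (λ j → off (suc j) λ ()))) (+-assoc _ _ _)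
  sum-at {suc B} {suc k} k<B a f g at off = trans
    (+-cong (off zero λ ()) (sum-at (ℕ.s<s⁻¹ k<B) a (f ∘ suc) (g ∘ suc)
      (λ j eq → at (suc j) (≡.cong suc eq)) (λ j neq → off (suc j) (neq ∘ ℕ.suc-injective))))
    (solve 3 (λ x y z → x :+ (y :+ z) := y :+ (x :+ z)) refl _ _ _)

  eval-slices : ∀ {n} B (p : Poly (suc n)) x → headBound p ℕ.≤ B →
    eval p x ≈ sum {B} (λ k → x zero ^ toℕ k * eval (slice (toℕ k) p) (x ∘ suc))
  eval-slices B []                x p≤B = sym (sum-zero B (λ k → zeroʳ (x zero ^ toℕ k)))
  eval-slices B ((a , j ∷ α) ∷ p) x p≤B = trans
    (+-congˡ (eval-slices B p x (ℕ.≤-trans (ℕ.m≤n⊔m (suc j) (headBound p)) p≤B)))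
    (sym (sum-at (ℕ.≤-trans (ℕ.m≤m⊔n (suc j) (headBound p)) p≤B) (a * monomial (j ∷ α) x) _
      (λ k → x zero ^ k * eval (slice k p) (x ∘ suc)) at off))
    where
    at : ∀ (k : Fin B) → j ≡ toℕ k → x zero ^ toℕ k * eval (slice (toℕ k) ((a , j ∷ α) ∷ p)) (x ∘ suc)
      ≈ a * monomial (j ∷ α) x + x zero ^ toℕ k * eval (slice (toℕ k) p) (x ∘ suc)
    at k ≡.refl with toℕ k ℕ.≟ toℕ k
    ... | yes _  = solve 4 (λ t a m e → t :* (a :* m :+ e) := a :* (t :* m) :+ t :* e) refl _ _ _ _
    ... | no neq = ⊥-elim (neq ≡.refl)
    off : ∀ (k : Fin B) → j ≢ toℕ k → x zero ^ toℕ k * eval (slice (toℕ k) ((a , j ∷ α) ∷ p)) (x ∘ suc)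
      ≈ x zero ^ toℕ k * eval (slice (toℕ k) p) (x ∘ suc)
    off k neq with j ℕ.≟ toℕ k
    ... | yes eq = ⊥-elim (neq eq)
    ... | no  _  = refl

  eval-[] : (p : Poly 0) → ∀ x → eval p x ≈ coeff p []
  eval-[] []             x = refl
  eval-[] ((a , []) ∷ p) x = +-cong (*-identityʳ a) (eval-[] p x)

  ≈ₚ⇒eval : ∀ {n} (p q : Poly n) → p ≈ₚ q → ∀ x → eval p x ≈ eval q x
  ≈ₚ⇒eval {zero}  p q p≈q x = trans (eval-[] p x) (trans (p≈q []) (sym (eval-[] q x)))
  ≈ₚ⇒eval {suc n} p q p≈q x = begin
    eval p x
      ≈⟨ eval-slices B p x (ℕ.m≤m+n _ _) ⟩
    sum {B} (λ k → x zero ^ toℕ k * eval (slice (toℕ k) p) (x ∘ suc))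
      ≈⟨ sum-cong B (λ k → *-congˡ (≈ₚ⇒eval (slice (toℕ k) p) (slice (toℕ k) q)
           (λ β → trans (coeff-slice (toℕ k) p β) (trans (p≈q (toℕ k ∷ β)) (sym (coeff-slice (toℕ k) q β)))) (x ∘ suc))) ⟩
    sum {B} (λ k → x zero ^ toℕ k * eval (slice (toℕ k) q) (x ∘ suc))
      ≈⟨ eval-slices B q x (ℕ.m≤n+m _ _) ⟨
    eval q x ∎
    where B = headBound p ℕ.+ headBound q

-- Polynomial functions, grids and proportional linear factors

module PolynomialIdentities {c ℓ : Level} (F : CommutativeRing c ℓ) (isField : IsField F)
    (_≈?_ : Decidable (CommutativeRing._≈_ F)) where
  open CommutativeRing F hiding (zero)
  open RawSemiringDefinitions (RawRing.rawSemiring rawRing) using (sum; product; _^_) renaming (_×_ to _·_)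
  open RingKit F
  open FieldKit F isField _≈?_
  open Matrices F using (1ᴹ)
  open SetoidReasoning setoid

  horner : ∀ {d} → Vector Carrier d → Carrier → Carrier
  horner {zero}  a t = 0#
  horner {suc d} a t = a zero + t * horner (a ∘ suc) t

  horner-congʳ : ∀ d (a : Vector Carrier d) {s t} → s ≈ t → horner a s ≈ horner a t
  horner-congʳ zero    a s≈t = refl
  horner-congʳ (suc d) a s≈t = +-congˡ (*-cong s≈t (horner-congʳ d (a ∘ suc) s≈t))

  -- A property of functions rather than of lists of terms: the restriction of a product of linear
  -- forms to a line has it without being expanded.
  DegreeBelow : ℕ → (Carrier → Carrier) → Set _
  DegreeBelow d g = ∃ λ (a : Vector Carrier d) → ∀ t → g t ≈ horner a t

  degree-combine : ∀ {d g h} u v → DegreeBelow d g → DegreeBelow d h → DegreeBelow d (λ t → u * g t + v * h t)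
  degree-combine {d} u v (a , g≈) (b , h≈) = (λ i → u * a i + v * b i) ,
    λ t → trans (+-cong (*-congˡ (g≈ t)) (*-congˡ (h≈ t))) (combine d a b t)
    where
    combine : ∀ d (a b : Vector Carrier d) t → u * horner a t + v * horner b t ≈ horner (λ i → u * a i + v * b i) t
    combine zero    a b t = trans (+-cong (zeroʳ u) (zeroʳ v)) (+-identityˡ 0#)
    combine (suc d) a b t = trans
      (solve 7 (λ u v a b t g h → u :* (a :+ t :* g) :+ v :* (b :+ t :* h) := (u :* a :+ v :* b) :+ t :* (u :* g :+ v :* h))
        refl u v (a zero) (b zero) t _ _)
      (+-congˡ (*-congˡ (combine d (a ∘ suc) (b ∘ suc) t)))

  degree-weaken : ∀ {d g} → DegreeBelow d g → DegreeBelow (suc d) g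
  degree-weaken {d} (a , g≈) = pad d a , λ t → trans (g≈ t) (sym (horner-pad d a t))
    where
    pad : ∀ d → Vector Carrier d → Vector Carrier (suc d)
    pad zero    a i       = 0#
    pad (suc d) a zero    = a zero
    pad (suc d) a (suc i) = pad d (a ∘ suc) i
    horner-pad : ∀ d a t → horner (pad d a) t ≈ horner a t
    horner-pad zero    a t = trans (+-identityˡ _) (zeroʳ t)
    horner-pad (suc d) a t = +-congˡ (*-congˡ (horner-pad d (a ∘ suc) t))

  degree-shift : ∀ {d g} → DegreeBelow d g → DegreeBelow (suc d) (λ t → t * g t)
  degree-shift {d} (a , g≈) = 0∷a , λ t → trans (*-congˡ (g≈ t)) (sym (+-identityˡ _))
    where
    0∷a : Vector Carrier (suc d)
    0∷a zero    = 0#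
    0∷a (suc i) = a i

  degree-product : ∀ N (u v : Vector Carrier N) → DegreeBelow (suc N) (λ t → product (λ i → u i + t * v i))
  degree-product zero    u v = (λ _ → 1#) , λ t → sym (trans (+-congˡ (zeroʳ t)) (+-identityʳ 1#))
  degree-product (suc N) u v = proj₁ combination , λ t → trans
    (solve 4 (λ u v t p → (u :+ t :* v) :* p := u :* p :+ v :* (t :* p)) refl (u zero) (v zero) t (g t)) (proj₂ combination t)
    where
    g : Carrier → Carrier
    g t = product (λ i → u (suc i) + t * v (suc i))
    tail : DegreeBelow (suc N) g
    tail = degree-product N (u ∘ suc) (v ∘ suc)
    combination : DegreeBelow (suc (suc N)) (λ t → u zero * g t + v zero * (t * g t))
    combination = degree-combine {g = g} {h = λ t → t * g t} (u zero) (v zero) (degree-weaken {g = g} tail) (degree-shift {g = g} tail)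

  -- The tail P inherits the problem through t P(t) - s P(s) = (t - s) P(t) + s (P(t) - P(s)).
  quotient : ∀ {d} (a : Vector Carrier (suc d)) s →
    ∃ λ (b : Vector Carrier d) → ∀ t → horner a t - horner a s ≈ (t - s) * horner b t
  quotient {zero} a s = (λ ()) , λ t → begin
    a zero + t * 0# - (a zero + s * 0#)  ≈⟨ +-cong (+-congˡ (zeroʳ t)) (-‿cong (+-congˡ (zeroʳ s))) ⟩
    a zero + 0# - (a zero + 0#)          ≈⟨ -‿inverseʳ _ ⟩
    0#                                   ≈⟨ zeroʳ _ ⟨
    (t - s) * 0#                         ∎
  quotient {suc d} a s = proj₁ combination , λ t → begin
    a zero + t * P t - (a zero + s * P s)      ≈⟨ solve 5 (λ a t p s q → a :+ t :* p :- (a :+ s :* q) := (t :- s) :* p :+ s :* (p :- q))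
                                                    refl (a zero) t (P t) s (P s) ⟩
    (t - s) * P t + s * (P t - P s)            ≈⟨ +-congˡ (*-congˡ (proj₂ tail t)) ⟩
    (t - s) * P t + s * ((t - s) * Q t)        ≈⟨ solve 4 (λ d p s q → d :* p :+ s :* (d :* q) := d :* (p :+ s :* q)) refl (t - s) (P t) s (Q t) ⟩
    (t - s) * (P t + s * Q t)                  ≈⟨ *-congˡ (+-congʳ (sym (*-identityˡ (P t)))) ⟩
    (t - s) * (1# * P t + s * Q t)             ≈⟨ *-congˡ (proj₂ combination t) ⟩
    (t - s) * horner (proj₁ combination) t     ∎
    where
    P Q : Carrier → Carrier
    P = horner (a ∘ suc)
    tail : ∃ λ (b : Vector Carrier d) → ∀ t → P t - P s ≈ (t - s) * horner b t
    tail = quotient (a ∘ suc) s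
    Q = horner (proj₁ tail)
    combination : DegreeBelow (suc d) (λ t → 1# * P t + s * Q t)
    combination = degree-combine {g = P} {h = Q} 1# s (a ∘ suc , λ _ → refl) (degree-weaken {g = Q} (proj₁ tail , λ _ → refl))

  vanishing : ∀ d (a : Vector Carrier d) (s : Fin d → Carrier) → (∀ {i j} → i ≢ j → ¬ (s i ≈ s j)) →
    (∀ i → horner a (s i) ≈ 0#) → ∀ t → horner a t ≈ 0#
  vanishing zero    a s distinct roots t = refl
  vanishing (suc d) a s distinct roots t with quotient a (s zero)
  ... | b , eq = trans (factor t) (trans (*-congˡ (vanishing d b (s ∘ suc) (λ i≢j → distinct (i≢j ∘ Fin.suc-injective)) roots′ t)) (zeroʳ _))
    where
    factor : ∀ t → horner a t ≈ (t - s zero) * horner b t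
    factor t = trans (sym (+-identityʳ _)) (trans (+-congˡ (trans (sym (RingProperties.-0#≈0# ring)) (-‿cong (sym (roots zero))))) (eq t))
    roots′ : ∀ i → horner b (s (suc i)) ≈ 0#
    roots′ i = cancel-unit (λ z → distinct {suc i} {zero} (λ ()) (minus≈0 z)) (trans (sym (factor _)) (roots (suc i)))

  module CharacteristicZero (char0 : ∀ k → ¬ (suc k · 1# ≈ 0#)) where

    ·1-injective : ∀ {j k} → j · 1# ≈ k · 1# → j ≡ k
    ·1-injective {zero}  {zero}  eq = ≡.refl
    ·1-injective {zero}  {suc k} eq = ⊥-elim (char0 k (sym eq))
    ·1-injective {suc j} {zero}  eq = ⊥-elim (char0 j eq)
    ·1-injective {suc j} {suc k} eq = ≡.cong suc (·1-injective (trans (shift j) (trans (+-congʳ eq) (sym (shift k)))))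
      where
      shift : ∀ j → j · 1# ≈ suc j · 1# - 1#
      shift j = solve 2 (λ o x → x := (o :+ x) :- o) refl 1# (j · 1#)

    -- The constant coefficient is the value at 0. The tail then vanishes at 1, ..., `d`, where the
    -- factor `t` can be cancelled, and these points are distinct in characteristic zero.
    horner-identity : ∀ d (a : Vector Carrier d) → (∀ t → horner a t ≈ 0#) → ∀ i → a i ≈ 0#
    horner-identity (suc d) a a≈0 = λ { zero → a₀≈0 ; (suc i) → horner-identity d (a ∘ suc) tail≈0 i }
      where
      a₀≈0 : a zero ≈ 0#
      a₀≈0 = trans (sym (trans (+-congˡ (zeroˡ _)) (+-identityʳ _))) (a≈0 0#)
      point : Fin d → Carrier
      point i = suc (toℕ i) · 1#
      tail≈0 : ∀ t → horner (a ∘ suc) t ≈ 0#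
      tail≈0 = vanishing d (a ∘ suc) point (λ i≢j eq → i≢j (Fin.toℕ-injective (ℕ.suc-injective (·1-injective eq))))
        (λ i → cancel-unit (char0 (toℕ i)) (trans (sym (+-identityˡ _)) (trans (+-congʳ (sym a₀≈0)) (a≈0 (point i)))))

    horner-sum : ∀ d (a : ℕ → Carrier) t → sum {d} (λ k → t ^ toℕ k * a (toℕ k)) ≈ horner {d} (a ∘ toℕ) t
    horner-sum zero    a t = refl
    horner-sum (suc d) a t = +-cong (*-identityˡ _) (trans
      (sum-cong d (λ k → *-assoc t (t ^ toℕ k) (a (suc (toℕ k)))))
      (trans (sym (*-distribˡ-∑ d t (λ k → t ^ toℕ k * a (suc (toℕ k))))) (*-congˡ (horner-sum d (a ∘ suc) t))))

    open Evaluation F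
    open Polynomials F

    cons : ∀ {n} → Carrier → Vector Carrier n → Vector Carrier (suc n)
    cons t x zero    = t
    cons t x (suc i) = x i

    -- With the other variables fixed, the values of the slices are the coefficients of a polynomial
    -- in the first variable; equal functions therefore have slices that are equal as functions, and
    -- induction applies to these.
    eval⇒≈ₚ : ∀ {n} (p q : Poly n) → (∀ x → eval p x ≈ eval q x) → p ≈ₚ q
    eval⇒≈ₚ {zero}  p q p≈q []      = trans (sym (eval-[] p (λ ()))) (trans (p≈q (λ ())) (eval-[] q (λ ())))
    eval⇒≈ₚ {suc n} p q p≈q (k ∷ β) with k ℕ.<? headBound p ℕ.+ headBound q
    ... | no k≮B = trans (coeff-beyond p β (ℕ.≤-trans (ℕ.m≤m+n _ _) (ℕ.≮⇒≥ k≮B)))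
                    (sym (coeff-beyond q β (ℕ.≤-trans (ℕ.m≤n+m _ _) (ℕ.≮⇒≥ k≮B))))
    ... | yes k<B = trans (sym (coeff-slice k p β)) (trans (eval⇒≈ₚ (slice k p) (slice k q) slices β) (coeff-slice k q β))
      where
      B = headBound p ℕ.+ headBound q
      module _ (x : Vector Carrier n) where
        P Q : ℕ → Carrier
        P k = eval (slice k p) x
        Q k = eval (slice k q) x
        combination : DegreeBelow B (λ t → 1# * horner {B} (P ∘ toℕ) t + - 1# * horner {B} (Q ∘ toℕ) t)
        combination = degree-combine {g = horner {B} (P ∘ toℕ)} {h = horner {B} (Q ∘ toℕ)} 1# (- 1#) (P ∘ toℕ , λ _ → refl) (Q ∘ toℕ , λ _ → refl)
        zero-everywhere : ∀ t → horner (proj₁ combination) t ≈ 0#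
        zero-everywhere t = begin
          horner (proj₁ combination) t                 ≈⟨ proj₂ combination t ⟨
          1# * horner {B} (P ∘ toℕ) t + - 1# * horner {B} (Q ∘ toℕ) t
            ≈⟨ +-cong (*-congˡ (trans (sym (horner-sum B P t)) (sym (eval-slices B p (cons t x) (ℕ.m≤m+n _ _)))))
                      (*-congˡ (trans (sym (horner-sum B Q t)) (sym (eval-slices B q (cons t x) (ℕ.m≤n+m _ _))))) ⟩
          1# * eval p (cons t x) + - 1# * eval q (cons t x)  ≈⟨ +-congʳ (*-congˡ (p≈q (cons t x))) ⟩
          1# * eval q (cons t x) + - 1# * eval q (cons t x)  ≈⟨ solve 2 (λ o e → o :* e :+ (:- o) :* e := con 0ℤ) refl 1# _ ⟩
          0# ∎
        difference : 1# * P k + - 1# * Q k ≈ 0#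
        difference = ≡.subst (λ j → 1# * P j + - 1# * Q j ≈ 0#) (Fin.toℕ-fromℕ< k<B)
          (horner-identity B (proj₁ combination) zero-everywhere (Fin.fromℕ< k<B))
      slices : ∀ x → eval (slice k p) x ≈ eval (slice k q) x
      slices x = minus≈0 (trans (+-cong (sym (*-identityˡ (eval (slice k p) x)))
        (trans (-‿cong (sym (*-identityˡ (eval (slice k q) x)))) (RingProperties.-‿distribˡ-* ring 1# (eval (slice k q) x)))) (difference x))

    LinesDegreeBelow : ∀ {n} → ℕ → (Vector Carrier n → Carrier) → Set _
    LinesDegreeBelow {n} d g = ∀ (x y : Vector Carrier n) → DegreeBelow d (λ t → g (λ i → x i + t * y i))

    Extensional : ∀ {n} → (Vector Carrier n → Carrier) → Set _
    Extensional {n} g = ∀ {x y : Vector Carrier n} → (∀ i → x i ≈ y i) → g x ≈ g y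

    -- Fixing the first coordinate at one of the `d` grid values leaves a function of fewer
    -- variables with the same property, which is zero by induction. On the line through `x` in the
    -- first direction this gives `d` zeros of a polynomial of degree less than `d`.
    grid-vanishing : ∀ {n} d (g : Vector Carrier n → Carrier) → Extensional g → LinesDegreeBelow d g →
      (∀ (x : Fin n → Fin d) → g (λ i → toℕ (x i) · 1#) ≈ 0#) → ∀ x → g x ≈ 0#
    grid-vanishing {zero}  d g g-ext lines grid x = trans (g-ext (λ ())) (grid (λ ()))
    grid-vanishing {suc n} d g g-ext lines grid x = trans (trans (g-ext on-line) (a-eq (x zero)))
      (vanishing d a (λ i → toℕ i · 1#) (λ i≢j eq → i≢j (Fin.toℕ-injective (·1-injective eq)))
        (λ i → trans (sym (a-eq (toℕ i · 1#))) (trans (g-ext (off-line i)) (section≈0 i (x ∘ suc)))) (x zero))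
      where
      origin direction : Vector Carrier (suc n)
      origin    = cons 0# (x ∘ suc)
      direction = cons 1# (λ _ → 0#)
      a : Vector Carrier d
      a = proj₁ (lines origin direction)
      a-eq : ∀ t → g (λ i → origin i + t * direction i) ≈ horner a t
      a-eq = proj₂ (lines origin direction)
      on-line : ∀ i → x i ≈ origin i + x zero * direction i
      on-line zero    = sym (trans (+-identityˡ _) (*-identityʳ _))
      on-line (suc i) = sym (trans (+-congˡ (zeroʳ _)) (+-identityʳ _))
      off-line : ∀ (k : Fin d) i → origin i + toℕ k · 1# * direction i ≈ cons (toℕ k · 1#) (x ∘ suc) i
      off-line k zero    = trans (+-identityˡ _) (*-identityʳ _)
      off-line k (suc i) = trans (+-congˡ (zeroʳ _)) (+-identityʳ _)
      section≈0 : ∀ (k : Fin d) (y : Vector Carrier n) → g (cons (toℕ k · 1#) y) ≈ 0#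
      section≈0 k = grid-vanishing d (λ y → g (cons (toℕ k · 1#) y))
        (λ y≈z → g-ext (λ { zero → refl ; (suc i) → y≈z i }))
        (λ y z → proj₁ (lines (cons (toℕ k · 1#) y) (cons 0# z)) , λ t → trans
          (g-ext (λ { zero → sym (trans (+-congˡ (zeroʳ t)) (+-identityʳ _)) ; (suc i) → refl }))
          (proj₂ (lines (cons (toℕ k · 1#) y) (cons 0# z)) t))
        (λ y → trans (g-ext (λ { zero → refl ; (suc i) → refl })) (grid (λ { zero → k ; (suc i) → y i })))

    -- One of `N + 1` values of `t` is good: otherwise two of them share a vanishing factor u + t v,
    -- and this forces u = v = 0.
    avoid-roots : ∀ {N} (u v : Vector Carrier N) → (∀ i → ¬ (u i ≈ 0# × v i ≈ 0#)) →
      ∃ λ t → ∀ i → ¬ (u i + t * v i ≈ 0#)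
    avoid-roots {N} u v nontrivial = search (Fin.any? (λ k → Fin.all? (λ i → ¬? (root? k i))))
      where
      value : Fin (suc N) → Fin N → Carrier
      value k i = u i + toℕ k · 1# * v i
      root? : ∀ k i → Dec (value k i ≈ 0#)
      root? k i = value k i ≈? 0#
      search : Dec (∃ λ k → ∀ i → ¬ (value k i ≈ 0#)) → ∃ λ t → ∀ i → ¬ (u i + t * v i ≈ 0#)
      search (yes (k , good)) = toℕ k · 1# , good
      search (no none) = ⊥-elim (collision (Fin.pigeonhole (ℕ.n<1+n N) (proj₁ ∘ root)))
        where
        root : ∀ k → ∃ λ i → value k i ≈ 0#
        root k with Fin.any? (root? k)
        ... | yes found   = found
        ... | no  no-root = ⊥-elim (none (k , λ i eq → no-root (i , eq)))
        collision : ¬ (∃₂ λ k l → toℕ k ℕ.< toℕ l × proj₁ (root k) ≡ proj₁ (root l))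
        collision (k , l , k<l , same) = nontrivial i (ui≈0 , vi≈0)
          where
          i = proj₁ (root k)
          root-l : value l i ≈ 0#
          root-l = ≡.subst (λ i → value l i ≈ 0#) (≡.sym same) (proj₂ (root l))
          vi≈0 : v i ≈ 0#
          vi≈0 = cancel-unit {toℕ k · 1# - toℕ l · 1#}
            (λ eq → ℕ.<-irrefl (·1-injective (minus≈0 eq)) k<l)
            (trans (solve 4 (λ k l u v → (k :- l) :* v := (u :+ k :* v) :- (u :+ l :* v)) refl _ _ (u i) (v i))
              (trans (+-cong (proj₂ (root k)) (-‿cong root-l)) (-‿inverseʳ 0#)))
          ui≈0 : u i ≈ 0#
          ui≈0 = trans (sym (+-identityʳ _)) (trans (+-congˡ (sym (trans (*-congˡ vi≈0) (zeroʳ _)))) (proj₂ (root k)))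

    pair : ∀ {n} → Vector Carrier n → Vector Carrier n → Carrier
    pair l x = sum (λ j → l j * x j)

    pair-line : ∀ {n} (l x y : Vector Carrier n) t → pair l (λ i → x i + t * y i) ≈ pair l x + t * pair l y
    pair-line {n} l x y t = begin
      sum (λ j → l j * (x j + t * y j))
        ≈⟨ sum-cong n (λ j → solve 4 (λ l x t y → l :* (x :+ t :* y) := l :* x :+ t :* (l :* y)) refl (l j) (x j) t (y j)) ⟩
      sum (λ j → l j * x j + t * (l j * y j))
        ≈⟨ ∑-+ n (λ j → l j * x j) (λ j → t * (l j * y j)) ⟩
      pair l x + sum (λ j → t * (l j * y j))
        ≈⟨ +-congˡ (*-distribˡ-∑ n t (λ j → l j * y j)) ⟨
      pair l x + t * pair l y ∎

    -- A vector space over an infinite field is not a finite union of proper subspaces.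
    common-nonzero : ∀ {n} N (a : Fin N → Vector Carrier n) (b : Vector Carrier n) →
      (∀ i → ∃ λ w → pair b w ≈ 0# × ¬ (pair (a i) w ≈ 0#)) →
      ∃ λ w → pair b w ≈ 0# × (∀ i → ¬ (pair (a i) w ≈ 0#))
    common-nonzero {n} zero    a b witness = (λ _ → 0#) , sum-zero n (λ j → zeroʳ (b j)) , λ ()
    common-nonzero {n} (suc N) a b witness = extend (witness zero) (common-nonzero N (a ∘ suc) b (witness ∘ suc))
      where
      extend : (∃ λ x → pair b x ≈ 0# × ¬ (pair (a zero) x ≈ 0#)) →
        (∃ λ y → pair b y ≈ 0# × (∀ i → ¬ (pair (a (suc i)) y ≈ 0#))) →
        ∃ λ w → pair b w ≈ 0# × (∀ i → ¬ (pair (a i) w ≈ 0#))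
      extend (x , bx≈0 , ax≉0) (y , by≈0 , ay≉0) = combine (avoid-roots (λ i → pair (a i) x) (λ i → pair (a i) y) nontrivial)
        where
        nontrivial : ∀ i → ¬ (pair (a i) x ≈ 0# × pair (a i) y ≈ 0#)
        nontrivial zero    (z , _) = ax≉0 z
        nontrivial (suc i) (_ , z) = ay≉0 i z
        combine : (∃ λ t → ∀ i → ¬ (pair (a i) x + t * pair (a i) y ≈ 0#)) →
          ∃ λ w → pair b w ≈ 0# × (∀ i → ¬ (pair (a i) w ≈ 0#))
        combine (t , good) = (λ i → x i + t * y i)
          , trans (pair-line b x y t) (trans (+-cong bx≈0 (trans (*-congˡ by≈0) (zeroʳ t))) (+-identityˡ 0#))
          , λ i eq → good i (trans (sym (pair-line (a i) x y t)) eq)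

    pair-basis : ∀ {n} (l : Vector Carrier n) i → pair l (1ᴹ i) ≈ l i
    pair-basis {n} l i = trans (sum-cong n (λ j → *-congˡ (reflexive (1ᴹ-sym i j)))) (sum-1ᴹʳ i l)

    -- This takes the place of unique factorization. If `a i` is not proportional to `b`, it is
    -- nonzero at some vector of the hyperplane b = 0; if this held for every `i`, `common-nonzero`
    -- would give a point of the hyperplane at which the product does not vanish.
    proportional-factor : ∀ {n} N (a : Fin N → Vector Carrier n) (b : Vector Carrier n) j → ¬ (b j ≈ 0#) →
      (∀ x → pair b x ≈ 0# → product (λ i → pair (a i) x) ≈ 0#) →
      ∃ λ i → ∃ λ z → ∀ k → a i k ≈ z * b k
    proportional-factor {n} N a b j bj≉0 vanish = search (Fin.any? (λ i → Fin.all? (λ k → minor? i k)))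
      where
      minor? : ∀ i k → Dec (b j * a i k ≈ a i j * b k)
      minor? i k = (b j * a i k) ≈? (a i j * b k)
      -- Since `b j` is nonzero, these vectors span the kernel of `b`; the values of a linear form
      -- on them are its 2 × 2 minors with `b`.
      w : Fin n → Vector Carrier n
      w k i = b j * 1ᴹ k i + - b k * 1ᴹ j i
      pair-w : ∀ l k → pair l (w k) ≈ b j * l k - l j * b k
      pair-w l k = begin
        pair l (w k)
          ≈⟨ pair-line l (λ i → b j * 1ᴹ k i) (1ᴹ j) (- b k) ⟩
        pair l (λ i → b j * 1ᴹ k i) + - b k * pair l (1ᴹ j)
          ≈⟨ +-cong (trans (sum-cong n (λ i → solve 3 (λ l b e → l :* (b :* e) := b :* (l :* e)) refl (l i) (b j) (1ᴹ k i)))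
               (trans (sym (*-distribˡ-∑ n (b j) (λ i → l i * 1ᴹ k i))) (*-congˡ (pair-basis l k)))) (*-congˡ (pair-basis l j)) ⟩
        b j * l k + - b k * l j
          ≈⟨ solve 4 (λ bj lk bk lj → bj :* lk :+ (:- bk) :* lj := bj :* lk :- lj :* bk) refl _ _ _ _ ⟩
        b j * l k - l j * b k ∎
      search : Dec (∃ λ i → ∀ k → b j * a i k ≈ a i j * b k) → ∃ λ i → ∃ λ z → ∀ k → a i k ≈ z * b k
      search (yes (i , minors)) = i , q * a i j , λ k → *-cancelˡ bj≉0 (trans (minors k)
        (sym (trans (solve 4 (λ b q a c → b :* ((q :* a) :* c) := (b :* q) :* (a :* c)) refl (b j) q (a i j) (b k))
          (trans (*-congʳ (proj₂ (IsField.inverse isField (b j) bj≉0))) (*-identityˡ _)))))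
        where
        q : Carrier
        q = proj₁ (IsField.inverse isField (b j) bj≉0)
      search (no none) = ⊥-elim (nonvanishing (common-nonzero N a b witness))
        where
        witness : ∀ i → ∃ λ v → pair b v ≈ 0# × ¬ (pair (a i) v ≈ 0#)
        witness i = w (proj₁ bad) , trans (pair-w b (proj₁ bad)) (-‿inverseʳ _) ,
          λ eq → proj₂ bad (minus≈0 (trans (sym (pair-w (a i) (proj₁ bad))) eq))
          where
          bad : ∃ λ k → ¬ (b j * a i k ≈ a i j * b k)
          bad = Fin.¬∀⟶∃¬ n _ (minor? i) (λ minors → none (i , minors))
        nonvanishing : ¬ (∃ λ x → pair b x ≈ 0# × (∀ i → ¬ (pair (a i) x ≈ 0#)))
        nonvanishing (x , bx≈0 , ax≉0) = product-nonzero N ax≉0 (vanish x bx≈0)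

-- Real and complex numbers

module RealOrder (em : ExcludedMiddle 0ℓ) (ℛ : CompleteOrderedField) where
  open CompleteOrderedField ℛ renaming (Carrier to ℝ; ring to ℝ-ring)
  open Over ℛ using (0≤1; 1≤suc; 0≤ℕ)
  open RawSemiringDefinitions (RawRing.rawSemiring rawRing) using (sum; product; _^_) renaming (_×_ to _·_)
  open RingKit ℝ-ring

  _≈?_ : Decidable _≈_
  x ≈? y = em

  open FieldKit ℝ-ring isField _≈?_ public using () renaming (*-nonzero to *-nonzeroʳ; minus≈0 to minus≈0ʳ)

  -0≈0 : - 0# ≈ 0#
  -0≈0 = RingProperties.-0#≈0# (CommutativeRing.ring ℝ-ring)

  -‿involutive : ∀ x → - (- x) ≈ x
  -‿involutive = RingProperties.-‿involutive (CommutativeRing.ring ℝ-ring)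

  ≤-reflexive : ∀ {x y} → x ≈ y → x ≤ y
  ≤-reflexive x≈y = ≤-respʳ-≈ x≈y ≤-refl

  +-mono-≤ : ∀ {x y u v} → x ≤ y → u ≤ v → (x + u) ≤ (y + v)
  +-mono-≤ {x} {y} {u} {v} x≤y u≤v = ≤-trans (+-monoʳ-≤ x u≤v)
    (≤-respˡ-≈ (+-comm v x) (≤-respʳ-≈ (+-comm v y) (+-monoʳ-≤ v x≤y)))

  ≤⇒0≤- : ∀ {x y} → x ≤ y → 0# ≤ (y - x)
  ≤⇒0≤- {x} {y} x≤y = ≤-respˡ-≈ (-‿inverseʳ x) (+-mono-≤ x≤y ≤-refl)

  0≤-⇒≤ : ∀ {x y} → 0# ≤ (y - x) → x ≤ y
  0≤-⇒≤ {x} {y} 0≤y-x = ≤-respˡ-≈ (+-identityˡ x)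
    (≤-respʳ-≈ (solve 2 (λ x y → (y :- x) :+ x := y) refl x y) (+-mono-≤ 0≤y-x (≤-refl {x})))

  neg-mono-≤ : ∀ {x y} → x ≤ y → (- y) ≤ (- x)
  neg-mono-≤ {x} {y} x≤y = 0≤-⇒≤ (≤-respʳ-≈ (solve 2 (λ x y → y :- x := (:- x) :- (:- y)) refl x y) (≤⇒0≤- x≤y))

  *-monoˡ-≤ : ∀ {a x y} → 0# ≤ a → x ≤ y → (a * x) ≤ (a * y)
  *-monoˡ-≤ {a} {x} {y} 0≤a x≤y = 0≤-⇒≤
    (≤-respʳ-≈ (solve 3 (λ a x y → a :* (y :- x) := a :* y :- a :* x) refl a x y) (*-nonNeg 0≤a (≤⇒0≤- x≤y)))

  *-monoʳ-≤ : ∀ {a x y} → 0# ≤ a → x ≤ y → (x * a) ≤ (y * a)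
  *-monoʳ-≤ {a} {x} {y} 0≤a x≤y = ≤-respˡ-≈ (*-comm a x) (≤-respʳ-≈ (*-comm a y) (*-monoˡ-≤ 0≤a x≤y))

  *-mono-≤ : ∀ {x y u v} → 0# ≤ x → 0# ≤ v → x ≤ y → u ≤ v → (x * u) ≤ (y * v)
  *-mono-≤ 0≤x 0≤v x≤y u≤v = ≤-trans (*-monoˡ-≤ 0≤x u≤v) (*-monoʳ-≤ 0≤v x≤y)

  +-nonNeg : ∀ {x y} → 0# ≤ x → 0# ≤ y → 0# ≤ (x + y)
  +-nonNeg 0≤x 0≤y = ≤-respˡ-≈ (+-identityˡ 0#) (+-mono-≤ 0≤x 0≤y)

  x≤x+y : ∀ {x y} → 0# ≤ y → x ≤ (x + y)
  x≤x+y {x} 0≤y = ≤-respˡ-≈ (+-identityʳ x) (+-monoʳ-≤ x 0≤y)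

  x≤y+x : ∀ {x y} → 0# ≤ y → x ≤ (y + x)
  x≤y+x {x} {y} 0≤y = ≤-respʳ-≈ (+-comm x y) (x≤x+y 0≤y)

  ≰⇒≥ : ∀ {x y} → ¬ (x ≤ y) → y ≤ x
  ≰⇒≥ {x} {y} x≰y with total x y
  ... | inj₁ x≤y = ⊥-elim (x≰y x≤y)
  ... | inj₂ y≤x = y≤x

  ≰⇒> : ∀ {x y} → ¬ (x ≤ y) → y < x
  ≰⇒> x≰y = ≰⇒≥ x≰y , λ y≈x → x≰y (≤-reflexive (sym y≈x))

  <⇒≱ : ∀ {x y} → x < y → ¬ (y ≤ x)
  <⇒≱ (x≤y , x≉y) y≤x = x≉y (antisym x≤y y≤x)

  ≮⇒≥ : ∀ {x y} → ¬ (x < y) → y ≤ x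
  ≮⇒≥ {x} {y} x≮y with em {P = y ≤ x}
  ... | yes y≤x = y≤x
  ... | no  y≰x = ⊥-elim (x≮y (≰⇒> y≰x))

  <-≤-trans : ∀ {x y z} → x < y → y ≤ z → x < z
  <-≤-trans x<y@(x≤y , _) y≤z = ≤-trans x≤y y≤z , λ x≈z → <⇒≱ x<y (≤-trans y≤z (≤-reflexive (sym x≈z)))

  ≤-<-trans : ∀ {x y z} → x ≤ y → y < z → x < z
  ≤-<-trans x≤y y<z@(y≤z , _) = ≤-trans x≤y y≤z , λ x≈z → <⇒≱ y<z (≤-trans (≤-reflexive (sym x≈z)) x≤y)

  <-≈-trans : ∀ {x y z} → x < y → y ≈ z → x < z
  <-≈-trans x<y y≈z = <-≤-trans x<y (≤-reflexive y≈z)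

  ≈-<-trans : ∀ {x y z} → x ≈ y → y < z → x < z
  ≈-<-trans x≈y y<z = ≤-<-trans (≤-reflexive x≈y) y<z

  +-monoʳ-< : ∀ x {y z} → y < z → (x + y) < (x + z)
  +-monoʳ-< x {y} {z} (y≤z , y≉z) = +-monoʳ-≤ x y≤z , λ eq → y≉z (trans (drop y) (trans (+-congˡ eq) (sym (drop z))))
    where
    drop : ∀ y → y ≈ - x + (x + y)
    drop y = solve 2 (λ x y → y := (:- x) :+ (x :+ y)) refl x y

  0<x*y : ∀ {x y} → 0# < x → 0# < y → 0# < (x * y)
  0<x*y (0≤x , 0≉x) (0≤y , 0≉y) = *-nonNeg 0≤x 0≤y , λ eq → *-nonzeroʳ (0≉x ∘ sym) (0≉y ∘ sym) (sym eq)

  0<1 : 0# < 1#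
  0<1 = 0≤1 , 0≉1

  0<suc : ∀ k → 0# < (suc k · 1#)
  0<suc k = <-≤-trans 0<1 (1≤suc k)

  0<x⇒≉0 : ∀ {x} → 0# < x → ¬ (x ≈ 0#)
  0<x⇒≉0 (_ , 0≉x) x≈0 = 0≉x (sym x≈0)

  *-cancelˡ-≤ : ∀ {a x y} → 0# < a → (a * x) ≤ (a * y) → x ≤ y
  *-cancelˡ-≤ {a} {x} {y} 0<a ax≤ay with em {P = x ≤ y}
  ... | yes x≤y = x≤y
  ... | no  x≰y = ⊥-elim (<⇒≱ (0<x*y 0<a 0<x-y)
      (≤-respˡ-≈ (solve 3 (λ a x y → a :* x :- a :* y := a :* (x :- y)) refl a x y)
        (≤-respʳ-≈ (-‿inverseʳ (a * y)) (+-mono-≤ ax≤ay ≤-refl))))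
    where
    0<x-y : 0# < (x - y)
    0<x-y = ≤⇒0≤- (≰⇒≥ x≰y) , λ 0≈x-y → x≰y (≤-reflexive (minus≈0ʳ (sym 0≈x-y)))

  square-nonNeg : ∀ x → 0# ≤ (x * x)
  square-nonNeg x with total 0# x
  ... | inj₁ 0≤x = *-nonNeg 0≤x 0≤x
  ... | inj₂ x≤0 = ≤-respʳ-≈ (solve 1 (λ x → (:- x) :* (:- x) := x :* x) refl x) (*-nonNeg 0≤-x 0≤-x)
    where
    0≤-x : 0# ≤ (- x)
    0≤-x = ≤-respˡ-≈ -0≈0 (neg-mono-≤ x≤0)

  ∣_∣ : ℝ → ℝ
  ∣ x ∣ = [ (λ _ → x) , (λ _ → - x) ]′ (total 0# x)


  ∣∣-nonNeg : ∀ x → 0# ≤ ∣ x ∣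
  ∣∣-nonNeg x with total 0# x
  ... | inj₁ 0≤x = 0≤x
  ... | inj₂ x≤0 = ≤-respˡ-≈ -0≈0 (neg-mono-≤ x≤0)

  x≤∣x∣ : ∀ x → x ≤ ∣ x ∣
  x≤∣x∣ x with total 0# x
  ... | inj₁ 0≤x = ≤-refl
  ... | inj₂ x≤0 = ≤-trans x≤0 (≤-respˡ-≈ -0≈0 (neg-mono-≤ x≤0))

  -x≤∣x∣ : ∀ x → (- x) ≤ ∣ x ∣
  -x≤∣x∣ x with total 0# x
  ... | inj₁ 0≤x = ≤-trans (≤-respʳ-≈ -0≈0 (neg-mono-≤ 0≤x)) 0≤x
  ... | inj₂ x≤0 = ≤-refl

  ∣∣-least : ∀ {x c} → x ≤ c → (- x) ≤ c → ∣ x ∣ ≤ c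
  ∣∣-least {x} x≤c -x≤c with total 0# x
  ... | inj₁ _ = x≤c
  ... | inj₂ _ = -x≤c

  ∣∣-mono : ∀ {x y} → x ≈ y → ∣ x ∣ ≤ ∣ y ∣
  ∣∣-mono {x} {y} x≈y = ∣∣-least (≤-trans (≤-reflexive x≈y) (x≤∣x∣ y)) (≤-trans (≤-reflexive (-‿cong x≈y)) (-x≤∣x∣ y))

  ∣∣-cong : ∀ {x y} → x ≈ y → ∣ x ∣ ≈ ∣ y ∣
  ∣∣-cong x≈y = antisym (∣∣-mono x≈y) (∣∣-mono (sym x≈y))

  ∣∣-of-nonNeg : ∀ {x} → 0# ≤ x → ∣ x ∣ ≈ x
  ∣∣-of-nonNeg {x} 0≤x = antisym (∣∣-least ≤-refl (≤-trans (≤-respʳ-≈ -0≈0 (neg-mono-≤ 0≤x)) 0≤x)) (x≤∣x∣ x)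

  ∣∣-+ : ∀ x y → ∣ x + y ∣ ≤ (∣ x ∣ + ∣ y ∣)
  ∣∣-+ x y = ∣∣-least (+-mono-≤ (x≤∣x∣ x) (x≤∣x∣ y))
    (≤-respˡ-≈ (solve 2 (λ x y → (:- x) :+ (:- y) := :- (x :+ y)) refl x y) (+-mono-≤ (-x≤∣x∣ x) (-x≤∣x∣ y)))

  ∣∣-neg : ∀ x → ∣ - x ∣ ≤ ∣ x ∣
  ∣∣-neg x = ∣∣-least (-x≤∣x∣ x) (≤-respˡ-≈ (solve 1 (λ x → x := :- (:- x)) refl x) (x≤∣x∣ x))

  ∣∣-or : ∀ x → (∣ x ∣ ≈ x) ⊎ (∣ x ∣ ≈ - x)
  ∣∣-or x with total 0# x
  ... | inj₁ _ = inj₁ refl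
  ... | inj₂ _ = inj₂ refl

  ∣∣-* : ∀ x y → ∣ x * y ∣ ≈ ∣ x ∣ * ∣ y ∣
  ∣∣-* x y = cases (∣∣-or x) (∣∣-or y)
    where
    0≤p : 0# ≤ (∣ x ∣ * ∣ y ∣)
    0≤p = *-nonNeg (∣∣-nonNeg x) (∣∣-nonNeg y)
    positive : ∀ {z} → ∣ x ∣ * ∣ y ∣ ≈ z → ∣ z ∣ ≈ ∣ x ∣ * ∣ y ∣
    positive eq = trans (∣∣-cong (sym eq)) (∣∣-of-nonNeg 0≤p)
    negative : ∀ {z} → ∣ x ∣ * ∣ y ∣ ≈ - z → ∣ z ∣ ≈ ∣ x ∣ * ∣ y ∣
    negative {z} eq = trans (antisym
      (≤-respˡ-≈ (∣∣-cong (solve 1 (λ z → :- (:- z) := z) refl z)) (∣∣-neg (- z))) (∣∣-neg z)) (positive eq)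
    cases : (∣ x ∣ ≈ x) ⊎ (∣ x ∣ ≈ - x) → (∣ y ∣ ≈ y) ⊎ (∣ y ∣ ≈ - y) → ∣ x * y ∣ ≈ ∣ x ∣ * ∣ y ∣
    cases (inj₁ p) (inj₁ q) = positive (*-cong p q)
    cases (inj₁ p) (inj₂ q) = negative (trans (*-cong p q) (solve 2 (λ x y → x :* (:- y) := :- (x :* y)) refl x y))
    cases (inj₂ p) (inj₁ q) = negative (trans (*-cong p q) (solve 2 (λ x y → (:- x) :* y := :- (x :* y)) refl x y))
    cases (inj₂ p) (inj₂ q) = positive (trans (*-cong p q) (solve 2 (λ x y → (:- x) :* (:- y) := x :* y) refl x y))

  ∣∣≈0 : ∀ {x} → ∣ x ∣ ≤ 0# → x ≈ 0#
  ∣∣≈0 {x} ∣x∣≤0 = antisym (≤-trans (x≤∣x∣ x) ∣x∣≤0)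
    (≤-respʳ-≈ (solve 1 (λ x → :- (:- x) := x) refl x) (≤-respˡ-≈ -0≈0 (neg-mono-≤ (≤-trans (-x≤∣x∣ x) ∣x∣≤0))))

  ·-mono : ∀ {j k} → j ℕ.≤ k → (j · 1#) ≤ (k · 1#)
  ·-mono {zero}  {k}     j≤k = 0≤ℕ k
  ·-mono {suc j} {suc k} j≤k = +-monoʳ-≤ 1# (·-mono (ℕ.s≤s⁻¹ j≤k))

  archimedean : ∀ x → ∃ λ k → x ≤ (k · 1#)
  archimedean x with em {P = ∃ λ k → x ≤ (k · 1#)}
  ... | yes found = found
  ... | no  none  = ⊥-elim (overshoot (supremum Naturals (0# , 0 , refl) (x , λ { y (k , y≈k) → ≤-trans (≤-reflexive y≈k) (≰⇒≥ (λ x≤k → none (k , x≤k))) })))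
    where
    Naturals : Pred ℝ 0ℓ
    Naturals y = ∃ λ k → y ≈ k · 1#
    overshoot : ¬ (∃ λ s → UpperBound Naturals s × (∀ b → UpperBound Naturals b → s ≤ b))
    overshoot (s , upper , least) = <⇒≱ s-1<s (least (s - 1#) λ { y (k , y≈k) →
        ≤-respˡ-≈ (trans (solve 2 (λ o k → (:- o) :+ (o :+ k) := k) refl 1# (k · 1#)) (sym y≈k))
          (≤-respʳ-≈ (+-comm (- 1#) s) (+-monoʳ-≤ (- 1#) (upper _ (suc k , refl)))) })
      where
      s-1<s : (s - 1#) < s
      s-1<s = <-≈-trans (+-monoʳ-< s (≤-respʳ-≈ -0≈0 (neg-mono-≤ 0≤1) , λ eq → 0≉1 (trans (sym -0≈0) (trans (-‿cong (sym eq)) (-‿involutive 1#)))))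
        (+-identityʳ s)

  archimedeanℕ : ∀ x → ∃ λ k → x ≤ (suc k · 1#)
  archimedeanℕ x = proj₁ (archimedean x) , ≤-trans (proj₂ (archimedean x)) (·-mono {j = proj₁ (archimedean x)} (ℕ.n≤1+n _))

  product-nonNeg : ∀ n {f : Vector ℝ n} → (∀ i → 0# ≤ f i) → 0# ≤ product f
  product-nonNeg zero    0≤f = 0≤1
  product-nonNeg (suc n) 0≤f = *-nonNeg (0≤f zero) (product-nonNeg n (0≤f ∘ suc))

  product-bound : ∀ n {f : Vector ℝ n} {B} → 0# ≤ B → (∀ i → 0# ≤ f i) → (∀ i → f i ≤ B) → product f ≤ (B ^ n)
  product-bound zero    0≤B 0≤f f≤B = ≤-refl
  product-bound (suc n) 0≤B 0≤f f≤B =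
    *-mono-≤ (0≤f zero) (≤-trans (product-nonNeg n (0≤f ∘ suc)) tail≤) (f≤B zero) tail≤
    where tail≤ = product-bound n 0≤B (0≤f ∘ suc) (f≤B ∘ suc)

  sum-bound : ∀ n {f : Vector ℝ n} {B} → (∀ i → f i ≤ B) → sum f ≤ ((n · 1#) * B)
  sum-bound zero    {B = B} f≤B = ≤-reflexive (sym (zeroˡ B))
  sum-bound (suc n) {B = B} f≤B = ≤-respʳ-≈ (sym (trans (distribʳ B 1# (n · 1#)) (+-congʳ (*-identityˡ B))))
    (+-mono-≤ (f≤B zero) (sum-bound n (f≤B ∘ suc)))

  ∣∣-sum : ∀ n (f : Vector ℝ n) → ∣ sum f ∣ ≤ sum (λ i → ∣ f i ∣)
  ∣∣-sum zero    f = ∣∣-least ≤-refl (≤-reflexive -0≈0)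
  ∣∣-sum (suc n) f = ≤-trans (∣∣-+ (f zero) (sum (f ∘ suc))) (+-monoʳ-≤ ∣ f zero ∣ (∣∣-sum n (f ∘ suc)))

  sum-nonNeg : ∀ n {f : Vector ℝ n} → (∀ i → 0# ≤ f i) → 0# ≤ sum f
  sum-nonNeg zero    0≤f = ≤-refl
  sum-nonNeg (suc n) 0≤f = +-nonNeg (0≤f zero) (sum-nonNeg n (0≤f ∘ suc))

  sum-mono : ∀ n {f g : Vector ℝ n} → (∀ i → f i ≤ g i) → sum f ≤ sum g
  sum-mono zero    f≤g = ≤-refl
  sum-mono (suc n) f≤g = +-mono-≤ (f≤g zero) (sum-mono n (f≤g ∘ suc))

  term≤sum : ∀ {n} {f : Vector ℝ n} → (∀ i → 0# ≤ f i) → ∀ i → f i ≤ sum f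
  term≤sum {suc n} 0≤f zero    = x≤x+y (sum-nonNeg n (0≤f ∘ suc))
  term≤sum {suc n} 0≤f (suc i) = ≤-trans (term≤sum (0≤f ∘ suc) i) (x≤y+x (0≤f zero))

  power-nonNeg : ∀ {x} k → 0# ≤ x → 0# ≤ (x ^ k)
  power-nonNeg zero    0≤x = 0≤1
  power-nonNeg (suc k) 0≤x = *-nonNeg 0≤x (power-nonNeg k 0≤x)

  power-positive : ∀ {x} k → 0# < x → 0# < (x ^ k)
  power-positive zero    0<x = 0<1
  power-positive (suc k) 0<x = 0<x*y 0<x (power-positive k 0<x)

  power-≤-one : ∀ {x} k → 0# ≤ x → x ≤ 1# → (x ^ k) ≤ 1#
  power-≤-one zero    0≤x x≤1 = ≤-refl
  power-≤-one (suc k) 0≤x x≤1 = ≤-respʳ-≈ (*-identityˡ 1#) (*-mono-≤ 0≤x 0≤1 x≤1 (power-≤-one k 0≤x x≤1))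

  1≤power : ∀ {x} k → 1# ≤ x → 1# ≤ (x ^ k)
  1≤power zero    1≤x = ≤-refl
  1≤power (suc k) 1≤x = ≤-respˡ-≈ (*-identityˡ 1#) (*-mono-≤ 0≤1 (≤-trans 0≤1 (1≤power k 1≤x)) 1≤x (1≤power k 1≤x))

ℚ-isField : IsField ℚ-ring
ℚ-isField = record { 0≉1 = λ () ; inverse = inverse }
  where
  inverse : ∀ q → q ≢ 0ℚ → ∃ λ r → q ℚ.* r ≡ 1ℚ
  inverse q q≢0 = ℚ.1/_ q {{ℚ.≢-nonZero q≢0}} , ℚ.*-inverseʳ q {{ℚ.≢-nonZero q≢0}}

module ComplexNumbers (em : ExcludedMiddle 0ℓ) (ℛ : CompleteOrderedField) where
  open CompleteOrderedField ℛ renaming (Carrier to ℝ; ring to ℝ-ring)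
  open Over ℛ
  open RealOrder em ℛ
  private
    module ℝ^ = RawSemiringDefinitions (RawRing.rawSemiring rawRing)
    module ℂ = CommutativeRing ℂ-ring
    module ℚ^ = RawSemiringDefinitions (RawRing.rawSemiring (CommutativeRing.rawRing ℚ-ring))
    module ℂ^ = RawSemiringDefinitions (RawRing.rawSemiring ℂ.rawRing)
    module RK = RingKit ℝ-ring
  open RK using (solve; _:=_; _:+_; _:*_; _:-_; :-_; fromInt)
  open FieldKit ℝ-ring isField _≈?_ using (*-cancelˡ)

  fromℤ≡fromInt : ∀ i → fromℤ i ≡ fromInt i
  fromℤ≡fromInt (+ k)    = ≡.refl
  fromℤ≡fromInt -[1+ k ] = ≡.refl

  private
    den : ℕ → ℝ
    den d = suc d ℝ^.× 1#

    den⁻¹ : ℕ → ℝ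
    den⁻¹ d = proj₁ (inverse (den d) (suc≉0 d))

    den-inverse : ∀ d → den d * den⁻¹ d ≈ 1#
    den-inverse d = proj₂ (inverse (den d) (suc≉0 d))

    -- The operations of `ℚ` reduce to lowest terms. On unreduced fractions sums and products have
    -- explicit numerators and denominators, so the homomorphism laws are proved there and
    -- transported along `ℚ.toℚᵘ`.
    value : ℚᵘ.ℚᵘ → ℝ
    value (ℚᵘ.mkℚᵘ n d) = fromInt n * den⁻¹ d

    fromℚ≈value : ∀ q → fromℚ q ≈ value (ℚ.toℚᵘ q)
    fromℚ≈value (ℚ.mkℚ n d _) = *-congʳ (reflexive (fromℤ≡fromInt n))

    value-unique : ∀ {x} n d → x * den d ≈ fromInt n → x ≈ value (ℚᵘ.mkℚᵘ n d)
    value-unique {x} n d eq = trans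
      (sym (trans (*-assoc x (den d) (den⁻¹ d)) (trans (*-congˡ (den-inverse d)) (*-identityʳ x)))) (*-congʳ eq)

    value-den : ∀ n d → value (ℚᵘ.mkℚᵘ n d) * den d ≈ fromInt n
    value-den n d = trans (*-assoc _ _ _) (trans (*-congˡ (trans (*-comm _ _) (den-inverse d))) (*-identityʳ _))

    value-cong : ∀ {p q} → p ℚᵘ.≃ q → value p ≈ value q
    value-cong {ℚᵘ.mkℚᵘ m d} {ℚᵘ.mkℚᵘ n e} (ℚᵘ.*≡* m*e≡n*d) = value-unique n e (*-cancelˡ (suc≉0 d) (trans
      (solve 3 (λ d v e → d :* (v :* e) := v :* d :* e) refl (den d) (value (ℚᵘ.mkℚᵘ m d)) (den e))
      (trans (*-congʳ (value-den m d))
        (trans (sym (RK.fromInt-* m (+ suc e))) (trans (RK.fromInt-cong m*e≡n*d)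
          (trans (RK.fromInt-* n (+ suc d)) (*-comm _ _)))))))

    value-+ : ∀ p q → value (p ℚᵘ.+ q) ≈ value p + value q
    value-+ (ℚᵘ.mkℚᵘ m d) (ℚᵘ.mkℚᵘ n e) = sym (value-unique (m ℤ.* + suc e ℤ.+ n ℤ.* + suc d) (e ℕ.+ d ℕ.* suc e) (trans
      (*-congˡ (SemiringMult.×1-homo-* semiring (suc d) (suc e)))
      (trans (solve 4 (λ v w d e → (v :+ w) :* (d :* e) := v :* d :* e :+ w :* e :* d) refl
          (value (ℚᵘ.mkℚᵘ m d)) (value (ℚᵘ.mkℚᵘ n e)) (den d) (den e))
        (trans (+-cong (*-congʳ (value-den m d)) (*-congʳ (value-den n e)))
          (sym (trans (RK.fromInt-+ (m ℤ.* + suc e) (n ℤ.* + suc d))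
            (+-cong (RK.fromInt-* m (+ suc e)) (RK.fromInt-* n (+ suc d)))))))))

    value-* : ∀ p q → value (p ℚᵘ.* q) ≈ value p * value q
    value-* (ℚᵘ.mkℚᵘ m d) (ℚᵘ.mkℚᵘ n e) = sym (value-unique (m ℤ.* n) (e ℕ.+ d ℕ.* suc e) (trans
      (*-congˡ (SemiringMult.×1-homo-* semiring (suc d) (suc e)))
      (trans (solve 4 (λ v w d e → v :* w :* (d :* e) := v :* d :* (w :* e)) refl
          (value (ℚᵘ.mkℚᵘ m d)) (value (ℚᵘ.mkℚᵘ n e)) (den d) (den e))
        (trans (*-cong (value-den m d) (value-den n e)) (sym (RK.fromInt-* m n))))))

  fromℚ-+ : ∀ p q → fromℚ (p ℚ.+ q) ≈ fromℚ p + fromℚ q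
  fromℚ-+ p q = trans (fromℚ≈value (p ℚ.+ q)) (trans (value-cong (ℚ.toℚᵘ-homo-+ p q))
    (trans (value-+ (ℚ.toℚᵘ p) (ℚ.toℚᵘ q)) (sym (+-cong (fromℚ≈value p) (fromℚ≈value q)))))

  fromℚ-* : ∀ p q → fromℚ (p ℚ.* q) ≈ fromℚ p * fromℚ q
  fromℚ-* p q = trans (fromℚ≈value (p ℚ.* q)) (trans (value-cong (ℚ.toℚᵘ-homo-* p q))
    (trans (value-* (ℚ.toℚᵘ p) (ℚ.toℚᵘ q)) (sym (*-cong (fromℚ≈value p) (fromℚ≈value q)))))

  fromℚ-0 : fromℚ 0ℚ ≈ 0#
  fromℚ-0 = zeroˡ _

  fromℚ-1 : fromℚ 1ℚ ≈ 1#
  fromℚ-1 = den-inverse 0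

  fromℚ-neg : ∀ q → fromℚ (ℚ.- q) ≈ - fromℚ q
  fromℚ-neg q = trans (solve 2 (λ x y → x := (x :+ y) :- y) refl (fromℚ (ℚ.- q)) (fromℚ q))
    (trans (+-congʳ (trans (sym (fromℚ-+ (ℚ.- q) q)) (trans (reflexive (≡.cong fromℚ (ℚ.+-inverseˡ q))) fromℚ-0)))
      (+-identityˡ _))

  fromℚ-fromInt : ∀ i → fromℚ (RingKit.fromInt ℚ-ring i) ≈ fromInt i
  fromℚ-fromInt (+ k)    = natural k
    where
    natural : ∀ k → fromℚ (k ℚ^.× 1ℚ) ≈ k ℝ^.× 1#
    natural zero    = fromℚ-0
    natural (suc k) = trans (fromℚ-+ 1ℚ (k ℚ^.× 1ℚ)) (+-cong fromℚ-1 (natural k))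
  fromℚ-fromInt -[1+ k ] = trans (fromℚ-neg (suc k ℚ^.× 1ℚ)) (-‿cong (fromℚ-fromInt (+ suc k)))

  fromℚ-injective : ∀ {p q} → fromℚ p ≈ fromℚ q → p ≡ q
  fromℚ-injective {p} {q} eq = FieldKit.minus≈0 ℚ-ring ℚ-isField ℚ._≟_ (reflects-0 (p ℚ.- q) (trans (fromℚ-+ p (ℚ.- q))
    (trans (+-cong eq (fromℚ-neg q)) (-‿inverseʳ (fromℚ q)))))
    where
    reflects-0 : ∀ r → fromℚ r ≈ 0# → r ≡ 0ℚ
    reflects-0 r r≈0 with r ℚ.≟ 0ℚ
    ... | yes r≡0 = r≡0
    ... | no  r≢0 = ⊥-elim (0≉1 (trans (sym (zeroˡ _)) (trans (*-congʳ (sym r≈0))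
        (trans (sym (fromℚ-* r (proj₁ r⁻¹))) (trans (reflexive (≡.cong fromℚ (proj₂ r⁻¹))) fromℚ-1)))))
      where
      r⁻¹ : ∃ λ s → r ℚ.* s ≡ 1ℚ
      r⁻¹ = IsField.inverse ℚ-isField r r≢0

  fromℚ-clears : ∀ q → RingKit.fromInt ℚ-ring (+ suc (ℚ.denominator-1 q)) ℚ.* q ≡ RingKit.fromInt ℚ-ring (ℚ.numerator q)
  fromℚ-clears q@(ℚ.mkℚ m d _) = fromℚ-injective (trans (fromℚ-* (RingKit.fromInt ℚ-ring (+ suc d)) q)
    (trans (*-cong (fromℚ-fromInt (+ suc d)) (fromℚ≈value q))
      (trans (*-comm _ _) (trans (value-den m d) (sym (fromℚ-fromInt m))))))

  fromℝ-homo : IsRingHomomorphism rawRing ℂ.rawRing fromℝ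
  fromℝ-homo = record
    { isSemiringHomomorphism = record
      { isNearSemiringHomomorphism = record
        { +-isMonoidHomomorphism = record
          { isMagmaHomomorphism = record
            { isRelHomomorphism = record { cong = λ x≈y → x≈y , refl }
            ; homo = λ x y → refl , sym (+-identityˡ 0#)
            }
          ; ε-homo = refl , refl
          }
        ; *-homo = λ x y →
            sym (trans (+-congˡ (trans (-‿cong (zeroˡ 0#)) -0≈0)) (+-identityʳ _)) ,
            sym (trans (+-cong (zeroʳ x) (zeroˡ y)) (+-identityˡ 0#))
        }
      ; 1#-homo = refl , refl
      }
    ; -‿homo = λ x → refl , sym -0≈0
    }

  fromℝ-* : ∀ x y → fromℝ (x * y) ℂ.≈ fromℝ x ℂ.* fromℝ y
  fromℝ-* = IsRingHomomorphism.*-homo fromℝ-homo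

  fromℚℂ : ℚ → ℂ
  fromℚℂ = fromℝ ∘ fromℚ

  fromℚℂ-homo : IsRingHomomorphism ℚ.+-*-rawRing ℂ.rawRing fromℚℂ
  fromℚℂ-homo = record
    { isSemiringHomomorphism = record
      { isNearSemiringHomomorphism = record
        { +-isMonoidHomomorphism = record
          { isMagmaHomomorphism = record
            { isRelHomomorphism = record { cong = λ { ≡.refl → ℂ.refl } }
            ; homo = λ p q → ℂ.trans (fromℚ-+ p q , refl) (+-homo (fromℚ p) (fromℚ q))
            }
          ; ε-homo = fromℚ-0 , refl
          }
        ; *-homo = λ p q → ℂ.trans (fromℚ-* p q , refl) (*-homo (fromℚ p) (fromℚ q))
        }
      ; 1#-homo = fromℚ-1 , refl
      }
    ; -‿homo = λ q → ℂ.trans (fromℚ-neg q , refl) (-‿homo (fromℚ q))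
    }
    where open IsRingHomomorphism fromℝ-homo

  conj-homo : IsRingHomomorphism ℂ.rawRing ℂ.rawRing conj
  conj-homo = record
    { isSemiringHomomorphism = record
      { isNearSemiringHomomorphism = record
        { +-isMonoidHomomorphism = record
          { isMagmaHomomorphism = record
            { isRelHomomorphism = record { cong = λ (p , q) → p , -‿cong q }
            ; homo = λ (a , b) (c , d) → refl , solve 2 (λ b d → :- (b :+ d) := (:- b) :+ (:- d)) refl b d
            }
          ; ε-homo = refl , -0≈0
          }
        ; *-homo = λ (a , b) (c , d) →
            solve 4 (λ a b c d → a :* c :+ (:- (b :* d)) := a :* c :+ (:- ((:- b) :* (:- d)))) refl a b c d ,
            solve 4 (λ a b c d → :- (a :* d :+ b :* c) := a :* (:- d) :+ (:- b) :* c) refl a b c d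
        }
      ; 1#-homo = refl , -0≈0
      }
    ; -‿homo = λ z → refl , refl
    }

  conj-involutive : ∀ z → conj (conj z) ℂ.≈ z
  conj-involutive (a , b) = refl , -‿involutive b

  conj-fromℝ : ∀ x → conj (fromℝ x) ℂ.≈ fromℝ x
  conj-fromℝ x = refl , -0≈0

  conj-fixed : ∀ {z} → conj z ℂ.≈ z → z ℂ.≈ fromℝ (proj₁ z)
  conj-fixed {a , b} (_ , -b≈b) = refl , FieldKit.cancel-unit ℝ-ring isField _≈?_ {x = 1# + 1#}
    (λ 2≈0 → suc≉0 1 (trans (+-congˡ (+-identityʳ 1#)) 2≈0))
    (trans (distribʳ b 1# 1#) (trans (+-cong (*-identityˡ b) (*-identityˡ b)) (trans (+-congʳ (sym -b≈b)) (-‿inverseˡ b))))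

  _≈ᶜ?_ : Decidable ℂ._≈_
  x ≈ᶜ? y = em

  ℂ-isField : IsField ℂ-ring
  ℂ-isField = record { 0≉1 = λ eq → 0≉1 (proj₁ eq) ; inverse = inverseᶜ }
    where
    inverseᶜ : ∀ z → ¬ (z ℂ.≈ ℂ.0#) → ∃ λ w → (z ℂ.* w) ℂ.≈ ℂ.1#
    inverseᶜ (a , b) z≉0 = (a * q , - (b * q)) ,
      trans (solve 3 (λ a b q → a :* (a :* q) :+ (:- (b :* (:- (b :* q)))) := (a :* a :+ b :* b) :* q) refl a b q) (proj₂ (inverse N N≉0)) ,
      trans (solve 3 (λ a b q → a :* (:- (b :* q)) :+ b :* (a :* q) := a :* q :- a :* q) refl a b q)
        (-‿inverseʳ (a * q))
      where
      N : ℝ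
      N = a * a + b * b
      square≈0 : ∀ x → (x * x) ≤ 0# → x ≈ 0#
      square≈0 x x²≤0 with x ≈? 0#
      ... | yes x≈0 = x≈0
      ... | no  x≉0 = ⊥-elim (*-nonzeroʳ x≉0 x≉0 (antisym x²≤0 (square-nonNeg x)))
      N≉0 : ¬ (N ≈ 0#)
      N≉0 N≈0 = z≉0 ( square≈0 a (≤-respʳ-≈ N≈0 (x≤x+y (square-nonNeg b)))
                    , square≈0 b (≤-respʳ-≈ N≈0 (x≤y+x (square-nonNeg a))))
      q : ℝ
      q = proj₁ (inverse N N≉0)

  ℂ-char0 : ∀ k → ¬ ((suc k ℂ^.× ℂ.1#) ℂ.≈ ℂ.0#)
  ℂ-char0 k (eq , _) = suc≉0 k (trans (sym (real-part (suc k))) eq)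
    where
    real-part : ∀ k → proj₁ (k ℂ^.× ℂ.1#) ≈ k ℝ^.× 1#
    real-part zero    = refl
    real-part (suc k) = +-congˡ (real-part k)

  -- A norm without square roots. It is subadditive and submultiplicative, agrees with the absolute
  -- value on ℝ and scales exactly under nonnegative real factors; the estimates rest on these
  -- properties.
  ‖_‖ : ℂ → ℝ
  ‖ a , b ‖ = ∣ a ∣ + ∣ b ∣

  ‖‖-nonNeg : ∀ z → 0# ≤ ‖ z ‖
  ‖‖-nonNeg (a , b) = +-nonNeg (∣∣-nonNeg a) (∣∣-nonNeg b)

  ‖‖-cong : ∀ {z w} → z ℂ.≈ w → ‖ z ‖ ≈ ‖ w ‖
  ‖‖-cong (p , q) = +-cong (∣∣-cong p) (∣∣-cong q)

  ‖‖-fromℝ : ∀ x → ‖ fromℝ x ‖ ≈ ∣ x ∣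
  ‖‖-fromℝ x = trans (+-congˡ (∣∣-of-nonNeg ≤-refl)) (+-identityʳ _)

  ‖‖-+ : ∀ z w → ‖ z ℂ.+ w ‖ ≤ (‖ z ‖ + ‖ w ‖)
  ‖‖-+ (a , b) (c , d) = ≤-respʳ-≈
    (solve 4 (λ a b c d → (a :+ c) :+ (b :+ d) := (a :+ b) :+ (c :+ d)) refl (∣ a ∣) (∣ b ∣) (∣ c ∣) (∣ d ∣))
    (+-mono-≤ (∣∣-+ a c) (∣∣-+ b d))

  ‖‖-* : ∀ z w → ‖ z ℂ.* w ‖ ≤ (‖ z ‖ * ‖ w ‖)
  ‖‖-* (a , b) (c , d) = ≤-respʳ-≈
    (trans (+-cong (+-cong (∣∣-* a c) (∣∣-* b d)) (+-cong (∣∣-* a d) (∣∣-* b c)))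
      (solve 4 (λ a b c d → (a :* c :+ b :* d) :+ (a :* d :+ b :* c) := (a :+ b) :* (c :+ d)) refl (∣ a ∣) (∣ b ∣) (∣ c ∣) (∣ d ∣)))
    (+-mono-≤ (≤-trans (∣∣-+ (a * c) (- (b * d))) (+-monoʳ-≤ ∣ a * c ∣ (∣∣-neg (b * d)))) (∣∣-+ (a * d) (b * c)))

  ‖‖-scale : ∀ {s} → 0# ≤ s → ∀ z → ‖ fromℝ s ℂ.* z ‖ ≈ s * ‖ z ‖
  ‖‖-scale {s} 0≤s (a , b) = trans (+-cong (part real) (part imaginary)) (sym (distribˡ s (∣ a ∣) (∣ b ∣)))
    where
    part : ∀ {x y} → x ≈ s * y → ∣ x ∣ ≈ s * ∣ y ∣
    part {x} {y} eq = trans (∣∣-cong eq) (trans (∣∣-* s y) (*-congʳ (∣∣-of-nonNeg 0≤s)))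
    real : s * a + - (0# * b) ≈ s * a
    real = trans (+-congˡ (trans (-‿cong (zeroˡ b)) -0≈0)) (+-identityʳ _)
    imaginary : s * b + 0# * a ≈ s * b
    imaginary = trans (+-congˡ (zeroˡ a)) (+-identityʳ _)

  ‖‖-product : ∀ n (f : Vector ℂ n) → ‖ ℂ^.product f ‖ ≤ ℝ^.product (λ i → ‖ f i ‖)
  ‖‖-product zero    f = ≤-reflexive (trans (‖‖-fromℝ 1#) (∣∣-of-nonNeg 0≤1))
  ‖‖-product (suc n) f = ≤-trans (‖‖-* (f zero) (ℂ^.product (f ∘ suc)))
    (*-monoˡ-≤ (‖‖-nonNeg (f zero)) (‖‖-product n (f ∘ suc)))

  ‖‖-sum : ∀ n (f : Vector ℂ n) → ‖ ℂ^.sum f ‖ ≤ ℝ^.sum (λ i → ‖ f i ‖)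
  ‖‖-sum zero    f = ≤-reflexive (trans (‖‖-fromℝ 0#) (∣∣-of-nonNeg ≤-refl))
  ‖‖-sum (suc n) f = ≤-trans (‖‖-+ (f zero) (ℂ^.sum (f ∘ suc))) (+-monoʳ-≤ ‖ f zero ‖ (‖‖-sum n (f ∘ suc)))

  eval-fromℝ : ∀ {n} (p : ℝ[x].Poly n) x → ℂ[x].eval (fromℝ[x] p) (fromℝ ∘ x) ℂ.≈ fromℝ (ℝ[x].eval p x)
  eval-fromℝ         []            x = ℂ.refl
  eval-fromℝ {n = n} ((a , α) ∷ p) x = ℂ.trans
    (ℂ.+-cong (ℂ.trans (ℂ.*-congˡ (ℂ.trans (RingKit.product-cong ℂ-ring n (λ i → ℂ.sym (φ-^ (x i) (lookup α i)))) (ℂ.sym (φ-product n (λ i → x i ℝ^.^ lookup α i)))))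
      (ℂ.sym (*-homo a _))) (eval-fromℝ p x))
    (ℂ.sym (+-homo _ _))
    where
    open RingHomKit ℝ-ring ℂ-ring fromℝ fromℝ-homo
    open IsRingHomomorphism fromℝ-homo

  eval-conj : ∀ {n} (p : ℝ[x].Poly n) x → ℂ[x].eval (fromℝ[x] p) (conj ∘ x) ℂ.≈ conj (ℂ[x].eval (fromℝ[x] p) x)
  eval-conj         []            x = ℂ.sym (IsRingHomomorphism.0#-homo conj-homo)
  eval-conj {n = n} ((a , α) ∷ p) x = ℂ.trans
    (ℂ.+-cong (ℂ.trans (ℂ.*-cong (ℂ.sym (conj-fromℝ a)) (ℂ.trans (RingKit.product-cong ℂ-ring n (λ i → ℂ.sym (φ-^ (x i) (lookup α i)))) (ℂ.sym (φ-product n (λ i → x i ℂ^.^ lookup α i)))))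
      (ℂ.sym (*-homo (fromℝ a) _))) (eval-conj p x))
    (ℂ.sym (+-homo _ _))
    where
    open RingHomKit ℂ-ring ℂ-ring conj conj-homo
    open IsRingHomomorphism conj-homo

-- Orbits of SLₙ(ℤ) on integral vectors

module ElementaryMatrices {c ℓ : Level} (R : CommutativeRing c ℓ) where
  open CommutativeRing R hiding (zero)
  open RawSemiringDefinitions (RawRing.rawSemiring rawRing) using (_^_)
  open Matrices R
  open RingKit R

  det-cong : ∀ {n} (M N : Matrix n) → (∀ i j → M i j ≈ N i j) → det M ≈ det N
  det-cong {zero}  M N M≈N = refl
  det-cong {suc n} M N M≈N = sum-cong (suc n) (λ j → *-congˡ {(- 1#) ^ toℕ j} (*-cong (M≈N zero j)
    (det-cong (λ i → removeAt (M (suc i)) j) (λ i → removeAt (N (suc i)) j) (λ i k → M≈N (suc i) (punchIn j k)))))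

  term-zeroˡ : ∀ {s a} d → a ≈ 0# → s * (a * d) ≈ 0#
  term-zeroˡ {s} d a≈0 = trans (*-congˡ (trans (*-congʳ a≈0) (zeroˡ _))) (zeroʳ s)

  term-zeroʳ : ∀ {s a d} → d ≈ 0# → s * (a * d) ≈ 0#
  term-zeroʳ {s} {a} d≈0 = trans (*-congˡ (trans (*-congˡ d≈0) (zeroʳ a))) (zeroʳ s)

  det-zero-row : ∀ {n} (M : Matrix n) r → (∀ j → M r j ≈ 0#) → det M ≈ 0#
  det-zero-row {suc n} M zero    row≈0 = sum-zero (suc n) (λ j → term-zeroˡ {(- 1#) ^ toℕ j} (det (λ i → removeAt (M (suc i)) j)) (row≈0 j))
  det-zero-row {suc n} M (suc r) row≈0 = sum-zero (suc n) (λ j → term-zeroʳ {(- 1#) ^ toℕ j} {M zero j}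
    (det-zero-row (λ i → removeAt (M (suc i)) j) r (λ k → row≈0 (punchIn j k))))

  -- Every term of the Laplace expansion but the first contains a vanishing entry or a vanishing
  -- minor. Elementary matrices are of this shape.
  det-first-row : ∀ {n} (M : Matrix (suc n)) → M zero zero ≈ 1# →
    (∀ j → M zero (suc j) ≈ 0# ⊎ det (λ i → removeAt (M (suc i)) (suc j)) ≈ 0#) →
    det M ≈ det (λ i k → M (suc i) (suc k))
  det-first-row {n} M M₀₀≈1 others = trans
    (sum-single zero (λ j → (- 1#) ^ toℕ j * (M zero j * det (λ i → removeAt (M (suc i)) j)))
      (λ { zero z → ⊥-elim (z ≡.refl)
         ; (suc j) _ → [ term-zeroˡ {(- 1#) ^ suc (toℕ j)} (det (λ i → removeAt (M (suc i)) (suc j))) , term-zeroʳ {(- 1#) ^ suc (toℕ j)} {M zero (suc j)} ]′ (others j) }))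
    (trans (*-identityˡ _) (trans (*-congʳ M₀₀≈1) (*-identityˡ _)))

  det-1ᴹ : ∀ n → det {n} 1ᴹ ≈ 1#
  det-1ᴹ zero    = refl
  det-1ᴹ (suc n) = trans (det-first-row {n} 1ᴹ refl (λ j → inj₁ refl))
    (trans (det-cong {n} (λ i k → 1ᴹ (suc i) (suc k)) 1ᴹ (λ i k → reflexive (1ᴹ-suc i k))) (det-1ᴹ n))

  -- The transvection that adds `t` times coordinate `c` to coordinate `r`.
  elementary : ∀ {n} → Fin n → Fin n → Carrier → Matrix n
  elementary r c t i j = 1ᴹ i j + 1ᴹ r i * (t * 1ᴹ c j)

  private
    no-change : ∀ {x y z} → y ≈ 0# → x + y * z ≈ x
    no-change {x} y≈0 = trans (+-congˡ (trans (*-congʳ y≈0) (zeroˡ _))) (+-identityʳ x)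

    no-change′ : ∀ {x y t z} → z ≈ 0# → x + y * (t * z) ≈ x
    no-change′ {x} {y} {t} z≈0 = trans (+-congˡ (trans (*-congˡ (trans (*-congˡ z≈0) (zeroʳ t))) (zeroʳ y))) (+-identityʳ x)

  det-elementary : ∀ {n} (r c : Fin n) t → r ≢ c → det (elementary r c t) ≈ 1#
  det-elementary zero zero t r≢c = ⊥-elim (r≢c ≡.refl)
  det-elementary {suc n} zero (suc c) t r≢c = trans
    (det-first-row (elementary zero (suc c) t) (no-change′ refl) others)
    (trans (det-cong (λ i k → elementary zero (suc c) t (suc i) (suc k)) 1ᴹ
      (λ i k → trans (no-change refl) (reflexive (1ᴹ-suc i k)))) (det-1ᴹ n))
    where
    others : ∀ j → elementary zero (suc c) t zero (suc j) ≈ 0# ⊎ det (λ i → removeAt (elementary zero (suc c) t (suc i)) (suc j)) ≈ 0#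
    others j = cases (c Fin.≟ j)
      where
      cases : Dec (c ≡ j) → _ ⊎ _
      -- The deleted column contains the only nonzero entry of the row below, so the minor has a
      -- zero row.
      cases (yes ≡.refl) = inj₂ (det-zero-row (λ i → removeAt (elementary zero (suc c) t (suc i)) (suc c)) c
        (λ k → trans (no-change refl) (reflexive (1ᴹ-off-diagonal (Fin.punchInᵢ≢i (suc c) k ∘ ≡.sym)))))
      cases (no c≢j)     = inj₁ (no-change′ (reflexive (1ᴹ-off-diagonal (c≢j ∘ Fin.suc-injective))))
  det-elementary {suc n} (suc r) c t r≢c = trans
    (det-first-row (elementary (suc r) c t) (no-change refl) (λ j → inj₁ (no-change refl)))
    (minor c r≢c)
    where
    minor : ∀ c → suc r ≢ c → det (λ i k → elementary (suc r) c t (suc i) (suc k)) ≈ 1#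
    minor zero    _   = trans (det-cong (λ i k → elementary (suc r) zero t (suc i) (suc k)) 1ᴹ
      (λ i k → trans (no-change′ refl) (reflexive (1ᴹ-suc i k)))) (det-1ᴹ n)
    minor (suc c) r≢c = trans (det-cong (λ i k → elementary (suc r) (suc c) t (suc i) (suc k)) (elementary r c t)
      (λ i k → +-cong (reflexive (1ᴹ-suc i k)) (*-cong (reflexive (1ᴹ-suc r i)) (*-congˡ (reflexive (1ᴹ-suc c k))))))
      (det-elementary r c t (r≢c ∘ ≡.cong suc))

  1ᴹ-inverse : ∀ n → InverseOf {n} 1ᴹ 1ᴹ
  1ᴹ-inverse n = (λ i j → sum-1ᴹˡ i (λ k → 1ᴹ k j)) , (λ i j → sum-1ᴹˡ i (λ k → 1ᴹ k j))

module IntegerOrbits where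
  open Matrices ℤ-ring
  open RingKit ℤ-ring
  open ElementaryMatrices ℤ-ring
  open RawSemiringDefinitions (RawRing.rawSemiring (CommutativeRing.rawRing ℤ-ring)) using () renaming (sum to sumℤ)
  open ≡.≡-Reasoning

  move : ∀ {n} → Fin n → Fin n → ℤ → Vector ℤ n → Vector ℤ n
  move r c t w i = w i ℤ.+ 1ᴹ r i ℤ.* (t ℤ.* w c)

  move-at : ∀ {n} (r c : Fin n) t w → move r c t w r ≡ w r ℤ.+ t ℤ.* w c
  move-at r c t w = ≡.cong (ℤ._+_ (w r)) (≡.trans (≡.cong (ℤ._* (t ℤ.* w c)) (1ᴹ-diagonal r)) (ℤ.*-identityˡ _))

  move-off : ∀ {n} {r : Fin n} (c : Fin n) t w {i} → r ≢ i → move r c t w i ≡ w i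
  move-off c t w {i} r≢i = ≡.trans (≡.cong (ℤ._+_ (w i)) (≡.cong (ℤ._* (t ℤ.* w c)) (1ᴹ-off-diagonal r≢i))) (ℤ.+-identityʳ _)

  elementary-*ᵛ : ∀ {n} (r c : Fin n) t w → elementary r c t *ᵛ Vec.tabulate w ≡ Vec.tabulate (move r c t w)
  elementary-*ᵛ {n} r c t w = Vec.tabulate-cong λ i → begin
    sumℤ (λ j → elementary r c t i j ℤ.* lookup (Vec.tabulate w) j)
      ≡⟨ sum-cong n (λ j → ≡.trans (≡.cong (elementary r c t i j ℤ.*_) (Vec.lookup∘tabulate w j))
           (solve 5 (λ e d t f w → (e :+ d :* (t :* f)) :* w := e :* w :+ d :* (t :* (f :* w))) ≡.refl (1ᴹ i j) (1ᴹ r i) t (1ᴹ c j) (w j))) ⟩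
    sumℤ (λ j → 1ᴹ i j ℤ.* w j ℤ.+ 1ᴹ r i ℤ.* (t ℤ.* (1ᴹ c j ℤ.* w j)))
      ≡⟨ ∑-+ n (λ j → 1ᴹ i j ℤ.* w j) (λ j → 1ᴹ r i ℤ.* (t ℤ.* (1ᴹ c j ℤ.* w j))) ⟩
    sumℤ (λ j → 1ᴹ i j ℤ.* w j) ℤ.+ sumℤ (λ j → 1ᴹ r i ℤ.* (t ℤ.* (1ᴹ c j ℤ.* w j)))
      ≡⟨ ≡.cong₂ ℤ._+_ (sum-1ᴹˡ i w) (≡.trans (≡.sym (*-distribˡ-∑ n (1ᴹ r i) (λ j → t ℤ.* (1ᴹ c j ℤ.* w j))))
           (≡.cong (1ᴹ r i ℤ.*_) (≡.trans (≡.sym (*-distribˡ-∑ n t (λ j → 1ᴹ c j ℤ.* w j))) (≡.cong (t ℤ.*_) (sum-1ᴹˡ c w))))) ⟩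
    move r c t w i ∎

  infix 4 _⇝_
  -- Paths of transvections instead of elements of SLₙ(ℤ): invariance is applied one step at a time,
  -- and a path is undone by reversing the signs of its steps.
  data _⇝_ {n} (w : Vector ℤ n) : Vector ℤ n → Set where
    done : ∀ {w′} → (∀ i → w i ≡ w′ i) → w ⇝ w′
    step : ∀ {w′} r c t → r ≢ c → move r c t w ⇝ w′ → w ⇝ w′

  ⇝-trans : ∀ {n} {u v w : Vector ℤ n} → u ⇝ v → v ⇝ w → u ⇝ w
  ⇝-trans (done u≗v) v⇝w = resp u≗v v⇝w
    where
    resp : ∀ {n} {u v w : Vector ℤ n} → (∀ i → u i ≡ v i) → v ⇝ w → u ⇝ w
    resp u≗v (done v≗w) = done λ i → ≡.trans (u≗v i) (v≗w i)
    resp u≗v (step r c t r≢c path) = step r c t r≢c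
      (resp (λ i → ≡.cong₂ (λ x y → x ℤ.+ 1ᴹ r i ℤ.* (t ℤ.* y)) (u≗v i) (u≗v c)) path)
  ⇝-trans (step r c t r≢c path) v⇝w = step r c t r≢c (⇝-trans path v⇝w)

  module _ {n} {Z : Pred (Vec ℤ n) 0ℓ} (invariant : ∀ γ → γ ∈ SL n → ∀ v → v ∈ Z → (γ *ᵛ v) ∈ Z) where

    move-∈ : ∀ r c t → r ≢ c → ∀ w → Vec.tabulate w ∈ Z → Vec.tabulate (move r c t w) ∈ Z
    move-∈ r c t r≢c w w∈Z = ≡.subst (_∈ Z) (elementary-*ᵛ r c t w)
      (invariant (elementary r c t) (det-elementary r c t r≢c) (Vec.tabulate w) w∈Z)

    ⇝-∈ : ∀ {w w′} → w ⇝ w′ → Vec.tabulate w ∈ Z → Vec.tabulate w′ ∈ Z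
    ⇝-∈ (done w≗w′)           w∈Z = ≡.subst (_∈ Z) (Vec.tabulate-cong w≗w′) w∈Z
    ⇝-∈ {w} (step r c t r≢c path) w∈Z = ⇝-∈ path (move-∈ r c t r≢c w w∈Z)

    -- Undoing the moves is linear, so it preserves the proportion between `u′` and `w′`, and it
    -- never leaves `Z`.
    ⇝-pull-back : ∀ {w w′} → w ⇝ w′ → ∀ k m u′ → Vec.tabulate u′ ∈ Z → (∀ i → k ℤ.* u′ i ≡ m ℤ.* w′ i) →
      ∃ λ (u : Vector ℤ n) → Vec.tabulate u ∈ Z × (∀ i → k ℤ.* u i ≡ m ℤ.* w i)
    ⇝-pull-back (done w≗w′) k m u′ u′∈Z eq = u′ , u′∈Z , λ i → ≡.trans (eq i) (≡.cong (m ℤ.*_) (≡.sym (w≗w′ i)))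
    ⇝-pull-back {w} (step r c t r≢c path) k m u′ u′∈Z eq with ⇝-pull-back path k m u′ u′∈Z eq
    ... | u , u∈Z , eq′ = move r c (ℤ.- t) u , move-∈ r c (ℤ.- t) r≢c u u∈Z , λ i → begin
      k ℤ.* (u i ℤ.+ 1ᴹ r i ℤ.* (ℤ.- t ℤ.* u c))
        ≡⟨ solve 5 (λ k u d t v → k :* (u :+ d :* ((:- t) :* v)) := k :* u :+ d :* ((:- t) :* (k :* v))) ≡.refl k (u i) (1ᴹ r i) t (u c) ⟩
      k ℤ.* u i ℤ.+ 1ᴹ r i ℤ.* (ℤ.- t ℤ.* (k ℤ.* u c))
        ≡⟨ ≡.cong₂ (λ x y → x ℤ.+ 1ᴹ r i ℤ.* (ℤ.- t ℤ.* y)) (eq′ i) (≡.trans (eq′ c) (≡.cong (m ℤ.*_) (move-off c t w r≢c))) ⟩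
      m ℤ.* (w i ℤ.+ 1ᴹ r i ℤ.* (t ℤ.* w c)) ℤ.+ 1ᴹ r i ℤ.* (ℤ.- t ℤ.* (m ℤ.* w c))
        ≡⟨ solve 5 (λ m w d t v → m :* (w :+ d :* (t :* v)) :+ d :* ((:- t) :* (m :* v)) := m :* w) ≡.refl m (w i) (1ᴹ r i) t (w c) ⟩
      m ℤ.* w i ∎

  axis : ∀ {n} → ℤ → Vector ℤ (suc n)
  axis k i = k ℤ.* 1ᴹ zero i

  size : ∀ {n} → Vector ℤ n → ℕ
  size {zero}  w = 0
  size {suc n} w = ℤ.∣ w zero ∣ ℕ.+ size (w ∘ suc)

  size-cong : ∀ {n} (v w : Vector ℤ n) → (∀ i → v i ≡ w i) → size v ≡ size w
  size-cong {zero}  v w v≗w = ≡.refl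
  size-cong {suc n} v w v≗w = ≡.cong₂ (λ x y → ℤ.∣ x ∣ ℕ.+ y) (v≗w zero) (size-cong (v ∘ suc) (w ∘ suc) (v≗w ∘ suc))

  size-decreases : ∀ {n} (v w : Vector ℤ n) r → ℤ.∣ v r ∣ ℕ.< ℤ.∣ w r ∣ → (∀ i → r ≢ i → v i ≡ w i) → size v ℕ.< size w
  size-decreases v w zero    v<w same = ℕ.+-mono-<-≤ v<w (ℕ.≤-reflexive (size-cong (v ∘ suc) (w ∘ suc) (λ i → same (suc i) λ ())))
  size-decreases v w (suc r) v<w same = ℕ.+-mono-≤-< (ℕ.≤-reflexive (≡.cong ℤ.∣_∣ (same zero λ ())))
    (size-decreases (v ∘ suc) (w ∘ suc) r v<w (λ i r≢i → same (suc i) (r≢i ∘ Fin.suc-injective)))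

  -- One step of the subtractive Euclidean algorithm: `t` is -1 for equal signs and 1 for opposite
  -- ones.
  closer : ∀ x y → y ≢ 0ℤ → ℤ.∣ y ∣ ℕ.≤ ℤ.∣ x ∣ → ∃ λ t → ℤ.∣ x ℤ.+ t ℤ.* y ∣ ℕ.< ℤ.∣ x ∣
  closer x        (+ zero)  y≢0 y≤x = ⊥-elim (y≢0 ≡.refl)
  closer (+ j)    (+ suc k) y≢0 y≤x = -1ℤ , ≡.subst (ℕ._< j) (≡.cong ℤ.∣_∣ (≡.sym eq)) (ℕ.∸-monoʳ-< ℕ.z<s y≤x)
    where
    eq : + j ℤ.+ -1ℤ ℤ.* + suc k ≡ + (j ℕ.∸ suc k)
    eq = ≡.trans (≡.cong (ℤ._+_ (+ j)) (ℤ.-1*i≡-i (+ suc k))) (ℤ.⊖-≥ y≤x)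
  closer -[1+ j ] (+ suc k) y≢0 y≤x = 1ℤ , ≡.subst (ℕ._< suc j) (≡.trans (≡.sym (ℤ.∣-i∣≡∣i∣ (+ (suc j ℕ.∸ suc k)))) (≡.cong ℤ.∣_∣ (≡.sym eq))) (ℕ.∸-monoʳ-< ℕ.z<s y≤x)
    where
    eq : -[1+ j ] ℤ.+ 1ℤ ℤ.* + suc k ≡ ℤ.- + (suc j ℕ.∸ suc k)
    eq = ≡.trans (≡.cong (λ z → -[1+ j ] ℤ.+ z) (ℤ.*-identityˡ (+ suc k))) (ℤ.⊖-≤ y≤x)
  closer (+ j)    -[1+ k ]  y≢0 y≤x = 1ℤ , ≡.subst (ℕ._< j) (≡.cong ℤ.∣_∣ (≡.sym eq)) (ℕ.∸-monoʳ-< ℕ.z<s y≤x)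
    where
    eq : + j ℤ.+ 1ℤ ℤ.* -[1+ k ] ≡ + (j ℕ.∸ suc k)
    eq = ≡.trans (≡.cong (ℤ._+_ (+ j)) (ℤ.*-identityˡ -[1+ k ])) (ℤ.⊖-≥ y≤x)
  closer -[1+ j ] -[1+ k ]  y≢0 y≤x = -1ℤ , ≡.subst (ℕ._< suc j) (≡.trans (≡.sym (ℤ.∣-i∣≡∣i∣ (+ (suc j ℕ.∸ suc k)))) (≡.cong ℤ.∣_∣ (≡.sym eq))) (ℕ.∸-monoʳ-< ℕ.z<s y≤x)
    where
    eq : -[1+ j ] ℤ.+ -1ℤ ℤ.* -[1+ k ] ≡ ℤ.- + (suc j ℕ.∸ suc k)
    eq = ≡.trans (≡.cong (λ z → -[1+ j ] ℤ.+ z) (ℤ.-1*i≡-i -[1+ k ])) (ℤ.⊖-≤ y≤x)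

  private
    to-axis-from-off : ∀ {n} (w : Vector ℤ (suc n)) r → zero ≢ r → w r ≢ 0ℤ → (∀ i → r ≢ i → w i ≡ 0ℤ) →
      ∃ λ k → w ⇝ axis (+ suc k)
    to-axis-from-off w r 0≢r wr≢0 others = path (w r) ≡.refl wr≢0
      where
      -- With `s` the sign of `w r`, the first move puts the absolute value of `w r` into the empty
      -- coordinate `zero`, and the second uses it to erase `w r`. Thus the multiple of the axis is
      -- positive.
      two-moves : ∀ s k → s ℤ.* w r ≡ k → w r ℤ.+ ℤ.- s ℤ.* k ≡ 0ℤ → w ⇝ axis k
      two-moves s k sw≡k cancels = step zero r s 0≢r (step r zero (ℤ.- s) (0≢r ∘ ≡.sym) (done pointwise))
        where
        w₁ = move zero r s w
        w₁0 : w₁ zero ≡ k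
        w₁0 = ≡.trans (move-at zero r s w) (≡.trans (≡.cong (ℤ._+ s ℤ.* w r) (others zero (0≢r ∘ ≡.sym))) (≡.trans (ℤ.+-identityˡ _) sw≡k))
        pointwise : ∀ i → move r zero (ℤ.- s) w₁ i ≡ axis k i
        pointwise i with r Fin.≟ i
        ... | yes ≡.refl = ≡.trans (≡.cong₂ (λ x y → x ℤ.+ 1ℤ ℤ.* (ℤ.- s ℤ.* y)) (move-off r s w 0≢r) w₁0)
          (≡.trans (≡.cong (ℤ._+_ (w r)) (ℤ.*-identityˡ _)) (≡.trans cancels (≡.sym (≡.trans (≡.cong (k ℤ.*_) (1ᴹ-off-diagonal 0≢r)) (ℤ.*-zeroʳ k)))))
        ... | no r≢i = ≡.trans (ℤ.+-identityʳ _) (at i r≢i)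
          where
          at : ∀ i → r ≢ i → w₁ i ≡ axis k i
          at zero    _   = ≡.trans w₁0 (≡.sym (ℤ.*-identityʳ k))
          at (suc i) r≢i = ≡.trans (ℤ.+-identityʳ _) (≡.trans (others (suc i) r≢i) (≡.sym (ℤ.*-zeroʳ k)))
      path : ∀ x → w r ≡ x → x ≢ 0ℤ → ∃ λ k → w ⇝ axis (+ suc k)
      path (+ zero)  _  x≢0 = ⊥-elim (x≢0 ≡.refl)
      path (+ suc k) eq _   = k , two-moves 1ℤ (+ suc k) (≡.trans (ℤ.*-identityˡ (w r)) eq)
        (≡.trans (≡.cong₂ ℤ._+_ eq (ℤ.-1*i≡-i (+ suc k))) (ℤ.+-inverseʳ (+ suc k)))
      path -[1+ k ]  eq _   = k , two-moves -1ℤ (+ suc k) (≡.trans (ℤ.-1*i≡-i (w r)) (≡.cong ℤ.-_ eq))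
        (≡.trans (≡.cong₂ ℤ._+_ eq (ℤ.*-identityˡ (+ suc k))) (ℤ.+-inverseˡ (+ suc k)))

    to-axis-single : ∀ {n} (w : Vector ℤ (suc (suc n))) r → w r ≢ 0ℤ → (∀ i → r ≢ i → w i ≡ 0ℤ) →
      ∃ λ k → w ⇝ axis (+ suc k)
    to-axis-single w (suc r) wr≢0 others = to-axis-from-off w (suc r) (λ ()) wr≢0 others
    -- From the first axis we pass through the second one, which also corrects the sign.
    to-axis-single w zero    wr≢0 others with to-axis-from-off w₂ (suc zero) (λ ()) (λ eq → wr≢0 (≡.trans (≡.sym w₂1) eq)) off
      where
      w₁ = move (suc zero) zero 1ℤ w
      w₂ = move zero (suc zero) -1ℤ w₁
      w₁1 : w₁ (suc zero) ≡ w zero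
      w₁1 = ≡.trans (move-at (suc zero) zero 1ℤ w) (≡.trans (≡.cong₂ ℤ._+_ (others (suc zero) (λ ())) (ℤ.*-identityˡ (w zero))) (ℤ.+-identityˡ _))
      w₂1 : w₂ (suc zero) ≡ w zero
      w₂1 = ≡.trans (move-off {r = zero} (suc zero) -1ℤ w₁ (λ ())) w₁1
      w₂0 : w₂ zero ≡ 0ℤ
      w₂0 = ≡.trans (move-at zero (suc zero) -1ℤ w₁) (≡.trans (≡.cong₂ (λ x y → x ℤ.+ -1ℤ ℤ.* y) (move-off {r = suc zero} zero 1ℤ w (λ ())) w₁1)
        (≡.trans (≡.cong (ℤ._+_ (w zero)) (ℤ.-1*i≡-i (w zero))) (ℤ.+-inverseʳ (w zero))))
      off : ∀ i → suc zero ≢ i → w₂ i ≡ 0ℤ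
      off zero          _ = w₂0
      off (suc zero)    n = ⊥-elim (n ≡.refl)
      off (suc (suc i)) _ = ≡.trans (move-off {r = zero} (suc zero) -1ℤ w₁ (λ ())) (≡.trans (move-off {r = suc zero} zero 1ℤ w (λ ())) (others (suc (suc i)) (λ ())))
    ... | k , path = k , step (suc zero) zero 1ℤ (λ ()) (step zero (suc zero) -1ℤ (λ ()) path)

  -- While two entries are nonzero, the larger in absolute value is reduced by the other, which
  -- lowers `size`. The recursion continues at the entry that was subtracted, since that one stays
  -- nonzero.
  to-axis : ∀ {n} (w : Vector ℤ (suc (suc n))) r → w r ≢ 0ℤ → ∃ λ k → w ⇝ axis (+ suc k)
  to-axis {n} w r wr≢0 = descend (suc (size w)) w r wr≢0 (ℕ.n<1+n _)
    where
    descend : ∀ fuel (w : Vector ℤ (suc (suc n))) r → w r ≢ 0ℤ → size w ℕ.< fuel → ∃ λ k → w ⇝ axis (+ suc k)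
    descend (suc fuel) w r wr≢0 w<fuel with Fin.any? (λ i → ¬? (r Fin.≟ i) ×-dec ¬? (w i ℤ.≟ 0ℤ))
    ... | no none = to-axis-single w r wr≢0 others
      where
      others : ∀ i → r ≢ i → w i ≡ 0ℤ
      others i r≢i with w i ℤ.≟ 0ℤ
      ... | yes wi≡0 = wi≡0
      ... | no  wi≢0 = ⊥-elim (none (i , r≢i , wi≢0))
    ... | yes (i , r≢i , wi≢0) = reduce (ℕ.≤-total ℤ.∣ w r ∣ ℤ.∣ w i ∣)
      where
      subtract : ∀ p q → p ≢ q → w q ≢ 0ℤ → ℤ.∣ w q ∣ ℕ.≤ ℤ.∣ w p ∣ → ∃ λ k → w ⇝ axis (+ suc k)
      subtract p q p≢q wq≢0 q≤p with closer (w p) (w q) wq≢0 q≤p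
      ... | t , smaller with descend fuel (move p q t w) q (λ eq → wq≢0 (≡.trans (≡.sym (move-off q t w p≢q)) eq))
          (ℕ.<-≤-trans (size-decreases (move p q t w) w p (≡.subst (λ z → ℤ.∣ z ∣ ℕ.< ℤ.∣ w p ∣) (≡.sym (move-at p q t w)) smaller)
            (λ i p≢i → move-off q t w p≢i)) (ℕ.s≤s⁻¹ w<fuel))
      ...   | k , path = k , step p q t p≢q path
      reduce : ℤ.∣ w r ∣ ℕ.≤ ℤ.∣ w i ∣ ⊎ ℤ.∣ w i ∣ ℕ.≤ ℤ.∣ w r ∣ → ∃ λ k → w ⇝ axis (+ suc k)
      reduce (inj₁ r≤i) = subtract i r (r≢i ∘ ≡.sym) wr≢0 r≤i
      reduce (inj₂ i≤r) = subtract r i r≢i wi≢0 i≤r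

  -- The paths of `z₀` and `v` end at the multiples `suc m` and `suc c` of the first unit vector.
  -- The former multiple lies in `Z`; running the path of `v` backwards from it yields `u`. The
  -- number `m` depends on `z₀` only.
  orbit-commensurable : ∀ {n} (Z : Pred (Vec ℤ (suc (suc n))) 0ℓ) →
    (∀ γ → γ ∈ SL _ → ∀ v → v ∈ Z → (γ *ᵛ v) ∈ Z) →
    ∀ z₀ → z₀ ∈ Z → z₀ ≢ replicate _ 0ℤ →
    ∃ λ m → ∀ (v : Vector ℤ (suc (suc n))) r → v r ≢ 0ℤ →
      ∃₂ λ c (u : Vector ℤ (suc (suc n))) → Vec.tabulate u ∈ Z × (∀ i → + suc c ℤ.* u i ≡ + suc m ℤ.* v i)
  orbit-commensurable {n} Z invariant z₀ z₀∈Z z₀≢0 = from-axis (nonzero-entry (Fin.any? (λ r → ¬? (lookup z₀ r ℤ.≟ 0ℤ))))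
    where
    nonzero-entry : Dec (∃ λ r → lookup z₀ r ≢ 0ℤ) → ∃ λ m → lookup z₀ ⇝ axis (+ suc m)
    nonzero-entry (yes (r , ≢0)) = to-axis (lookup z₀) r ≢0
    nonzero-entry (no none) = ⊥-elim (z₀≢0 (≡.trans (≡.sym (Vec.tabulate∘lookup z₀)) (≡.trans (Vec.tabulate-cong zero-entry)
        (Vec.tabulate∘lookup (replicate _ 0ℤ)))))
      where
      zero-entry : ∀ r → lookup z₀ r ≡ lookup (replicate _ 0ℤ) r
      zero-entry r with lookup z₀ r ℤ.≟ 0ℤ
      ... | yes eq = ≡.trans eq (≡.sym (Vec.lookup-replicate r 0ℤ))
      ... | no  ≢0 = ⊥-elim (none (r , ≢0))
    from-axis : (∃ λ m → lookup z₀ ⇝ axis (+ suc m)) → _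
    from-axis (m , path₀) = m , λ v r vr≢0 → pull (to-axis v r vr≢0)
      where
      axis∈Z : Vec.tabulate (axis (+ suc m)) ∈ Z
      axis∈Z = ⇝-∈ invariant path₀ (≡.subst (_∈ Z) (≡.sym (Vec.tabulate∘lookup z₀)) z₀∈Z)
      pull : ∀ {v} → (∃ λ c → v ⇝ axis (+ suc c)) → _
      pull (c , path) with ⇝-pull-back invariant path (+ suc c) (+ suc m) (axis (+ suc m)) axis∈Z
          (λ i → solve 3 (λ c m d → c :* (m :* d) := m :* (c :* d)) ≡.refl (+ suc c) (+ suc m) (1ᴹ zero i))
      ... | u , u∈Z , eq = c , u , u∈Z , eq

-- Discrete sets of real numbers

∏ : ∀ {n} → (Fin n → ℕ) → ℕ
∏ {zero}  k = 1
∏ {suc n} k = k zero ℕ.* ∏ (k ∘ suc)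

-- Mixed-radix coding, through which the pigeonhole principle for `Fin` applies to tuples.
encode : ∀ {n} {k : Fin n → ℕ} → (∀ i → Fin (k i)) → Fin (∏ k)
encode {zero}  a = zero
encode {suc n} a = Fin.combine (a zero) (encode (a ∘ suc))

encode-injective : ∀ {n} {k : Fin n → ℕ} (a b : ∀ i → Fin (k i)) → encode a ≡ encode b → ∀ i → a i ≡ b i
encode-injective a b eq zero    = Fin.combine-injectiveˡ (a zero) (encode (a ∘ suc)) (b zero) (encode (b ∘ suc)) eq
encode-injective a b eq (suc i) = encode-injective (a ∘ suc) (b ∘ suc)
  (Fin.combine-injectiveʳ (a zero) (encode (a ∘ suc)) (b zero) (encode (b ∘ suc)) eq) i

finToFun-injective : ∀ {m n} (p q : Fin (m ℕ.^ n)) → (∀ i → Fin.finToFun {m} {n} p i ≡ Fin.finToFun {m} {n} q i) → p ≡ q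
finToFun-injective {m} {n} p q eq = ≡.trans (≡.sym (Fin.funToFin-finToFin {n} {m} p))
  (≡.trans (funToFin-cong (Fin.finToFun {m} {n} p) (Fin.finToFun {m} {n} q) eq) (Fin.funToFin-finToFin {n} {m} q))
  where
  funToFin-cong : ∀ {n} (f g : Fin n → Fin m) → (∀ i → f i ≡ g i) → Fin.funToFin f ≡ Fin.funToFin g
  funToFin-cong {zero}  f g f≗g = ≡.refl
  funToFin-cong {suc n} f g f≗g = ≡.cong₂ Fin.combine (f≗g zero) (funToFin-cong (f ∘ suc) (g ∘ suc) (f≗g ∘ suc))

module DiscreteSets (em : ExcludedMiddle 0ℓ) (ℛ : CompleteOrderedField) where
  open CompleteOrderedField ℛ renaming (Carrier to ℝ; ring to ℝ-ring)
  open Over ℛ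
  open RealOrder em ℛ
  open RingKit ℝ-ring using (solve; _:=_; _:+_; _:-_; :-_)

  ListedBy : ∀ {N} → Pred ℝ 0ℓ → (Fin N → ℝ) → Set
  ListedBy S L = ∀ y → y ∈ S → ∃ λ i → y ≈ L i

  Finite : Pred ℝ 0ℓ → Set
  Finite S = ∃ λ N → ∃ λ (L : Fin N → ℝ) → ListedBy S L

  Finite-insert : ∀ {S T : Pred ℝ 0ℓ} a → Finite S → (∀ y → y ∈ T → y ∈ S ⊎ y ≈ a) → Finite T
  Finite-insert {S} {T} a (N , L , listed) T⊆ = suc N , L′ , λ y y∈T → [ old y , (λ y≈a → zero , y≈a) ]′ (T⊆ y y∈T)
    where
    L′ : Fin (suc N) → ℝ
    L′ zero    = a
    L′ (suc i) = L i
    old : ∀ y → y ∈ S → ∃ λ i → y ≈ L′ i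
    old y y∈S = suc (proj₁ (listed y y∈S)) , proj₂ (listed y y∈S)

  Finite-map : ∀ {S T : Pred ℝ 0ℓ} (g : ℝ → ℝ) → (∀ {x y} → x ≈ y → g x ≈ g y) → Finite S →
    (∀ y → y ∈ T → ∃ λ x → x ∈ S × y ≈ g x) → Finite T
  Finite-map g g-cong (N , L , listed) T⊆ = N , g ∘ L , λ y y∈T → let x , x∈S , y≈gx = T⊆ y y∈T ; i , x≈Li = listed x x∈S in
    i , trans y≈gx (g-cong x≈Li)

  Finite-∪ : ∀ {S T U : Pred ℝ 0ℓ} → Finite S → Finite T → (∀ y → y ∈ U → y ∈ S ⊎ y ∈ T) → Finite U
  Finite-∪ {S} {T} {U} (M , K , listedS) (N , L , listedT) U⊆ = M ℕ.+ N , (λ i → [ K , L ]′ (Fin.splitAt M i)) ,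
    λ y y∈U → [ left y , right y ]′ (U⊆ y y∈U)
    where
    left : ∀ y → y ∈ S → ∃ λ i → y ≈ [ K , L ]′ (Fin.splitAt M i)
    left y y∈S = proj₁ (listedS y y∈S) Fin.↑ˡ N ,
      trans (proj₂ (listedS y y∈S)) (reflexive (≡.cong [ K , L ]′ (≡.sym (Fin.splitAt-↑ˡ M (proj₁ (listedS y y∈S)) N))))
    right : ∀ y → y ∈ T → ∃ λ i → y ≈ [ K , L ]′ (Fin.splitAt M i)
    right y y∈T = M Fin.↑ʳ proj₁ (listedT y y∈T) ,
      trans (proj₂ (listedT y y∈T)) (reflexive (≡.cong [ K , L ]′ (≡.sym (Fin.splitAt-↑ʳ M N (proj₁ (listedT y y∈T))))))

  Finite-⋃ : ∀ k {S : ℕ → Pred ℝ 0ℓ} {U : Pred ℝ 0ℓ} → (∀ j → Finite (S j)) →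
    (∀ y → y ∈ U → ∃ λ j → j ℕ.< k × y ∈ S j) → Finite U
  Finite-⋃ zero    finite U⊆ = 0 , (λ ()) , λ y y∈U → ⊥-elim (ℕ.n≮0 (proj₁ (proj₂ (U⊆ y y∈U))))
  Finite-⋃ (suc k) {S} {U} finite U⊆ = Finite-∪ {T = λ y → ∃ λ j → j ℕ.< k × y ∈ S (suc j)} (finite 0)
    (Finite-⋃ k {S = S ∘ suc} (finite ∘ suc) (λ y y∈ → y∈))
    λ y y∈U → split (U⊆ y y∈U)
    where
    split : ∀ {y} → (∃ λ j → j ℕ.< suc k × y ∈ S j) → y ∈ S 0 ⊎ ∃ λ j → j ℕ.< k × y ∈ S (suc j)
    split (zero  , _   , y∈S) = inj₁ y∈S
    split (suc j , j<k , y∈S) = inj₂ (j , ℕ.s<s⁻¹ j<k , y∈S)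

  half : ∀ {ε} → 0# < ε → ∃ λ δ → 0# < δ × δ < ε
  half {ε} 0<ε = ε * h , 0<x*y 0<ε 0<h , <-≈-trans (≈-<-trans (sym (+-identityʳ (ε * h))) (+-monoʳ-< (ε * h) (0<x*y 0<ε 0<h)))
      (trans (sym (distribˡ ε h h)) (trans (*-congˡ h+h≈1) (*-identityʳ ε)))
    where
    2≉0 : ¬ ((1# + 1#) ≈ 0#)
    2≉0 eq = suc≉0 1 (trans (+-congˡ (+-identityʳ 1#)) eq)
    h : ℝ
    h = proj₁ (inverse (1# + 1#) 2≉0)
    h+h≈1 : h + h ≈ 1#
    h+h≈1 = trans (sym (trans (distribʳ h 1# 1#) (+-cong (*-identityˡ h) (*-identityˡ h)))) (proj₂ (inverse (1# + 1#) 2≉0))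
    0<h : 0# < h
    0<h = ≰⇒> λ h≤0 → <⇒≱ 0<1 (≤-respˡ-≈ h+h≈1 (≤-respʳ-≈ (+-identityˡ 0#) (+-mono-≤ h≤0 h≤0)))

  -- Bolzano–Weierstrass: the supremum of the a for which S ∩ [-R, a] is finite
  -- would be an accumulation point of S if it were not beyond R.
  discrete⇒finite : ∀ {S} → Discrete S → ∀ {R} → 0# ≤ R → Finite (λ y → y ∈ S × ∣ y ∣ ≤ R)
  discrete⇒finite {S} discrete {R} 0≤R = conclude (supremum T (- R , -R≤R , start) (R , λ a → proj₁))
    where
    Below : ℝ → Pred ℝ 0ℓ
    Below a y = y ∈ S × (- R) ≤ y × y ≤ a
    T : Pred ℝ 0ℓ
    T a = a ≤ R × Finite (Below a)
    -R≤R : (- R) ≤ R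
    -R≤R = ≤-trans (neg-mono-≤ 0≤R) (≤-trans (≤-reflexive -0≈0) 0≤R)
    start : Finite (Below (- R))
    start = 1 , (λ _ → - R) , λ { y (_ , -R≤y , y≤-R) → zero , antisym y≤-R -R≤y }
    conclude : (∃ λ s → UpperBound T s × (∀ b → UpperBound T b → s ≤ b)) → Finite (λ y → y ∈ S × ∣ y ∣ ≤ R)
    conclude (s , upper , least) = isolated (em {P = ∃ Isolating})
      where
      Isolating : ℝ → Set
      Isolating ε = 0# < ε × ¬ (∃ λ y → y ∈ S × ¬ (y ≈ s) × (s - ε) < y × y < (s + ε))
      isolated : Dec (∃ Isolating) → Finite (λ y → y ∈ S × ∣ y ∣ ≤ R)
      isolated (no none) = ⊥-elim (discrete s accumulates)
        where
        accumulates : AccumulationPoint S s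
        accumulates ε 0<ε with em {P = ∃ λ y → y ∈ S × ¬ (y ≈ s) × (s - ε) < y × y < (s + ε)}
        ... | yes found = found
        ... | no  empty = ⊥-elim (none (ε , 0<ε , empty))
      isolated (yes (ε , 0<ε , empty)) = reach (em {P = ∃ λ a → a ∈ T × (s - ε) < a})
        where
        reach : Dec (∃ λ a → a ∈ T × (s - ε) < a) → Finite (λ y → y ∈ S × ∣ y ∣ ≤ R)
        reach (no none) = ⊥-elim (<⇒≱ 0<ε (≤-respˡ-≈ (solve 2 (λ s ε → (:- s) :+ ε :+ s := ε) refl s ε)
          (≤-respʳ-≈ (trans (solve 2 (λ s ε → (:- s) :+ ε :+ (s :- ε) := s :- s) refl s ε) (-‿inverseʳ s))
            (+-monoʳ-≤ (- s + ε) (least (s - ε) (λ a a∈T → ≮⇒≥ (λ s-ε<a → none (a , a∈T , s-ε<a))))))))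
        reach (yes (a , (_ , finite-a) , s-ε<a)) = beyond (em {P = R < (s + ε)})
          where
          -- As `a` is above s - ε and `b` below s + ε, no point of `S` other than `s` lies between
          -- them.
          extend : ∀ b → b < (s + ε) → Finite (Below b)
          extend b b<s+ε = Finite-insert {S = Below a} {T = Below b} s finite-a λ y (y∈S , -R≤y , y≤b) → place y y∈S -R≤y y≤b (em {P = y ≤ a}) (em {P = y ≈ s})
            where
            place : ∀ y → y ∈ S → (- R) ≤ y → y ≤ b → Dec (y ≤ a) → Dec (y ≈ s) → y ∈ Below a ⊎ y ≈ s
            place y y∈S -R≤y y≤b (yes y≤a) _         = inj₁ (y∈S , -R≤y , y≤a)
            place y y∈S -R≤y y≤b (no  y≰a) (yes y≈s) = inj₂ y≈s
            place y y∈S -R≤y y≤b (no  y≰a) (no  y≉s) = ⊥-elim (empty (y , y∈S , y≉s , <-≤-trans s-ε<a (≰⇒≥ y≰a) , ≤-<-trans y≤b b<s+ε))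
          beyond : Dec (R < (s + ε)) → Finite (λ y → y ∈ S × ∣ y ∣ ≤ R)
          beyond (yes R<s+ε) = Finite-map {S = Below R} id id (extend R R<s+ε)
            λ y (y∈S , ∣y∣≤R) → y , (y∈S , ≤-respʳ-≈ (-‿involutive y) (neg-mono-≤ (≤-trans (-x≤∣x∣ y) ∣y∣≤R)) , ≤-trans (x≤∣x∣ y) ∣y∣≤R) , refl
          -- Here s + δ is still at most `R` and would belong to `T`, beyond its supremum.
          beyond (no R≮s+ε) = nudge (half 0<ε)
            where
            nudge : (∃ λ δ → 0# < δ × δ < ε) → Finite (λ y → y ∈ S × ∣ y ∣ ≤ R)
            nudge (δ , 0<δ , δ<ε) = ⊥-elim (<⇒≱ (≈-<-trans (sym (+-identityʳ s)) (+-monoʳ-< s 0<δ))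
              (upper (s + δ) (≤-trans (proj₁ (+-monoʳ-< s δ<ε)) (≮⇒≥ R≮s+ε) , extend (s + δ) (+-monoʳ-< s δ<ε))))

-- Dirichlet's pigeonhole principle for real linear forms

module Dirichlet (em : ExcludedMiddle 0ℓ) (ℛ : CompleteOrderedField) where
  open CompleteOrderedField ℛ renaming (Carrier to ℝ; ring to ℝ-ring)
  open Over ℛ using (0≤ℕ)
  open RealOrder em ℛ
  open RawSemiringDefinitions (RawRing.rawSemiring rawRing) using (sum) renaming (_×_ to _·_)
  open RingKit ℝ-ring

  cell : ∀ k {B y} → 0# ≤ B → y ≤ (suc k · 1# * B) → 0# ≤ y →
    ∃ λ (c : Fin (suc k)) → (toℕ c · 1# * B) ≤ y × y ≤ (suc (toℕ c) · 1# * B)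
  cell zero    {B} 0≤B y≤ 0≤y = zero , ≤-respˡ-≈ (sym (zeroˡ B)) 0≤y , y≤
  cell (suc k) {B} {y} 0≤B y≤ 0≤y with em {P = y ≤ (suc k · 1# * B)}
  ... | no  y≰ = Fin.fromℕ (suc k) ,
    ≡.subst (λ j → (j · 1# * B) ≤ y × y ≤ (suc j · 1# * B)) (≡.sym (Fin.toℕ-fromℕ (suc k))) (≰⇒≥ y≰ , y≤)
  ... | yes y≤′ with cell k 0≤B y≤′ 0≤y
  ...   | c , c≤y , y≤c = Fin.inject₁ c ,
    ≡.subst (λ j → (j · 1# * B) ≤ y × y ≤ (suc j · 1# * B)) (≡.sym (Fin.toℕ-inject₁ c)) (c≤y , y≤c)

  form : ∀ {n} → Vector ℝ n → Vector ℤ n → ℝ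
  form l x = sum (λ j → l j * fromInt (x j))

  form-bound : ∀ {n} (l : Vector ℝ n) (x : Vector ℤ n) {H} → (∀ j → ∣ fromInt (x j) ∣ ≤ H) →
    ∣ form l x ∣ ≤ (sum (λ j → ∣ l j ∣) * H)
  form-bound {n} l x {H} x≤H = ≤-trans (∣∣-sum n (λ j → l j * fromInt (x j)))
    (≤-respʳ-≈ (sym (*-distribʳ-∑ n H (λ j → ∣ l j ∣))) (sum-mono n λ j → ≤-respˡ-≈ (sym (∣∣-* (l j) (fromInt (x j))))
      (*-monoˡ-≤ (∣∣-nonNeg (l j)) (x≤H j))))

  form-minus : ∀ {n} (l : Vector ℝ n) (x y : Vector ℤ n) → form l (λ j → x j ℤ.- y j) ≈ form l x - form l y
  form-minus {n} l x y = trans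
    (sum-cong n (λ j → trans (*-congˡ (trans (fromInt-+ (x j) (ℤ.- y j)) (+-congˡ (fromInt-neg (y j)))))
      (solve 3 (λ l x y → l :* (x :- y) := l :* x :- l :* y) refl (l j) (fromInt (x j)) (fromInt (y j)))))
    (trans (∑-+ n (λ j → l j * fromInt (x j)) (λ j → - (l j * fromInt (y j)))) (+-congˡ (sum-neg n (λ j → l j * fromInt (y j)))))
    where
    sum-neg : ∀ n (f : Vector ℝ n) → sum (λ j → - f j) ≈ - sum f
    sum-neg zero    f = sym -0≈0
    sum-neg (suc n) f = trans (+-congˡ (sum-neg n (f ∘ suc))) (solve 2 (λ x y → (:- x) :+ (:- y) := :- (x :+ y)) refl (f zero) (sum (f ∘ suc)))

  close-in-cell : ∀ {d B y z} → y ≤ (suc d · 1# * B) → (d · 1# * B) ≤ z → (y - z) ≤ B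
  close-in-cell {d} {B} y≤ ≤z = ≤-respʳ-≈
    (trans (solve 3 (λ o d B → (o :+ d) :* B :+ (:- (d :* B)) := o :* B) refl 1# (d · 1#) B) (*-identityˡ B))
    (+-mono-≤ y≤ (neg-mono-≤ ≤z))

  shifted-difference : ∀ {k u v a w} → w ≈ u - v → k * w ≈ k * (u + a) - k * (v + a)
  shifted-difference {k} {u} {v} {a} w≈ = trans (*-congˡ w≈)
    (solve 4 (λ k u v a → k :* (u :- v) := k :* (u :+ a) :- k :* (v :+ a)) refl k u v a)

  -- Pigeonhole principle on the (H+1)ⁿ points of {0,…,H}ⁿ; the range of the i-th
  -- form is cut into kᵢ = 1 + cᵢ intervals of equal length.
  module Boxes {n} (l : Fin n → Vector ℝ n) {A} (0≤A : 0# ≤ A) (l≤A : ∀ i → sum (λ j → ∣ l i j ∣) ≤ A) (H : ℕ) (c : Fin n → ℕ) where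

    AH : ℝ
    AH = A * H · 1#

    0≤AH : 0# ≤ AH
    0≤AH = *-nonNeg 0≤A (0≤ℕ H)

    point : (Fin n → Fin (suc H)) → Vector ℤ n
    point a j = + toℕ (a j)

    value≤ : ∀ a i → ∣ form (l i) (point a) ∣ ≤ AH
    value≤ a i = ≤-trans (form-bound (l i) (point a) {H · 1#} (λ j → ≤-respˡ-≈ (sym (∣∣-of-nonNeg (0≤ℕ (toℕ (a j)))))
        (·-mono (ℕ.s≤s⁻¹ (Fin.toℕ<n (a j))))))
      (*-monoʳ-≤ (0≤ℕ H) (l≤A i))

    -- Adding `AH` makes the value nonnegative, and multiplying by the number of cells gives all
    -- cells the length `AH + AH`, so that nothing has to be divided.
    shifted : (Fin n → Fin (suc H)) → Fin n → ℝ
    shifted a i = suc (c i) · 1# * (form (l i) (point a) + AH)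

    located : ∀ a i → ∃ λ (d : Fin (suc (c i))) →
      (toℕ d · 1# * (AH + AH)) ≤ shifted a i × shifted a i ≤ (suc (toℕ d) · 1# * (AH + AH))
    located a i = cell (c i) (+-nonNeg 0≤AH 0≤AH)
      (*-monoˡ-≤ (0≤ℕ (suc (c i))) (+-mono-≤ (≤-trans (x≤∣x∣ (form (l i) (point a))) (value≤ a i)) ≤-refl))
      (*-nonNeg (0≤ℕ (suc (c i))) (≤-respˡ-≈ (-‿inverseʳ (form (l i) (point a)))
        (+-monoʳ-≤ (form (l i) (point a)) (≤-trans (-x≤∣x∣ (form (l i) (point a))) (value≤ a i)))))

    box : ∀ a i → Fin (suc (c i))
    box a i = proj₁ (located a i)

    same-box : ∀ a b i → box a i ≡ box b i → (shifted a i - shifted b i) ≤ (AH + AH)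
    same-box a b i same = close-in-cell {toℕ (box a i)} (proj₂ (proj₂ (located a i)))
      (≡.subst (λ d → (toℕ d · 1# * (AH + AH)) ≤ shifted b i) (≡.sym same) (proj₁ (proj₂ (located b i))))

    difference : ∀ a b → (∀ i → box a i ≡ box b i) →
      ∀ i → (suc (c i) · 1# * ∣ form (l i) (λ j → point a j ℤ.- point b j) ∣) ≤ (AH + AH)
    difference a b same i = ≤-respˡ-≈ (trans (∣∣-* (suc (c i) · 1#) _) (*-congʳ (∣∣-of-nonNeg (0≤ℕ (suc (c i))))))
      (∣∣-least (≤-respˡ-≈ (sym forward) (same-box a b i (same i))) (≤-respˡ-≈ (sym backward) (same-box b a i (≡.sym (same i)))))
      where
      forward : suc (c i) · 1# * form (l i) (λ j → point a j ℤ.- point b j) ≈ shifted a i - shifted b i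
      forward = shifted-difference {suc (c i) · 1#} {form (l i) (point a)} {form (l i) (point b)} {AH} (form-minus (l i) (point a) (point b))
      backward : - (suc (c i) · 1# * form (l i) (λ j → point a j ℤ.- point b j)) ≈ shifted b i - shifted a i
      backward = trans (-‿cong forward) (solve 2 (λ u v → :- (u :- v) := v :- u) refl (shifted a i) (shifted b i))

    dirichlet : ∏ (λ i → suc (c i)) ℕ.< suc H ℕ.^ n →
      ∃ λ (x : Vector ℤ n) → (∃ λ r → x r ≢ 0ℤ) × (∀ i → (suc (c i) · 1# * ∣ form (l i) x ∣) ≤ (AH + AH))
    dirichlet few = collide (Fin.pigeonhole few (λ p → encode (box (digits p))))
      where
      digits : Fin (suc H ℕ.^ n) → Fin n → Fin (suc H)
      digits = Fin.finToFun {suc H} {n}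
      collide : (∃₂ λ p q → toℕ p ℕ.< toℕ q × encode (box (digits p)) ≡ encode (box (digits q))) →
        ∃ λ (x : Vector ℤ n) → (∃ λ r → x r ≢ 0ℤ) × (∀ i → (suc (c i) · 1# * ∣ form (l i) x ∣) ≤ (AH + AH))
      collide (p , q , p<q , eq) = (λ j → point (digits p) j ℤ.- point (digits q) j) ,
        Fin.¬∀⟶∃¬ n _ (λ j → (point (digits p) j ℤ.- point (digits q) j) ℤ.≟ 0ℤ)
          (λ x≡0 → ℕ.<-irrefl (≡.cong toℕ (finToFun-injective {suc H} {n} p q
            (λ j → Fin.toℕ-injective (ℤ.+-injective (ℤ.i-j≡0⇒i≡j (point (digits p) j) (point (digits q) j) (x≡0 j)))))) p<q) ,
        difference (digits p) (digits q) (encode-injective (box (digits p)) (box (digits q)) eq)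

-- Simultaneous approximation along a line

select : ∀ {a p} {A : Set a} {P : Set p} → Dec P → A → A → A
select (yes _) x y = x
select (no  _) x y = y

select-yes : ∀ {a p} {A : Set a} {P : Set p} (d : Dec P) {x y : A} → P → select d x y ≡ x
select-yes (yes _)  _ = ≡.refl
select-yes (no  ¬p) p = ⊥-elim (¬p p)

select-no : ∀ {a p} {A : Set a} {P : Set p} (d : Dec P) {x y : A} → ¬ P → select d x y ≡ y
select-no (yes p) ¬p = ⊥-elim (¬p p)
select-no (no  _) _  = ≡.refl

∏-* : ∀ {n} (a b : Fin n → ℕ) → ∏ (λ i → a i ℕ.* b i) ≡ ∏ a ℕ.* ∏ b
∏-* {zero}  a b = ≡.refl
∏-* {suc n} a b = ≡.trans (≡.cong (a zero ℕ.* b zero ℕ.*_) (∏-* (a ∘ suc) (b ∘ suc)))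
  (ℕ.[m*n]*[o*p]≡[m*o]*[n*p] (a zero) (b zero) (∏ (a ∘ suc)) (∏ (b ∘ suc)))

ℕ^-distrib-* : ∀ a b k → (a ℕ.* b) ℕ.^ k ≡ a ℕ.^ k ℕ.* b ℕ.^ k
ℕ^-distrib-* a b zero    = ≡.refl
ℕ^-distrib-* a b (suc k) = ≡.trans (≡.cong (a ℕ.* b ℕ.*_) (ℕ^-distrib-* a b k)) (ℕ.[m*n]*[o*p]≡[m*o]*[n*p] a b (a ℕ.^ k) (b ℕ.^ k))

∏-^ : ∀ {n} (a : Fin n → ℕ) k → ∏ (λ i → a i ℕ.^ k) ≡ ∏ a ℕ.^ k
∏-^ {zero}  a k = ≡.sym (ℕ.^-zeroˡ k)
∏-^ {suc n} a k = ≡.trans (≡.cong (a zero ℕ.^ k ℕ.*_) (∏-^ (a ∘ suc) k)) (≡.sym (ℕ^-distrib-* (a zero) (∏ (a ∘ suc)) k))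

∏-cong : ∀ {n} {a b : Fin n → ℕ} → (∀ i → a i ≡ b i) → ∏ a ≡ ∏ b
∏-cong {zero}  a≗b = ≡.refl
∏-cong {suc n} a≗b = ≡.cong₂ ℕ._*_ (a≗b zero) (∏-cong (a≗b ∘ suc))

∏-select : ∀ {N} (p : Fin (suc N)) T → ∏ (λ i → select (i Fin.≟ p) 1 T) ≡ T ℕ.^ N
∏-select {N} zero T = ≡.trans (ℕ.*-identityˡ _) (∏-const N)
  where
  ∏-const : ∀ N → ∏ {N} (λ i → T) ≡ T ℕ.^ N
  ∏-const zero    = ≡.refl
  ∏-const (suc N) = ≡.cong (T ℕ.*_) (∏-const N)
∏-select {suc N} (suc p) T = ≡.cong (T ℕ.*_) (≡.trans (∏-cong (λ i → select-suc (i Fin.≟ p))) (∏-select p T))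
  where
  select-suc : ∀ {i} (d : Dec (i ≡ p)) → select (Relation.Nullary.map′ (≡.cong suc) Fin.suc-injective d) 1 T ≡ select d 1 T
  select-suc (yes _) = ≡.refl
  select-suc (no  _) = ≡.refl

-- The vector ω spans the line along which the integral points in question are sought:
-- the coordinate x_p is contracted by T^(n-1), the deviations x_r - ω_r x_p from
-- the line are expanded by T.
module Approximation (em : ExcludedMiddle 0ℓ) (ℛ : CompleteOrderedField) {N : ℕ}
    (ω : Vector (CompleteOrderedField.Carrier ℛ) (suc N)) (p : Fin (suc N)) where
  open CompleteOrderedField ℛ renaming (Carrier to ℝ; ring to ℝ-ring)
  open Over ℛ using (suc≉0; 0≤ℕ)
  open RealOrder em ℛ
  open Dirichlet em ℛ
  open RawSemiringDefinitions (RawRing.rawSemiring rawRing) using (sum; _^_) renaming (_×_ to _·_)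
  open RingKit ℝ-ring
  open Matrices ℝ-ring using (1ᴹ)
  open SemiringExp semiring using (^-congˡ)

  n : ℕ
  n = suc N

  T# : ℕ → ℝ
  T# t = suc t · 1#

  τ : ℕ → ℝ
  τ t = proj₁ (inverse (T# t) (suc≉0 t))

  T*τ≈1 : ∀ t → T# t * τ t ≈ 1#
  T*τ≈1 t = proj₂ (inverse (T# t) (suc≉0 t))

  0<τ : ∀ t → 0# < τ t
  0<τ t = ≰⇒> λ τ≤0 → <⇒≱ 0<1 (≤-respˡ-≈ (T*τ≈1 t) (≤-respʳ-≈ (zeroʳ (T# t)) (*-monoˡ-≤ (0≤ℕ (suc t)) τ≤0)))

  power-* : ∀ x y k → (x * y) ^ k ≈ x ^ k * y ^ k
  power-* x y zero    = sym (*-identityˡ 1#)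
  power-* x y (suc k) = trans (*-congˡ (power-* x y k)) (solve 4 (λ x y a b → x :* y :* (a :* b) := x :* a :* (y :* b)) refl x y (x ^ k) (y ^ k))

  power-one : ∀ k → 1# ^ k ≈ 1#
  power-one zero    = refl
  power-one (suc k) = trans (*-identityˡ _) (power-one k)

  T^*τ^≈1 : ∀ t k → T# t ^ k * τ t ^ k ≈ 1#
  T^*τ^≈1 t k = trans (sym (power-* (T# t) (τ t) k)) (trans (^-congˡ k (T*τ≈1 t)) (power-one k))

  ·1-^ : ∀ a k → (a ℕ.^ k) · 1# ≈ (a · 1#) ^ k
  ·1-^ a zero    = +-identityʳ 1#
  ·1-^ a (suc k) = trans (SemiringMult.×1-homo-* semiring a (a ℕ.^ k)) (*-congˡ (·1-^ a k))

  coord : Fin n → Vector ℝ n → ℝ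
  coord r x = select (r Fin.≟ p) (x p) (x r - ω r * x p)

  scale : ℕ → Fin n → ℝ
  scale t r = select (r Fin.≟ p) (τ t ^ N) (T# t)

  0≤scale : ∀ t r → 0# ≤ scale t r
  0≤scale t r = cases (r Fin.≟ p)
    where
    cases : ∀ (d : Dec (r ≡ p)) → 0# ≤ select d (τ t ^ N) (T# t)
    cases (yes _) = power-nonNeg N (proj₁ (0<τ t))
    cases (no  _) = 0≤ℕ (suc t)

  row : Fin n → Vector ℝ n
  row r s = select (r Fin.≟ p) (1ᴹ p s) (1ᴹ r s - ω r * 1ᴹ p s)

  form-row : ∀ r (x : Vector ℤ n) → form (row r) x ≈ coord r (fromInt ∘ x)
  form-row r x = cases (r Fin.≟ p)
    where
    cases : ∀ (d : Dec (r ≡ p)) → sum (λ s → select d (1ᴹ p s) (1ᴹ r s - ω r * 1ᴹ p s) * fromInt (x s)) ≈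
      select d (fromInt (x p)) (fromInt (x r) - ω r * fromInt (x p))
    cases (yes _) = sum-1ᴹˡ p (fromInt ∘ x)
    cases (no  _) = trans (FieldKit.sum-eliminate ℝ-ring isField _≈?_ n (ω r) (1ᴹ r) (1ᴹ p) (fromInt ∘ x))
      (+-cong (sum-1ᴹˡ r (fromInt ∘ x)) (-‿cong (*-congˡ (sum-1ᴹˡ p (fromInt ∘ x)))))

  u : ℕ → Fin n → Vector ℤ n → ℝ
  u t r x = scale t r * coord r (fromInt ∘ x)

  -- A common bound for the row sums of the coordinate forms; it involves `ω` and `p` but not `t`,
  -- as uniformity in `t` requires.
  A : ℝ
  A = sum (λ r → sum (λ s → ∣ row r s ∣))

  private
    0≤rowsum : ∀ r → 0# ≤ sum (λ s → ∣ row r s ∣)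
    0≤rowsum r = ≤-trans (∣∣-nonNeg (row r zero)) (term≤sum {f = λ s → ∣ row r s ∣} (λ s → ∣∣-nonNeg (row r s)) zero)

  row≤A : ∀ r → sum (λ s → ∣ row r s ∣) ≤ A
  row≤A r = term≤sum {f = λ r → sum (λ s → ∣ row r s ∣)} 0≤rowsum r

  0≤A : 0# ≤ A
  0≤A = ≤-trans (0≤rowsum zero) (row≤A zero)

  module _ (t d : ℕ) (j : Fin n) where

    private
      D# : ℝ
      D# = suc d · 1#

      -- The factor `Dᵢ` refines the cells in all directions except `j`, which makes the resulting
      -- box long in direction `j`. With the exponent `n` the product of the `K i` is the `n`-th
      -- power of the integer `H`, so no roots occur, and it is just below the number of points.
      Tᵢ Dᵢ K : Fin n → ℕ
      Tᵢ i = select (i Fin.≟ p) 1 (suc t)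
      Dᵢ i = select (i Fin.≟ j) 1 (suc d)
      K i = (Tᵢ i ℕ.* Dᵢ i) ℕ.^ n

      H : ℕ
      H = (suc t ℕ.* suc d) ℕ.^ N

      select-positive : ∀ {P : Set} (dec : Dec P) a → 0 ℕ.< select dec 1 (suc a)
      select-positive (yes _) a = ℕ.z<s
      select-positive (no  _) a = ℕ.z<s

      K-positive : ∀ i → suc (ℕ.pred (K i)) ≡ K i
      K-positive i = ℕ.suc-pred (K i) {{ℕ.>-nonZero (ℕ.m^n>0 (Tᵢ i ℕ.* Dᵢ i)
        {{ℕ.>-nonZero (ℕ.*-mono-< (select-positive (i Fin.≟ p) t) (select-positive (i Fin.≟ j) d))}} n)}}

      few : ∏ (λ i → suc (ℕ.pred (K i))) ℕ.< suc H ℕ.^ n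
      few = ≡.subst (ℕ._< suc H ℕ.^ n) (≡.sym (begin
        ∏ (λ i → suc (ℕ.pred (K i)))     ≡⟨ ∏-cong K-positive ⟩
        ∏ K                              ≡⟨ ∏-^ (λ i → Tᵢ i ℕ.* Dᵢ i) n ⟩
        ∏ (λ i → Tᵢ i ℕ.* Dᵢ i) ℕ.^ n    ≡⟨ ≡.cong (ℕ._^ n) (≡.trans (∏-* Tᵢ Dᵢ) (≡.cong₂ ℕ._*_ (∏-select p (suc t)) (∏-select j (suc d)))) ⟩
        (suc t ℕ.^ N ℕ.* suc d ℕ.^ N) ℕ.^ n ≡⟨ ≡.cong (ℕ._^ n) (ℕ^-distrib-* (suc t) (suc d) N) ⟨
        H ℕ.^ n                          ∎)) (ℕ.^-monoˡ-< n (ℕ.n<1+n H))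
        where open ≡.≡-Reasoning

      -- For i = p the weight τᴺ is already the scale. Otherwise `K i` contains Tⁿ with n = N + 1,
      -- and τᴺ Tⁿ = T.
      scale-K : ∀ i → τ t ^ N * (K i · 1#) ≈ scale t i * (Dᵢ i · 1#) ^ n
      scale-K i = trans (*-congˡ (trans (·1-^ (Tᵢ i ℕ.* Dᵢ i) n) (trans (^-congˡ n (SemiringMult.×1-homo-* semiring (Tᵢ i) (Dᵢ i)))
          (power-* (Tᵢ i · 1#) (Dᵢ i · 1#) n))))
        (trans (sym (*-assoc _ _ _)) (*-congʳ (cases (i Fin.≟ p))))
        where
        cases : ∀ (dec : Dec (i ≡ p)) → τ t ^ N * (select dec 1 (suc t) · 1#) ^ n ≈ select dec (τ t ^ N) (T# t)
        cases (yes _) = trans (*-congˡ (trans (^-congˡ n (+-identityʳ 1#)) (power-one n))) (*-identityʳ _)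
        cases (no  _) = trans (solve 3 (λ a b c → a :* (b :* c) := b :* (c :* a)) refl (τ t ^ N) (T# t) (T# t ^ N))
          (trans (*-congˡ (T^*τ^≈1 t N)) (*-identityʳ _))

      vector : ∃ λ (x : Vector ℤ n) → (∃ λ r → x r ≢ 0ℤ) ×
        (∀ i → (suc (ℕ.pred (K i)) · 1# * ∣ form (row i) x ∣) ≤ (A * H · 1# + A * H · 1#))
      vector = Boxes.dirichlet row {A} 0≤A row≤A H (ℕ.pred ∘ K) few

    y : Vector ℤ n
    y = proj₁ vector

    y≢0 : ∃ λ r → y r ≢ 0ℤ
    y≢0 = proj₁ (proj₂ vector)

    private
      -- Multiplying the inequality of the pigeonhole principle by τᴺ cancels the power of T in `H`,
      -- so that the bound depends on `d` but not on `t`.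
      u-bound : ∀ i → ((Dᵢ i · 1#) ^ n * ∣ u t i y ∣) ≤ ((A + A) * D# ^ N)
      u-bound i = ≤-respˡ-≈ left (≤-respʳ-≈ right (*-monoˡ-≤ (power-nonNeg N (proj₁ (0<τ t))) (proj₂ (proj₂ vector) i)))
        where
        f = form (row i) y
        left : τ t ^ N * (suc (ℕ.pred (K i)) · 1# * ∣ f ∣) ≈ (Dᵢ i · 1#) ^ n * ∣ u t i y ∣
        left = trans (sym (*-assoc _ _ _)) (trans (*-congʳ (trans (*-congˡ (reflexive (≡.cong (_· 1#) (K-positive i)))) (scale-K i)))
          (trans (solve 3 (λ s k m → s :* k :* m := k :* (s :* m)) refl (scale t i) ((Dᵢ i · 1#) ^ n) (∣ f ∣))
            (*-congˡ (sym (trans (∣∣-* (scale t i) (coord i (fromInt ∘ y)))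
              (*-cong (∣∣-of-nonNeg (0≤scale t i)) (∣∣-cong (sym (form-row i y)))))))))
        right : τ t ^ N * (A * H · 1# + A * H · 1#) ≈ (A + A) * D# ^ N
        right = trans (*-congˡ (+-cong H≈ H≈))
          (trans (solve 4 (λ s a h k → s :* (a :* (h :* k) :+ a :* (h :* k)) := (h :* s) :* ((a :+ a) :* k)) refl (τ t ^ N) A (T# t ^ N) (D# ^ N))
            (trans (*-congʳ (T^*τ^≈1 t N)) (*-identityˡ _)))
          where
          H≈ : A * H · 1# ≈ A * (T# t ^ N * D# ^ N)
          H≈ = *-congˡ (trans (·1-^ (suc t ℕ.* suc d) N) (trans (^-congˡ N (SemiringMult.×1-homo-* semiring (suc t) (suc d))) (power-* (T# t) D# N)))

    y-off : ∀ i → i ≢ j → (D# * ∣ u t i y ∣) ≤ (A + A)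
    y-off i i≢j = *-cancelˡ-≤ (power-positive N (0<suc d))
      (≤-respˡ-≈ (trans (*-congʳ (^-congˡ n (reflexive (≡.cong (_· 1#) (off (i Fin.≟ j))))))
          (solve 3 (λ d k m → d :* k :* m := k :* (d :* m)) refl D# (D# ^ N) (∣ u t i y ∣)))
        (≤-respʳ-≈ (*-comm _ _) (u-bound i)))
      where
      off : ∀ (dec : Dec (i ≡ j)) → select dec 1 (suc d) ≡ suc d
      off (yes i≡j) = ⊥-elim (i≢j i≡j)
      off (no  _)   = ≡.refl

    y-at : ∣ u t j y ∣ ≤ ((A + A) * D# ^ N)
    y-at = ≤-respˡ-≈ (trans (*-congʳ (trans (^-congˡ n (trans (reflexive (≡.cong (_· 1#) (at (j Fin.≟ j)))) (+-identityʳ 1#))) (power-one n)))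
      (*-identityˡ _)) (u-bound j)
      where
      at : ∀ (dec : Dec (j ≡ j)) → select dec 1 (suc d) ≡ 1
      at (yes _)  = ≡.refl
      at (no neq) = ⊥-elim (neq ≡.refl)

-- Lattices carrying the same form

module RingIdentities {c ℓ : Level} (R : CommutativeRing c ℓ) where
  open CommutativeRing R hiding (zero)
  open RingKit R using (solve; _:=_; con; _:+_; _:*_; _:-_; :-_)

  *-interchange : ∀ a b c d → (a * b) * (c * d) ≈ (a * c) * (b * d)
  *-interchange = solve 4 (λ a b c d → (a :* b) :* (c :* d) := (a :* c) :* (b :* d)) refl

  *-swap : ∀ a b c → a * (b * c) ≈ b * (a * c)
  *-swap = solve 3 (λ a b c → a :* (b :* c) := b :* (a :* c)) refl

  *-regroup : ∀ y x i c → y * ((x * i) * c) ≈ (y * i) * (x * c)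
  *-regroup = solve 4 (λ y x i c → y :* ((x :* i) :* c) := (y :* i) :* (x :* c)) refl

  neg-*ˡ : ∀ a b → - (a * b) ≈ - a * b
  neg-*ˡ = solve 2 (λ a b → :- (a :* b) := (:- a) :* b) refl

  opposite-sum : ∀ a b → a * b + - a * b ≈ 0#
  opposite-sum = solve 2 (λ a b → a :* b :+ (:- a) :* b := con 0ℤ) refl

  -- The common multiplier cancels from the two cross products, so that only the weights are
  -- compared.
  cross-multiplied : ∀ {v x t x′ t′ w₁ w₂ w₃ w₄ a₀ a b₀ b e e₀ : Carrier} → w₁ ≈ x → w₂ ≈ t → w₃ ≈ x′ → w₄ ≈ t′ →
    b₀ ≈ e₀ * a₀ → b ≈ e * a → e ≈ e₀ → v * (x * t) ≈ x′ * t′ →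
    v * ((w₁ * b₀) * (w₂ * a)) ≈ (w₃ * a₀) * (w₄ * b)
  cross-multiplied {v} {x} {t} {x′} {t′} {a₀ = a₀} {a = a} {e = e} {e₀ = e₀} w₁≈x w₂≈t w₃≈x′ w₄≈t′ b₀≈ b≈ e≈e₀ weights =
    trans (*-congˡ (*-cong (*-cong w₁≈x b₀≈) (*-congʳ w₂≈t)))
      (trans (solve 6 (λ v x e a t b → v :* ((x :* (e :* a)) :* (t :* b)) := (v :* (x :* t)) :* (e :* (a :* b))) refl
          v x e₀ a₀ t a)
        (trans (*-cong weights (*-congʳ (sym e≈e₀)))
          (trans (solve 5 (λ x t e a b → (x :* t) :* (e :* (a :* b)) := (x :* a) :* (t :* (e :* b))) refl x′ t′ e a₀ a)
            (sym (*-cong (*-congʳ w₃≈x′) (*-cong w₄≈t′ b≈))))))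

  private
    module RK = RingKit R
  open RawSemiringDefinitions (RawRing.rawSemiring rawRing) using (sum)

  sum-splitAt : ∀ m {k} (f : Vector Carrier m) (g : Vector Carrier k) →
    sum (λ j → [ f , g ]′ (Fin.splitAt m j)) ≈ sum f + sum g
  sum-splitAt zero        f g = sym (+-identityˡ _)
  sum-splitAt (suc m) {k} f g = trans (+-congˡ (trans (RK.sum-cong (m ℕ.+ k) (λ j → reflexive (shift (Fin.splitAt m j)))) (sum-splitAt m (f ∘ suc) g)))
    (sym (+-assoc _ _ _))
    where
    shift : ∀ (s : Fin m ⊎ Fin k) → [ f , g ]′ (Sum.map₁ suc s) ≡ [ f ∘ suc , g ]′ s
    shift (inj₁ _) = ≡.refl
    shift (inj₂ _) = ≡.refl

  sum-blocks : ∀ m {k} (f x : Vector Carrier m) (g y : Vector Carrier k) →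
    sum (λ j → [ f , g ]′ (Fin.splitAt m j) * [ x , y ]′ (Fin.splitAt m j)) ≈ sum (λ j → f j * x j) + sum (λ j → g j * y j)
  sum-blocks m {k} f x g y = trans (RK.sum-cong (m ℕ.+ k) (λ j → reflexive (blocks (Fin.splitAt m j)))) (sum-splitAt m (λ j → f j * x j) (λ j → g j * y j))
    where
    blocks : ∀ (s : Fin m ⊎ Fin k) → [ f , g ]′ s * [ x , y ]′ s ≡ [ (λ j → f j * x j) , (λ j → g j * y j) ]′ s
    blocks (inj₁ _) = ≡.refl
    blocks (inj₂ _) = ≡.refl

module IntegralPoints (em : ExcludedMiddle 0ℓ) (ℛ : CompleteOrderedField) where
  open CompleteOrderedField ℛ renaming (Carrier to ℝ; ring to ℝ-ring)
  open Over ℛ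
  open RealOrder em ℛ
  open ComplexNumbers em ℛ
  private
    module ℂ = CommutativeRing ℂ-ring
    module ℂ^ = RawSemiringDefinitions (RawRing.rawSemiring ℂ.rawRing)
    module CK = RingKit ℂ-ring
    module CI = RingIdentities ℂ-ring
    module CF = FieldKit ℂ-ring ℂ-isField _≈ᶜ?_
    sumℤ : ∀ {m} → Vector ℤ m → ℤ
    sumℤ = RawSemiringDefinitions.sum (RawRing.rawSemiring (CommutativeRing.rawRing ℤ-ring))
  open RawSemiringDefinitions (RawRing.rawSemiring rawRing) using (sum) renaming (_×_ to _·_)
  open RingKit ℝ-ring using (fromInt; fromInt-+; fromInt-*; sum-cong)
  open PolynomialIdentities ℂ-ring ℂ-isField _≈ᶜ?_
  open CharacteristicZero ℂ-char0 using (pair; pair-line; Extensional; LinesDegreeBelow; grid-vanishing; proportional-factor)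

  ⟦_⟧ : ∀ {n} → Vector ℤ n → Vector ℂ n
  ⟦ x ⟧ r = fromℝ (fromInt (x r))

  fromInt-sum : ∀ m (f : Vector ℤ m) → fromInt (sumℤ f) ≈ sum (fromInt ∘ f)
  fromInt-sum zero    f = refl
  fromInt-sum (suc m) f = trans (fromInt-+ (f zero) (sumℤ (f ∘ suc))) (+-congˡ (fromInt-sum m (f ∘ suc)))

  gridPoint : ∀ {n d} → (Fin n → Vector ℤ n) → (Fin n → Fin d) → Vector ℤ n
  gridPoint Y x r = sumℤ (λ j → Y j r ℤ.* + toℕ (x j))

  gridPoint-real : ∀ {n d} (Y : Fin n → Vector ℤ n) (x : Fin n → Fin d) r →
    fromInt (gridPoint Y x r) ≈ sum (λ j → fromInt (Y j r) * toℕ (x j) · 1#)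
  gridPoint-real {n} Y x r = trans (fromInt-sum n (λ j → Y j r ℤ.* + toℕ (x j))) (sum-cong n (λ j → fromInt-* (Y j r) (+ toℕ (x j))))

  pair-cong : ∀ {n} (a : Vector ℂ n) {x y : Vector ℂ n} → (∀ r → x r ℂ.≈ y r) → pair a x ℂ.≈ pair a y
  pair-cong {n} a x≈y = CK.sum-cong n (λ r → ℂ.*-congˡ (x≈y r))

  product-pair-cong : ∀ {n} (a : Fin n → Vector ℂ n) {x y : Vector ℂ n} → (∀ r → x r ℂ.≈ y r) →
    ℂ^.product (λ i → pair (a i) x) ℂ.≈ ℂ^.product (λ i → pair (a i) y)
  product-pair-cong {n} a x≈y = CK.product-cong n (λ i → pair-cong (a i) x≈y)

  independent⇒spanning : ∀ {n} {l : Fin n → Vector ℂ n} → LinearlyIndependent l →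
    ∀ (t : Vector ℂ n) → ∃ λ (c : Vector ℂ n) → ∀ r → ℂ^.sum (λ i → l i r ℂ.* c i) ℂ.≈ t r
  independent⇒spanning {n} {l} independent = CF.injective⇒surjective (λ r i → l i r)
    (λ c eq → independent c (λ r → ℂ.trans (CK.sum-cong n (λ i → ℂ.*-comm (c i) (l i r))) (eq r)))

  column : ∀ {n} → (Fin n → Vector ℂ n) → (Fin n → Vector ℤ n) → Fin n → Vector ℂ n
  column l Y i j = pair (l i) ⟦ Y j ⟧

  abstract
    formValue : ∀ {n} → Vector ℂ n → Vector ℤ n → ℂ
    formValue a x = pair a ⟦ x ⟧

    formValue≈ : ∀ {n} (a : Vector ℂ n) x → formValue a x ℂ.≈ pair a ⟦ x ⟧
    formValue≈ a x = ℂ.refl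

    productValue : ∀ {n} → (Fin n → Vector ℂ n) → Vector ℤ n → ℂ
    productValue l x = ℂ^.product (λ i → pair (l i) ⟦ x ⟧)

    productValue≈ : ∀ {n} (l : Fin n → Vector ℂ n) x → productValue l x ℂ.≈ ℂ^.product (λ i → pair (l i) ⟦ x ⟧)
    productValue≈ l x = ℂ.refl

  on-grid : ∀ {n d} (l : Fin n → Vector ℂ n) (Y : Fin n → Vector ℤ n) (x : Fin n → Fin d) i →
    pair (column l Y i) (λ j → toℕ (x j) ℂ^.× ℂ.1#) ℂ.≈ pair (l i) ⟦ gridPoint Y x ⟧
  on-grid {n} l Y x i = ℂ.trans (ℂ.sym (CK.sum-*-sum (l i) (λ r j → ⟦ Y j ⟧ r) (λ j → toℕ (x j) ℂ^.× ℂ.1#)))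
    (pair-cong (l i) (λ r → ℂ.trans (CK.sum-cong n (λ j → ℂ.trans
        (ℂ.*-congˡ (ℂ.sym (RingHomKit.φ-fromInt ℝ-ring ℂ-ring fromℝ fromℝ-homo (+ toℕ (x j)))))
        (ℂ.sym (fromℝ-* (fromInt (Y j r)) (toℕ (x j) · 1#)))))
      (ℂ.trans (ℂ.sym (RingHomKit.φ-sum ℝ-ring ℂ-ring fromℝ fromℝ-homo n (λ j → fromInt (Y j r) * toℕ (x j) · 1#)))
        (sym (gridPoint-real Y x r) , refl))))

  module _ {n} (a b : Fin n → Vector ℂ n) where

    private
      products : (Fin n → Vector ℂ n) → Vector ℂ n → ℂ
      products a c = ℂ^.product (λ i → pair (a i) c)

      gap : Vector ℂ n → ℂ
      gap c = ℂ.1# ℂ.* products a c ℂ.+ ℂ.- ℂ.1# ℂ.* products b c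

      gap-extensional : Extensional gap
      gap-extensional x≈y = ℂ.+-cong (ℂ.*-congˡ (product-pair-cong a x≈y)) (ℂ.*-congˡ (product-pair-cong b x≈y))

      gap-zero : ∀ {z w} → z ℂ.≈ w → ℂ.1# ℂ.* z ℂ.+ ℂ.- ℂ.1# ℂ.* w ℂ.≈ ℂ.0#
      gap-zero {z} {w} z≈w = ℂ.trans (ℂ.+-congʳ (ℂ.*-congˡ z≈w))
        (CI.opposite-sum ℂ.1# w)

      products-line : ∀ (a : Fin n → Vector ℂ n) (x y : Vector ℂ n) → DegreeBelow (suc n) (λ s → products a (λ i → x i ℂ.+ s ℂ.* y i))
      products-line a x y = proj₁ poly , λ s → ℂ.trans (CK.product-cong n (λ i → pair-line (a i) x y s)) (proj₂ poly s)
        where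
        poly : DegreeBelow (suc n) (λ s → ℂ^.product (λ i → pair (a i) x ℂ.+ s ℂ.* pair (a i) y))
        poly = degree-product n (λ i → pair (a i) x) (λ i → pair (a i) y)

      gap-lines : LinesDegreeBelow (suc n) gap
      gap-lines x y = degree-combine {g = λ s → products a (λ i → x i ℂ.+ s ℂ.* y i)} {h = λ s → products b (λ i → x i ℂ.+ s ℂ.* y i)}
        ℂ.1# (ℂ.- ℂ.1#) (products-line a x y) (products-line b x y)

    -- A difference of two products of `n` linear forms has degree at most `n` on every line, hence
    -- n + 1 grid values in each coordinate decide.
    agree-on-grid⇒agree :
      (∀ (x : Fin n → Fin (suc n)) → products a (λ j → toℕ (x j) ℂ^.× ℂ.1#) ℂ.≈ products b (λ j → toℕ (x j) ℂ^.× ℂ.1#)) →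
      ∀ c → products a c ℂ.≈ products b c
    agree-on-grid⇒agree grid c = CF.minus≈0 (ℂ.trans
      (ℂ.+-cong (ℂ.sym (ℂ.*-identityˡ (products a c))) (ℂ.trans (ℂ.-‿cong (ℂ.sym (ℂ.*-identityˡ (products b c))))
        (CI.neg-*ˡ ℂ.1# (products b c))))
      (grid-vanishing (suc n) gap gap-extensional gap-lines (λ x → gap-zero (grid x)) c))

  -- Bases on which the form takes the same values at the grid points give the same form in
  -- coordinates, hence the same linear factors up to order and scalars.  The pigeonhole
  -- principle is applied to the pattern of values together with the order of the factors.
  module Recurrence {n M : ℕ} (l : Fin n → Vector ℂ n) (Y : ℕ → Fin n → Vector ℤ n) (g : Vector ℤ n → ℝ)
    (F≈g : ∀ x → ℂ^.product (λ i → pair (l i) ⟦ x ⟧) ℂ.≈ fromℝ (g x))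
    (values : Fin M → ℝ) (listed : ∀ s (x : Fin n → Fin (suc n)) → ∃ λ i → g (gridPoint (Y s) x) ≈ values i)
    (j₀ : Fin n) (nonzero : ∀ s i → ¬ (column l (Y s) i j₀ ℂ.≈ ℂ.0#)) where

    private
      digits : Fin (suc n ℕ.^ n) → Fin n → Fin (suc n)
      digits = Fin.finToFun {suc n} {n}

      index : ℕ → Fin (suc n ℕ.^ n) → Fin M
      index s k = proj₁ (listed s (digits k))

      Shape : Set
      Shape = Fin (∏ {suc n ℕ.^ n} (λ _ → M))

      shape : ℕ → Shape
      shape s = encode (index s)

      products : ℕ → Vector ℂ n → ℂ
      products s c = ℂ^.product (λ i → pair (column l (Y s) i) c)

      module _ (s s′ : ℕ) (same : shape s ≡ shape s′) where

        same-g : ∀ k → g (gridPoint (Y s) (digits k)) ≈ g (gridPoint (Y s′) (digits k))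
        same-g k = trans (proj₂ (listed s (digits k)))
          (trans (reflexive (≡.cong values (encode-injective (index s) (index s′) same k))) (sym (proj₂ (listed s′ (digits k)))))

        same-on-digits : ∀ k → products s (λ j → toℕ (digits k j) ℂ^.× ℂ.1#) ℂ.≈ products s′ (λ j → toℕ (digits k j) ℂ^.× ℂ.1#)
        same-on-digits k = ℂ.trans (to-g s) (ℂ.trans (same-g k , refl) (ℂ.sym (to-g s′)))
          where
          to-g : ∀ s → products s (λ j → toℕ (digits k j) ℂ^.× ℂ.1#) ℂ.≈ fromℝ (g (gridPoint (Y s) (digits k)))
          to-g s = ℂ.trans (CK.product-cong n (on-grid l (Y s) (digits k))) (F≈g (gridPoint (Y s) (digits k)))

        same-on-grid : ∀ (x : Fin n → Fin (suc n)) → products s (λ j → toℕ (x j) ℂ^.× ℂ.1#) ℂ.≈ products s′ (λ j → toℕ (x j) ℂ^.× ℂ.1#)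
        same-on-grid x = ℂ.trans (product-pair-cong (column l (Y s)) x≗) (ℂ.trans (same-on-digits k) (ℂ.sym (product-pair-cong (column l (Y s′)) x≗)))
          where
          k : Fin (suc n ℕ.^ n)
          k = Fin.funToFin {n} {suc n} x
          x≗ : ∀ j → toℕ (x j) ℂ^.× ℂ.1# ℂ.≈ toℕ (digits k j) ℂ^.× ℂ.1#
          x≗ j = ℂ.reflexive (≡.cong (λ i → toℕ i ℂ^.× ℂ.1#) (≡.sym (Fin.finToFun-funToFin {n} {suc n} x j)))

        -- Where the `k`-th factor in the coordinates `Y s` vanishes, the whole product does, and so
        -- does the equal product in the coordinates `Y s′`.
        matching : ∀ k → ∃ λ i → ∃ λ z → ∀ j → column l (Y s′) i j ℂ.≈ z ℂ.* column l (Y s) k j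
        matching k = proportional-factor n (column l (Y s′)) (column l (Y s) k) j₀ (nonzero s k)
          (λ x vanish → ℂ.trans (ℂ.sym (agree-on-grid⇒agree (column l (Y s)) (column l (Y s′)) same-on-grid x))
            (CK.product-zero {f = λ i → pair (column l (Y s) i) x} k vanish))

      -- One index is chosen for each shape, so that the factors of all indices of this shape are
      -- matched with those of one and the same system of vectors; only then can two matchings be
      -- compared.
      representative : Shape → ℕ
      representative m = choose (em {P = ∃ λ s → shape s ≡ m})
        where
        choose : Dec (∃ λ s → shape s ≡ m) → ℕ
        choose (yes (s , _)) = s
        choose (no _)        = 0

      representative-shape : ∀ s → shape s ≡ shape (representative (shape s))
      representative-shape s with em {P = ∃ λ s′ → shape s′ ≡ shape s}
      ... | yes (s′ , eq) = ≡.sym eq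
      ... | no  none      = ⊥-elim (none (s , ≡.refl))

      match : ∀ s k → ∃ λ i → ∃ λ z → ∀ j → column l (Y (representative (shape s))) i j ℂ.≈ z ℂ.* column l (Y s) k j
      match s = matching s (representative (shape s)) (representative-shape s)

      partner : ℕ → Fin n → Fin n
      partner s k = proj₁ (match s k)

      multiplier : ℕ → Fin n → ℂ
      multiplier s k = proj₁ (proj₂ (match s k))

      multiplier-nonzero : ∀ s k → ¬ (multiplier s k ℂ.≈ ℂ.0#)
      multiplier-nonzero s k z≈0 = nonzero (representative (shape s)) (partner s k)
        (ℂ.trans (proj₂ (proj₂ (match s k)) j₀) (ℂ.trans (ℂ.*-congʳ z≈0) (ℂ.zeroˡ _)))

      multiplier⁻¹ : ℕ → Fin n → ℂ
      multiplier⁻¹ s k = proj₁ (IsField.inverse ℂ-isField (multiplier s k) (multiplier-nonzero s k))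

      proportional : ∀ s s′ → shape s ≡ shape s′ → encode (partner s) ≡ encode (partner s′) →
        ∀ k j → multiplier s k ℂ.* column l (Y s) k j ℂ.≈ multiplier s′ k ℂ.* column l (Y s′) k j
      proportional s s′ eq₁ eq₂ k j = ℂ.trans (ℂ.sym (proj₂ (proj₂ (match s k)) j))
        (ℂ.trans (ℂ.reflexive (≡.cong₂ (λ m i → column l (Y (representative m)) i j) eq₁ (encode-injective (partner s) (partner s′) eq₂ k)))
          (proj₂ (proj₂ (match s′ k)) j))

      code : ℕ → Fin (∏ {suc n ℕ.^ n} (λ _ → M) ℕ.* ∏ {n} (λ _ → n))
      code s = Fin.combine (shape s) (encode (partner s))

      ratio : ∀ s s′ → code s ≡ code s′ → ∀ k j →
        column l (Y s′) k j ℂ.≈ (multiplier s k ℂ.* multiplier⁻¹ s′ k) ℂ.* column l (Y s) k j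
      ratio s s′ eq k j = CF.*-cancelˡ (multiplier-nonzero s′ k) (ℂ.trans
        (ℂ.sym (proportional s s′ (Fin.combine-injectiveˡ (shape s) (encode (partner s)) (shape s′) (encode (partner s′)) eq)
          (Fin.combine-injectiveʳ (shape s) (encode (partner s)) (shape s′) (encode (partner s′)) eq) k j))
        (ℂ.sym (ℂ.trans (CI.*-regroup
            (multiplier s′ k) (multiplier s k) (multiplier⁻¹ s′ k) (column l (Y s) k j))
          (ℂ.trans (ℂ.*-congʳ (proj₂ (IsField.inverse ℂ-isField (multiplier s′ k) (multiplier-nonzero s′ k)))) (ℂ.*-identityˡ _)))))

    recurrence : ∃₂ λ s s′ → s ℕ.< s′ × ∃ λ (e : Fin n → ℂ) → ∀ k j → column l (Y s′) k j ℂ.≈ e k ℂ.* column l (Y s) k j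
    recurrence = unpack (Fin.pigeonhole (ℕ.n<1+n _) (code ∘ toℕ))
      where
      unpack : (∃₂ λ (s s′ : Fin (suc (∏ {suc n ℕ.^ n} (λ _ → M) ℕ.* ∏ {n} (λ _ → n)))) → toℕ s ℕ.< toℕ s′ × code (toℕ s) ≡ code (toℕ s′)) →
        ∃₂ λ s s′ → s ℕ.< s′ × ∃ λ (e : Fin n → ℂ) → ∀ k j → column l (Y s′) k j ℂ.≈ e k ℂ.* column l (Y s) k j
      unpack (s , s′ , s<s′ , eq) = toℕ s , toℕ s′ , s<s′ , (λ k → multiplier (toℕ s) k ℂ.* multiplier⁻¹ (toℕ s′) k) , ratio (toℕ s) (toℕ s′) eq

-- Independent integral vectors and the multipliers between them

module DiagonalDominance (em : ExcludedMiddle 0ℓ) (ℛ : CompleteOrderedField) where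
  open CompleteOrderedField ℛ renaming (Carrier to ℝ; ring to ℝ-ring)
  open RealOrder em ℛ
  open RawSemiringDefinitions (RawRing.rawSemiring rawRing) using (sum) renaming (_×_ to _·_)
  open RingKit ℝ-ring
  open FieldKit ℝ-ring isField _≈?_ using (TrivialKernel)

  argmax : ∀ {N} (f : Fin (suc N) → ℝ) → ∃ λ i → ∀ j → f j ≤ f i
  argmax {zero}  f = zero , λ { zero → ≤-refl }
  argmax {suc N} f = compare (argmax (f ∘ suc))
    where
    compare : (∃ λ i → ∀ j → f (suc j) ≤ f (suc i)) → ∃ λ i → ∀ j → f j ≤ f i
    compare (i , max) with total (f zero) (f (suc i))
    ... | inj₁ 0≤i = suc i , λ { zero → 0≤i ; (suc j) → max j }
    ... | inj₂ i≤0 = zero , λ { zero → ≤-refl ; (suc j) → ≤-trans (max j) i≤0 }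

  -- In the row of a coordinate `c m` of largest modulus the diagonal term outweighs all others
  -- together, unless `c m` is 0.
  diagonally-dominant : ∀ {N} (G : Fin (suc N) → Fin (suc N) → ℝ) β → 0# ≤ β →
    (∀ i j → i ≢ j → ∣ G i j ∣ ≤ β) → (∀ i → (suc N · 1# * β) < ∣ G i i ∣) → TrivialKernel G
  diagonally-dominant {N} G β 0≤β off diagonal c Gc≈0 with argmax (λ j → ∣ c j ∣)
  ... | m , max = λ j → ∣∣≈0 (≤-trans (max j) ∣cm∣≤0)
    where
    M = ∣ c m ∣
    0≤M = ∣∣-nonNeg (c m)
    rest : Fin (suc N) → ℝ
    rest j = select (j Fin.≟ m) 0# (G m j * c j)
    diagonal-term : Fin (suc N) → ℝ
    diagonal-term j = select (j Fin.≟ m) (G m j * c j) 0#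
    split : ∀ j → G m j * c j ≈ diagonal-term j + rest j
    split j = cases (j Fin.≟ m)
      where
      cases : ∀ (d : Dec (j ≡ m)) → G m j * c j ≈ select d (G m j * c j) 0# + select d 0# (G m j * c j)
      cases (yes _) = sym (+-identityʳ _)
      cases (no  _) = sym (+-identityˡ _)
    diagonal-sum : sum diagonal-term ≈ G m m * c m
    diagonal-sum = trans (sum-single m diagonal-term (λ j m≢j → reflexive (select-no (j Fin.≟ m) (m≢j ∘ ≡.sym))))
      (reflexive (select-yes (m Fin.≟ m) ≡.refl))
    balance : G m m * c m + sum rest ≈ 0#
    balance = trans (+-congʳ (sym diagonal-sum)) (trans (sym (∑-+ (suc N) diagonal-term rest)) (trans (sym (sum-cong (suc N) split)) (Gc≈0 m)))
    rest≤ : ∀ j → ∣ rest j ∣ ≤ (β * M)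
    rest≤ j = cases (j Fin.≟ m)
      where
      cases : ∀ (d : Dec (j ≡ m)) → ∣ select d 0# (G m j * c j) ∣ ≤ (β * M)
      cases (yes _)   = ≤-respˡ-≈ (sym (∣∣-of-nonNeg ≤-refl)) (*-nonNeg 0≤β 0≤M)
      cases (no  j≢m) = ≤-respˡ-≈ (sym (∣∣-* (G m j) (c j))) (*-mono-≤ (∣∣-nonNeg _) 0≤M (off m j (j≢m ∘ ≡.sym)) (max j))
    dominated : (∣ G m m ∣ * M) ≤ ((suc N · 1# * β) * M)
    dominated = ≤-respˡ-≈ (∣∣-* (G m m) (c m)) (≤-trans (∣∣-mono opposite) (≤-trans (∣∣-neg (sum rest))
      (≤-trans (∣∣-sum (suc N) rest) (≤-respʳ-≈ (sym (*-assoc (suc N · 1#) β M)) (sum-bound (suc N) rest≤)))))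
      where
      opposite : G m m * c m ≈ - sum rest
      opposite = trans (solve 2 (λ x s → x := (x :+ s) :- s) refl (G m m * c m) (sum rest)) (trans (+-congʳ balance) (+-identityˡ _))
    ∣cm∣≤0 : M ≤ 0#
    ∣cm∣≤0 = ≮⇒≥ λ 0<M → <⇒≱ (diagonal m) (*-cancelˡ-≤ 0<M (≤-respˡ-≈ (*-comm _ M) (≤-respʳ-≈ (*-comm _ M) dominated)))

module LatticePoints (em : ExcludedMiddle 0ℓ) (ℛ : CompleteOrderedField) {N : ℕ}
    (ω : Vector (CompleteOrderedField.Carrier ℛ) (suc N)) (p : Fin (suc N)) where
  open CompleteOrderedField ℛ renaming (Carrier to ℝ; ring to ℝ-ring)
  open Over ℛ
  open RealOrder em ℛ
  open ComplexNumbers em ℛ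
  open Approximation em ℛ ω p
  open DiagonalDominance em ℛ
  open DiscreteSets em ℛ using (Finite)
  open IntegralPoints em ℛ using (⟦_⟧; gridPoint; gridPoint-real; column; formValue; formValue≈; productValue; productValue≈; module Recurrence)
  private
    module ℂ = CommutativeRing ℂ-ring
    module ℂ^ = RawSemiringDefinitions (RawRing.rawSemiring ℂ.rawRing)
    module CK = RingKit ℂ-ring
    module CI = RingIdentities ℂ-ring
  open RawSemiringDefinitions (RawRing.rawSemiring rawRing) using (sum; product; _^_) renaming (_×_ to _·_)
  open RingKit ℝ-ring 
  open FieldKit ℝ-ring isField _≈?_ using (sum-eliminate)
  open PolynomialIdentities ℂ-ring ℂ-isField _≈ᶜ?_
  open CharacteristicZero ℂ-char0 using (pair; pair-line)

  -- E η² ≤ W ∣g₂ g₁∣ ≤ W ‖x₂ x₁‖ C² = ‖y₁ y₂‖ C² ≤ B² C². In the application g = x r splits one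
  -- weighted factor x off a value of the form, r being the product of the others.
  crossed-bound : ∀ {E W η B C g₂ g₁ : ℝ} {x₂ x₁ y₁ y₂ r₂ r₁ : ℂ} → 0# ≤ W → E ≤ W → 0# ≤ η → 0# ≤ B → 0# ≤ C →
    fromℝ g₂ ℂ.≈ x₂ ℂ.* r₂ → fromℝ g₁ ℂ.≈ x₁ ℂ.* r₁ → η ≤ ∣ g₂ ∣ → η ≤ ∣ g₁ ∣ → ‖ r₂ ‖ ≤ C → ‖ r₁ ‖ ≤ C →
    fromℝ W ℂ.* (x₂ ℂ.* x₁) ℂ.≈ y₁ ℂ.* y₂ → ‖ y₁ ‖ ≤ B → ‖ y₂ ‖ ≤ B → (E * (η * η)) ≤ ((B * B) * (C * C))
  crossed-bound {E} {W} {η} {B} {C} {g₂} {g₁} {x₂} {x₁} {y₁} {y₂} {r₂} {r₁} 0≤W E≤W 0≤η 0≤B 0≤C g₂≈ g₁≈ η≤g₂ η≤g₁ r₂≤C r₁≤C crossed y₁≤B y₂≤B =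
    ≤-trans (*-monoʳ-≤ (*-nonNeg 0≤η 0≤η) E≤W) (≤-trans (*-monoˡ-≤ 0≤W lower)
      (≤-respˡ-≈ (*-assoc W (‖ x₂ ℂ.* x₁ ‖) (C * C)) (*-monoʳ-≤ (*-nonNeg 0≤C 0≤C) upper)))
    where
    gg≈ : fromℝ (g₂ * g₁) ℂ.≈ (x₂ ℂ.* x₁) ℂ.* (r₂ ℂ.* r₁)
    gg≈ = ℂ.trans (fromℝ-* g₂ g₁) (ℂ.trans (ℂ.*-cong g₂≈ g₁≈)
      (CI.*-interchange x₂ r₂ x₁ r₁))
    lower : (η * η) ≤ (‖ x₂ ℂ.* x₁ ‖ * (C * C))
    lower = ≤-trans (*-mono-≤ 0≤η (∣∣-nonNeg g₁) η≤g₂ η≤g₁)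
      (≤-respˡ-≈ (trans (‖‖-cong (ℂ.sym gg≈)) (trans (‖‖-fromℝ (g₂ * g₁)) (∣∣-* g₂ g₁)))
        (≤-trans (‖‖-* (x₂ ℂ.* x₁) (r₂ ℂ.* r₁)) (*-monoˡ-≤ (‖‖-nonNeg (x₂ ℂ.* x₁))
          (≤-trans (‖‖-* r₂ r₁) (*-mono-≤ (‖‖-nonNeg r₂) 0≤C r₂≤C r₁≤C)))))
    upper : (W * ‖ x₂ ℂ.* x₁ ‖) ≤ (B * B)
    upper = ≤-respˡ-≈ (trans (‖‖-cong (ℂ.sym crossed)) (‖‖-scale 0≤W (x₂ ℂ.* x₁)))
      (≤-trans (‖‖-* y₁ y₂) (*-mono-≤ (‖‖-nonNeg y₁) 0≤B y₁≤B y₂≤B))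

  module Bounds (ωp≈1 : ω p ≈ 1#) (l : Fin n → Vector ℂ n) (i₀ : Fin n)
    (l-ω : ∀ i → i ≢ i₀ → pair (l i) (fromℝ ∘ ω) ℂ.≈ ℂ.0#) where

    -- The counterpart of `scale` for the linear factors: all factors except `i₀` vanish on `ω`, so
    -- they measure deviations from the line and are expanded.
    weight : ℕ → Fin n → ℝ
    weight t i = select (i Fin.≟ i₀) (τ t ^ N) (T# t)

    weight-product : ∀ t → product (weight t) ≈ 1#
    weight-product t = trans (RingKit.product-remove ℝ-ring (weight t) i₀) (trans
      (*-cong (reflexive (select-yes (i₀ Fin.≟ i₀) ≡.refl))
        (trans (RingKit.product-cong ℝ-ring N (λ i → reflexive (select-no (punchIn i₀ i Fin.≟ i₀) (Fin.punchInᵢ≢i i₀ i)))) (constant N)))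
      (trans (*-comm _ _) (T^*τ^≈1 t N)))
      where
      constant : ∀ k → product {k} (λ _ → T# t) ≈ T# t ^ k
      constant zero    = refl
      constant (suc k) = *-congˡ (constant k)

    F : Vector ℂ n → ℂ
    F x = ℂ^.product (λ i → pair (l i) x)

    L : ℕ → Fin n → Vector ℂ n → ℂ
    L t i x = fromℝ (weight t i) ℂ.* pair (l i) x

    F≈∏L : ∀ t x → F x ℂ.≈ ℂ^.product (λ i → L t i x)
    F≈∏L t x = ℂ.sym (ℂ.trans (CK.product-* n (fromℝ ∘ weight t) (λ i → pair (l i) x)) (ℂ.trans (ℂ.*-congʳ
      (ℂ.trans (ℂ.sym (RingHomKit.φ-product ℝ-ring ℂ-ring fromℝ fromℝ-homo n (weight t))) (weight-product t , refl)))
      (ℂ.*-identityˡ _)))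

    C₀ : ℝ
    C₀ = sum (λ i → sum (λ r → ‖ l i r ‖) + ‖ pair (l i) (fromℝ ∘ ω) ‖)

    private
      part : Fin n → ℝ
      part i = sum (λ r → ‖ l i r ‖) + ‖ pair (l i) (fromℝ ∘ ω) ‖

      0≤part : ∀ i → 0# ≤ part i
      0≤part i = +-nonNeg (sum-nonNeg n (λ r → ‖‖-nonNeg (l i r))) (‖‖-nonNeg _)

    0≤C₀ : 0# ≤ C₀
    0≤C₀ = sum-nonNeg n 0≤part

    deviation : Vector ℤ n → Vector ℝ n
    deviation x r = fromInt (x r) - ω r * fromInt (x p)

    scaled-pair : ∀ s (a : Vector ℂ n) (e : Vector ℝ n) {U} → (∀ r → ∣ s * e r ∣ ≤ U) →
      ‖ fromℝ s ℂ.* pair a (fromℝ ∘ e) ‖ ≤ (sum (λ r → ‖ a r ‖) * U)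
    scaled-pair s a e {U} small = ≤-respˡ-≈ (‖‖-cong (ℂ.sym (ℂ.trans (CK.*-distribˡ-∑ n (fromℝ s) (λ r → a r ℂ.* fromℝ (e r)))
        (CK.sum-cong n (λ r → ℂ.trans (CI.*-swap (fromℝ s) (a r) (fromℝ (e r)))
          (ℂ.*-congˡ (ℂ.sym (fromℝ-* s (e r)))))))))
      (≤-trans (‖‖-sum n (λ r → a r ℂ.* fromℝ (s * e r)))
        (≤-respʳ-≈ (sym (*-distribʳ-∑ n U (λ r → ‖ a r ‖))) (sum-mono n (λ r → ≤-trans (‖‖-* (a r) (fromℝ (s * e r)))
          (*-monoˡ-≤ (‖‖-nonNeg (a r)) (≤-respˡ-≈ (sym (‖‖-fromℝ (s * e r))) (small r)))))))

    pair-decomposition : ∀ (a : Vector ℂ n) x →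
      pair a ⟦ x ⟧ ℂ.≈ pair a (fromℝ ∘ deviation x) ℂ.+ fromℝ (fromInt (x p)) ℂ.* pair a (fromℝ ∘ ω)
    pair-decomposition a x = ℂ.trans
      (CK.sum-cong n (λ r → ℂ.*-congˡ {a r} (ℂ.trans (solve 3 (λ x ω y → x := (x :- ω :* y) :+ y :* ω) refl (fromInt (x r)) (ω r) (fromInt (x p)) , refl)
        (ℂ.trans (IsRingHomomorphism.+-homo fromℝ-homo (deviation x r) (fromInt (x p) * ω r))
          (ℂ.+-congˡ (fromℝ-* (fromInt (x p)) (ω r)))))))
      (pair-line a (fromℝ ∘ deviation x) (fromℝ ∘ ω) (fromℝ (fromInt (x p))))

    1≤T : ∀ t → 1# ≤ T# t
    1≤T t = 1≤suc t

    τ≤1 : ∀ t → τ t ≤ 1#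
    τ≤1 t = *-cancelˡ-≤ (0<suc t) (≤-respˡ-≈ (sym (T*τ≈1 t)) (≤-respʳ-≈ (sym (*-identityʳ _)) (1≤T t)))

    -- In x = deviation + xₚ ω the second summand affects the factor `i₀` alone, whose weight τᴺ is
    -- the one under which xₚ is bounded. The deviation is bounded even with the larger weight T.
    L-bound : ∀ t x {U} → (∀ r → ∣ u t r x ∣ ≤ U) → ∀ i → ‖ L t i ⟦ x ⟧ ‖ ≤ (C₀ * U)
    L-bound t x {U} u≤U i = ≤-trans (cases (i Fin.≟ i₀)) (*-monoʳ-≤ 0≤U (term≤sum 0≤part i))
      where
      0≤U : 0# ≤ U
      0≤U = ≤-trans (∣∣-nonNeg (u t p x)) (u≤U p)
      e = deviation x
      xp = fromInt (x p)
      -- At `p` the coordinate controlled by `U` is xₚ and not the deviation; there the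
      -- normalisation of `ω` has to be used.
      ep≈0 : e p ≈ 0#
      ep≈0 = trans (+-congˡ (-‿cong (trans (*-congʳ ωp≈1) (*-identityˡ xp)))) (-‿inverseʳ xp)
      Te≤U : ∀ r → ∣ T# t * e r ∣ ≤ U
      Te≤U r = at (r Fin.≟ p) (u≤U r)
        where
        at : ∀ (d : Dec (r ≡ p)) → ∣ select d (τ t ^ N) (T# t) * select d xp (e r) ∣ ≤ U → ∣ T# t * e r ∣ ≤ U
        at (yes ≡.refl) _ = ≤-respˡ-≈ (trans (sym (∣∣-of-nonNeg ≤-refl)) (∣∣-cong (sym (trans (*-congˡ ep≈0) (zeroʳ _))))) 0≤U
        at (no  _)      b = b
      τx≤U : ∣ τ t ^ N * xp ∣ ≤ U
      τx≤U = at (p Fin.≟ p) (u≤U p)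
        where
        at : ∀ (d : Dec (p ≡ p)) → ∣ select d (τ t ^ N) (T# t) * select d xp (e p) ∣ ≤ U → ∣ τ t ^ N * xp ∣ ≤ U
        at (yes _)   b = b
        at (no  p≢p) _ = ⊥-elim (p≢p ≡.refl)
      τe≤U : ∀ r → ∣ τ t ^ N * e r ∣ ≤ U
      τe≤U r = ≤-trans (≤-respˡ-≈ (sym (∣∣-* _ (e r))) (≤-respʳ-≈ (sym (∣∣-* (T# t) (e r)))
        (*-monoʳ-≤ (∣∣-nonNeg (e r)) (≤-respˡ-≈ (sym (∣∣-of-nonNeg 0≤τ^N)) (≤-respʳ-≈ (sym (∣∣-of-nonNeg (0≤ℕ (suc t))))
          (≤-trans (power-≤-one N (proj₁ (0<τ t)) (τ≤1 t)) (1≤T t)))))))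
        (Te≤U r)
        where
        0≤τ^N : 0# ≤ (τ t ^ N)
        0≤τ^N = power-nonNeg N (proj₁ (0<τ t))
      distribute : ∀ s → fromℝ s ℂ.* pair (l i) ⟦ x ⟧ ℂ.≈
        fromℝ s ℂ.* pair (l i) (fromℝ ∘ e) ℂ.+ fromℝ (s * xp) ℂ.* pair (l i) (fromℝ ∘ ω)
      distribute s = ℂ.trans (ℂ.*-congˡ (pair-decomposition (l i) x)) (ℂ.trans (ℂ.distribˡ _ _ _)
        (ℂ.+-congˡ (ℂ.trans (ℂ.sym (ℂ.*-assoc _ _ _)) (ℂ.*-congʳ (ℂ.sym (fromℝ-* s xp))))))
      combined : ∀ s → (∀ r → ∣ s * e r ∣ ≤ U) → ‖ fromℝ (s * xp) ℂ.* pair (l i) (fromℝ ∘ ω) ‖ ≤ (‖ pair (l i) (fromℝ ∘ ω) ‖ * U) →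
        ‖ fromℝ s ℂ.* pair (l i) ⟦ x ⟧ ‖ ≤ (part i * U)
      combined s se≤U second = ≤-respˡ-≈ (‖‖-cong (ℂ.sym (distribute s))) (≤-trans (‖‖-+ _ _)
        (≤-respʳ-≈ (sym (distribʳ U _ _)) (+-mono-≤ (scaled-pair s (l i) e se≤U) second)))
      cases : ∀ (d : Dec (i ≡ i₀)) → ‖ fromℝ (select d (τ t ^ N) (T# t)) ℂ.* pair (l i) ⟦ x ⟧ ‖ ≤ (part i * U)
      cases (yes _)    = combined (τ t ^ N) τe≤U (≤-trans (‖‖-* _ _) (≤-respˡ-≈ (*-comm _ _)
        (*-monoˡ-≤ (‖‖-nonNeg _) (≤-respˡ-≈ (sym (‖‖-fromℝ _)) τx≤U))))
      cases (no i≢i₀) = combined (T# t) Te≤U (≤-respˡ-≈ (sym (trans (‖‖-cong (ℂ.trans (ℂ.*-congˡ (l-ω i i≢i₀)) (ℂ.zeroʳ _)))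
        (trans (‖‖-fromℝ 0#) (∣∣-of-nonNeg ≤-refl)))) (*-nonNeg (‖‖-nonNeg _) 0≤U))

    F-bound : ∀ t x {U} → (∀ r → ∣ u t r x ∣ ≤ U) → ‖ F ⟦ x ⟧ ‖ ≤ ((C₀ * U) ^ n)
    F-bound t x {U} u≤U = ≤-respˡ-≈ (‖‖-cong (ℂ.sym (F≈∏L t ⟦ x ⟧))) (≤-trans (‖‖-product n (λ i → L t i ⟦ x ⟧))
      (product-bound n (*-nonNeg 0≤C₀ (≤-trans (∣∣-nonNeg (u t p x)) (u≤U p))) (λ i → ‖‖-nonNeg _) (L-bound t x u≤U)))

    module Points (g : Vector ℤ n → ℝ) (value≈g : ∀ x → productValue l x ℂ.≈ fromℝ (g x))
      (η : ℝ) (0<η : 0# < η) (g-lower : ∀ x → (∃ λ r → x r ≢ 0ℤ) → η ≤ ∣ g x ∣) where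

      F≈g : ∀ x → F ⟦ x ⟧ ℂ.≈ fromℝ (g x)
      F≈g x = ℂ.trans (ℂ.sym (productValue≈ l x)) (value≈g x)

      lower : ∀ x → (∃ λ r → x r ≢ 0ℤ) → η ≤ ‖ F ⟦ x ⟧ ‖
      lower x x≢0 = ≤-respʳ-≈ (sym (trans (‖‖-cong (F≈g x)) (‖‖-fromℝ (g x)))) (g-lower x x≢0)

      private
        n# : ℝ
        n# = n · 1#

        0≤2A : 0# ≤ (A + A)
        0≤2A = +-nonNeg 0≤A 0≤A

        Q X : ℝ
        Q = C₀ * (n# * (A + A))
        X = Q + 1#

        0≤Q : 0# ≤ Q
        0≤Q = *-nonNeg 0≤C₀ (*-nonNeg (0≤ℕ n) 0≤2A)

        Q<X : Q < X
        Q<X = ≈-<-trans (sym (+-identityʳ Q)) (+-monoʳ-< Q 0<1)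

        0≤X : 0# ≤ X
        0≤X = ≤-trans 0≤Q (proj₁ Q<X)

        η⁻¹ : ℝ
        η⁻¹ = proj₁ (inverse η (0<x⇒≉0 0<η))

        η*η⁻¹≈1 : η * η⁻¹ ≈ 1#
        η*η⁻¹≈1 = proj₂ (inverse η (0<x⇒≉0 0<η))

        0≤η⁻¹ : 0# ≤ η⁻¹
        0≤η⁻¹ = ≰⇒≥ λ η⁻¹≤0 → <⇒≱ 0<1 (≤-respˡ-≈ η*η⁻¹≈1 (≤-respʳ-≈ (zeroʳ η) (*-monoˡ-≤ (proj₁ 0<η) η⁻¹≤0)))

      -- D = d + 1 is at least X + X / η. Then C₀ n β = Q / D is smaller than 1 and than η, hence so
      -- is its `n`-th power. Nothing here depends on `t`.
      d : ℕ
      d = proj₁ (archimedeanℕ (X + X * η⁻¹))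

      β : ℝ
      β = τ d * (A + A)

      private
        D≥ : (X + X * η⁻¹) ≤ T# d
        D≥ = proj₂ (archimedeanℕ (X + X * η⁻¹))

        τD≈1 : τ d * T# d ≈ 1#
        τD≈1 = trans (*-comm _ _) (T*τ≈1 d)

        τX≤1 : (τ d * X) ≤ 1#
        τX≤1 = ≤-respʳ-≈ τD≈1 (*-monoˡ-≤ (proj₁ (0<τ d)) (≤-trans (x≤x+y (*-nonNeg 0≤X 0≤η⁻¹)) D≥))

        τX≤η : (τ d * X) ≤ η
        τX≤η = ≤-respˡ-≈ (trans (solve 4 (λ t x i e → e :* (t :* (x :* i)) := t :* x :* (e :* i)) refl (τ d) X η⁻¹ η)
            (trans (*-congˡ η*η⁻¹≈1) (*-identityʳ _)))
          (≤-respʳ-≈ (*-identityʳ η) (*-monoˡ-≤ (proj₁ 0<η)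
            (≤-respʳ-≈ τD≈1 (*-monoˡ-≤ (proj₁ (0<τ d)) (≤-trans (x≤y+x 0≤X) D≥)))))

        q : ℝ
        q = C₀ * (n# * β)

        q≈τQ : q ≈ τ d * Q
        q≈τQ = solve 4 (λ c n t a → c :* (n :* (t :* a)) := t :* (c :* (n :* a))) refl C₀ n# (τ d) (A + A)

        q<τX : q < (τ d * X)
        q<τX = ≈-<-trans q≈τQ (*-monoˡ-≤ (proj₁ (0<τ d)) (proj₁ Q<X) ,
          λ eq → proj₂ Q<X (FieldKit.*-cancelˡ ℝ-ring isField _≈?_ (0<x⇒≉0 (0<τ d)) eq))

      0≤β : 0# ≤ β
      0≤β = *-nonNeg (proj₁ (0<τ d)) 0≤2A

      private
        0≤q : 0# ≤ q
        0≤q = *-nonNeg 0≤C₀ (*-nonNeg (0≤ℕ n) 0≤β)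

        q^n<η : (q ^ n) < η
        q^n<η = ≤-<-trans (≤-respʳ-≈ (*-identityʳ q) (*-monoˡ-≤ 0≤q (power-≤-one N 0≤q (≤-trans (proj₁ q<τX) τX≤1))))
          (<-≤-trans q<τX τX≤η)

      -- Otherwise every weighted factor would be at most C₀ n β, and the form would be smaller at
      -- `x` than its lower bound `η`.
      not-small : ∀ t x → (∃ λ r → x r ≢ 0ℤ) → ¬ (∀ r → ∣ u t r x ∣ ≤ (n# * β))
      not-small t x x≢0 small = <⇒≱ q^n<η (≤-trans (lower x x≢0) (F-bound t x small))

      β≤nβ : β ≤ (n# * β)
      β≤nβ = ≤-respˡ-≈ (*-identityˡ β) (*-monoʳ-≤ 0≤β (1≤suc N))

      P : ℕ → Fin n → Vector ℤ n
      P t j = y t d j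

      off-diagonal : ∀ t i j → i ≢ j → ∣ u t i (P t j) ∣ ≤ β
      off-diagonal t i j i≢j = ≤-respˡ-≈ (trans (sym (*-assoc _ _ _)) (trans (*-congʳ τD≈1) (*-identityˡ _)))
        (*-monoˡ-≤ (proj₁ (0<τ d)) (y-off t d j i i≢j))

      on-diagonal : ∀ t j → (n# * β) < ∣ u t j (P t j) ∣
      on-diagonal t j = ≰⇒> λ small → not-small t (P t j) (y≢0 t d j) λ r → cases small r (r Fin.≟ j)
        where
        cases : ∣ u t j (P t j) ∣ ≤ (n# * β) → ∀ r → Dec (r ≡ j) → ∣ u t r (P t j) ∣ ≤ (n# * β)
        cases small r (yes ≡.refl) = small
        cases small r (no  r≢j)    = ≤-trans (off-diagonal t r j r≢j) β≤nβ

      coord-combination : ∀ i (Y : Fin n → Vector ℤ n) (c : Vector ℝ n) →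
        sum (λ j → coord i (fromInt ∘ Y j) * c j) ≈ coord i (λ r → sum (λ j → fromInt (Y j r) * c j))
      coord-combination i Y c = cases (i Fin.≟ p)
        where
        cases : ∀ (dec : Dec (i ≡ p)) →
          sum (λ j → select dec (fromInt (Y j p)) (fromInt (Y j i) - ω i * fromInt (Y j p)) * c j) ≈
          select dec (sum (λ j → fromInt (Y j p) * c j)) (sum (λ j → fromInt (Y j i) * c j) - ω i * sum (λ j → fromInt (Y j p) * c j))
        cases (yes _) = refl
        cases (no  _) = sum-eliminate n (ω i) (λ j → fromInt (Y j i)) (λ j → fromInt (Y j p)) c

      u-combination : ∀ t i (Y : Fin n → Vector ℤ n) (c : Vector ℝ n) →
        sum (λ j → u t i (Y j) * c j) ≈ scale t i * coord i (λ r → sum (λ j → fromInt (Y j r) * c j))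
      u-combination t i Y c = trans (sum-cong n (λ j → *-assoc (scale t i) (coord i (fromInt ∘ Y j)) (c j)))
        (trans (sym (*-distribˡ-∑ n (scale t i) (λ j → coord i (fromInt ∘ Y j) * c j))) (*-congˡ (coord-combination i Y c)))

      coord-cong : ∀ i {x z : Vector ℝ n} → (∀ r → x r ≈ z r) → coord i x ≈ coord i z
      coord-cong i {x} {z} x≈z = cases (i Fin.≟ p)
        where
        cases : ∀ (dec : Dec (i ≡ p)) → select dec (x p) (x i - ω i * x p) ≈ select dec (z p) (z i - ω i * z p)
        cases (yes _) = x≈z p
        cases (no  _) = +-cong (x≈z i) (-‿cong (*-congˡ (x≈z p)))

      coord-zero : ∀ i → coord i (λ r → 0#) ≈ 0#
      coord-zero i = cases (i Fin.≟ p)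
        where
        cases : ∀ (dec : Dec (i ≡ p)) → select dec 0# (0# - ω i * 0#) ≈ 0#
        cases (yes _) = refl
        cases (no  _) = trans (+-congˡ (-‿cong (zeroʳ (ω i)))) (-‿inverseʳ 0#)

      -- A relation between the vectors `P t j` is one between the columns of the matrix of their
      -- weighted coordinates, which is diagonally dominant.
      P-independent : ∀ t (c : Vector ℝ n) → (∀ r → sum (λ j → fromInt (P t j r) * c j) ≈ 0#) → ∀ j → c j ≈ 0#
      P-independent t c Pc≈0 = diagonally-dominant (λ i j → u t i (P t j)) β 0≤β (off-diagonal t) (on-diagonal t) c
        (λ i → trans (u-combination t i (P t) c) (trans (*-congˡ (trans (coord-cong i Pc≈0) (coord-zero i))) (zeroʳ _)))

      U₁ : ℝ
      U₁ = (A + A) * T# d ^ N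

      0≤U₁ : 0# ≤ U₁
      0≤U₁ = *-nonNeg 0≤2A (power-nonNeg N (0≤ℕ (suc d)))

      u-column : ∀ t i j → ∣ u t i (P t j) ∣ ≤ U₁
      u-column t i j = cases (i Fin.≟ j)
        where
        cases : Dec (i ≡ j) → ∣ u t i (P t j) ∣ ≤ U₁
        cases (yes ≡.refl) = y-at t d j
        cases (no  i≢j)    = ≤-trans (off-diagonal t i j i≢j) (≤-trans
          (≤-respʳ-≈ (*-identityˡ _) (*-monoʳ-≤ 0≤2A (τ≤1 d)))
          (≤-respˡ-≈ (*-identityʳ _) (*-monoˡ-≤ 0≤2A (1≤power N (1≤T d)))))

      -- A grid point is a sum of `n` vectors with weighted coordinates at most `U₁` and with
      -- coefficients at most `n`.
      U₂ : ℝ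
      U₂ = n# * (U₁ * n#)

      u-grid : ∀ t (x : Fin n → Fin (suc n)) i → ∣ u t i (gridPoint (P t) x) ∣ ≤ U₂
      u-grid t x i = ≤-respˡ-≈ (∣∣-cong (sym (trans (*-congˡ (coord-cong i (gridPoint-real (P t) x))) (sym (u-combination t i (P t) (λ j → toℕ (x j) · 1#))))))
        (≤-trans (∣∣-sum n (λ j → u t i (P t j) * toℕ (x j) · 1#)) (sum-bound n (λ j → ≤-respˡ-≈ (sym (∣∣-* (u t i (P t j)) (toℕ (x j) · 1#)))
          (*-mono-≤ (∣∣-nonNeg _) (0≤ℕ n) (u-column t i j) (≤-respˡ-≈ (sym (∣∣-of-nonNeg (0≤ℕ (toℕ (x j))))) (·-mono (ℕ.s≤s⁻¹ (Fin.toℕ<n (x j)))))))))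

      F-grid : ∀ t (x : Fin n → Fin (suc n)) → ‖ F ⟦ gridPoint (P t) x ⟧ ‖ ≤ ((C₀ * U₂) ^ n)
      F-grid t x = F-bound t (gridPoint (P t) x) (u-grid t x)

      B : ℝ
      B = C₀ * U₁

      L-column : ∀ t i j → ‖ L t i ⟦ P t j ⟧ ‖ ≤ B
      L-column t i j = L-bound t (P t j) (λ r → u-column t r j) i

      F-column : ∀ t j → η ≤ ‖ F ⟦ P t j ⟧ ‖
      F-column t j = lower (P t j) (y≢0 t d j)

      module Multipliers
        (finite : ∀ {R} → 0# ≤ R → Finite (λ y → (∃ λ x → y ≈ g x) × ∣ y ∣ ≤ R)) where

        private
          0≤B : 0# ≤ B
          0≤B = *-nonNeg 0≤C₀ 0≤U₁

          grid-values : Finite (λ y → (∃ λ x → y ≈ g x) × ∣ y ∣ ≤ ((C₀ * U₂) ^ n))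
          grid-values = finite (power-nonNeg n (*-nonNeg 0≤C₀ (*-nonNeg (0≤ℕ n) (*-nonNeg 0≤U₁ (0≤ℕ n)))))

          listed : ∀ t (x : Fin n → Fin (suc n)) → ∃ λ i → g (gridPoint (P t) x) ≈ proj₁ (proj₂ grid-values) i
          listed t x = proj₂ (proj₂ grid-values) (g (gridPoint (P t) x)) ((gridPoint (P t) x , refl) ,
            ≤-respˡ-≈ (trans (‖‖-cong (F≈g (gridPoint (P t) x))) (‖‖-fromℝ (g (gridPoint (P t) x)))) (F-grid t x))

          column-nonzero : ∀ t i → ¬ (column l (P t) i zero ℂ.≈ ℂ.0#)
          column-nonzero t i a≈0 = <⇒≱ 0<η (≤-trans (F-column t zero)
            (≤-reflexive (trans (‖‖-cong (CK.product-zero {f = λ i → pair (l i) ⟦ P t zero ⟧} i a≈0)) (trans (‖‖-fromℝ 0#) (∣∣-of-nonNeg ≤-refl)))))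

          -- Each weighted factor at a vector `P t zero` is at most `B`, and therefore at least η /
          -- Bᴺ, as their product is at least `η`. So K / η² bounds the quotient of two products of
          -- two such factors, and `E` is chosen beyond it.
          K E# : ℝ
          K = (B * B) * (B ^ N * B ^ N)

          bound-exists : ∃ λ e → (K * (proj₁ (inverse (η * η) (0<x⇒≉0 (0<x*y 0<η 0<η)))) + 1#) ≤ (suc e · 1#)
          bound-exists = archimedeanℕ _

          E : ℕ
          E = suc (proj₁ bound-exists)

          E# = E · 1#

          K<Eη² : K < (E# * (η * η))
          K<Eη² = <-≤-trans (<-≈-trans (≈-<-trans (sym (+-identityʳ K)) (+-monoʳ-< K (0<x*y 0<η 0<η)))
              (sym (trans (distribʳ (η * η) (K * i) 1#) (+-cong
                (trans (*-assoc K i (η * η)) (trans (*-congˡ (trans (*-comm i (η * η)) (proj₂ (inverse (η * η) (0<x⇒≉0 (0<x*y 0<η 0<η))))) ) (*-identityʳ K)))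
                (*-identityˡ (η * η))))))
            (*-monoʳ-≤ (*-nonNeg (proj₁ 0<η) (proj₁ 0<η)) (proj₂ bound-exists))
            where i = proj₁ (inverse (η * η) (0<x⇒≉0 (0<x*y 0<η 0<η)))

          -- The parameters T are restricted to powers of `E`, since then any two of them differ by
          -- a factor of at least `E`; `pred` compensates for T = t + 1.
          level : ℕ → ℕ
          level s = ℕ.pred (E ℕ.^ s)

          T-level : ∀ s → T# (level s) ≈ E# ^ s
          T-level s = trans (reflexive (≡.cong (_· 1#) (ℕ.suc-pred (E ℕ.^ s) {{ℕ.>-nonZero (ℕ.m^n>0 E s)}}))) (·1-^ E s)

        module Distinct (t₁ t₂ : ℕ) (V : ℝ) (T₂≈T₁V : T# t₂ ≈ T# t₁ * V) (E≤V : E# ≤ V)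
          (e : Fin n → ℂ) (e-column : ∀ k → column l (P t₂) k zero ℂ.≈ e k ℂ.* column l (P t₁) k zero) where

          Vτ₂≈τ₁ : V * τ t₂ ≈ τ t₁
          Vτ₂≈τ₁ = trans (sym (trans (*-congʳ (T*τ≈1 t₁)) (*-identityˡ (V * τ t₂))))
            (trans (solve 4 (λ T s v x → (T :* s) :* (v :* x) := s :* ((T :* v) :* x)) refl (T# t₁) (τ t₁) V (τ t₂))
              (trans (*-congˡ (trans (*-congʳ (sym T₂≈T₁V)) (T*τ≈1 t₂))) (*-identityʳ (τ t₁))))

          -- From t₁ to t₂ the weight of the i₀-th form drops by V^N and the others grow by V.
          weights : (V ^ n) * (τ t₂ ^ N * T# t₁) ≈ τ t₁ ^ N * T# t₂
          weights = trans (solve 4 (λ v vn x t → (v :* vn) :* (x :* t) := (vn :* x) :* (t :* v)) refl V (V ^ N) (τ t₂ ^ N) (T# t₁))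
            (*-cong (trans (sym (power-* V (τ t₂) N)) (SemiringExp.^-congˡ semiring N Vτ₂≈τ₁)) (sym T₂≈T₁V))

          L₁ L₂ : Fin n → ℂ
          L₁ i = L t₁ i ⟦ P t₁ zero ⟧
          L₂ i = L t₂ i ⟦ P t₂ zero ⟧

          cross : ∀ i → i ≢ i₀ → e i ℂ.≈ e i₀ → fromℝ (V ^ n) ℂ.* (L₂ i₀ ℂ.* L₁ i) ℂ.≈ L₁ i₀ ℂ.* L₂ i
          cross i i≢i₀ same = CI.cross-multiplied {fromℝ (V ^ n)} {fromℝ (τ t₂ ^ N)} {fromℝ (T# t₁)} {fromℝ (τ t₁ ^ N)} {fromℝ (T# t₂)}
            (weight-yes t₂) (weight-no t₁) (weight-yes t₁) (weight-no t₂)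
            (e-column i₀) (e-column i) same weightsᶜ
            where
            weight-yes : ∀ t → fromℝ (weight t i₀) ℂ.≈ fromℝ (τ t ^ N)
            weight-yes t = ℂ.reflexive (≡.cong fromℝ (select-yes (i₀ Fin.≟ i₀) ≡.refl))
            weight-no : ∀ t → fromℝ (weight t i) ℂ.≈ fromℝ (T# t)
            weight-no t = ℂ.reflexive (≡.cong fromℝ (select-no (i Fin.≟ i₀) i≢i₀))
            weightsᶜ : fromℝ (V ^ n) ℂ.* (fromℝ (τ t₂ ^ N) ℂ.* fromℝ (T# t₁)) ℂ.≈ fromℝ (τ t₁ ^ N) ℂ.* fromℝ (T# t₂)
            weightsᶜ = ℂ.trans (ℂ.*-congˡ (ℂ.sym (fromℝ-* (τ t₂ ^ N) (T# t₁)))) (ℂ.trans (ℂ.sym (fromℝ-* (V ^ n) (τ t₂ ^ N * T# t₁)))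
              (ℂ.trans (weights , refl) (fromℝ-* (τ t₁ ^ N) (T# t₂))))

          others : (f : Fin n → ℂ) (i : Fin n) → ℂ
          others f i = ℂ^.product (removeAt f i)

          others-bound : ∀ t i → ‖ others (λ i → L t i ⟦ P t zero ⟧) i ‖ ≤ (B ^ N)
          others-bound t i = ≤-trans (‖‖-product N (removeAt (λ i → L t i ⟦ P t zero ⟧) i)) (product-bound N 0≤B (λ k → ‖‖-nonNeg _) (λ k → L-column t (punchIn i k) zero))

          -- If the multipliers agreed, the quotient of the weighted factors `i₀` and `i` would
          -- change by Vⁿ between the two levels, through the weights alone; the bounds allow at
          -- most K / η², which is less than `E`.
          distinct : ∀ i → i ≢ i₀ → ¬ (e i ℂ.≈ e i₀)
          distinct i i≢i₀ same = <⇒≱ K<Eη² (crossed-bound 0≤V^n E≤V^n (proj₁ 0<η) 0≤B (power-nonNeg N 0≤B)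
            (ℂ.trans (ℂ.sym (F≈g (P t₂ zero))) (ℂ.trans (F≈∏L t₂ ⟦ P t₂ zero ⟧) (CK.product-remove L₂ i₀)))
            (ℂ.trans (ℂ.sym (F≈g (P t₁ zero))) (ℂ.trans (F≈∏L t₁ ⟦ P t₁ zero ⟧) (CK.product-remove L₁ i)))
            (g-lower (P t₂ zero) (y≢0 t₂ d zero)) (g-lower (P t₁ zero) (y≢0 t₁ d zero)) (others-bound t₂ i₀) (others-bound t₁ i) (cross i i≢i₀ same)
            (L-column t₁ i₀ zero) (L-column t₂ i zero))
            where
            1≤V : 1# ≤ V
            1≤V = ≤-trans (1≤suc (proj₁ bound-exists)) E≤V
            0≤V : 0# ≤ V
            0≤V = ≤-trans 0≤1 1≤V
            0≤V^n : 0# ≤ (V ^ n)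
            0≤V^n = power-nonNeg n 0≤V
            E≤V^n : E# ≤ (V ^ n)
            E≤V^n = ≤-trans E≤V (≤-respˡ-≈ (*-identityʳ V) (*-monoˡ-≤ 0≤V (1≤power N 1≤V)))

        private
          V-bounds : ∀ s s′ → s ℕ.< s′ → T# (level s′) ≈ T# (level s) * E# ^ (s′ ℕ.∸ s) × E# ≤ (E# ^ (s′ ℕ.∸ s))
          V-bounds s s′ s<s′ = trans (T-level s′) (trans
              (reflexive (≡.cong (E# ^_) (≡.sym (ℕ.m+[n∸m]≡n (ℕ.<⇒≤ s<s′)))))
              (trans (SemiringExp.^-homo-* semiring E# s (s′ ℕ.∸ s)) (*-congʳ (sym (T-level s))))) ,
            at-least (s′ ℕ.∸ s) (ℕ.m<n⇒0<n∸m s<s′)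
            where
            at-least : ∀ m → 0 ℕ.< m → E# ≤ (E# ^ m)
            at-least (suc m) _ = ≤-respˡ-≈ (*-identityʳ E#) (*-monoˡ-≤ (0≤ℕ E) (1≤power m (1≤suc (proj₁ bound-exists))))

        multipliers : ∃₂ λ t₁ t₂ → ∃ λ (e : Fin n → ℂ) →
          (∀ k j → formValue (l k) (P t₂ j) ℂ.≈ e k ℂ.* formValue (l k) (P t₁ j)) × (∀ i → i ≢ i₀ → ¬ (e i ℂ.≈ e i₀))
        multipliers = conclude (Recurrence.recurrence {n} l (λ s → P (level s)) g F≈g (proj₁ (proj₂ grid-values)) (listed ∘ level) zero (column-nonzero ∘ level))
          where
          conclude : (∃₂ λ s s′ → s ℕ.< s′ × ∃ λ (e : Fin n → ℂ) → ∀ k j → column l (P (level s′)) k j ℂ.≈ e k ℂ.* column l (P (level s)) k j) →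
            ∃₂ λ t₁ t₂ → ∃ λ (e : Fin n → ℂ) →
              (∀ k j → formValue (l k) (P t₂ j) ℂ.≈ e k ℂ.* formValue (l k) (P t₁ j)) × (∀ i → i ≢ i₀ → ¬ (e i ℂ.≈ e i₀))
          conclude (s , s′ , s<s′ , e , eq) = level s , level s′ , e ,
            (λ k j → ℂ.trans (formValue≈ (l k) (P (level s′) j)) (ℂ.trans (eq k j) (ℂ.*-congˡ (ℂ.sym (formValue≈ (l k) (P (level s) j)))))) ,
            Distinct.distinct (level s) (level s′) (E# ^ (s′ ℕ.∸ s)) (proj₁ (V-bounds s s′ s<s′)) (proj₂ (V-bounds s s′ s<s′)) e (λ k → eq k zero)

module LatticeMultipliers (em : ExcludedMiddle 0ℓ) (ℛ : CompleteOrderedField) where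
  open CompleteOrderedField ℛ renaming (Carrier to ℝ; ring to ℝ-ring)
  open Over ℛ
  open RealOrder em ℛ
  open ComplexNumbers em ℛ
  open DiscreteSets em ℛ using (Finite)
  open IntegralPoints em ℛ using (formValue; productValue)
  open RingKit ℝ-ring using (fromInt)
  open RawSemiringDefinitions (RawRing.rawSemiring rawRing) using (sum)
  private
    module ℂ = CommutativeRing ℂ-ring
  open PolynomialIdentities ℂ-ring ℂ-isField _≈ᶜ?_
  open CharacteristicZero ℂ-char0 using (pair)

  Multipliers : ∀ {n} → (Fin n → Vector ℂ n) → Fin n → Set
  Multipliers {n} l i₀ = ∃₂ λ (P₁ P₂ : Fin n → Vector ℤ n) →
    (∀ (c : Vector ℝ n) → (∀ r → sum (λ j → fromInt (P₁ j r) * c j) ≈ 0#) → ∀ j → c j ≈ 0#) ×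
    ∃ λ (e : Fin n → ℂ) → (∀ k j → formValue (l k) (P₂ j) ℂ.≈ e k ℂ.* formValue (l k) (P₁ j)) × (∀ i → i ≢ i₀ → ¬ (e i ℂ.≈ e i₀))

  multipliers : ∀ {n} (l : Fin n → Vector ℂ n) (i₀ p : Fin n) (ω : Vector ℝ n) → ω p ≈ 1# →
    (∀ i → i ≢ i₀ → pair (l i) (fromℝ ∘ ω) ℂ.≈ ℂ.0#) →
    (g : Vector ℤ n → ℝ) → (∀ x → productValue l x ℂ.≈ fromℝ (g x)) →
    ∀ η → 0# < η → (∀ x → (∃ λ r → x r ≢ 0ℤ) → η ≤ ∣ g x ∣) →
    (∀ {R} → 0# ≤ R → Finite (λ y → (∃ λ x → y ≈ g x) × ∣ y ∣ ≤ R)) → Multipliers l i₀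
  multipliers {suc N} l i₀ p ω ωp≈1 l-ω g value≈g η 0<η lower finite = package M.multipliers
    where
    module B = LatticePoints.Bounds em ℛ ω p ωp≈1 l i₀ l-ω
    module Pts = B.Points g value≈g η 0<η lower
    module M = Pts.Multipliers finite
    package : (∃₂ λ t₁ t₂ → ∃ λ (e : Fin (suc N) → ℂ) →
      (∀ k j → formValue (l k) (Pts.P t₂ j) ℂ.≈ e k ℂ.* formValue (l k) (Pts.P t₁ j)) × (∀ i → i ≢ i₀ → ¬ (e i ℂ.≈ e i₀))) → Multipliers l i₀
    package (t₁ , t₂ , e , columns , distinct) = Pts.P t₁ , Pts.P t₂ , Pts.P-independent t₁ , e , columns , distinct

-- The number field generated by a multiplier

module RationalMultipliers (em : ExcludedMiddle 0ℓ) (ℛ : CompleteOrderedField) {n : ℕ}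
    (l : Fin n → Vector (Over.ℂ ℛ) n) where
  open Over ℛ
  open ComplexNumbers em ℛ
  private
    module ℂ = CommutativeRing ℂ-ring
    module ℂ^ = RawSemiringDefinitions (RawRing.rawSemiring ℂ.rawRing)
    module ℚ^ = RawSemiringDefinitions (RawRing.rawSemiring (CommutativeRing.rawRing ℚ-ring))
    module CK = RingKit ℂ-ring
    module CI = RingIdentities ℂ-ring
    module CF = FieldKit ℂ-ring ℂ-isField _≈ᶜ?_
    module QF = FieldKit ℚ-ring ℚ-isField ℚ._≟_
    module QC = FieldExtension ℚ-ring ℚ-isField ℚ._≟_ ℂ-ring ℂ-isField fromℚℂ fromℚℂ-homo
    module φ = RingHomKit ℚ-ring ℂ-ring fromℚℂ fromℚℂ-homo
    module H = IsRingHomomorphism fromℚℂ-homo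
  open IntegralPoints em ℛ using (pair-cong)
  open PolynomialIdentities ℂ-ring ℂ-isField _≈ᶜ?_
  open CharacteristicZero ℂ-char0 using (pair)
  open Matrices ℚ-ring using (1ᴹ)

  ev : Fin n → Vector ℚ n → ℂ
  ev i x = pair (l i) (fromℚℂ ∘ x)

  ev-cong : ∀ i {x y : Vector ℚ n} → (∀ r → x r ≡ y r) → ev i x ℂ.≈ ev i y
  ev-cong i x≗y = pair-cong (l i) (λ r → ℂ.reflexive (≡.cong fromℚℂ (x≗y r)))

  ev-combination : ∀ i {m} (M : Fin m → Vector ℚ n) (c : Vector ℚ m) →
    ev i (λ r → ℚ^.sum (λ j → M j r ℚ.* c j)) ℂ.≈ ℂ^.sum (λ j → ev i (M j) ℂ.* fromℚℂ (c j))
  ev-combination i {m} M c = ℂ.trans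
    (pair-cong (l i) (λ r → ℂ.trans (φ.φ-sum m (λ j → M j r ℚ.* c j)) (CK.sum-cong m (λ j → H.*-homo (M j r) (c j)))))
    (CK.sum-*-sum (l i) (λ r j → fromℚℂ (M j r)) (fromℚℂ ∘ c))

  -- A condition on all forms at once. Under anisotropy it determines `A` from `ν`, so `divide` may
  -- work with the matrix whose columns are the `A (1ᴹ j)`.
  Eigen : (Vector ℚ n → Vector ℚ n) → (Fin n → ℂ) → Set
  Eigen A ν = ∀ i x → ev i (A x) ℂ.≈ ν i ℂ.* ev i x

  module _ (anisotropic : ∀ i (x : Vector ℚ n) → ev i x ℂ.≈ ℂ.0# → ∀ r → x r ≡ 0ℚ) where

    -- By anisotropy each single form embeds ℚⁿ into ℂ; equations between rational vectors can thus
    -- be verified after applying any one of them.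
    ev-injective : ∀ i {x y : Vector ℚ n} → ev i x ℂ.≈ ev i y → ∀ r → x r ≡ y r
    ev-injective i {x} {y} eq r = QF.minus≈0 (anisotropic i (λ r → x r ℚ.- y r) (ℂ.trans
      (pair-cong (l i) (λ r → ℂ.trans (H.+-homo (x r) (ℚ.- y r)) (ℂ.+-congˡ (ℂ.trans (H.-‿homo (y r)) (minus-one (fromℚℂ (y r)))))))
      (ℂ.trans (CharacteristicZero.pair-line ℂ-char0 (l i) (fromℚℂ ∘ x) (fromℚℂ ∘ y) (ℂ.- ℂ.1#))
        (ℂ.trans (ℂ.+-cong eq (ℂ.sym (minus-one (ev i y)))) (ℂ.-‿inverseʳ (ev i y))))) r)
      where
      minus-one : ∀ z → ℂ.- z ℂ.≈ ℂ.- ℂ.1# ℂ.* z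
      minus-one z = ℂ.trans (ℂ.-‿cong (ℂ.sym (ℂ.*-identityˡ z))) (CI.neg-*ˡ ℂ.1# z)

    -- If A x = 0, then ν i₀ times the value of the form `l i₀` at x is 0, whence x = 0 by
    -- anisotropy; an injective square matrix is surjective.
    divide : ∀ {A ν} → Eigen A ν → (∀ i → ¬ (ν i ℂ.≈ ℂ.0#)) → Fin n → ∀ y → ∃ λ (z : Vector ℚ n) → ∀ i → ν i ℂ.* ev i z ℂ.≈ ev i y
    divide {A} {ν} A-eigen ν≉0 i₀ y = proj₁ solution , λ i → ℂ.trans (ℂ.sym (matrix-eigen i (proj₁ solution))) (ev-cong i (proj₂ solution))
      where
      matrix : Fin n → Fin n → ℚ
      matrix r j = A (1ᴹ j) r
      matrix-eigen : ∀ i x → ev i (λ r → ℚ^.sum (λ j → matrix r j ℚ.* x j)) ℂ.≈ ν i ℂ.* ev i x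
      matrix-eigen i x = ℂ.trans (ev-combination i (λ j → A (1ᴹ j)) x) (ℂ.trans
        (CK.sum-cong n (λ j → ℂ.trans (ℂ.*-congʳ (A-eigen i (1ᴹ j))) (ℂ.*-assoc (ν i) (ev i (1ᴹ j)) (fromℚℂ (x j)))))
        (ℂ.trans (ℂ.sym (CK.*-distribˡ-∑ n (ν i) (λ j → ev i (1ᴹ j) ℂ.* fromℚℂ (x j))))
          (ℂ.*-congˡ (ℂ.trans (ℂ.sym (ev-combination i 1ᴹ x)) (ev-cong i (λ r → ≡.trans
            (RingKit.sum-cong ℚ-ring n (λ j → ℚ.*-comm (1ᴹ j r) (x j))) (RingKit.sum-1ᴹʳ ℚ-ring r x)))))))
      injective : QF.TrivialKernel matrix
      injective x Mx≡0 = anisotropic i₀ x (CF.cancel-unit (ν≉0 i₀) (ℂ.trans (ℂ.sym (matrix-eigen i₀ x))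
        (ℂ.trans (ev-cong i₀ Mx≡0) (CK.sum-zero n (λ r → ℂ.trans (ℂ.*-congˡ H.0#-homo) (ℂ.zeroʳ (l i₀ r)))))))
      solution : ∃ λ (z : Vector ℚ n) → ∀ r → ℚ^.sum (λ j → matrix r j ℚ.* z j) ≡ y r
      solution = QF.injective⇒surjective matrix injective y

    module _ (e : Fin n → ℂ) (γ : Vector ℚ n → Vector ℚ n) (γ-eigen : Eigen γ e)
             (i₀ : Fin n) (e-distinct : ∀ i → i ≢ i₀ → ¬ (e i ℂ.≈ e i₀))
             (separating : ∀ (v : Vector ℂ n) → (∀ i → pair (l i) v ℂ.≈ ℂ.0#) → ∀ r → v r ℂ.≈ ℂ.0#)
             (b : Vector ℚ n) (b≢0 : ∃ λ r → b r ≢ 0ℚ) where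

      private
        m : ℕ
        m = suc n

        γ^ : ℕ → Vector ℚ n → Vector ℚ n
        γ^ zero    x = x
        γ^ (suc k) x = γ (γ^ k x)

        γ^-eigen : ∀ k i x → ev i (γ^ k x) ℂ.≈ (e i ℂ^.^ k) ℂ.* ev i x
        γ^-eigen zero    i x = ℂ.sym (ℂ.*-identityˡ (ev i x))
        γ^-eigen (suc k) i x = ℂ.trans (γ-eigen i (γ^ k x)) (ℂ.trans (ℂ.*-congˡ (γ^-eigen k i x)) (ℂ.sym (ℂ.*-assoc (e i) (e i ℂ^.^ k) (ev i x))))

        ev-b≉0 : ∀ i → ¬ (ev i b ℂ.≈ ℂ.0#)
        ev-b≉0 i eq = proj₂ b≢0 (anisotropic i b eq (proj₁ b≢0))

        polynomial : Vector ℂ m → Vector ℚ n → Vector ℂ n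
        polynomial c x r = ℂ^.sum (λ k → fromℚℂ (γ^ (toℕ k) x r) ℂ.* c k)

        polynomial-eigen : ∀ i c x → pair (l i) (polynomial c x) ℂ.≈ ℂ^.sum (λ k → (e i ℂ^.^ toℕ k) ℂ.* c k) ℂ.* ev i x
        polynomial-eigen i c x = ℂ.trans (CK.sum-*-sum (l i) (λ r k → fromℚℂ (γ^ (toℕ k) x r)) c) (ℂ.trans
          (CK.sum-cong m (λ k → ℂ.trans (ℂ.*-congʳ (γ^-eigen (toℕ k) i x)) (rearrange (e i ℂ^.^ toℕ k) (ev i x) (c k))))
          (ℂ.sym (CK.*-distribʳ-∑ m (ev i x) (λ k → (e i ℂ^.^ toℕ k) ℂ.* c k))))
          where
          rearrange : ∀ p x c → (p ℂ.* x) ℂ.* c ℂ.≈ (p ℂ.* c) ℂ.* x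
          rearrange p x c = ℂ.trans (ℂ.*-assoc p x c) (ℂ.trans (ℂ.*-congˡ (ℂ.*-comm x c)) (ℂ.sym (ℂ.*-assoc p c x)))

        -- The factors of ρ(t) = ∏ (t - e k) over k ≠ i₀; the constant factor 1 at `i₀` lets the
        -- product run over all of `Fin n`. This ρ vanishes at every eigenvalue except e i₀, whether
        -- or not the others coincide.
        factor₀ factor₁ : Fin n → ℂ
        factor₀ i = select (i Fin.≟ i₀) ℂ.1# (ℂ.- e i)
        factor₁ i = select (i Fin.≟ i₀) ℂ.0# ℂ.1#

        ρ-poly : DegreeBelow m (λ t → ℂ^.product (λ i → factor₀ i ℂ.+ t ℂ.* factor₁ i))
        ρ-poly = degree-product n factor₀ factor₁

        ρ : Vector ℂ m
        ρ = proj₁ ρ-poly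

        value : Vector ℂ m → Fin n → ℂ
        value c i = ℂ^.sum (λ k → (e i ℂ^.^ toℕ k) ℂ.* c k)

        horner-value : ∀ d (c : Vector ℂ d) t → ℂ^.sum (λ k → (t ℂ^.^ toℕ k) ℂ.* c k) ℂ.≈ horner c t
        horner-value zero    c t = ℂ.refl
        horner-value (suc d) c t = ℂ.+-cong (ℂ.*-identityˡ (c zero)) (ℂ.trans
          (CK.sum-cong d (λ k → ℂ.*-assoc t (t ℂ^.^ toℕ k) (c (suc k))))
          (ℂ.trans (ℂ.sym (CK.*-distribˡ-∑ d t (λ k → (t ℂ^.^ toℕ k) ℂ.* c (suc k)))) (ℂ.*-congˡ (horner-value d (c ∘ suc) t))))

        ρ-value : ∀ i → value ρ i ℂ.≈ ℂ^.product (λ k → factor₀ k ℂ.+ e i ℂ.* factor₁ k)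
        ρ-value i = ℂ.trans (horner-value m ρ (e i)) (ℂ.sym (proj₂ ρ-poly (e i)))

        ρ-value-off : ∀ i → i ≢ i₀ → value ρ i ℂ.≈ ℂ.0#
        ρ-value-off i i≢i₀ = ℂ.trans (ρ-value i) (CK.product-zero {f = λ k → factor₀ k ℂ.+ e i ℂ.* factor₁ k} i (ℂ.trans
          (ℂ.+-cong (ℂ.reflexive (select-no (i Fin.≟ i₀) i≢i₀)) (ℂ.trans (ℂ.*-congˡ (ℂ.reflexive (select-no (i Fin.≟ i₀) i≢i₀))) (ℂ.*-identityʳ (e i))))
          (ℂ.-‿inverseˡ (e i))))

        ρ-value-at : ¬ (value ρ i₀ ℂ.≈ ℂ.0#)
        ρ-value-at eq = CF.product-nonzero n factors (ℂ.trans (ℂ.sym (ρ-value i₀)) eq)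
          where
          factors : ∀ k → ¬ (factor₀ k ℂ.+ e i₀ ℂ.* factor₁ k ℂ.≈ ℂ.0#)
          factors k with k Fin.≟ i₀
          ... | yes _    = λ eq → IsField.0≉1 ℂ-isField (ℂ.sym (ℂ.trans (ℂ.sym (ℂ.trans (ℂ.+-congˡ (ℂ.zeroʳ (e i₀))) (ℂ.+-identityʳ ℂ.1#))) eq))
          ... | no  k≢i₀ = λ eq → e-distinct k k≢i₀ (ℂ.sym (CF.minus≈0 (ℂ.trans (ℂ.+-comm (e i₀) (ℂ.- e k)) (ℂ.trans (ℂ.+-congˡ (ℂ.sym (ℂ.*-identityʳ (e i₀)))) eq))))

        -- If ρ(γ) b were zero, the form `l i₀` would give ρ(e i₀) times its value at `b` as zero,
        -- and neither factor is. This coordinate serves to normalise the solutions below.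
        pivot : ∃ λ r → ¬ (polynomial ρ b r ℂ.≈ ℂ.0#)
        pivot = choose (CF.zero⊎nonzero (polynomial ρ b))
          where
          choose : (∀ r → polynomial ρ b r ℂ.≈ ℂ.0#) ⊎ (∃ λ r → ¬ (polynomial ρ b r ℂ.≈ ℂ.0#)) → ∃ λ r → ¬ (polynomial ρ b r ℂ.≈ ℂ.0#)
          choose (inj₂ found) = found
          choose (inj₁ zeros) = ⊥-elim (CF.*-nonzero ρ-value-at (ev-b≉0 i₀) (ℂ.trans (ℂ.sym (polynomial-eigen i₀ ρ b))
            (CK.sum-zero n (λ r → ℂ.trans (ℂ.*-congˡ (zeros r)) (ℂ.zeroʳ (l i₀ r))))))

        r₀ : Fin n
        r₀ = proj₁ pivot

        polynomialℚ : Vector ℚ m → Vector ℚ n → Vector ℚ n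
        polynomialℚ c x r = ℚ^.sum (λ k → γ^ (toℕ k) x r ℚ.* c k)

        polynomialℚ-eigen : ∀ c → Eigen (polynomialℚ c) (value (fromℚℂ ∘ c))
        polynomialℚ-eigen c i x = ℂ.trans
          (pair-cong (l i) (λ r → ℂ.trans (φ.φ-sum m (λ k → γ^ (toℕ k) x r ℚ.* c k)) (CK.sum-cong m (λ k → H.*-homo (γ^ (toℕ k) x r) (c k)))))
          (polynomial-eigen i (fromℚℂ ∘ c) x)

        -- Over ℂ the polynomial ρ in γ projects onto the i₀-th eigenline, so it maps w
        -- and b to proportional vectors; descending this relation to ℚ gives p and q.
        module Relation (w : Vector ℚ n) where

          ratio : ℂ
          ratio = ev i₀ w ℂ.* proj₁ (IsField.inverse ℂ-isField (ev i₀ b) (ev-b≉0 i₀))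

          ratio-b : ratio ℂ.* ev i₀ b ℂ.≈ ev i₀ w
          ratio-b = ℂ.trans (ℂ.*-assoc _ _ _) (ℂ.trans (ℂ.*-congˡ (ℂ.trans (ℂ.*-comm _ _) (proj₂ (IsField.inverse ℂ-isField (ev i₀ b) (ev-b≉0 i₀))))) (ℂ.*-identityʳ (ev i₀ w)))

          relation : ∀ r → polynomial ρ w r ℂ.+ ℂ.- ratio ℂ.* polynomial ρ b r ℂ.≈ ℂ.0#
          relation = separating (λ r → polynomial ρ w r ℂ.+ ℂ.- ratio ℂ.* polynomial ρ b r) (λ i → ℂ.trans
            (CharacteristicZero.pair-line ℂ-char0 (l i) (polynomial ρ w) (polynomial ρ b) (ℂ.- ratio))
            (ℂ.trans (ℂ.+-cong (polynomial-eigen i ρ w) (ℂ.*-congˡ (polynomial-eigen i ρ b))) (vanish i (i Fin.≟ i₀))))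
            where
            vanish : ∀ i → Dec (i ≡ i₀) → value ρ i ℂ.* ev i w ℂ.+ ℂ.- ratio ℂ.* (value ρ i ℂ.* ev i b) ℂ.≈ ℂ.0#
            vanish i (no i≢i₀) = ℂ.trans (ℂ.+-cong (ℂ.trans (ℂ.*-congʳ (ρ-value-off i i≢i₀)) (ℂ.zeroˡ (ev i w)))
              (ℂ.trans (ℂ.*-congˡ (ℂ.trans (ℂ.*-congʳ (ρ-value-off i i≢i₀)) (ℂ.zeroˡ (ev i b)))) (ℂ.zeroʳ (ℂ.- ratio)))) (ℂ.+-identityˡ ℂ.0#)
            vanish i (yes ≡.refl) = ℂ.trans (ℂ.+-cong (ℂ.*-congˡ (ℂ.sym ratio-b)) (ℂ.sym (CI.neg-*ˡ ratio (value ρ i ℂ.* ev i b))))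
              (ℂ.trans (ℂ.+-congˡ (ℂ.-‿cong (CI.*-swap ratio (value ρ i) (ev i b)))) (ℂ.-‿inverseʳ (value ρ i ℂ.* (ratio ℂ.* ev i b))))

          s : ℂ
          s = proj₁ (IsField.inverse ℂ-isField (polynomial ρ b r₀) (proj₂ pivot))

          -- The unknowns are the coefficients of p, followed by those of q. Row `zero` sets the
          -- coordinate `r₀` of p(γ) b to 1, which excludes p = 0; the other rows express p(γ) w +
          -- q(γ) b = 0. Over ℂ, suitable multiples of ρ solve it.
          system : Fin (suc n) → Fin (m ℕ.+ m) → ℚ
          system zero    j = [ (λ k → γ^ (toℕ k) b r₀) , (λ k → 0ℚ) ]′ (Fin.splitAt m j)
          system (suc r) j = [ (λ k → γ^ (toℕ k) w r) , (λ k → γ^ (toℕ k) b r) ]′ (Fin.splitAt m j)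

          target : Fin (suc n) → ℚ
          target zero    = 1ℚ
          target (suc r) = 0ℚ

          solutionᶜ : Fin (m ℕ.+ m) → ℂ
          solutionᶜ j = [ (λ k → ρ k ℂ.* s) , (λ k → ρ k ℂ.* (ℂ.- ratio ℂ.* s)) ]′ (Fin.splitAt m j)

          scaled : ∀ x r t → ℂ^.sum (λ k → fromℚℂ (γ^ (toℕ k) x r) ℂ.* (ρ k ℂ.* t)) ℂ.≈ polynomial ρ x r ℂ.* t
          scaled x r t = ℂ.trans (CK.sum-cong m (λ k → ℂ.sym (ℂ.*-assoc (fromℚℂ (γ^ (toℕ k) x r)) (ρ k) t)))
            (ℂ.sym (CK.*-distribʳ-∑ m t (λ k → fromℚℂ (γ^ (toℕ k) x r) ℂ.* ρ k)))

          φ-blocks : ∀ {k} (f g : Fin k → ℚ) (j : Fin k ⊎ Fin k) → fromℚℂ ([ f , g ]′ j) ≡ [ fromℚℂ ∘ f , fromℚℂ ∘ g ]′ j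
          φ-blocks f g (inj₁ _) = ≡.refl
          φ-blocks f g (inj₂ _) = ≡.refl

          blocksᶜ : ∀ (f g : Fin m → ℚ) →
            ℂ^.sum (λ j → fromℚℂ ([ f , g ]′ (Fin.splitAt m j)) ℂ.* solutionᶜ j) ℂ.≈
            ℂ^.sum (λ k → fromℚℂ (f k) ℂ.* (ρ k ℂ.* s)) ℂ.+ ℂ^.sum (λ k → fromℚℂ (g k) ℂ.* (ρ k ℂ.* (ℂ.- ratio ℂ.* s)))
          blocksᶜ f g = ℂ.trans (CK.sum-cong (m ℕ.+ m) (λ j → ℂ.*-congʳ {solutionᶜ j} (ℂ.reflexive (φ-blocks f g (Fin.splitAt m j)))))
            (CI.sum-blocks m (fromℚℂ ∘ f) (λ k → ρ k ℂ.* s) (fromℚℂ ∘ g) (λ k → ρ k ℂ.* (ℂ.- ratio ℂ.* s)))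

          solvesᶜ : ∀ i → ℂ^.sum (λ j → fromℚℂ (system i j) ℂ.* solutionᶜ j) ℂ.≈ fromℚℂ (target i)
          solvesᶜ zero    = ℂ.trans (blocksᶜ (λ k → γ^ (toℕ k) b r₀) (λ k → 0ℚ)) (ℂ.trans (ℂ.+-cong (scaled b r₀ s)
              (CK.sum-zero m (λ k → ℂ.trans (ℂ.*-congʳ {ρ k ℂ.* (ℂ.- ratio ℂ.* s)} H.0#-homo) (ℂ.zeroˡ (ρ k ℂ.* (ℂ.- ratio ℂ.* s))))))
            (ℂ.trans (ℂ.+-identityʳ _) (ℂ.trans (proj₂ (IsField.inverse ℂ-isField (polynomial ρ b r₀) (proj₂ pivot))) (ℂ.sym H.1#-homo))))
          solvesᶜ (suc r) = ℂ.trans (blocksᶜ (λ k → γ^ (toℕ k) w r) (λ k → γ^ (toℕ k) b r)) (ℂ.trans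
            (ℂ.+-cong (scaled w r s) (ℂ.trans (scaled b r (ℂ.- ratio ℂ.* s)) (ℂ.trans (CI.*-swap (polynomial ρ b r) (ℂ.- ratio) s) (ℂ.sym (ℂ.*-assoc (ℂ.- ratio) (polynomial ρ b r) s)))))
            (ℂ.trans (ℂ.sym (ℂ.distribʳ s (polynomial ρ w r) (ℂ.- ratio ℂ.* polynomial ρ b r)))
              (ℂ.trans (ℂ.*-congʳ (relation r)) (ℂ.trans (ℂ.zeroˡ s) (ℂ.sym H.0#-homo)))))

          descended : ∃ λ (z : Vector ℚ (m ℕ.+ m)) → ∀ i → ℚ^.sum (λ j → system i j ℚ.* z j) ≡ target i
          descended = QC.descend-solution (m ℕ.+ m) system target solutionᶜ solvesᶜ

          p q : Vector ℚ m
          p k = proj₁ descended (k Fin.↑ˡ m)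
          q k = proj₁ descended (m Fin.↑ʳ k)

          blocksℚ : ∀ (f g : Fin m → ℚ) → ℚ^.sum (λ j → [ f , g ]′ (Fin.splitAt m j) ℚ.* proj₁ descended j) ≡
            ℚ^.sum (λ k → f k ℚ.* p k) ℚ.+ ℚ^.sum (λ k → g k ℚ.* q k)
          blocksℚ f g = ≡.trans (RingKit.sum-cong ℚ-ring (m ℕ.+ m) (λ j → ≡.cong ([ f , g ]′ (Fin.splitAt m j) ℚ.*_) (unsplit j)))
            (RingIdentities.sum-blocks ℚ-ring m f p g q)
            where
            cases : ∀ (j : Fin m ⊎ Fin m) → proj₁ descended (Fin.join m m j) ≡ [ p , q ]′ j
            cases (inj₁ _) = ≡.refl
            cases (inj₂ _) = ≡.refl
            unsplit : ∀ j → proj₁ descended j ≡ [ p , q ]′ (Fin.splitAt m j)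
            unsplit j = ≡.trans (≡.cong (proj₁ descended) (≡.sym (Fin.join-splitAt m m j))) (cases (Fin.splitAt m j))

          normalised : polynomialℚ p b r₀ ≡ 1ℚ
          normalised = ≡.trans (≡.sym (≡.trans (≡.cong (polynomialℚ p b r₀ ℚ.+_) (RingKit.sum-zero ℚ-ring m (λ k → ℚ.*-zeroˡ (q k)))) (ℚ.+-identityʳ _)))
            (≡.trans (≡.sym (blocksℚ (λ k → γ^ (toℕ k) b r₀) (λ k → 0ℚ))) (proj₂ descended zero))

          relationℚ : ∀ r → polynomialℚ p w r ℚ.+ polynomialℚ q b r ≡ 0ℚ
          relationℚ r = ≡.trans (≡.sym (blocksℚ (λ k → γ^ (toℕ k) w r) (λ k → γ^ (toℕ k) b r))) (proj₂ descended (suc r))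

      -- This presents `w` as A⁻¹ A′ b with simultaneously diagonal `A` and `A′`. With polynomials
      -- in γ for both, it says that `b` generates ℚⁿ over ℚ[γ].
      Fraction : Vector ℚ n → Set
      Fraction w = ∃₂ λ A ν → ∃₂ λ A′ ν′ → Eigen A ν × Eigen A′ ν′ ×
        (∀ i → ¬ (ν i ℂ.≈ ℂ.0#)) × (∀ i → ν i ℂ.* ev i w ℂ.≈ ν′ i ℂ.* ev i b)

      fraction : ∀ w → Fraction w
      fraction w = polynomialℚ p , value (fromℚℂ ∘ p) , polynomialℚ (λ k → ℚ.- q k) , value (fromℚℂ ∘ (λ k → ℚ.- q k)) ,
        polynomialℚ-eigen p , polynomialℚ-eigen (λ k → ℚ.- q k) , ν≉0 ,
        λ i → ℂ.trans (ℂ.sym (polynomialℚ-eigen p i w)) (ℂ.trans (ev-cong i agree) (polynomialℚ-eigen (λ k → ℚ.- q k) i b))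
        where
        open Relation w
        -- A vanishing eigenvalue would give p(γ) b = 0 by anisotropy, against the coordinate that
        -- was set to 1.
        ν≉0 : ∀ i → ¬ (value (fromℚℂ ∘ p) i ℂ.≈ ℂ.0#)
        ν≉0 i νi≈0 = IsField.0≉1 ℚ-isField (≡.trans (≡.sym (anisotropic i (polynomialℚ p b)
          (ℂ.trans (polynomialℚ-eigen p i b) (ℂ.trans (ℂ.*-congʳ νi≈0) (ℂ.zeroˡ (ev i b)))) r₀)) normalised)
        sum-neg : ∀ k (f g : Vector ℚ k) → ℚ^.sum (λ j → f j ℚ.* (ℚ.- g j)) ≡ ℚ.- ℚ^.sum (λ j → f j ℚ.* g j)
        sum-neg zero    f g = ≡.refl
        sum-neg (suc k) f g = ≡.trans (≡.cong₂ ℚ._+_ (≡.sym (ℚ.neg-distribʳ-* (f zero) (g zero))) (sum-neg k (f ∘ suc) (g ∘ suc)))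
          (≡.sym (ℚ.neg-distrib-+ (f zero ℚ.* g zero) _))
        agree : ∀ r → polynomialℚ p w r ≡ polynomialℚ (λ k → ℚ.- q k) b r
        agree r = QF.minus≈0 (≡.trans (≡.cong (polynomialℚ p w r ℚ.+_) (≡.trans (≡.cong ℚ.-_ (sum-neg m (λ k → γ^ (toℕ k) b r) q))
          (RingProperties.-‿involutive (CommutativeRing.ring ℚ-ring) (polynomialℚ q b r)))) (relationℚ r))

      -- With w = A⁻¹ A′ b the vector z = A⁻¹ A′ v has the property: it is the product of `w` and
      -- `v` in the multiplication with unit `b`.
      product-exists : ∀ w v → ∃ λ (z : Vector ℚ n) → ∀ i → ev i b ℂ.* ev i z ℂ.≈ ev i w ℂ.* ev i v
      product-exists w v = from-fraction (fraction w)
        where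
        from-fraction : Fraction w → ∃ λ (z : Vector ℚ n) → ∀ i → ev i b ℂ.* ev i z ℂ.≈ ev i w ℂ.* ev i v
        from-fraction (A , ν , A′ , ν′ , A-eigen , A′-eigen , ν≉0 , relation) = quotient-of (divide {A} {ν} A-eigen ν≉0 i₀ (A′ v))
          where
          quotient-of : (∃ λ (z : Vector ℚ n) → ∀ i → ν i ℂ.* ev i z ℂ.≈ ev i (A′ v)) →
            ∃ λ (z : Vector ℚ n) → ∀ i → ev i b ℂ.* ev i z ℂ.≈ ev i w ℂ.* ev i v
          quotient-of (z , νz≈) = z , λ i → CF.*-cancelˡ (ν≉0 i) (ℂ.trans (CI.*-swap (ν i) (ev i b) (ev i z))
            (ℂ.trans (ℂ.*-congˡ (ℂ.trans (νz≈ i) (A′-eigen i v))) (ℂ.trans (CI.*-swap (ev i b) (ν′ i) (ev i v))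
              (ℂ.trans (ℂ.sym (ℂ.*-assoc (ν′ i) (ev i b) (ev i v))) (ℂ.trans (ℂ.*-congʳ (ℂ.sym (relation i))) (ℂ.*-assoc (ν i) (ev i w) (ev i v)))))))

      -- With w = A⁻¹ A′ b it is z = A′⁻¹ A b; the eigenvalues of `A′` are nonzero because no form
      -- vanishes at `w`.
      inverse-exists : ∀ w → (∃ λ r → w r ≢ 0ℚ) → ∃ λ (z : Vector ℚ n) → ∀ i → ev i w ℂ.* ev i z ℂ.≈ ev i b ℂ.* ev i b
      inverse-exists w w≢0 = from-fraction (fraction w)
        where
        from-fraction : Fraction w → ∃ λ (z : Vector ℚ n) → ∀ i → ev i w ℂ.* ev i z ℂ.≈ ev i b ℂ.* ev i b
        from-fraction (A , ν , A′ , ν′ , A-eigen , A′-eigen , ν≉0 , relation) = quotient-of (divide {A′} {ν′} A′-eigen ν′≉0 i₀ (A b))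
          where
          ν′≉0 : ∀ i → ¬ (ν′ i ℂ.≈ ℂ.0#)
          ν′≉0 i ν′i≈0 = CF.*-nonzero (ν≉0 i) (λ eq → proj₂ w≢0 (anisotropic i w eq (proj₁ w≢0)))
            (ℂ.trans (relation i) (ℂ.trans (ℂ.*-congʳ ν′i≈0) (ℂ.zeroˡ (ev i b))))
          quotient-of : (∃ λ (z : Vector ℚ n) → ∀ i → ν′ i ℂ.* ev i z ℂ.≈ ev i (A b)) →
            ∃ λ (z : Vector ℚ n) → ∀ i → ev i w ℂ.* ev i z ℂ.≈ ev i b ℂ.* ev i b
          quotient-of (z , ν′z≈) = z , λ i → CF.*-cancelˡ (ν≉0 i) (ℂ.trans (ℂ.sym (ℂ.*-assoc (ν i) (ev i w) (ev i z)))
            (ℂ.trans (ℂ.*-congʳ (relation i)) (ℂ.trans (ℂ.*-congʳ (ℂ.*-comm (ν′ i) (ev i b))) (ℂ.trans (ℂ.*-assoc (ev i b) (ν′ i) (ev i z))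
              (ℂ.trans (ℂ.*-congˡ (ℂ.trans (ν′z≈ i) (A-eigen i b))) (CI.*-swap (ev i b) (ν i) (ev i b)))))))

-- The multiplication on ℚⁿ and its embeddings into ℂ

module FieldOfMultipliers (em : ExcludedMiddle 0ℓ) (ℛ : CompleteOrderedField) {n : ℕ}
    (l : Fin n → Vector (Over.ℂ ℛ) n) where
  open Over ℛ
  open ComplexNumbers em ℛ
  open RationalMultipliers em ℛ l
  private
    module ℂ = CommutativeRing ℂ-ring
    module ℂ^ = RawSemiringDefinitions (RawRing.rawSemiring ℂ.rawRing)
    module CK = RingKit ℂ-ring
    module CI = RingIdentities ℂ-ring
    module CF = FieldKit ℂ-ring ℂ-isField _≈ᶜ?_
    module QF = FieldKit ℚ-ring ℚ-isField ℚ._≟_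
    module H = IsRingHomomorphism fromℚℂ-homo
  open IntegralPoints em ℛ using (independent⇒spanning)
  open Matrices ℚ-ring using (1ᴹ)
  open Matrices ℂ-ring using () renaming (1ᴹ to 1ᴹᶜ)

  ev-basis : ∀ i x → ev i x ℂ.≈ ℂ^.sum (λ j → ev i (1ᴹ j) ℂ.* fromℚℂ (x j))
  ev-basis i x = ℂ.trans (ev-cong i (λ r → ≡.sym (≡.trans (RingKit.sum-cong ℚ-ring n (λ j → ℚ.*-comm (1ᴹ j r) (x j))) (RingKit.sum-1ᴹʳ ℚ-ring r x))))
    (ev-combination i 1ᴹ x)

  ev-unit : ∀ i r → ev i (1ᴹ r) ℂ.≈ l i r
  ev-unit i r = ℂ.trans (CK.sum-single r (λ s → l i s ℂ.* fromℚℂ (1ᴹ r s))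
      (λ s r≢s → ℂ.trans (ℂ.*-congˡ (ℂ.trans (ℂ.reflexive (≡.cong fromℚℂ (RingKit.1ᴹ-off-diagonal ℚ-ring r≢s))) H.0#-homo)) (ℂ.zeroʳ (l i s))))
    (ℂ.trans (ℂ.*-congˡ (ℂ.trans (ℂ.reflexive (≡.cong fromℚℂ (RingKit.1ᴹ-diagonal ℚ-ring r))) H.1#-homo)) (ℂ.*-identityʳ (l i r)))

  ev-+ : ∀ i x y → ev i (λ r → x r ℚ.+ y r) ℂ.≈ ev i x ℂ.+ ev i y
  ev-+ i x y = ℂ.trans (CK.sum-cong n (λ r → ℂ.trans (ℂ.*-congˡ (H.+-homo (x r) (y r))) (ℂ.distribˡ (l i r) (fromℚℂ (x r)) (fromℚℂ (y r)))))
    (CK.∑-+ n (λ r → l i r ℂ.* fromℚℂ (x r)) (λ r → l i r ℂ.* fromℚℂ (y r)))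

  ev-0 : ∀ i → ev i (λ r → 0ℚ) ℂ.≈ ℂ.0#
  ev-0 i = CK.sum-zero n (λ r → ℂ.trans (ℂ.*-congˡ H.0#-homo) (ℂ.zeroʳ (l i r)))

  ev-scale : ∀ i q x → ev i (λ r → q ℚ.* x r) ℂ.≈ fromℚℂ q ℂ.* ev i x
  ev-scale i q x = ℂ.trans (CK.sum-cong n (λ r → ℂ.trans (ℂ.*-congˡ (H.*-homo q (x r))) (CI.*-swap (l i r) (fromℚℂ q) (fromℚℂ (x r)))))
    (ℂ.sym (CK.*-distribˡ-∑ n (fromℚℂ q) (λ r → l i r ℂ.* fromℚℂ (x r))))

  ev-neg : ∀ i x → ev i (λ r → ℚ.- x r) ℂ.≈ ℂ.- ev i x
  ev-neg i x = ℂ.trans (opposite (ev i (λ r → ℚ.- x r)) (ev i x)) (ℂ.trans (ℂ.+-congʳ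
      (ℂ.trans (ℂ.sym (ev-+ i (λ r → ℚ.- x r) x)) (ℂ.trans (ev-cong i (λ r → ℚ.+-inverseˡ (x r))) (ev-0 i)))) (ℂ.+-identityˡ (ℂ.- ev i x)))
    where
    opposite : ∀ a b → a ℂ.≈ (a ℂ.+ b) ℂ.+ ℂ.- b
    opposite a b = ℂ.sym (ℂ.trans (ℂ.+-assoc a b (ℂ.- b)) (ℂ.trans (ℂ.+-congˡ (ℂ.-‿inverseʳ b)) (ℂ.+-identityʳ a)))

  module Construction
    (anisotropic : ∀ i (x : Vector ℚ n) → ev i x ℂ.≈ ℂ.0# → ∀ r → x r ≡ 0ℚ)
    (l-independent : LinearlyIndependent l) (i₀ : Fin n)
    (b : Vector ℚ n) (b≢0 : ∃ λ r → b r ≢ 0ℚ)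
    (mul : ∀ w v → ∃ λ (z : Vector ℚ n) → ∀ i → ev i b ℂ.* ev i z ℂ.≈ ev i w ℂ.* ev i v)
    (inv : ∀ w → (∃ λ r → w r ≢ 0ℚ) → ∃ λ (z : Vector ℚ n) → ∀ i → ev i w ℂ.* ev i z ℂ.≈ ev i b ℂ.* ev i b) where

    ev-b≉0 : ∀ i → ¬ (ev i b ℂ.≈ ℂ.0#)
    ev-b≉0 i eq = proj₂ b≢0 (anisotropic i b eq (proj₁ b≢0))

    κ : Fin n → ℂ
    κ i = proj₁ (IsField.inverse ℂ-isField (ev i b) (ev-b≉0 i))

    b*κ≈1 : ∀ i → ev i b ℂ.* κ i ℂ.≈ ℂ.1#
    b*κ≈1 i = proj₂ (IsField.inverse ℂ-isField (ev i b) (ev-b≉0 i))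

    κ≉0 : ∀ i → ¬ (κ i ℂ.≈ ℂ.0#)
    κ≉0 i κ≈0 = IsField.0≉1 ℂ-isField (ℂ.trans (ℂ.sym (ℂ.zeroʳ (ev i b))) (ℂ.trans (ℂ.*-congˡ (ℂ.sym κ≈0)) (b*κ≈1 i)))

    Θ : Fin n → Vector ℚ n → ℂ
    Θ i x = κ i ℂ.* ev i x

    Θ-b : ∀ i → Θ i b ℂ.≈ ℂ.1#
    Θ-b i = ℂ.trans (ℂ.*-comm (κ i) (ev i b)) (b*κ≈1 i)

    Θ-injective : ∀ i {x y} → Θ i x ℂ.≈ Θ i y → ∀ r → x r ≡ y r
    Θ-injective i eq = ev-injective anisotropic i (CF.*-cancelˡ (κ≉0 i) eq)

    -- Equality is read off through `Θ i₀`, which makes this map injective by definition and lets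
    -- the ring laws be inherited from ℂ. It amounts to equality of coordinates, so the other `Θ i`
    -- respect it.
    K-raw : RawRing 0ℓ 0ℓ
    K-raw = record
      { Carrier = Vector ℚ n
      ; _≈_ = λ x y → Θ i₀ x ℂ.≈ Θ i₀ y
      ; _+_ = λ x y r → x r ℚ.+ y r
      ; _*_ = λ x y → proj₁ (mul x y)
      ; -_  = λ x r → ℚ.- x r
      ; 0#  = λ r → 0ℚ
      ; 1#  = b
      }

    Θ-cong : ∀ i {x y} → Θ i₀ x ℂ.≈ Θ i₀ y → Θ i x ℂ.≈ Θ i y
    Θ-cong i {x} {y} eq = ℂ.*-congˡ (ev-cong i (Θ-injective i₀ {x} {y} eq))

    private
      b-square : ∀ i z → (κ i ℂ.* κ i) ℂ.* (ev i b ℂ.* z) ℂ.≈ κ i ℂ.* z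
      b-square i z = ℂ.trans (CI.*-interchange (κ i) (κ i) (ev i b) z) (ℂ.trans (ℂ.*-congʳ (Θ-b i)) (ℂ.*-identityˡ (κ i ℂ.* z)))

    Θ-* : ∀ i x y → Θ i (proj₁ (mul x y)) ℂ.≈ Θ i x ℂ.* Θ i y
    Θ-* i x y = ℂ.trans (ℂ.sym (b-square i (ev i (proj₁ (mul x y))))) (ℂ.trans (ℂ.*-congˡ (proj₂ (mul x y) i))
      (CI.*-interchange (κ i) (κ i) (ev i x) (ev i y)))

    Θ-homo : ∀ i → IsRingHomomorphism K-raw ℂ.rawRing (Θ i)
    Θ-homo i = record
      { isSemiringHomomorphism = record
        { isNearSemiringHomomorphism = record
          { +-isMonoidHomomorphism = record
            { isMagmaHomomorphism = record
              { isRelHomomorphism = record { cong = λ {x} {y} → Θ-cong i {x} {y} }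
              ; homo = λ x y → ℂ.trans (ℂ.*-congˡ (ev-+ i x y)) (ℂ.distribˡ (κ i) (ev i x) (ev i y))
              }
            ; ε-homo = ℂ.trans (ℂ.*-congˡ (ev-0 i)) (ℂ.zeroʳ (κ i))
            }
          ; *-homo = Θ-* i
          }
        ; 1#-homo = Θ-b i
        }
      ; -‿homo = λ x → ℂ.trans (ℂ.*-congˡ (ev-neg i x)) (ℂ.sym (RingProperties.-‿distribʳ-* ℂ.ring (κ i) (ev i x)))
      }

    K-ring : CommutativeRing 0ℓ 0ℓ
    K-ring = record
      { RawRing K-raw
      ; isCommutativeRing = RingMonomorphism.isCommutativeRing {R₁ = K-raw} {R₂ = ℂ.rawRing} {⟦_⟧ = Θ i₀}
          (record { isRingHomomorphism = Θ-homo i₀ ; injective = λ eq → eq }) ℂ.isCommutativeRing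
      }

    private
      module K = CommutativeRing K-ring
      module K^ = RawSemiringDefinitions (RawRing.rawSemiring K.rawRing)

    Θ-sum : ∀ i m (f : Fin m → Vector ℚ n) → Θ i (K^.sum f) ℂ.≈ ℂ^.sum (Θ i ∘ f)
    Θ-sum i = RingHomKit.φ-sum K-ring ℂ-ring (Θ i) (Θ-homo i)

    ι : ℚ → Vector ℚ n
    ι q r = q ℚ.* b r

    Θ-ι : ∀ i q → Θ i (ι q) ℂ.≈ fromℚℂ q
    Θ-ι i q = ℂ.trans (ℂ.*-congˡ (ev-scale i q b)) (ℂ.trans (CI.*-swap (κ i) (fromℚℂ q) (ev i b))
      (ℂ.trans (ℂ.*-congˡ (Θ-b i)) (ℂ.*-identityʳ (fromℚℂ q))))

    private
      module Θ₀ = IsRingHomomorphism (Θ-homo i₀)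

    ι-homo : IsRingHomomorphism ℚ.+-*-rawRing K-raw ι
    ι-homo = record
      { isSemiringHomomorphism = record
        { isNearSemiringHomomorphism = record
          { +-isMonoidHomomorphism = record
            { isMagmaHomomorphism = record
              { isRelHomomorphism = record { cong = λ { ≡.refl → ℂ.refl } }
              ; homo = λ p q → ℂ.trans (Θ-ι i₀ (p ℚ.+ q)) (ℂ.trans (H.+-homo p q)
                  (ℂ.sym (ℂ.trans (Θ₀.+-homo (ι p) (ι q)) (ℂ.+-cong (Θ-ι i₀ p) (Θ-ι i₀ q)))))
              }
            ; ε-homo = ℂ.trans (Θ-ι i₀ 0ℚ) (ℂ.trans H.0#-homo (ℂ.sym Θ₀.0#-homo))
            }
          ; *-homo = λ p q → ℂ.trans (Θ-ι i₀ (p ℚ.* q)) (ℂ.trans (H.*-homo p q)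
              (ℂ.sym (ℂ.trans (Θ₀.*-homo (ι p) (ι q)) (ℂ.*-cong (Θ-ι i₀ p) (Θ-ι i₀ q)))))
          }
        ; 1#-homo = ℂ.trans (Θ-ι i₀ 1ℚ) (ℂ.trans H.1#-homo (ℂ.sym Θ₀.1#-homo))
        }
      ; -‿homo = λ q → ℂ.trans (Θ-ι i₀ (ℚ.- q)) (ℂ.trans (H.-‿homo q)
          (ℂ.sym (ℂ.trans (Θ₀.-‿homo (ι q)) (ℂ.-‿cong (Θ-ι i₀ q)))))
      }

    Θ-basis : ∀ i (q : Vector ℚ n) → Θ i (K^.sum (λ j → ι (q j) K.* 1ᴹ j)) ℂ.≈ Θ i q
    Θ-basis i q = ℂ.trans (Θ-sum i n (λ j → ι (q j) K.* 1ᴹ j)) (ℂ.trans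
      (CK.sum-cong n (λ j → ℂ.trans (Θ-* i (ι (q j)) (1ᴹ j)) (ℂ.trans (ℂ.*-congʳ (Θ-ι i (q j)))
        (ℂ.trans (CI.*-swap (fromℚℂ (q j)) (κ i) (ev i (1ᴹ j))) (ℂ.*-congˡ (ℂ.*-comm (fromℚℂ (q j)) (ev i (1ᴹ j))))))))
      (ℂ.trans (ℂ.sym (CK.*-distribˡ-∑ n (κ i) (λ j → ev i (1ᴹ j) ℂ.* fromℚℂ (q j)))) (ℂ.*-congˡ (ℂ.sym (ev-basis i q)))))

    K-isField : IsField K-ring
    K-isField = record
      { 0≉1 = λ eq → IsField.0≉1 ℂ-isField (ℂ.trans (ℂ.sym Θ₀.0#-homo) (ℂ.trans eq (Θ-b i₀)))
      ; inverse = λ x x≉0 → inverse x (QF.zero⊎nonzero x) x≉0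
      }
      where
      inverse : ∀ x → (∀ r → x r ≡ 0ℚ) ⊎ (∃ λ r → x r ≢ 0ℚ) → ¬ (x K.≈ K.0#) → ∃ λ y → (x K.* y) K.≈ K.1#
      inverse x (inj₁ x≡0) x≉0 = ⊥-elim (x≉0 (ℂ.*-congˡ (ev-cong i₀ x≡0)))
      inverse x (inj₂ x≢0) _   = proj₁ (inv x x≢0) , ℂ.trans (Θ-* i₀ x (proj₁ (inv x x≢0)))
        (ℂ.trans (CI.*-interchange (κ i₀) (ev i₀ x) (κ i₀) (ev i₀ (proj₁ (inv x x≢0)))) (ℂ.trans (ℂ.*-congˡ (proj₂ (inv x x≢0) i₀)) (b-square i₀ (ev i₀ b))))

    -- The chosen basis is the standard basis of ℚⁿ, so the coefficients of the norm polynomial are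
    -- the lᵢⱼ / lᵢ(b).
    𝒦 : NumberField n
    𝒦 = record
      { ring        = K-ring
      ; isField     = K-isField
      ; ι           = ι
      ; ι-homo      = ι-homo
      ; α           = 1ᴹ
      ; spanning    = λ x → x , ℂ.sym (Θ-basis i₀ x)
      ; independent = λ q eq → Θ-injective i₀ {q} {λ r → 0ℚ} (ℂ.trans (ℂ.sym (Θ-basis i₀ q)) eq)
      }

    Θ-unit : ∀ i r → Θ i (1ᴹ r) ℂ.≈ κ i ℂ.* l i r
    Θ-unit i r = ℂ.*-congˡ (ev-unit i r)

    -- Evaluated at the unit vectors, the equality of two embeddings is a linear relation κᵢ lᵢ = κⱼ
    -- lⱼ between independent forms.
    Θ-distinct : ∀ {i j} → i ≢ j → ¬ (∀ x → Θ i x ℂ.≈ Θ j x)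
    Θ-distinct {i} {j} i≢j same = κ≉0 i (ℂ.trans (ℂ.sym cᵢ≈κᵢ) (l-independent c c-relation i))
      where
      c : Vector ℂ n
      c k = κ i ℂ.* 1ᴹᶜ i k ℂ.+ ℂ.- (κ j ℂ.* 1ᴹᶜ j k)
      cᵢ≈κᵢ : c i ℂ.≈ κ i
      cᵢ≈κᵢ = ℂ.trans (ℂ.+-cong (ℂ.trans (ℂ.*-congˡ (ℂ.reflexive (CK.1ᴹ-diagonal i))) (ℂ.*-identityʳ (κ i)))
        (ℂ.trans (ℂ.-‿cong (ℂ.trans (ℂ.*-congˡ (ℂ.reflexive (CK.1ᴹ-off-diagonal (i≢j ∘ ≡.sym)))) (ℂ.zeroʳ (κ j)))) (RingProperties.-0#≈0# ℂ.ring)))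
        (ℂ.+-identityʳ (κ i))
      c-relation : ∀ r → ℂ^.sum (λ k → c k ℂ.* l k r) ℂ.≈ ℂ.0#
      c-relation r = ℂ.trans (CF.sum-eliminate n (κ j) (λ k → κ i ℂ.* 1ᴹᶜ i k) (1ᴹᶜ j) (λ k → l k r)) (ℂ.trans
        (ℂ.+-cong (ℂ.trans (CK.sum-cong n (λ k → ℂ.*-assoc (κ i) (1ᴹᶜ i k) (l k r))) (ℂ.trans (ℂ.sym (CK.*-distribˡ-∑ n (κ i) (λ k → 1ᴹᶜ i k ℂ.* l k r)))
            (ℂ.*-congˡ (CK.sum-1ᴹˡ i (λ k → l k r)))))
          (ℂ.-‿cong (ℂ.*-congˡ (CK.sum-1ᴹˡ j (λ k → l k r)))))
        (ℂ.trans (ℂ.+-congʳ (ℂ.trans (ℂ.sym (Θ-unit i r)) (ℂ.trans (same (1ᴹ r)) (Θ-unit j r)))) (ℂ.-‿inverseʳ (κ j ℂ.* l j r))))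

    -- After multiplication by the denominator both sides are the image of the numerator, on which
    -- ring homomorphisms have no choice. This makes an embedding of the field linear over ℚ.
    rational-homo-unique : ∀ (ψ : ℚ → ℂ) → IsRingHomomorphism ℚ.+-*-rawRing ℂ.rawRing ψ → ∀ q → ψ q ℂ.≈ fromℚℂ q
    rational-homo-unique ψ ψ-homo q = CF.*-cancelˡ den≉0 (ℂ.trans (numerator ψ ψ-homo) (ℂ.sym (numerator fromℚℂ fromℚℂ-homo)))
      where
      d : ℕ
      d = suc (ℚ.denominator-1 q)
      den≉0 : ¬ (CK.fromInt (+ d) ℂ.≈ ℂ.0#)
      den≉0 = ℂ-char0 (ℚ.denominator-1 q)
      clear : RingKit.fromInt ℚ-ring (+ d) ℚ.* q ≡ RingKit.fromInt ℚ-ring (ℚ.numerator q)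
      clear = fromℚ-clears q
      numerator : ∀ (ψ : ℚ → ℂ) → IsRingHomomorphism ℚ.+-*-rawRing ℂ.rawRing ψ → CK.fromInt (+ d) ℂ.* ψ q ℂ.≈ CK.fromInt (ℚ.numerator q)
      numerator ψ ψ-homo = ℂ.trans (ℂ.*-congʳ (ℂ.sym (RingHomKit.φ-fromInt ℚ-ring ℂ-ring ψ ψ-homo (+ d))))
        (ℂ.trans (ℂ.sym (IsRingHomomorphism.*-homo ψ-homo (RingKit.fromInt ℚ-ring (+ d)) q))
          (ℂ.trans (ℂ.reflexive (≡.cong ψ clear)) (RingHomKit.φ-fromInt ℚ-ring ℂ-ring ψ ψ-homo (ℚ.numerator q))))

    -- A further embedding φ is a combination Σ cᵢ ev i of the linear forms; multiplicativity
    -- and independence force cᵢ(Θᵢ - φ) = 0 for all i.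
    Θ-complete : ∀ φ → IsRingHomomorphism K-raw ℂ.rawRing φ → ∃ λ i → ∀ x → φ x ℂ.≈ Θ i x
    Θ-complete φ φ-homo = select-embedding (CF.zero⊎nonzero c)
      where
      module Φ = IsRingHomomorphism φ-homo
      coefficients : ∃ λ (c : Vector ℂ n) → ∀ r → ℂ^.sum (λ i → l i r ℂ.* c i) ℂ.≈ φ (1ᴹ r)
      coefficients = independent⇒spanning l-independent (λ r → φ (1ᴹ r))
      c : Vector ℂ n
      c = proj₁ coefficients
      φ∘ι-homo : IsRingHomomorphism ℚ.+-*-rawRing ℂ.rawRing (φ ∘ ι)
      φ∘ι-homo = record
        { isSemiringHomomorphism = record
          { isNearSemiringHomomorphism = record
            { +-isMonoidHomomorphism = record
              { isMagmaHomomorphism = record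
                { isRelHomomorphism = record { cong = λ { ≡.refl → ℂ.refl } }
                ; homo = λ p q → ℂ.trans (Φ.⟦⟧-cong {ι (p ℚ.+ q)} {ι p K.+ ι q} (I.+-homo p q)) (Φ.+-homo (ι p) (ι q))
                }
              ; ε-homo = ℂ.trans (Φ.⟦⟧-cong {ι 0ℚ} {K.0#} I.0#-homo) Φ.0#-homo
              }
            ; *-homo = λ p q → ℂ.trans (Φ.⟦⟧-cong {ι (p ℚ.* q)} {ι p K.* ι q} (I.*-homo p q)) (Φ.*-homo (ι p) (ι q))
            }
          ; 1#-homo = ℂ.trans (Φ.⟦⟧-cong {ι 1ℚ} {K.1#} I.1#-homo) Φ.1#-homo
          }
        ; -‿homo = λ q → ℂ.trans (Φ.⟦⟧-cong {ι (ℚ.- q)} {K.- ι q} (I.-‿homo q)) (Φ.-‿homo (ι q))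
        }
        where module I = IsRingHomomorphism ι-homo
      φ-combination : ∀ x → φ x ℂ.≈ ℂ^.sum (λ i → c i ℂ.* ev i x)
      φ-combination x = ℂ.trans (Φ.⟦⟧-cong {x} {K^.sum (λ j → ι (x j) K.* 1ᴹ j)} (ℂ.sym (Θ-basis i₀ x)))
        (ℂ.trans (RingHomKit.φ-sum K-ring ℂ-ring φ φ-homo n (λ j → ι (x j) K.* 1ᴹ j))
          (ℂ.trans (CK.sum-cong n (λ j → ℂ.trans (Φ.*-homo (ι (x j)) (1ᴹ j)) (ℂ.trans (ℂ.*-comm (φ (ι (x j))) (φ (1ᴹ j)))
              (ℂ.*-cong (ℂ.trans (ℂ.sym (proj₂ coefficients j)) (CK.sum-cong n (λ i → ℂ.*-comm (l i j) (c i)))) (rational-homo-unique (φ ∘ ι) φ∘ι-homo (x j))))))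
            (ℂ.sym (CK.sum-*-sum c l (fromℚℂ ∘ x)))))
      annihilates : ∀ x i → c i ℂ.* (Θ i x ℂ.+ ℂ.- φ x) ℂ.≈ ℂ.0#
      annihilates x = l-independent (λ i → c i ℂ.* (Θ i x ℂ.+ ℂ.- φ x)) (λ r → ℂ.trans
        (CK.sum-cong n (λ i → ℂ.trans (ℂ.*-congʳ (ℂ.*-comm (c i) (Θ i x ℂ.+ ℂ.- φ x))) (ℂ.trans (ℂ.*-assoc (Θ i x ℂ.+ ℂ.- φ x) (c i) (l i r))
          (ℂ.trans (ℂ.distribʳ (c i ℂ.* l i r) (Θ i x) (ℂ.- φ x)) (ℂ.+-cong (term i r) (ℂ.*-congˡ (ℂ.*-congˡ (ℂ.sym (ev-unit i r)))))))))
        (ℂ.trans (CK.∑-+ n (λ i → c i ℂ.* ev i (x K.* 1ᴹ r)) (λ i → ℂ.- φ x ℂ.* (c i ℂ.* ev i (1ᴹ r))))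
          (ℂ.trans (ℂ.+-cong (ℂ.trans (ℂ.sym (φ-combination (x K.* 1ᴹ r))) (Φ.*-homo x (1ᴹ r)))
              (ℂ.trans (ℂ.sym (CK.*-distribˡ-∑ n (ℂ.- φ x) (λ i → c i ℂ.* ev i (1ᴹ r)))) (ℂ.*-congˡ (ℂ.sym (φ-combination (1ᴹ r))))))
            (CI.opposite-sum (φ x) (φ (1ᴹ r))))))
        where
        term : ∀ i r → Θ i x ℂ.* (c i ℂ.* l i r) ℂ.≈ c i ℂ.* ev i (x K.* 1ᴹ r)
        term i r = ℂ.trans (CI.*-swap (Θ i x) (c i) (l i r)) (ℂ.*-congˡ (ℂ.trans (ℂ.*-congˡ (ℂ.sym (ev-unit i r)))
          (CF.*-cancelˡ (κ≉0 i) (ℂ.trans (CI.*-swap (κ i) (Θ i x) (ev i (1ᴹ r))) (ℂ.sym (Θ-* i x (1ᴹ r)))))))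
      select-embedding : (∀ i → c i ℂ.≈ ℂ.0#) ⊎ (∃ λ i → ¬ (c i ℂ.≈ ℂ.0#)) → ∃ λ i → ∀ x → φ x ℂ.≈ Θ i x
      select-embedding (inj₁ c≈0) = ⊥-elim (IsField.0≉1 ℂ-isField (ℂ.trans (ℂ.sym (CK.sum-zero n (λ i → ℂ.trans (ℂ.*-congʳ (c≈0 i)) (ℂ.zeroˡ (ev i b)))))
        (ℂ.trans (ℂ.sym (φ-combination b)) Φ.1#-homo)))
      select-embedding (inj₂ (i , ci≉0)) = i , λ x → ℂ.sym (CF.minus≈0 (CF.cancel-unit ci≉0 (annihilates x i)))

    embeddings : AllEmbeddings 𝒦 Θ
    embeddings = record { homo = Θ-homo ; distinct = Θ-distinct ; complete = Θ-complete }

-- Conjugation of the linear factors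

record Enumeration {n : ℕ} (P : Fin n → Set) : Set where
  field
    count    : ℕ
    element  : Fin count → Fin n
    holds    : ∀ k → P (element k)
    distinct : ∀ {j k} → element j ≡ element k → j ≡ k
    covers   : ∀ i → P i → ∃ λ k → element k ≡ i

enumerate : ∀ {n} {P : Fin n → Set} → (∀ i → Dec (P i)) → Enumeration P
enumerate {zero}  P? = record { count = 0 ; element = λ () ; holds = λ () ; distinct = λ { {()} } ; covers = λ () }
enumerate {suc n} {P} P? = extend (P? zero) (enumerate (P? ∘ suc))
  where
  extend : Dec (P zero) → Enumeration (P ∘ suc) → Enumeration P
  extend (no ¬p₀) E = record
    { count    = E.count
    ; element  = suc ∘ E.element
    ; holds    = E.holds
    ; distinct = E.distinct ∘ Fin.suc-injective
    ; covers   = λ { zero p₀ → ⊥-elim (¬p₀ p₀) ; (suc i) p → proj₁ (E.covers i p) , ≡.cong suc (proj₂ (E.covers i p)) }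
    }
    where module E = Enumeration E
  extend (yes p₀) E = record
    { count    = suc E.count
    ; element  = element
    ; holds    = λ { zero → p₀ ; (suc k) → E.holds k }
    ; distinct = λ {j} {k} → distinct j k
    ; covers   = λ { zero _ → zero , ≡.refl ; (suc i) p → suc (proj₁ (E.covers i p)) , ≡.cong suc (proj₂ (E.covers i p)) }
    }
    where
    module E = Enumeration E
    element : Fin (suc E.count) → Fin (suc n)
    element zero    = zero
    element (suc k) = suc (E.element k)
    distinct : ∀ j k → element j ≡ element k → j ≡ k
    distinct zero    zero    _  = ≡.refl
    distinct (suc j) (suc k) eq = ≡.cong suc (E.distinct (Fin.suc-injective eq))

-- Each orbit is represented by its smaller element; in the absence of fixed points exactly one of
-- `i` and `σ i` is smaller than its image.
fixed-point-free-involution : ∀ {n} (σ : Fin n → Fin n) → (∀ i → σ (σ i) ≡ i) → (∀ i → σ i ≢ i) →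
  ∃ λ s → Σ ((Fin s ⊎ Fin s ⊎ Fin 0) ↔ Fin n) λ index →
    ∀ k → Inverse.to index (inj₂ (inj₁ k)) ≡ σ (Inverse.to index (inj₁ k))
fixed-point-free-involution {n} σ σσ≡ σ≢ = E.count , mk↔ₛ′ to from to-from from-to , λ k → ≡.refl
  where
  Smaller : Fin n → Set
  Smaller i = toℕ i ℕ.< toℕ (σ i)
  E : Enumeration Smaller
  E = enumerate (λ i → toℕ i ℕ.<? toℕ (σ i))
  module E = Enumeration E
  to : Fin E.count ⊎ Fin E.count ⊎ Fin 0 → Fin n
  to (inj₁ k)        = E.element k
  to (inj₂ (inj₁ k)) = σ (E.element k)
  larger : ∀ i → ¬ Smaller i → Smaller (σ i)
  larger i ¬smaller = ≡.subst (λ j → toℕ (σ i) ℕ.< toℕ j) (≡.sym (σσ≡ i))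
    (ℕ.≤∧≢⇒< (ℕ.≮⇒≥ ¬smaller) (λ eq → σ≢ i (Fin.toℕ-injective eq)))
  from′ : ∀ i → Dec (Smaller i) → Fin E.count ⊎ Fin E.count ⊎ Fin 0
  from′ i (yes p) = inj₁ (proj₁ (E.covers i p))
  from′ i (no ¬p) = inj₂ (inj₁ (proj₁ (E.covers (σ i) (larger i ¬p))))
  from : Fin n → Fin E.count ⊎ Fin E.count ⊎ Fin 0
  from i = from′ i (toℕ i ℕ.<? toℕ (σ i))
  to-from : ∀ i → to (from i) ≡ i
  to-from i = cases (toℕ i ℕ.<? toℕ (σ i))
    where
    cases : ∀ d → to (from′ i d) ≡ i
    cases (yes p) = proj₂ (E.covers i p)
    cases (no ¬p) = ≡.trans (≡.cong σ (proj₂ (E.covers (σ i) (larger i ¬p)))) (σσ≡ i)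
  from-to : ∀ x → from (to x) ≡ x
  from-to (inj₁ k) = cases (toℕ (E.element k) ℕ.<? toℕ (σ (E.element k)))
    where
    cases : ∀ d → from′ (E.element k) d ≡ inj₁ k
    cases (yes p) = ≡.cong inj₁ (E.distinct (proj₂ (E.covers (E.element k) p)))
    cases (no ¬p) = ⊥-elim (¬p (E.holds k))
  from-to (inj₂ (inj₁ k)) = cases (toℕ (σ (E.element k)) ℕ.<? toℕ (σ (σ (E.element k))))
    where
    cases : ∀ d → from′ (σ (E.element k)) d ≡ inj₂ (inj₁ k)
    cases (yes p) = ⊥-elim (ℕ.<-asym (E.holds k) (≡.subst (λ j → toℕ (σ (E.element k)) ℕ.< toℕ j) (σσ≡ (E.element k)) p))
    cases (no ¬p) = ≡.cong (inj₂ ∘ inj₁) (E.distinct (≡.trans (proj₂ (E.covers (σ (σ (E.element k))) (larger (σ (E.element k)) ¬p))) (σσ≡ (E.element k))))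

module Factorization (em : ExcludedMiddle 0ℓ) (ℛ : CompleteOrderedField) {n : ℕ}
    (f : Over.ℝ[x].Poly ℛ n) (l : Fin n → Vector (Over.ℂ ℛ) n) (factors : Over.Factors ℛ f l) where
  open Over ℛ
  open ComplexNumbers em ℛ
  private
    module ℝ = CompleteOrderedField ℛ
    module ℂ = CommutativeRing ℂ-ring
    module ℂ^ = RawSemiringDefinitions (RawRing.rawSemiring ℂ.rawRing)
    module CK = RingKit ℂ-ring
    module CI = RingIdentities ℂ-ring
    module CF = FieldKit ℂ-ring ℂ-isField _≈ᶜ?_
    module Conj = IsRingHomomorphism conj-homo
  open IntegralPoints em ℛ using (pair-cong; independent⇒spanning)
  open PolynomialIdentities ℂ-ring ℂ-isField _≈ᶜ?_
  open CharacteristicZero ℂ-char0 using (pair; pair-line; proportional-factor)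
  open Matrices ℂ-ring using () renaming (1ᴹ to 1ᴹᶜ)
  open Factors factors

  eval-factorization : ∀ x → ℂ[x].eval (fromℝ[x] f) x ℂ.≈ ℂ^.product (λ i → pair (l i) x)
  eval-factorization x = ℂ.trans (E.≈ₚ⇒eval (fromℝ[x] f) (ℂ[x].productₚ (λ i → ℂ[x].linear (l i))) factorization x)
    (ℂ.trans (E.eval-productₚ n (λ i → ℂ[x].linear (l i)) x) (CK.product-cong n (λ i → E.eval-linear (l i) x)))
    where module E = Evaluation ℂ-ring

  factor-nonzero : ∀ i → ∃ λ j → ¬ (l i j ℂ.≈ ℂ.0#)
  factor-nonzero i = choose (CF.zero⊎nonzero (l i))
    where
    choose : (∀ j → l i j ℂ.≈ ℂ.0#) ⊎ (∃ λ j → ¬ (l i j ℂ.≈ ℂ.0#)) → ∃ λ j → ¬ (l i j ℂ.≈ ℂ.0#)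
    choose (inj₂ found) = found
    choose (inj₁ li≈0)  = ⊥-elim (IsField.0≉1 ℂ-isField (ℂ.trans
      (ℂ.sym (independent (1ᴹᶜ i) (λ j → ℂ.trans (CK.sum-1ᴹˡ i (λ k → l k j)) (li≈0 j)) i)) (ℂ.reflexive (CK.1ᴹ-diagonal i))))

  proportional⇒≡ : ∀ {i k} z → (∀ j → l i j ℂ.≈ z ℂ.* l k j) → i ≡ k
  proportional⇒≡ {i} {k} z li≈zlk = decide (i Fin.≟ k)
    where
    c : Vector ℂ n
    c m = 1ᴹᶜ i m ℂ.+ ℂ.- (z ℂ.* 1ᴹᶜ k m)
    relation : ∀ j → ℂ^.sum (λ m → c m ℂ.* l m j) ℂ.≈ ℂ.0#
    relation j = ℂ.trans (CF.sum-eliminate n z (1ᴹᶜ i) (1ᴹᶜ k) (λ m → l m j))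
      (ℂ.trans (ℂ.+-cong (ℂ.trans (CK.sum-1ᴹˡ i (λ m → l m j)) (li≈zlk j)) (ℂ.-‿cong (ℂ.*-congˡ (CK.sum-1ᴹˡ k (λ m → l m j)))))
        (ℂ.-‿inverseʳ (z ℂ.* l k j)))
    decide : Dec (i ≡ k) → i ≡ k
    decide (yes eq) = eq
    decide (no i≢k) = ⊥-elim (IsField.0≉1 ℂ-isField (ℂ.trans (ℂ.sym (independent c relation i))
      (ℂ.trans (ℂ.+-cong (ℂ.reflexive (CK.1ᴹ-diagonal i)) (ℂ.trans (ℂ.-‿cong (ℂ.trans (ℂ.*-congˡ (ℂ.reflexive (CK.1ᴹ-off-diagonal (i≢k ∘ ≡.sym)))) (ℂ.zeroʳ z)))
        (RingProperties.-0#≈0# ℂ.ring))) (ℂ.+-identityʳ ℂ.1#))))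

  pair-conj : ∀ (a x : Vector ℂ n) → conj (pair a x) ℂ.≈ pair (conj ∘ a) (conj ∘ x)
  pair-conj a x = ℂ.trans (RingHomKit.φ-sum ℂ-ring ℂ-ring conj conj-homo n (λ j → a j ℂ.* x j)) (CK.sum-cong n (λ j → Conj.*-homo (a j) (x j)))

  -- Conjugating the argument of a real polynomial conjugates its value; used at the conjugate of
  -- `x`, this transfers the conjugation from the argument to the forms.
  conj-factorization : ∀ x → ℂ^.product (λ i → pair (conj ∘ l i) x) ℂ.≈ ℂ^.product (λ i → pair (l i) x)
  conj-factorization x = ℂ.trans (CK.product-cong n (λ i → ℂ.trans
      (pair-cong (conj ∘ l i) (λ j → ℂ.sym (conj-involutive (x j)))) (ℂ.sym (pair-conj (l i) (conj ∘ x)))))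
    (ℂ.trans (ℂ.sym (RingHomKit.φ-product ℂ-ring ℂ-ring conj conj-homo n (λ i → pair (l i) (conj ∘ x))))
      (ℂ.trans (Conj.⟦⟧-cong (ℂ.sym (eval-factorization (conj ∘ x)))) (ℂ.trans (ℂ.sym (eval-conj f (conj ∘ x)))
        (ℂ.trans (Evaluation.eval-congʳ ℂ-ring (fromℝ[x] f) (λ j → conj-involutive (x j))) (eval-factorization x)))))

  conj-nonzero : ∀ {z} → ¬ (z ℂ.≈ ℂ.0#) → ¬ (conj z ℂ.≈ ℂ.0#)
  conj-nonzero {z} z≉0 eq = z≉0 (ℂ.trans (ℂ.sym (conj-involutive z)) (ℂ.trans (Conj.⟦⟧-cong eq) Conj.0#-homo))

  partner : ∀ i → ∃ λ k → ∃ λ z → ∀ j → l k j ℂ.≈ z ℂ.* conj (l i j)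
  partner i = proportional-factor n l (conj ∘ l i) (proj₁ (factor-nonzero i)) (conj-nonzero (proj₂ (factor-nonzero i)))
    (λ x vanish → ℂ.trans (ℂ.sym (conj-factorization x)) (CK.product-zero {f = λ i → pair (conj ∘ l i) x} i vanish))

  σ : Fin n → Fin n
  σ i = proj₁ (partner i)

  ζ : Fin n → ℂ
  ζ i = proj₁ (proj₂ (partner i))

  l-σ : ∀ i j → l (σ i) j ℂ.≈ ζ i ℂ.* conj (l i j)
  l-σ i = proj₂ (proj₂ (partner i))

  ζ≉0 : ∀ i → ¬ (ζ i ℂ.≈ ℂ.0#)
  ζ≉0 i ζ≈0 = proj₂ (factor-nonzero (σ i)) (ℂ.trans (l-σ i (proj₁ (factor-nonzero (σ i)))) (ℂ.trans (ℂ.*-congʳ ζ≈0) (ℂ.zeroˡ _)))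

  σ-involutive : ∀ i → σ (σ i) ≡ i
  σ-involutive i = proportional⇒≡ (ζ (σ i) ℂ.* conj (ζ i)) (λ j → ℂ.trans (l-σ (σ i) j) (ℂ.trans
    (ℂ.*-congˡ (ℂ.trans (Conj.⟦⟧-cong (l-σ i j)) (ℂ.trans (Conj.*-homo (ζ i) (conj (l i j))) (ℂ.*-congˡ (conj-involutive (l i j))))))
    (ℂ.sym (ℂ.*-assoc (ζ (σ i)) (conj (ζ i)) (l i j)))))

  -- A form that is real up to a scalar is proportional to its conjugate, hence to `l (σ i)`.
  -- Contrapositively, the factors moved by `σ` are non-real, as a signature demands.
  real⇒fixed : ∀ i → RealUpToScaling (l i) → σ i ≡ i
  real⇒fixed i (r , z , z≉0 , li≈zr) = proportional⇒≡ (ζ i ℂ.* (conj z ℂ.* z⁻¹)) (λ j → ℂ.trans (l-σ i j) (ℂ.trans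
    (ℂ.*-congˡ (ℂ.trans (Conj.⟦⟧-cong (li≈zr j)) (ℂ.trans (Conj.*-homo z (fromℝ (r j))) (ℂ.trans (ℂ.*-congˡ (conj-fromℝ (r j))) (rescale j)))))
    (ℂ.sym (ℂ.*-assoc (ζ i) (conj z ℂ.* z⁻¹) (l i j)))))
    where
    z⁻¹ : ℂ
    z⁻¹ = proj₁ (IsField.inverse ℂ-isField z z≉0)
    rescale : ∀ j → conj z ℂ.* fromℝ (r j) ℂ.≈ (conj z ℂ.* z⁻¹) ℂ.* l i j
    rescale j = ℂ.sym (ℂ.trans (ℂ.*-congˡ (li≈zr j)) (ℂ.trans (CI.*-interchange (conj z) z⁻¹ z (fromℝ (r j)))
      (ℂ.trans (CI.*-interchange (conj z) z z⁻¹ (fromℝ (r j))) (ℂ.trans (ℂ.*-comm (conj z ℂ.* z⁻¹) (z ℂ.* fromℝ (r j)))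
        (ℂ.trans (CI.*-interchange z (fromℝ (r j)) (conj z) z⁻¹) (ℂ.trans (ℂ.*-congˡ (ℂ.*-comm (fromℝ (r j)) z⁻¹))
          (ℂ.trans (CI.*-interchange z (conj z) z⁻¹ (fromℝ (r j))) (ℂ.trans (ℂ.*-congʳ (proj₂ (IsField.inverse ℂ-isField z z≉0))) (ℂ.*-identityˡ _)))))))))

  no-fixed⇒totally-imaginary : (∀ i → σ i ≢ i) → ∃ λ s → HasSignature l s 0
  no-fixed⇒totally-imaginary σ≢ = build (fixed-point-free-involution σ σ-involutive σ≢)
    where
    build : (∃ λ s → Σ ((Fin s ⊎ Fin s ⊎ Fin 0) ↔ Fin n) λ index →
      ∀ k → Inverse.to index (inj₂ (inj₁ k)) ≡ σ (Inverse.to index (inj₁ k))) → ∃ λ s → HasSignature l s 0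
    build (s , index , paired) = s , record
      { index     = index
      ; nonReal   = λ k real → σ≢ _ (real⇒fixed _ real)
      ; conjugate = λ k → ≡.subst (λ i → l i ∝ (conj ∘ l (Inverse.to index (inj₁ k)))) (≡.sym (paired k)) (ζ _ , ζ≉0 _ , l-σ _)
      ; real      = λ ()
      }

  -- Independent forms, being `n` in number, span the dual space, and so each coordinate of `v` is a
  -- combination of the values that are assumed to vanish.
  separating : ∀ (v : Vector ℂ n) → (∀ i → pair (l i) v ℂ.≈ ℂ.0#) → ∀ r → v r ℂ.≈ ℂ.0#
  separating v lv≈0 r = ℂ.trans (ℂ.sym (CK.sum-1ᴹˡ r v)) (ℂ.trans
    (CK.sum-cong n (λ s → ℂ.*-congʳ {v s} (ℂ.trans (ℂ.sym (proj₂ dual s)) (CK.sum-cong n (λ i → ℂ.*-comm (l i s) (proj₁ dual i))))))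
    (ℂ.trans (ℂ.sym (CK.sum-*-sum (proj₁ dual) l v)) (CK.sum-zero n (λ i → ℂ.trans (ℂ.*-congˡ (lv≈0 i)) (ℂ.zeroʳ (proj₁ dual i))))))
    where
    dual : ∃ λ (c : Vector ℂ n) → ∀ s → ℂ^.sum (λ i → l i s ℂ.* c i) ℂ.≈ 1ᴹᶜ r s
    dual = independent⇒spanning independent (1ᴹᶜ r)

  module RealDirection (i₀ : Fin n) (i₀-fixed : σ i₀ ≡ i₀) where

    private
      dual : ∃ λ (v : Vector ℂ n) → ∀ i → pair (l i) v ℂ.≈ 1ᴹᶜ i₀ i
      dual = CF.injective⇒surjective l separating (1ᴹᶜ i₀)

      v : Vector ℂ n
      v = proj₁ dual

      pivot : ∃ λ p → ¬ (v p ℂ.≈ ℂ.0#)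
      pivot = choose (CF.zero⊎nonzero v)
        where
        choose : (∀ r → v r ℂ.≈ ℂ.0#) ⊎ (∃ λ p → ¬ (v p ℂ.≈ ℂ.0#)) → ∃ λ p → ¬ (v p ℂ.≈ ℂ.0#)
        choose (inj₂ found) = found
        choose (inj₁ v≈0)   = ⊥-elim (IsField.0≉1 ℂ-isField (ℂ.trans (ℂ.sym (CK.sum-zero n (λ r → ℂ.trans (ℂ.*-congˡ (v≈0 r)) (ℂ.zeroʳ (l i₀ r)))))
          (ℂ.trans (proj₂ dual i₀) (ℂ.reflexive (CK.1ᴹ-diagonal i₀)))))

    p : Fin n
    p = proj₁ pivot

    private
      vp⁻¹ : ℂ
      vp⁻¹ = proj₁ (IsField.inverse ℂ-isField (v p) (proj₂ pivot))

      -- The vector of the common zero line of the other factors with coordinate 1 at `p`. Since `σ`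
      -- fixes `i₀` it permutes the other factors, so the conjugate of `w` lies on the same line;
      -- having the same coordinate at `p`, it equals `w`.
      w : Vector ℂ n
      w r = v r ℂ.* vp⁻¹

      wp≈1 : w p ℂ.≈ ℂ.1#
      wp≈1 = proj₂ (IsField.inverse ℂ-isField (v p) (proj₂ pivot))

      l-w : ∀ i → i ≢ i₀ → pair (l i) w ℂ.≈ ℂ.0#
      l-w i i≢i₀ = ℂ.trans (CK.sum-cong n (λ r → ℂ.sym (ℂ.*-assoc (l i r) (v r) vp⁻¹))) (ℂ.trans (ℂ.sym (CK.*-distribʳ-∑ n vp⁻¹ (λ r → l i r ℂ.* v r)))
        (ℂ.trans (ℂ.*-congʳ (ℂ.trans (proj₂ dual i) (ℂ.reflexive (CK.1ᴹ-off-diagonal (i≢i₀ ∘ ≡.sym))))) (ℂ.zeroˡ vp⁻¹)))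

      l-conj-w : ∀ i → i ≢ i₀ → pair (l i) (conj ∘ w) ℂ.≈ ℂ.0#
      l-conj-w i i≢i₀ = ℂ.trans (pair-cong-left (λ r → ℂ.sym (conj-involutive (l i r)))) (ℂ.trans (ℂ.sym (pair-conj (conj ∘ l i) w))
        (ℂ.trans (Conj.⟦⟧-cong conj-l-w) Conj.0#-homo))
        where
        pair-cong-left : ∀ {a a′ x : Vector ℂ n} → (∀ r → a r ℂ.≈ a′ r) → pair a x ℂ.≈ pair a′ x
        pair-cong-left {x = x} a≈a′ = CK.sum-cong n (λ r → ℂ.*-congʳ {x r} (a≈a′ r))
        σi≢i₀ : σ i ≢ i₀
        σi≢i₀ eq = i≢i₀ (≡.trans (≡.sym (σ-involutive i)) (≡.trans (≡.cong σ eq) i₀-fixed))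
        conj-l-w : pair (conj ∘ l i) w ℂ.≈ ℂ.0#
        conj-l-w = CF.cancel-unit (ζ≉0 i) (ℂ.trans (CK.*-distribˡ-∑ n (ζ i) (λ r → conj (l i r) ℂ.* w r))
          (ℂ.trans (CK.sum-cong n (λ r → ℂ.trans (ℂ.sym (ℂ.*-assoc (ζ i) (conj (l i r)) (w r))) (ℂ.*-congʳ {w r} (ℂ.sym (l-σ i r))))) (l-w (σ i) σi≢i₀)))

      difference : Vector ℂ n
      difference r = w r ℂ.+ ℂ.- ℂ.1# ℂ.* conj (w r)

      t : ℂ
      t = pair (l i₀) difference

      difference≈tv : ∀ r → difference r ℂ.+ ℂ.- t ℂ.* v r ℂ.≈ ℂ.0#
      difference≈tv = separating (λ r → difference r ℂ.+ ℂ.- t ℂ.* v r) (λ i → ℂ.trans (pair-line (l i) difference v (ℂ.- t)) (cases i (i Fin.≟ i₀)))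
        where
        cases : ∀ i → Dec (i ≡ i₀) → pair (l i) difference ℂ.+ ℂ.- t ℂ.* pair (l i) v ℂ.≈ ℂ.0#
        cases i (yes ≡.refl) = ℂ.trans (ℂ.+-congˡ (ℂ.trans (ℂ.*-congˡ (ℂ.trans (proj₂ dual i₀) (ℂ.reflexive (CK.1ᴹ-diagonal i₀)))) (ℂ.*-identityʳ (ℂ.- t)))) (ℂ.-‿inverseʳ t)
        cases i (no i≢i₀) = ℂ.trans (ℂ.+-cong
            (ℂ.trans (pair-line (l i) w (conj ∘ w) (ℂ.- ℂ.1#)) (ℂ.trans (ℂ.+-cong (l-w i i≢i₀) (ℂ.trans (ℂ.*-congˡ (l-conj-w i i≢i₀)) (ℂ.zeroʳ (ℂ.- ℂ.1#)))) (ℂ.+-identityˡ ℂ.0#)))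
            (ℂ.trans (ℂ.*-congˡ (ℂ.trans (proj₂ dual i) (ℂ.reflexive (CK.1ᴹ-off-diagonal (i≢i₀ ∘ ≡.sym))))) (ℂ.zeroʳ (ℂ.- t))))
          (ℂ.+-identityˡ ℂ.0#)

      difference-zero : ∀ {z z′} → z ℂ.≈ z′ → z ℂ.+ ℂ.- ℂ.1# ℂ.* z′ ℂ.≈ ℂ.0#
      difference-zero {z} {z′} z≈z′ = ℂ.trans (ℂ.+-cong (ℂ.trans z≈z′ (ℂ.sym (ℂ.*-identityˡ z′))) ℂ.refl) (CI.opposite-sum ℂ.1# z′)

      -- At `p` the difference is 1 - 1 = 0, whereas `v` does not vanish there.
      -t≈0 : ℂ.- t ℂ.≈ ℂ.0#
      -t≈0 = CF.cancel-unit (proj₂ pivot) (ℂ.trans (ℂ.*-comm (v p) (ℂ.- t)) (ℂ.trans (ℂ.sym (ℂ.+-identityˡ (ℂ.- t ℂ.* v p)))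
        (ℂ.trans (ℂ.+-congʳ (ℂ.sym (difference-zero (ℂ.trans wp≈1 (ℂ.sym (ℂ.trans (Conj.⟦⟧-cong wp≈1) Conj.1#-homo)))))) (difference≈tv p))))

      w-real : ∀ r → w r ℂ.≈ fromℝ (proj₁ (w r))
      w-real r = conj-fixed (ℂ.sym (CF.minus≈0 (ℂ.trans (ℂ.+-congˡ (ℂ.trans (ℂ.-‿cong (ℂ.sym (ℂ.*-identityˡ (conj (w r))))) (CI.neg-*ˡ ℂ.1# (conj (w r)))))
        (ℂ.trans (ℂ.sym (ℂ.trans (ℂ.+-congˡ (ℂ.trans (ℂ.*-congʳ -t≈0) (ℂ.zeroˡ (v r)))) (ℂ.+-identityʳ (difference r)))) (difference≈tv r)))))

    ω : Vector ℝ.Carrier n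
    ω r = proj₁ (w r)

    ωp≈1 : ω p ℝ.≈ ℝ.1#
    ωp≈1 = proj₁ wp≈1

    l-ω : ∀ i → i ≢ i₀ → pair (l i) (fromℝ ∘ ω) ℂ.≈ ℂ.0#
    l-ω i i≢i₀ = ℂ.trans (pair-cong (l i) (λ r → ℂ.sym (w-real r))) (l-w i i≢i₀)

  RealDirections : Set
  RealDirections = ∃ λ i₀ → ∃ λ p → ∃ λ (ω : Vector ℝ.Carrier n) → ω p ℝ.≈ ℝ.1# × (∀ i → i ≢ i₀ → pair (l i) (fromℝ ∘ ω) ℂ.≈ ℂ.0#)

  real-direction : ¬ (∃ λ s → HasSignature l s 0) → RealDirections
  real-direction ¬imaginary = choose (Fin.any? (λ i → σ i Fin.≟ i))
    where
    choose : Dec (∃ λ i → σ i ≡ i) → RealDirections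
    choose (yes (i₀ , fixed)) = i₀ , R.p , R.ω , R.ωp≈1 , R.l-ω
      where module R = RealDirection i₀ fixed
    choose (no none) = ⊥-elim (¬imaginary (no-fixed⇒totally-imaginary (λ i eq → none (i , eq))))

-- Values of the form at all integral points

module FormValues (em : ExcludedMiddle 0ℓ) (ℛ : CompleteOrderedField) {n : ℕ} (f : Over.Form ℛ n) where
  open CompleteOrderedField ℛ renaming (Carrier to ℝ; ring to ℝ-ring)
  open Over ℛ
  open RealOrder em ℛ
  open ComplexNumbers em ℛ
  open DiscreteSets em ℛ
  open IntegralPoints em ℛ using (⟦_⟧; pair-cong)
  open RawSemiringDefinitions (RawRing.rawSemiring rawRing) using (_^_) renaming (_×_ to _·_)
  open RingKit ℝ-ring using (fromInt; fromInt-*)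
  private
    module ℂ = CommutativeRing ℂ-ring
    module ℂ^ = RawSemiringDefinitions (RawRing.rawSemiring ℂ.rawRing)
    module CK = RingKit ℂ-ring
    module CI = RingIdentities ℂ-ring
    module CF = FieldKit ℂ-ring ℂ-isField _≈ᶜ?_
  open PolynomialIdentities ℂ-ring ℂ-isField _≈ᶜ?_
  open CharacteristicZero ℂ-char0 using (pair)

  poly : ℝ[x].Poly n
  poly = Form.poly f

  l : Fin n → Vector ℂ n
  l = proj₁ (Form.factors f)

  open Factorization em ℛ poly l (proj₂ (Form.factors f)) public
  open RationalMultipliers em ℛ l

  product-real : ∀ x → ℂ^.product (λ i → pair (l i) (fromℝ ∘ x)) ℂ.≈ fromℝ (ℝ[x].eval poly x)
  product-real x = ℂ.trans (ℂ.sym (eval-factorization (fromℝ ∘ x))) (eval-fromℝ poly x)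

  g : Vector ℤ n → ℝ
  g x = ℝ[x].eval poly (fromInt ∘ x)

  product≈g : ∀ x → ℂ^.product (λ i → pair (l i) ⟦ x ⟧) ℂ.≈ fromℝ (g x)
  product≈g x = product-real (fromInt ∘ x)

  g-cong : ∀ {x y : Vector ℤ n} → (∀ r → x r ≡ y r) → g x ≈ g y
  g-cong x≗y = Evaluation.eval-congʳ ℝ-ring poly (λ r → reflexive (≡.cong fromInt (x≗y r)))

  g-homogeneous : ∀ k x y → (∀ r → y r ≡ k ℤ.* x r) → g y ≈ fromInt k ^ n * g x
  g-homogeneous k x y y≡kx = proj₁ (ℂ.trans (ℂ.sym (product≈g y)) (ℂ.trans (CK.product-cong n scaled)
    (ℂ.trans (CK.product-* n (λ _ → fromℝ (fromInt k)) (λ i → pair (l i) ⟦ x ⟧)) (ℂ.trans (ℂ.*-cong (constant n) (product≈g x))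
      (ℂ.sym (fromℝ-* (fromInt k ^ n) (g x)))))))
    where
    scaled : ∀ i → pair (l i) ⟦ y ⟧ ℂ.≈ fromℝ (fromInt k) ℂ.* pair (l i) ⟦ x ⟧
    scaled i = ℂ.trans (CK.sum-cong n (λ r → ℂ.trans (ℂ.*-congˡ (ℂ.trans (trans (reflexive (≡.cong fromInt (y≡kx r))) (fromInt-* k (x r)) , refl)
        (fromℝ-* (fromInt k) (fromInt (x r))))) (CI.*-swap (l i r) (fromℝ (fromInt k)) (fromℝ (fromInt (x r))))))
      (ℂ.sym (CK.*-distribˡ-∑ n (fromℝ (fromInt k)) (λ r → l i r ℂ.* ⟦ x ⟧ r)))
    constant : ∀ m → ℂ^.product {m} (λ _ → fromℝ (fromInt k)) ℂ.≈ fromℝ (fromInt k ^ m)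
    constant zero    = ℂ.refl
    constant (suc m) = ℂ.trans (ℂ.*-congˡ (constant m)) (ℂ.sym (fromℝ-* (fromInt k) (fromInt k ^ m)))

  module _ (no-rational-zero : ¬ RepresentsZeroOverℚ f) where

    anisotropic : ∀ i (x : Vector ℚ n) → ev i x ℂ.≈ ℂ.0# → ∀ r → x r ≡ 0ℚ
    anisotropic i x evx≈0 r with x r ℚ.≟ 0ℚ
    ... | yes xr≡0 = xr≡0
    ... | no  xr≢0 = ⊥-elim (no-rational-zero (Vec.tabulate x , nonzero , trans
      (Evaluation.eval-congʳ ℝ-ring poly (λ r → reflexive (≡.cong fromℚ (Vec.lookup∘tabulate x r))))
      (proj₁ (ℂ.trans (ℂ.sym (product-real (fromℚ ∘ x))) (CK.product-zero {f = λ i → ev i x} i evx≈0)))))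
      where
      nonzero : Vec.tabulate x ≢ replicate n 0ℚ
      nonzero eq = xr≢0 (≡.trans (≡.sym (Vec.lookup∘tabulate x r)) (≡.trans (≡.cong (λ v → lookup v r) eq) (Vec.lookup-replicate r 0ℚ)))

    fromIntℚ : ℤ → ℚ
    fromIntℚ = RingKit.fromInt ℚ-ring

    ev-integral : ∀ i (x : Vector ℤ n) → ev i (fromIntℚ ∘ x) ℂ.≈ pair (l i) ⟦ x ⟧
    ev-integral i x = pair-cong (l i) (λ r → fromℚ-fromInt (x r) , refl)

    fromIntℚ-nonzero : ∀ {k} → k ≢ 0ℤ → fromIntℚ k ≢ 0ℚ
    fromIntℚ-nonzero {+ zero}   k≢0 _  = k≢0 ≡.refl
    fromIntℚ-nonzero {+ suc k}  _   eq = suc≉0 k (trans (sym (fromℚ-fromInt (+ suc k))) (trans (reflexive (≡.cong fromℚ eq)) fromℚ-0))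
    fromIntℚ-nonzero { -[1+ k ]} _  eq = suc≉0 k (trans (sym (-‿involutive (suc k · 1#)))
      (trans (-‿cong (trans (sym (fromℚ-fromInt -[1+ k ])) (trans (reflexive (≡.cong fromℚ eq)) fromℚ-0))) -0≈0))

    g-nonzero : ∀ x r → x r ≢ 0ℤ → ¬ (g x ≈ 0#)
    g-nonzero x r xr≢0 gx≈0 = zero-factor (CF.product≈0 n {λ i → pair (l i) ⟦ x ⟧} (ℂ.trans (product≈g x) (gx≈0 , refl)))
      where
      zero-factor : ¬ (∃ λ i → pair (l i) ⟦ x ⟧ ℂ.≈ ℂ.0#)
      zero-factor (i , eq) = fromIntℚ-nonzero xr≢0 (anisotropic i (fromIntℚ ∘ x) (ℂ.trans (ev-integral i x) eq) r)

    module _ (1≤n : 1 ℕ.≤ n) (Z : Pred (Vec ℤ n) 0ℓ) (discrete : Discrete (Values f Z)) (m : ℕ)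
      (commensurable : ∀ (v : Vector ℤ n) r → v r ≢ 0ℤ →
        ∃₂ λ c (u : Vector ℤ n) → Vec.tabulate u ∈ Z × (∀ i → + suc c ℤ.* u i ≡ + suc m ℤ.* v i)) where

      private
        C : ℕ → ℝ
        C c = (suc c · 1#) ^ n

        0<C : ∀ c → 0# < C c
        0<C c = power-positive n (0<suc c)

        1≤C : ∀ c → 1# ≤ C c
        1≤C c = 1≤power n (1≤suc c)

        μ : ℝ
        μ = proj₁ (inverse (C m) (0<x⇒≉0 (0<C m)))

        C*μ≈1 : C m * μ ≈ 1#
        C*μ≈1 = proj₂ (inverse (C m) (0<x⇒≉0 (0<C m)))

        0<μ : 0# < μ
        0<μ = ≰⇒> λ μ≤0 → <⇒≱ 0<1 (≤-respˡ-≈ C*μ≈1 (≤-respʳ-≈ (zeroʳ (C m)) (*-monoˡ-≤ (proj₁ (0<C m)) μ≤0)))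

        orbit-value : ∀ u → Vec.tabulate u ∈ Z → g u ∈ Values f Z
        orbit-value u u∈Z = Vec.tabulate u , u∈Z , Evaluation.eval-congʳ ℝ-ring poly
          (λ r → reflexive (≡.trans (≡.sym (fromℤ≡fromInt (u r))) (≡.cong fromℤ (≡.sym (Vec.lookup∘tabulate u r)))))

        value-relation : ∀ c u v → (∀ i → + suc c ℤ.* u i ≡ + suc m ℤ.* v i) → C c * g u ≈ C m * g v
        value-relation c u v eq = trans (sym (g-homogeneous (+ suc c) u (λ i → + suc c ℤ.* u i) (λ _ → ≡.refl)))
          (g-homogeneous (+ suc m) v (λ i → + suc c ℤ.* u i) eq)

        smallest : ∀ N (L : Fin N → ℝ) → ∃ λ η → 0# < η × η ≤ 1# × (∀ i → ¬ (L i ≈ 0#) → η ≤ ∣ L i ∣)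
        -- Keeping the bound at most 1 makes it valid also for the orbit values of modulus at least
        -- 1, which are not taken from the list.
        smallest zero    L = 1# , 0<1 , ≤-refl , λ ()
        smallest (suc N) L = extend (smallest N (L ∘ suc)) (em {P = L zero ≈ 0#})
          where
          Bound : ℝ → Set
          Bound η = 0# < η × η ≤ 1# × (∀ i → ¬ (L i ≈ 0#) → η ≤ ∣ L i ∣)
          extend : (∃ λ η → 0# < η × η ≤ 1# × (∀ i → ¬ (L (suc i) ≈ 0#) → η ≤ ∣ L (suc i) ∣)) → Dec (L zero ≈ 0#) → ∃ Bound
          extend (η , 0<η , η≤1 , η≤) (yes z) = η , 0<η , η≤1 , λ { zero ≉0 → ⊥-elim (≉0 z) ; (suc i) ≉0 → η≤ i ≉0 }
          extend (η , 0<η , η≤1 , η≤) (no L₀≉0) with total η (∣ L zero ∣)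
          ... | inj₁ η≤L₀ = η , 0<η , η≤1 , λ { zero _ → η≤L₀ ; (suc i) ≉0 → η≤ i ≉0 }
          ... | inj₂ L₀≤η = ∣ L zero ∣ , ≰⇒> (L₀≉0 ∘ ∣∣≈0) , ≤-trans L₀≤η η≤1 ,
                λ { zero _ → ≤-refl ; (suc i) ≉0 → ≤-trans L₀≤η (η≤ i ≉0) }

        small-values : Finite (λ y → y ∈ Values f Z × ∣ y ∣ ≤ 1#)
        small-values = discrete⇒finite discrete 0≤1

        gap : ∃ λ η → 0# < η × η ≤ 1# × (∀ i → ¬ (proj₁ (proj₂ small-values) i ≈ 0#) → η ≤ ∣ proj₁ (proj₂ small-values) i ∣)
        gap = smallest (proj₁ small-values) (proj₁ (proj₂ small-values))

        η₀ : ℝ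
        η₀ = proj₁ gap

        0<η₀ : 0# < η₀
        0<η₀ = proj₁ (proj₂ gap)

        orbit-lower : ∀ u → Vec.tabulate u ∈ Z → ¬ (g u ≈ 0#) → η₀ ≤ ∣ g u ∣
        orbit-lower u u∈Z gu≉0 = cases (total (∣ g u ∣) 1#)
          where
          listed : ∣ g u ∣ ≤ 1# → ∃ λ i → g u ≈ proj₁ (proj₂ small-values) i
          listed gu≤1 = proj₂ (proj₂ small-values) (g u) (orbit-value u u∈Z , gu≤1)
          cases : ∣ g u ∣ ≤ 1# ⊎ 1# ≤ ∣ g u ∣ → η₀ ≤ ∣ g u ∣
          cases (inj₂ 1≤gu) = ≤-trans (proj₁ (proj₂ (proj₂ gap))) 1≤gu
          cases (inj₁ gu≤1) = ≤-trans (proj₂ (proj₂ (proj₂ gap)) (proj₁ (listed gu≤1)) (λ eq → gu≉0 (trans (proj₂ (listed gu≤1)) eq)))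
            (∣∣-mono (sym (proj₂ (listed gu≤1))))

        abs-relation : ∀ c u v → (∀ i → + suc c ℤ.* u i ≡ + suc m ℤ.* v i) → C c * ∣ g u ∣ ≈ C m * ∣ g v ∣
        abs-relation c u v eq = trans (scale c u) (trans (∣∣-cong (value-relation c u v eq)) (sym (scale m v)))
          where
          scale : ∀ c u → C c * ∣ g u ∣ ≈ ∣ C c * g u ∣
          scale c u = sym (trans (∣∣-* (C c) (g u)) (*-congʳ (∣∣-of-nonNeg (proj₁ (0<C c)))))

        orbit-nonzero : ∀ c u v r → v r ≢ 0ℤ → (∀ i → + suc c ℤ.* u i ≡ + suc m ℤ.* v i) → ¬ (g u ≈ 0#)
        orbit-nonzero c u v r vr≢0 eq gu≈0 = *-nonzeroʳ (0<x⇒≉0 (0<C m)) (g-nonzero v r vr≢0)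
          (trans (sym (value-relation c u v eq)) (trans (*-congˡ gu≈0) (zeroʳ (C c))))

      -- Passing from `v` to its companion in `Z` multiplies the modulus of the form by (m + 1)ⁿ /
      -- (c + 1)ⁿ, which is at most (m + 1)ⁿ; `μ` is the inverse of the latter.
      η : ℝ
      η = η₀ * μ

      0<η : 0# < η
      0<η = 0<x*y 0<η₀ 0<μ

      lower : ∀ v → (∃ λ r → v r ≢ 0ℤ) → η ≤ ∣ g v ∣
      lower v (r , vr≢0) = from-orbit (commensurable v r vr≢0)
        where
        from-orbit : (∃₂ λ c (u : Vector ℤ n) → Vec.tabulate u ∈ Z × (∀ i → + suc c ℤ.* u i ≡ + suc m ℤ.* v i)) → η ≤ ∣ g v ∣
        from-orbit (c , u , u∈Z , eq) = *-cancelˡ-≤ (0<C m) (≤-respˡ-≈ (sym cancel) (≤-respʳ-≈ (abs-relation c u v eq)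
          (≤-trans (orbit-lower u u∈Z (orbit-nonzero c u v r vr≢0 eq)) (≤-respˡ-≈ (*-identityˡ (∣ g u ∣)) (*-monoʳ-≤ (∣∣-nonNeg (g u)) (1≤C c))))))
          where
          cancel : C m * (η₀ * μ) ≈ η₀
          cancel = trans (RingIdentities.*-swap ℝ-ring (C m) η₀ μ) (trans (*-congˡ C*μ≈1) (*-identityʳ η₀))

      -- From (c + 1)ⁿ ∣g u∣ = (m + 1)ⁿ ∣g x∣ ≤ CR and ∣g u∣ ≥ η₀ it follows that only finitely many
      -- `c` occur; for each of them g u lies in a bounded part of a discrete set. The value at the
      -- zero vector is added by hand.
      finite : ∀ {R} → 0# ≤ R → Finite (λ y → (∃ λ x → y ≈ g x) × ∣ y ∣ ≤ R)
      finite {R} 0≤R = Finite-insert {S = Union} (g (λ _ → 0ℤ)) (Finite-⋃ bound {S = Multiple} multiples (λ y y∈ → y∈))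
        (λ { y ((x , y≈gx) , y≤R) → place y x y≈gx y≤R (Fin.any? (λ r → ¬? (x r ℤ.≟ 0ℤ))) })
        where
        CR : ℝ
        CR = C m * R
        0≤CR : 0# ≤ CR
        0≤CR = *-nonNeg (proj₁ (0<C m)) 0≤R
        η₀⁻¹ : ℝ
        η₀⁻¹ = proj₁ (inverse η₀ (0<x⇒≉0 0<η₀))
        bound : ℕ
        bound = proj₁ (archimedean (CR * η₀⁻¹))
        Multiple : ℕ → Pred ℝ 0ℓ
        Multiple c y = ∃ λ z → (z ∈ Values f Z × ∣ z ∣ ≤ CR) × y ≈ C c * μ * z
        Union : Pred ℝ 0ℓ
        Union y = ∃ λ c → c ℕ.< bound × y ∈ Multiple c
        multiples : ∀ c → Finite (Multiple c)
        multiples c = Finite-map {S = λ z → z ∈ Values f Z × ∣ z ∣ ≤ CR} (λ z → C c * μ * z) *-congˡ (discrete⇒finite discrete 0≤CR) (λ y y∈ → y∈)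
        place : ∀ y x → y ≈ g x → ∣ y ∣ ≤ R → Dec (∃ λ r → x r ≢ 0ℤ) → y ∈ Union ⊎ y ≈ g (λ _ → 0ℤ)
        place y x y≈gx y≤R (no none) = inj₂ (trans y≈gx (g-cong zero-entry))
          where
          zero-entry : ∀ r → x r ≡ 0ℤ
          zero-entry r with x r ℤ.≟ 0ℤ
          ... | yes xr≡0 = xr≡0
          ... | no  xr≢0 = ⊥-elim (none (r , xr≢0))
        place y x y≈gx y≤R (yes (r , xr≢0)) = inj₁ (from-orbit (commensurable x r xr≢0))
          where
          from-orbit : (∃₂ λ c (u : Vector ℤ n) → Vec.tabulate u ∈ Z × (∀ i → + suc c ℤ.* u i ≡ + suc m ℤ.* x i)) → y ∈ Union
          from-orbit (c , u , u∈Z , eq) = c , c<bound , g u , (orbit-value u u∈Z , gu≤CR) , y≈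
            where
            Cgu≤CR : (C c * ∣ g u ∣) ≤ CR
            Cgu≤CR = ≤-respˡ-≈ (sym (abs-relation c u x eq)) (*-monoˡ-≤ (proj₁ (0<C m)) (≤-respˡ-≈ (∣∣-cong y≈gx) y≤R))
            gu≤CR : ∣ g u ∣ ≤ CR
            gu≤CR = ≤-trans (≤-respˡ-≈ (*-identityˡ (∣ g u ∣)) (*-monoʳ-≤ (∣∣-nonNeg (g u)) (1≤C c))) Cgu≤CR
            y≈ : y ≈ C c * μ * g u
            y≈ = trans y≈gx (sym (trans (*-congʳ (*-comm (C c) μ)) (trans (*-assoc μ (C c) (g u)) (trans (*-congˡ (value-relation c u x eq))
              (trans (RingIdentities.*-swap ℝ-ring μ (C m) (g x)) (trans (sym (*-assoc (C m) μ (g x))) (trans (*-congʳ C*μ≈1) (*-identityˡ (g x)))))))))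
            C≤ : C c ≤ (CR * η₀⁻¹)
            C≤ = ≤-respˡ-≈ (trans (*-assoc (C c) η₀ η₀⁻¹) (trans (*-congˡ (proj₂ (inverse η₀ (0<x⇒≉0 0<η₀)))) (*-identityʳ (C c))))
              (*-monoʳ-≤ 0≤η₀⁻¹ (≤-trans (*-monoˡ-≤ (proj₁ (0<C c)) (orbit-lower u u∈Z (orbit-nonzero c u x r xr≢0 eq))) Cgu≤CR))
              where
              0≤η₀⁻¹ : 0# ≤ η₀⁻¹
              0≤η₀⁻¹ = ≰⇒≥ λ η₀⁻¹≤0 → <⇒≱ 0<1 (≤-respˡ-≈ (proj₂ (inverse η₀ (0<x⇒≉0 0<η₀))) (≤-respʳ-≈ (zeroʳ η₀) (*-monoˡ-≤ (proj₁ 0<η₀) η₀⁻¹≤0)))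
            -- The degree being positive, a bound for (c + 1)ⁿ is a bound for `c`.
            suc≤C : (suc c · 1#) ≤ C c
            suc≤C = at-least n 1≤n
              where
              at-least : ∀ k → 1 ℕ.≤ k → (suc c · 1#) ≤ ((suc c · 1#) ^ k)
              at-least (suc k) _ = ≤-respˡ-≈ (*-identityʳ (suc c · 1#)) (*-monoˡ-≤ (proj₁ (0<suc c)) (1≤power k (1≤suc c)))
            c<bound : c ℕ.< bound
            c<bound = decide (c ℕ.<? bound)
              where
              decide : Dec (c ℕ.< bound) → c ℕ.< bound
              decide (yes c<) = c<
              decide (no  c≮) = ⊥-elim (<⇒≱ successor (≤-trans suc≤C (≤-trans C≤ (≤-trans (proj₂ (archimedean (CR * η₀⁻¹))) (·-mono (ℕ.≮⇒≥ c≮))))))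
                where
                successor : (c · 1#) < (suc c · 1#)
                successor = <-≈-trans (≈-<-trans (sym (+-identityʳ (c · 1#))) (+-monoʳ-< (c · 1#) 0<1)) (+-comm (c · 1#) 1#)

-- From multipliers to the norm form

module NormForms (em : ExcludedMiddle 0ℓ) (ℛ : CompleteOrderedField) {n : ℕ} (f : Over.Form ℛ n) where
  open CompleteOrderedField ℛ renaming (Carrier to ℝ; ring to ℝ-ring)
  open Over ℛ
  open ComplexNumbers em ℛ
  open FormValues em ℛ f
  open IntegralPoints em ℛ using (column; formValue; formValue≈; productValue; productValue≈)
  open LatticeMultipliers em ℛ
  open RawSemiringDefinitions (RawRing.rawSemiring rawRing) using (sum)
  open RingKit ℝ-ring using (fromInt; sum-cong)
  open RationalMultipliers em ℛ l
  private
    module ℂ = CommutativeRing ℂ-ring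
    module ℂ^ = RawSemiringDefinitions (RawRing.rawSemiring ℂ.rawRing)
    module ℚ^ = RawSemiringDefinitions (RawRing.rawSemiring (CommutativeRing.rawRing ℚ-ring))
    module CK = RingKit ℂ-ring
    module CF = FieldKit ℂ-ring ℂ-isField _≈ᶜ?_
    module QF = FieldKit ℚ-ring ℚ-isField ℚ._≟_
    module QC = FieldExtension ℚ-ring ℚ-isField ℚ._≟_ ℂ-ring ℂ-isField fromℚℂ fromℚℂ-homo
    module H = IsRingHomomorphism fromℚℂ-homo
    module Eval = Evaluation ℂ-ring
  open PolynomialIdentities ℂ-ring ℂ-isField _≈ᶜ?_
  open CharacteristicZero ℂ-char0 using (pair; eval⇒≈ₚ)
  open Matrices ℚ-ring using (1ᴹ)
  open Matrices ℂ-ring using () renaming (1ᴹ to 1ᴹᶜ)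

  module Multiplier (no-rational-zero : ¬ RepresentsZeroOverℚ f) (P₁ P₂ : Fin n → Vector ℤ n)
    (P₁-independent : ∀ (c : Vector ℝ n) → (∀ r → sum (λ j → fromInt (P₁ j r) * c j) ≈ 0#) → ∀ j → c j ≈ 0#)
    (e : Fin n → ℂ) (columns : ∀ k j → column l P₂ k j ℂ.≈ e k ℂ.* column l P₁ k j) where

    private
      rational : (Fin n → Vector ℤ n) → Fin n → Vector ℚ n
      rational P j r = fromIntℚ no-rational-zero (P j r)

      apply : (Fin n → Vector ℤ n) → Vector ℚ n → Vector ℚ n
      apply P c r = ℚ^.sum (λ j → rational P j r ℚ.* c j)

      ev-apply : ∀ P i c → ev i (apply P c) ℂ.≈ ℂ^.sum (λ j → column l P i j ℂ.* fromℚℂ (c j))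
      ev-apply P i c = ℂ.trans (ev-combination i (rational P) c)
        (CK.sum-cong n (λ j → ℂ.*-congʳ {fromℚℂ (c j)} (ev-integral no-rational-zero i (P j))))

      -- A rational relation between the vectors `P₁ j` is in particular a real one. Independence
      -- therefore turns them into a basis of ℚⁿ, in which `γ` can be defined.
      injective : QF.TrivialKernel (λ r j → rational P₁ j r)
      injective c Pc≡0 j = QC.φ-reflects-0 (P₁-independent (fromℚ ∘ c) real-relation j , refl)
        where
        real-relation : ∀ r → sum (λ j → fromInt (P₁ j r) * fromℚ (c j)) ≈ 0#
        real-relation r = trans (sum-cong n (λ j → trans (*-congʳ (sym (fromℚ-fromInt (P₁ j r)))) (sym (fromℚ-* (rational P₁ j r) (c j)))))
          (trans (sym (fromℚ-sum n (λ j → rational P₁ j r ℚ.* c j))) (trans (reflexive (≡.cong fromℚ (Pc≡0 r))) fromℚ-0))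
          where
          fromℚ-sum : ∀ m (h : Vector ℚ m) → fromℚ (ℚ^.sum h) ≈ sum (fromℚ ∘ h)
          fromℚ-sum zero    h = fromℚ-0
          fromℚ-sum (suc m) h = trans (fromℚ-+ (h zero) (ℚ^.sum (h ∘ suc))) (+-congˡ (fromℚ-sum m (h ∘ suc)))

      coordinates : ∀ x → ∃ λ (c : Vector ℚ n) → ∀ r → apply P₁ c r ≡ x r
      coordinates = QF.injective⇒surjective (λ r j → rational P₁ j r) injective

    γ : Vector ℚ n → Vector ℚ n
    γ x = apply P₂ (proj₁ (coordinates x))

    γ-eigen : Eigen γ e
    γ-eigen i x = ℂ.trans (ev-apply P₂ i c) (ℂ.trans
      (CK.sum-cong n (λ j → ℂ.trans (ℂ.*-congʳ {fromℚℂ (c j)} (columns i j)) (ℂ.*-assoc (e i) (column l P₁ i j) (fromℚℂ (c j)))))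
      (ℂ.trans (ℂ.sym (CK.*-distribˡ-∑ n (e i) (λ j → column l P₁ i j ℂ.* fromℚℂ (c j))))
        (ℂ.*-congˡ (ℂ.trans (ℂ.sym (ev-apply P₁ i c)) (ev-cong i (proj₂ (coordinates x)))))))
      where
      c : Vector ℚ n
      c = proj₁ (coordinates x)

  module FromField (anisotropic : ∀ i (x : Vector ℚ n) → ev i x ℂ.≈ ℂ.0# → ∀ r → x r ≡ 0ℚ) (i₀ : Fin n)
    (b : Vector ℚ n) (b≢0 : ∃ λ r → b r ≢ 0ℚ)
    (mul : ∀ w v → ∃ λ (z : Vector ℚ n) → ∀ i → ev i b ℂ.* ev i z ℂ.≈ ev i w ℂ.* ev i v)
    (inv : ∀ w → (∃ λ r → w r ≢ 0ℚ) → ∃ λ (z : Vector ℚ n) → ∀ i → ev i w ℂ.* ev i z ℂ.≈ ev i b ℂ.* ev i b) where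

    open FieldOfMultipliers em ℛ l
    open Construction anisotropic (Factors.independent (proj₂ (Form.factors f))) i₀ b b≢0 mul inv

    private
      c : ℝ
      c = ℝ[x].eval poly (fromℚ ∘ b)

      c≈ : fromℝ c ℂ.≈ ℂ^.product (λ i → ev i b)
      c≈ = ℂ.sym (product-real (fromℚ ∘ b))

      c≉0 : ¬ (c ≈ 0#)
      c≉0 c≈0 = CF.product-nonzero n ev-b≉0 (ℂ.trans (ℂ.sym c≈) (c≈0 , refl))

      norm : ℂ[x].Poly n
      norm = normPoly 𝒦 Θ

      eval-norm : ∀ x → ℂ[x].eval norm x ℂ.≈ ℂ^.product (λ i → κ i ℂ.* pair (l i) x)
      eval-norm x = ℂ.trans (Eval.eval-productₚ n (λ i → ℂ[x].linear (λ j → Θ i (1ᴹ j))) x) (CK.product-cong n (λ i →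
        ℂ.trans (Eval.eval-linear (λ j → Θ i (1ᴹ j)) x) (ℂ.trans
          (CK.sum-cong n (λ j → ℂ.trans (ℂ.*-congʳ {x j} (Θ-unit i j)) (ℂ.*-assoc (κ i) (l i j) (x j))))
          (ℂ.sym (CK.*-distribˡ-∑ n (κ i) (λ j → l i j ℂ.* x j))))))

      c*norm : ∀ x → fromℝ c ℂ.* ℂ[x].eval norm x ℂ.≈ ℂ[x].eval (fromℝ[x] poly) x
      c*norm x = ℂ.trans (ℂ.*-cong c≈ (eval-norm x)) (ℂ.trans (ℂ.sym (CK.product-* n (λ i → ev i b) (λ i → κ i ℂ.* pair (l i) x)))
        (ℂ.trans (CK.product-cong n (λ i → ℂ.trans (ℂ.sym (ℂ.*-assoc (ev i b) (κ i) (pair (l i) x))) (ℂ.trans (ℂ.*-congʳ {pair (l i) x} (b*κ≈1 i)) (ℂ.*-identityˡ (pair (l i) x)))))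
          (ℂ.sym (eval-factorization x))))

      -- The field was built on ℚⁿ with its standard basis, so the ℚ-equivalence is realised by the
      -- identity matrix.
      identity-substitution : Vector (ℂ[x].Poly n) n
      identity-substitution i = ℂ[x].linear (λ j → fromℝ (fromℚ (1ᴹ i j)))

      eval-identity : ∀ x i → ℂ[x].eval (identity-substitution i) x ℂ.≈ x i
      eval-identity x i = ℂ.trans (Eval.eval-linear (λ j → fromℝ (fromℚ (1ᴹ i j))) x) (ℂ.trans
        (CK.sum-cong n (λ j → ℂ.*-congʳ {x j} (unit i j))) (CK.sum-1ᴹˡ i x))
        where
        unit : ∀ i j → fromℚℂ (1ᴹ i j) ℂ.≈ 1ᴹᶜ i j
        unit i j = cases (i Fin.≟ j)
          where
          cases : Dec (i ≡ j) → fromℚℂ (1ᴹ i j) ℂ.≈ 1ᴹᶜ i j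
          cases (yes ≡.refl) = ℂ.trans (ℂ.reflexive (≡.cong fromℚℂ (RingKit.1ᴹ-diagonal ℚ-ring i))) (ℂ.trans H.1#-homo (ℂ.reflexive (≡.sym (CK.1ᴹ-diagonal i))))
          cases (no i≢j)     = ℂ.trans (ℂ.reflexive (≡.cong fromℚℂ (RingKit.1ᴹ-off-diagonal ℚ-ring i≢j))) (ℂ.trans H.0#-homo (ℂ.reflexive (≡.sym (CK.1ᴹ-off-diagonal i≢j))))

    isNormForm : IsNormForm f
    isNormForm = 𝒦 , Θ , embeddings , c , c≉0 , 1ᴹ , ElementaryMatrices.det-1ᴹ ℚ-ring n , 1ᴹ , ElementaryMatrices.1ᴹ-inverse ℚ-ring n ,
      eval⇒≈ₚ (fromℝ[x] poly) ((ℂ[x].const (fromℝ c) ℂ[x].*ₚ norm) ℂ[x].∘ₚ identity-substitution) (λ x → ℂ.sym (ℂ.trans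
        (Eval.eval-∘ₚ (ℂ[x].const (fromℝ c) ℂ[x].*ₚ norm) identity-substitution x) (ℂ.trans
          (Eval.eval-congʳ (ℂ[x].const (fromℝ c) ℂ[x].*ₚ norm) (eval-identity x))
          (ℂ.trans (Eval.eval-*ₚ (ℂ[x].const (fromℝ c)) norm x) (ℂ.trans (ℂ.*-congʳ (Eval.eval-const (fromℝ c) x)) (c*norm x))))))

  module FromMultipliers (no-rational-zero : ¬ RepresentsZeroOverℚ f) (i₀ b₀ : Fin n) (P₁ P₂ : Fin n → Vector ℤ n)
    (P₁-independent : ∀ (c : Vector ℝ n) → (∀ r → sum (λ j → fromInt (P₁ j r) * c j) ≈ 0#) → ∀ j → c j ≈ 0#)
    (e : Fin n → ℂ) (values : ∀ k j → formValue (l k) (P₂ j) ℂ.≈ e k ℂ.* formValue (l k) (P₁ j))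
    (e-distinct : ∀ i → i ≢ i₀ → ¬ (e i ℂ.≈ e i₀)) where

    private
      columns : ∀ k j → column l P₂ k j ℂ.≈ e k ℂ.* column l P₁ k j
      columns k j = ℂ.trans (ℂ.sym (formValue≈ (l k) (P₂ j))) (ℂ.trans (values k j) (ℂ.*-congˡ (formValue≈ (l k) (P₁ j))))

    open Multiplier no-rational-zero P₁ P₂ P₁-independent e columns

    private
      b≢0 : ∃ λ r → 1ᴹ b₀ r ≢ 0ℚ
      b≢0 = b₀ , λ eq → IsField.0≉1 ℚ-isField (≡.trans (≡.sym eq) (RingKit.1ᴹ-diagonal ℚ-ring b₀))

    isNormForm : IsNormForm f
    isNormForm = FromField.isNormForm (anisotropic no-rational-zero) i₀ (1ᴹ b₀) b≢0
      (product-exists (anisotropic no-rational-zero) e γ γ-eigen i₀ e-distinct separating (1ᴹ b₀) b≢0)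
      (inverse-exists (anisotropic no-rational-zero) e γ γ-eigen i₀ e-distinct separating (1ᴹ b₀) b≢0)

  commensurable⇒norm-form : 1 ℕ.≤ n → (Z : Pred (Vec ℤ n) 0ℓ) →
    (∃ λ m → ∀ (v : Vector ℤ n) r → v r ≢ 0ℤ →
      ∃₂ λ c (u : Vector ℤ n) → Vec.tabulate u ∈ Z × (∀ i → + suc c ℤ.* u i ≡ + suc m ℤ.* v i)) →
    Discrete (Values f Z) → ¬ RepresentsZeroOverℚ f → ¬ TotallyImaginary f → IsNormForm f
  commensurable⇒norm-form 1≤n Z (m , commensurable) discrete no-rational-zero ¬imaginary =
    from-direction (real-direction (λ signature → ¬imaginary (l , proj₂ (Form.factors f) , signature)))
    where
    from-multipliers : ∀ i₀ → Multipliers l i₀ → IsNormForm f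
    from-multipliers i₀ (P₁ , P₂ , P₁-independent , e , values , distinct) =
      -- The second `i₀` merely selects a standard unit vector as the unit `b` of the field; any
      -- nonzero rational vector could be taken.
      FromMultipliers.isNormForm no-rational-zero i₀ i₀ P₁ P₂ P₁-independent e values distinct
    value≈g : ∀ x → productValue l x ℂ.≈ fromℝ (g x)
    value≈g x = ℂ.trans (productValue≈ l x) (product≈g x)
    from-direction : RealDirections → IsNormForm f
    from-direction (i₀ , p , ω , ωp≈1 , l-ω) = from-multipliers i₀ (multipliers l i₀ p ω ωp≈1 l-ω g value≈g
      (η no-rational-zero 1≤n Z discrete m commensurable) (0<η no-rational-zero 1≤n Z discrete m commensurable)
      (lower no-rational-zero 1≤n Z discrete m commensurable) (finite no-rational-zero 1≤n Z discrete m commensurable))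

open import Data.Nat.Base using (_≤_)

corollary1p3 : ExcludedMiddle 0ℓ → (ℛ : CompleteOrderedField) → let open Over ℛ in
    (n : ℕ) → 2 ≤ n → (f : Form n) →
    (Z : Pred (Vec ℤ n) 0ℓ) → ∃ Z → replicate n 0ℤ ∉ Z → SLℤ-Invariant Z →
    Discrete (Values f Z) →
    ¬ RepresentsZeroOverℚ f →
    ¬ TotallyImaginary f →
    IsNormForm f
corollary1p3 em ℛ (suc zero) (ℕ.s≤s ())
-- Transvections need two coordinates to act on. As zero is not in `Z`, the given point `z₀` has a
-- nonzero entry from which the Euclidean descent can start.
corollary1p3 em ℛ (suc (suc n)) 2≤n f Z (z₀ , z₀∈Z) 0∉Z invariant =
  NormForms.commensurable⇒norm-form em ℛ f (ℕ.s≤s ℕ.z≤n) Z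
    (IntegerOrbits.orbit-commensurable Z invariant z₀ z₀∈Z (λ eq → 0∉Z (≡.subst (_∈ Z) eq z₀∈Z)))
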